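{- Let $A$ be a maximal indecomposable cyclotomic matrix over $\mathbb{Z}[i]$ that has only zeros on the diagonal and whose nonzero entries are all units of $\mathbb{Z}[i]$. Then $A$ is equivalent to an adjacency matrix of one of the graphs $T_{2k}$ ($k\geqslant 3$), $T_{2k}^{(i)}$ ($k\geqslant 3$), $S_8^\dagger$, $S_{14}$, $S_{16}$.
   Context: **Matrices.** Let $R=\mathbb{Z}[i]$. A cyclotomic matrix over $R$ is a (finite, square) Hermitian matrix with entries in $R$ all of whose eigenvalues lie in $[-2,2]$. A Hermitian $R$-matrix is the adjacency matrix $(w(u,v))_{u,v}$ of a weighted directed graph ($R$-graph) with weight function $w$ satisfying $w(v,u)=\overline{w(u,v)}$; $w(v,v)$ is the charge of $v$. A matrix is indecomposable if its underlying graph (distinct $u,v$ adjacent iff $w(u,v)\neq 0$) is connected. An indecomposable cyclotomic $R$-matrix is maximal if it is not a (proper) principal submatrix of any other indecomposable cyclotomic $R$-matrix. Two $n\times n$ matrices $A,B$ over $R$ are equivalent if $A=\pm\sigma(QBQ^*)$ for some unitary matrix $Q$ with entries in $R$ ($QQ^*=Q^*Q=I$), some choice of sign, and $\sigma$ either the identity or complex conjugation applied entrywise. **Graphs.** Weights not determined by the listed ones via $w(v,u)=\overline{w(u,v)}$ are $0$. $T_{2k}$ ($k\ge 3$): vertices $t_j,b_j$, $j\in\mathbb{Z}/k$; for every $j$: $w(t_j,t_{j+1})=w(t_j,b_{j+1})=1$, $w(b_j,t_{j+1})=w(b_j,b_{j+1})=-1$. $T_{2k}^{(i)}$ ($k\ge3$):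 vertices $t_1,b_1,\dots,t_k,b_k$; for $1\le j\le k-1$ the same weights as in $T_{2k}$; and $w(t_k,t_1)=w(t_k,b_1)=i$, $w(b_k,t_1)=w(b_k,b_1)=-i$. $S_8^\dagger$: vertices $a,\dots,h$; weight $1$: $ab, cd, ef, gh, ac, ag, ce, fh$; weight $-1$: $bh, bd, eg, df$; $w(e,a)=w(g,c)=w(b,f)=w(d,h)=i$. $S_{14}$: vertices $o_j,n_j$, $j\in\mathbb{Z}/7$; $w(o_j,n_j)=w(o_j,n_{j+1})=w(o_j,n_{j+3})=1$, $w(o_j,n_{j-1})=-1$. $S_{16}$: vertices $o_j,n_j$, $j\in\mathbb{Z}/8$; $w(o_j,o_{j+1})=1$, $w(n_j,n_{j+3})=1$, $w(o_j,n_{j+1})=-1$, $w(o_j,n_{j-1})=1$. -}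

module Defs where

open import Algebra.Bundles.Raw using (RawRing)
import Algebra.Definitions.RawMonoid as RawMonoidDefinitions
open import Data.Bool.Base using (if_then_else_)
open import Data.Fin.Base as Fin using (Fin; toℕ)
import Data.Fin.Properties as Fin
open import Data.Integer.Base as ℤ using (ℤ; 0ℤ; 1ℤ)
open import Data.Nat.Base as ℕ using (ℕ; zero; suc)
open import Data.Nat.DivMod using (_mod_)
import Data.Nat.Properties as ℕ
open import Data.Product.Base using (Σ-syntax; ∃-syntax; _×_; _,_)
open import Data.Rational.Base as ℚ using (ℚ; 0ℚ; 1ℚ; ½; ∣_∣)
import Data.Rational.Properties as ℚ
open import Data.Rational.Solver using (module +-*-Solver)
open import Data.Sign.Base as Sign using (Sign)
open import Data.Vec.Functional using (Vector)
open import Function.Bundles using (_↔_; Inverse)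
open import Level using (0ℓ)
open import Relation.Binary.Construct.Closure.ReflexiveTransitive using (Star)
open import Relation.Binary.Core using (_Preserves_⟶_)
open import Relation.Binary.PropositionalEquality
  using (_≡_; _≢_; refl; sym; trans; cong; subst; module ≡-Reasoning)
open import Relation.Nullary.Decidable.Core using (does)
open import Relation.Nullary.Negation.Core using (¬_)

------------------------------------------------------------------------
-- Real numbers as Cauchy sequences of rationals, up to the setoid
-- equality Real._≈_

IsCauchy : (ℕ → ℚ) → Set
IsCauchy x = ∀ ε → 0ℚ ℚ.< ε →
  ∃[ N ] ∀ m n → N ℕ.≤ m → N ℕ.≤ n → ∣ x m ℚ.- x n ∣ ℚ.< ε

record ℝ : Set where
  constructor mkℝ
  field
    seq    : ℕ → ℚ
    cauchy : IsCauchy seq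

open ℝ public

module Real where

  infix  4 _≈_ _≤_
  infixl 6 _+_
  infixl 7 _*_
  infix  8 -_

  _≈_ : ℝ → ℝ → Set
  x ≈ y = ∀ ε → 0ℚ ℚ.< ε →
    ∃[ N ] ∀ n → N ℕ.≤ n → ∣ seq x n ℚ.- seq y n ∣ ℚ.< ε

  _≤_ : ℝ → ℝ → Set
  x ≤ y = ∀ ε → 0ℚ ℚ.< ε →
    ∃[ N ] ∀ n → N ℕ.≤ n → seq x n ℚ.< seq y n ℚ.+ ε

  fromℚ : ℚ → ℝ
  fromℚ q = mkℝ (λ _ → q) λ ε 0<ε →
    0 , λ _ _ _ _ → subst (ℚ._< ε) (sym (cong ∣_∣ (ℚ.+-inverseʳ q))) 0<ε

  private abstract
    half>0 : ∀ {ε} → 0ℚ ℚ.< ε → 0ℚ ℚ.< ½ ℚ.* ε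
    half>0 {ε} 0<ε = ℚ.positive⁻¹ (½ ℚ.* ε)
      {{ℚ.pos*pos⇒pos ½ ε {{ℚ.positive 0<ε}}}}

    half+half : ∀ ε → ½ ℚ.* ε ℚ.+ ½ ℚ.* ε ≡ ε
    half+half ε = trans (sym (ℚ.*-distribʳ-+ ε ½ ½)) (ℚ.*-identityˡ ε)

    bounded : ∀ {x} → IsCauchy x →
      ∃[ B ] ℚ.Positive B × ∃[ N ] ∀ n → N ℕ.≤ n → ∣ x n ∣ ℚ.≤ B
    bounded {x} c with N , close ← c 1ℚ (ℚ.positive⁻¹ 1ℚ) =
      1ℚ ℚ.+ ∣ x N ∣ ,
      ℚ.pos+nonNeg⇒pos 1ℚ ∣ x N ∣ {{ℚ.∣-∣-nonNeg (x N)}} ,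
      N , λ n N≤n → begin
        ∣ x n ∣                         ≡⟨ cong ∣_∣ (split (x n) (x N)) ⟩
        ∣ (x n ℚ.- x N) ℚ.+ x N ∣       ≤⟨ ℚ.∣p+q∣≤∣p∣+∣q∣ (x n ℚ.- x N) (x N) ⟩
        ∣ x n ℚ.- x N ∣ ℚ.+ ∣ x N ∣     ≤⟨ ℚ.+-monoˡ-≤ ∣ x N ∣
                                             (ℚ.<⇒≤ (close n N N≤n ℕ.≤-refl)) ⟩
        1ℚ ℚ.+ ∣ x N ∣                  ∎
      where
      open ℚ.≤-Reasoning
      split : ∀ p q → p ≡ (p ℚ.- q) ℚ.+ q
      split = solve 2 (λ p q → p := (p :- q) :+ q) refl
        where open +-*-Solver

    scaling : ∀ B → ℚ.Positive B → ∀ ε → 0ℚ ℚ.< ε →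
      ∃[ η ] 0ℚ ℚ.< η ×
      (∀ p q → ∣ p ∣ ℚ.≤ B → ∣ q ∣ ℚ.< η → ∣ p ℚ.* q ∣ ℚ.< ε)
    scaling B B>0 ε 0<ε = B⁻¹ ℚ.* ε , η>0 , below
      where
      instance
        B-positive : ℚ.Positive B
        B-positive = B>0
        B-nonZero : ℚ.NonZero B
        B-nonZero = ℚ.pos⇒nonZero B
      B⁻¹ : ℚ
      B⁻¹ = ℚ.1/ B
      η>0 : 0ℚ ℚ.< B⁻¹ ℚ.* ε
      η>0 = ℚ.positive⁻¹ (B⁻¹ ℚ.* ε)
        {{ℚ.pos*pos⇒pos B⁻¹ {{ℚ.1/pos⇒pos B}} ε {{ℚ.positive 0<ε}}}}
      open ℚ.≤-Reasoning
      below : ∀ p q → ∣ p ∣ ℚ.≤ B → ∣ q ∣ ℚ.< B⁻¹ ℚ.* ε → ∣ p ℚ.* q ∣ ℚ.< ε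
      below p q p≤B q<η = begin-strict
        ∣ p ℚ.* q ∣             ≡⟨ ℚ.∣p*q∣≡∣p∣*∣q∣ p q ⟩
        ∣ p ∣ ℚ.* ∣ q ∣         ≤⟨ ℚ.*-monoʳ-≤-nonNeg ∣ q ∣ {{ℚ.∣-∣-nonNeg q}} p≤B ⟩
        B ℚ.* ∣ q ∣             <⟨ ℚ.*-monoʳ-<-pos B q<η ⟩
        B ℚ.* (B⁻¹ ℚ.* ε)       ≡⟨ ℚ.*-assoc B B⁻¹ ε ⟨
        (B ℚ.* B⁻¹) ℚ.* ε       ≡⟨ cong (ℚ._* ε) (ℚ.*-inverseʳ B) ⟩
        1ℚ ℚ.* ε                ≡⟨ ℚ.*-identityˡ ε ⟩
        ε                       ∎

    halves : ∀ {p q ε} → ∣ p ∣ ℚ.< ½ ℚ.* ε → ∣ q ∣ ℚ.< ½ ℚ.* ε →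
      ∣ p ℚ.+ q ∣ ℚ.< ε
    halves {p} {q} {ε} p< q< = begin-strict
      ∣ p ℚ.+ q ∣               ≤⟨ ℚ.∣p+q∣≤∣p∣+∣q∣ p q ⟩
      ∣ p ∣ ℚ.+ ∣ q ∣           <⟨ ℚ.+-mono-< p< q< ⟩
      ½ ℚ.* ε ℚ.+ ½ ℚ.* ε       ≡⟨ half+half ε ⟩
      ε                         ∎
      where open ℚ.≤-Reasoning

    +-cauchy : ∀ {x y} → IsCauchy x → IsCauchy y →
      IsCauchy (λ n → x n ℚ.+ y n)
    +-cauchy {x} {y} cx cy ε 0<ε
      with N₁ , close₁ ← cx (½ ℚ.* ε) (half>0 0<ε)
         | N₂ , close₂ ← cy (½ ℚ.* ε) (half>0 0<ε) =
      N₁ ℕ.⊔ N₂ , λ m n N≤m N≤n →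
        subst (λ d → ∣ d ∣ ℚ.< ε) (sym (regroup (x m) (y m) (x n) (y n)))
          (halves {x m ℚ.- x n} {y m ℚ.- y n}
            (close₁ m n (ℕ.m⊔n≤o⇒m≤o N₁ N₂ N≤m) (ℕ.m⊔n≤o⇒m≤o N₁ N₂ N≤n))
            (close₂ m n (ℕ.m⊔n≤o⇒n≤o N₁ N₂ N≤m) (ℕ.m⊔n≤o⇒n≤o N₁ N₂ N≤n)))
      where
      regroup : ∀ a b c d →
        (a ℚ.+ b) ℚ.- (c ℚ.+ d) ≡ (a ℚ.- c) ℚ.+ (b ℚ.- d)
      regroup = solve 4
        (λ a b c d → (a :+ b) :- (c :+ d) := (a :- c) :+ (b :- d)) refl
        where open +-*-Solver

    product-difference : ∀ p q r s →
      p ℚ.* q ℚ.- r ℚ.* s ≡ p ℚ.* (q ℚ.- s) ℚ.+ s ℚ.* (p ℚ.- r)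
    product-difference = solve 4
      (λ p q r s → p :* q :- r :* s := p :* (q :- s) :+ s :* (p :- r)) refl
      where open +-*-Solver

    *-cauchy : ∀ {x y} → IsCauchy x → IsCauchy y →
      IsCauchy (λ n → x n ℚ.* y n)
    *-cauchy {x} {y} cx cy ε 0<ε =
      let B , B>0 , M₁ , x≤B = bounded {x} cx
          C , C>0 , M₂ , y≤C = bounded {y} cy
          η₁ , η₁>0 , below₁ = scaling C C>0 (½ ℚ.* ε) (half>0 0<ε)
          η₂ , η₂>0 , below₂ = scaling B B>0 (½ ℚ.* ε) (half>0 0<ε)
          N₁ , close₁ = cx η₁ η₁>0
          N₂ , close₂ = cy η₂ η₂>0
          M = M₁ ℕ.⊔ M₂
          N = N₁ ℕ.⊔ N₂
      in M ℕ.⊔ N , λ m n ≤m ≤n →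
        let M≤m = ℕ.m⊔n≤o⇒m≤o M N ≤m
            M≤n = ℕ.m⊔n≤o⇒m≤o M N ≤n
            N≤m = ℕ.m⊔n≤o⇒n≤o M N ≤m
            N≤n = ℕ.m⊔n≤o⇒n≤o M N ≤n
        in subst (λ d → ∣ d ∣ ℚ.< ε) (sym (product-difference (x m) (y m) (x n) (y n)))
          (halves {x m ℚ.* (y m ℚ.- y n)} {y n ℚ.* (x m ℚ.- x n)}
            (below₂ (x m) (y m ℚ.- y n)
              (x≤B m (ℕ.m⊔n≤o⇒m≤o M₁ M₂ M≤m))
              (close₂ m n (ℕ.m⊔n≤o⇒n≤o N₁ N₂ N≤m) (ℕ.m⊔n≤o⇒n≤o N₁ N₂ N≤n)))
            (below₁ (y n) (x m ℚ.- x n)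
              (y≤C n (ℕ.m⊔n≤o⇒n≤o M₁ M₂ M≤n))
              (close₁ m n (ℕ.m⊔n≤o⇒m≤o N₁ N₂ N≤m) (ℕ.m⊔n≤o⇒m≤o N₁ N₂ N≤n))))

    neg-cauchy : ∀ {x} → IsCauchy x → IsCauchy (λ n → ℚ.- x n)
    neg-cauchy {x} c ε 0<ε with N , close ← c ε 0<ε =
      N , λ m n N≤m N≤n →
        subst (ℚ._< ε) (sym (flip (x m) (x n))) (close m n N≤m N≤n)
      where
      open ≡-Reasoning
      flip : ∀ p q → ∣ (ℚ.- p) ℚ.- (ℚ.- q) ∣ ≡ ∣ p ℚ.- q ∣
      flip p q = begin
        ∣ (ℚ.- p) ℚ.- (ℚ.- q) ∣   ≡⟨ cong ∣_∣ (ℚ.neg-distrib-+ p (ℚ.- q)) ⟨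
        ∣ ℚ.- (p ℚ.- q) ∣         ≡⟨ ℚ.∣-p∣≡∣p∣ (p ℚ.- q) ⟩
        ∣ p ℚ.- q ∣               ∎

  _+_ : ℝ → ℝ → ℝ
  x + y = mkℝ (λ n → seq x n ℚ.+ seq y n) (+-cauchy {seq x} {seq y} (cauchy x) (cauchy y))

  _*_ : ℝ → ℝ → ℝ
  x * y = mkℝ (λ n → seq x n ℚ.* seq y n) (*-cauchy {seq x} {seq y} (cauchy x) (cauchy y))

  -_ : ℝ → ℝ
  - x = mkℝ (λ n → ℚ.- seq x n) (neg-cauchy {seq x} (cauchy x))

  rawRing : RawRing 0ℓ 0ℓ
  rawRing = record
    { Carrier = ℝ
    ; _≈_     = _≈_
    ; _+_     = _+_
    ; _*_     = _*_
    ; -_      = -_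
    ; 0#      = fromℚ 0ℚ
    ; 1#      = fromℚ 1ℚ
    }

------------------------------------------------------------------------
-- Adjoining a square root i of -1;  x +i y  stands for x + i y.  Over ℤ
-- this gives the Gaussian integers, over ℝ the complex numbers.

infix 5 _+i_

record _[i] (A : Set) : Set where
  constructor _+i_
  field
    re : A
    im : A

open _[i] public

module Adjoin-i (R : RawRing 0ℓ 0ℓ) where
  private module R = RawRing R

  conj : R.Carrier [i] → R.Carrier [i]
  conj (a +i b) = a +i R.- b

  rawRing : RawRing 0ℓ 0ℓ
  rawRing = record
    { Carrier = R.Carrier [i]
    ; _≈_     = λ { (a +i b) (c +i d) → (a R.≈ c) × (b R.≈ d) }
    ; _+_     = λ { (a +i b) (c +i d) → a R.+ c +i b R.+ d }
    ; _*_     = λ { (a +i b) (c +i d) →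
                    a R.* c R.+ R.- (b R.* d) +i a R.* d R.+ b R.* c }
    ; -_      = λ { (a +i b) → R.- a +i R.- b }
    ; 0#      = R.0# +i R.0#
    ; 1#      = R.1# +i R.0#
    }

ℤ[i] ℂ : Set
ℤ[i] = ℤ [i]
ℂ    = ℝ [i]

module Gaussian where
  open Adjoin-i ℤ.+-*-rawRing public
  open RawRing rawRing public
    using (_+_; _*_; -_; 0#; 1#; +-rawMonoid)
  open RawMonoidDefinitions +-rawMonoid public using (sum)

  𝐢 : ℤ[i]
  𝐢 = 0ℤ +i 1ℤ

  IsUnit : ℤ[i] → Set
  IsUnit z = ∃[ y ] z * y ≡ 1#

module Complex where
  open Adjoin-i Real.rawRing public
  open RawRing rawRing public
    using (_≈_; _*_; 0#; +-rawMonoid)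
  open RawMonoidDefinitions +-rawMonoid public using (sum)

  fromℤ[i] : ℤ[i] → ℂ
  fromℤ[i] (a +i b) = Real.fromℚ (a ℚ./ 1) +i Real.fromℚ (b ℚ./ 1)

------------------------------------------------------------------------
-- Matrices over the Gaussian integers; equality is entrywise

Matrix : ℕ → Set
Matrix n = Fin n → Fin n → ℤ[i]

infix 4 _≐_
infixl 7 _⊗_
infix 9 _*ᴴ

_≐_ : ∀ {n} → Matrix n → Matrix n → Set
A ≐ B = ∀ u v → A u v ≡ B u v

I : ∀ {n} → Matrix n
I u v = if does (u Fin.≟ v) then Gaussian.1# else Gaussian.0#

_⊗_ : ∀ {n} → Matrix n → Matrix n → Matrix n
(A ⊗ B) u v = Gaussian.sum λ x → A u x Gaussian.* B x v

_*ᴴ : ∀ {n} → Matrix n → Matrix n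
(A *ᴴ) u v = Gaussian.conj (A v u)

IsHermitian : ∀ {n} → Matrix n → Set
IsHermitian A = A *ᴴ ≐ A

IsUnitary : ∀ {n} → Matrix n → Set
IsUnitary Q = (Q ⊗ Q *ᴴ ≐ I) × (Q *ᴴ ⊗ Q ≐ I)

IsEigenvalue : ∀ {n} → Matrix n → ℂ → Set
IsEigenvalue {n} A μ = Σ[ v ∈ Vector ℂ n ] ¬ (∀ x → v x ≈ 0#) ×
  (∀ u → sum (λ x → fromℤ[i] (A u x) * v x) ≈ μ * v u)
  where open Complex

IsCyclotomic : ∀ {n} → Matrix n → Set
IsCyclotomic A = IsHermitian A × (∀ μ → IsEigenvalue A μ →
  (im μ Real.≈ Real.fromℚ 0ℚ) ×
  (Real.fromℚ (ℤ.- (ℤ.+ 2) ℚ./ 1) Real.≤ re μ) ×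
  (re μ Real.≤ Real.fromℚ (ℤ.+ 2 ℚ./ 1)))

Adjacent : ∀ {n} → Matrix n → Fin n → Fin n → Set
Adjacent A u v = u ≢ v × A u v ≢ Gaussian.0#

-- Adjacency is symmetric for the Hermitian matrices considered here, so
-- directed paths suffice.
IsIndecomposable : ∀ {n} → Matrix n → Set
IsIndecomposable A = ∀ u v → Star (Adjacent A) u v

IsProperPrincipalSubmatrixOf : ∀ {m n} → Matrix m → Matrix n → Set
IsProperPrincipalSubmatrixOf {m} {n} A B = m ℕ.< n ×
  (∃[ f ] f Preserves Fin._<_ ⟶ Fin._<_ × (∀ u v → A u v ≡ B (f u) (f v)))

record IsMaximal {n} (A : Matrix n) : Set where
  field
    cyclotomic     : IsCyclotomic A
    indecomposable : IsIndecomposable A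
    maximal        : ∀ {m} (B : Matrix m) → IsCyclotomic B → IsIndecomposable B →
                     ¬ IsProperPrincipalSubmatrixOf A B

± : Sign → ℤ[i] → ℤ[i]
± Sign.+ z = z
± Sign.- z = Gaussian.- z

data Automorphism : Set where
  identity conjugation : Automorphism

⟦_⟧ : Automorphism → ℤ[i] → ℤ[i]
⟦ identity    ⟧ z = z
⟦ conjugation ⟧ z = Gaussian.conj z

infix 4 _∼_

_∼_ : ∀ {n} → Matrix n → Matrix n → Set
A ∼ B = ∃[ Q ] IsUnitary Q × ∃[ s ] ∃[ σ ]
  (A ≐ λ u v → ± s (⟦ σ ⟧ ((Q ⊗ B ⊗ Q *ᴴ) u v)))

------------------------------------------------------------------------
-- Weighted graphs

record Graph : Set₁ where
  field
    Vertex : Set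
    weight : Vertex → Vertex → ℤ[i]

-- An adjacency matrix arises from any enumeration of the vertices.
IsAdjacencyMatrixOf : ∀ {n} → Matrix n → Graph → Set
IsAdjacencyMatrixOf {n} M G = Σ[ e ∈ Fin n ↔ Vertex ]
  (∀ u v → M u v ≡ weight (Inverse.to e u) (Inverse.to e v))
  where open Graph G

EquivalentToAdjacencyMatrixOf : ∀ {n} → Matrix n → Graph → Set
EquivalentToAdjacencyMatrixOf A G = ∃[ M ] IsAdjacencyMatrixOf M G × A ∼ M

-- The weights determined by listing w u v for certain pairs (u , v).  In the
-- graphs below no pair of vertices is listed in both orders and u ≢ v, so at
-- most one of the two summands is nonzero.
hermitian : ∀ {V : Set} → (V → V → ℤ[i]) → V → V → ℤ[i]
hermitian w u v = w u v Gaussian.+ Gaussian.conj (w v u)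

infixl 6 _⊕_

-- Fin k represents ℤ/k, and j ⊕ s is j + s reduced modulo k.
_⊕_ : ∀ {k} → Fin k → ℕ → Fin k
_⊕_ {suc k} j s = (toℕ j ℕ.+ s) mod suc k

[_≡_] : ∀ {k} → Fin k → Fin k → ℤ[i]
[ j ≡ l ] = I j l

module Vertices where

  data TB : Set where
    t b : TB

  data ON : Set where
    o n : ON

  data Letter : Set where
    a b c d e f g h : Letter

open Vertices

-- The edges going around from position k to position 1 carry the factor ζ,
-- so ζ = 1 gives T₂ₖ and ζ = i gives T₂ₖ⁽ⁱ⁾.
T-graph : ℤ[i] → ℕ → Graph
T-graph ζ k = record
  { Vertex = TB × Fin k
  ; weight = hermitian listed
  }
  where
  open Gaussian

  sign : TB → ℤ[i]
  sign t = 1#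
  sign b = - 1#

  factor : Fin k → ℤ[i]
  factor j = if does (suc (toℕ j) ℕ.≟ k) then ζ else 1#

  listed : TB × Fin k → TB × Fin k → ℤ[i]
  listed (x , j) (_ , l) = [ l ≡ j ⊕ 1 ] * (sign x * factor j)

T₂ₖ T₂ₖ⁽ⁱ⁾ : ℕ → Graph
T₂ₖ    = T-graph Gaussian.1#
T₂ₖ⁽ⁱ⁾ = T-graph Gaussian.𝐢

S₈† : Graph
S₈† = record
  { Vertex = Letter
  ; weight = hermitian listed
  }
  where
  open Gaussian

  listed : Letter → Letter → ℤ[i]
  listed a b = 1#
  listed c d = 1#
  listed e f = 1#
  listed g h = 1#
  listed a c = 1#
  listed a g = 1#
  listed c e = 1#
  listed f h = 1#
  listed b h = - 1#
  listed b d = - 1#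
  listed e g = - 1#
  listed d f = - 1#
  listed e a = 𝐢
  listed g c = 𝐢
  listed b f = 𝐢
  listed d h = 𝐢
  listed _ _ = 0#

S₁₄ : Graph
S₁₄ = record
  { Vertex = ON × Fin 7
  ; weight = hermitian listed
  }
  where
  open Gaussian

  -- j ⊕ 6 is j - 1.
  listed : ON × Fin 7 → ON × Fin 7 → ℤ[i]
  listed (o , j) (n , l) =
    [ l ≡ j ] + [ l ≡ j ⊕ 1 ] + [ l ≡ j ⊕ 3 ] + - [ l ≡ j ⊕ 6 ]
  listed _ _ = 0#

S₁₆ : Graph
S₁₆ = record
  { Vertex = ON × Fin 8
  ; weight = hermitian listed
  }
  where
  open Gaussian

  -- j ⊕ 7 is j - 1.
  listed : ON × Fin 8 → ON × Fin 8 → ℤ[i]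
  listed (o , j) (o , l) = [ l ≡ j ⊕ 1 ]
  listed (n , j) (n , l) = [ l ≡ j ⊕ 3 ]
  listed (o , j) (n , l) = - [ l ≡ j ⊕ 1 ] + [ l ≡ j ⊕ 7 ]
  listed (n , _) (o , _) = 0#

{-# OPTIONS --safe #-}

-- Scaling rows by units turns the matrix into a gain graph with fourth roots
-- of unity as weights, and the eigenvalue bound says that the integral
-- Hermitian forms of all finite configurations in it are at most twice the
-- norm. Growing a configuration vertex by vertex, a certificate tree either
-- refutes each way of attaching the next vertex by an explicit vector, or
-- recognises the configuration inside one of finitely many target graphs.
-- The only unbounded growth is along induced paths; a graph with a long
-- induced path embeds in a wheel T₂ₖ or T₂ₖ⁽ⁱ⁾. Every target M satisfies
-- M² = 4, so it is cyclotomic itself, and a maximal matrix that embeds in it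
-- must be all of it.
module Submission where

open import Data.Bool.Base using (Bool; true; false; if_then_else_)
open import Data.Empty using (⊥; ⊥-elim)
open import Data.Fin.Base as Fin using (Fin; zero; suc; toℕ)
import Data.Fin.Properties as Fin
open import Data.Integer.Base as ℤ using (ℤ; 0ℤ)
import Data.Integer.Properties as ℤ
open import Data.Maybe.Base as Maybe using (Maybe; just; nothing)
open import Data.Nat.Base as ℕ using (ℕ; zero; suc; z≤n; s≤s)
import Data.Nat.Properties as ℕ
open import Data.Product.Base using (Σ; Σ-syntax; ∃-syntax; _×_; _,_; proj₁; proj₂)
open import Data.Sign.Base as Sign using (Sign)
open import Data.Sum.Base using (_⊎_; inj₁; inj₂)
open import Data.Unit.Base using (⊤; tt)
open import Data.Vec.Base as Vec using (Vec; []; _∷_)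
import Data.Vec.Properties as Vec
open import Function.Base using (_∘_)
open import Function.Bundles using (_↔_; Inverse; mk↔ₛ′)
open import Relation.Binary.Definitions using (tri<; tri≈; tri>; DecidableEquality)
open import Relation.Binary.PropositionalEquality hiding ([_])
open import Relation.Nullary.Decidable using (Dec; yes; no; does; ¬?; _×-dec_; map′; toWitness)
open import Relation.Nullary.Negation.Core using (¬_; contradiction)

module Forms where

 open import Data.Integer.Base using (1ℤ)
 open import Data.Rational.Base
 open import Data.Rational.Properties
 open import Data.Rational.Solver using (module +-*-Solver)
 open +-*-Solver using (solve; _:+_; _:*_; _:-_; :-_; con; _:=_)
 import Data.Rational.Unnormalised.Base as ℚᵘ
 import Data.Rational.Unnormalised.Properties as ℚᵘ
 open import Relation.Nullary.Decidable using (decidable-stable)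

 -- The embedding of the integers

 fromℤ : ℤ → ℚ
 fromℤ z = z / 1

 toℚᵘ-fromℤ : ∀ z → toℚᵘ (fromℤ z) ℚᵘ.≃ ℚᵘ.mkℚᵘ z 0
 toℚᵘ-fromℤ z = toℚᵘ-fromℚᵘ (ℚᵘ.mkℚᵘ z 0)

 fromℤ-+ : ∀ a b → fromℤ (a ℤ.+ b) ≡ fromℤ a + fromℤ b
 fromℤ-+ a b = toℚᵘ-injective (begin
   toℚᵘ (fromℤ (a ℤ.+ b)) ≈⟨ toℚᵘ-fromℤ (a ℤ.+ b) ⟩
   ℚᵘ.mkℚᵘ (a ℤ.+ b) 0 ≈⟨ ℚᵘ.*≡* (cong (ℤ._* 1ℤ) (sym (cong₂ ℤ._+_ (ℤ.*-identityʳ a) (ℤ.*-identityʳ b)))) ⟩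
   ℚᵘ.mkℚᵘ a 0 ℚᵘ.+ ℚᵘ.mkℚᵘ b 0 ≈⟨ ℚᵘ.+-cong (toℚᵘ-fromℤ a) (toℚᵘ-fromℤ b) ⟨
   toℚᵘ (fromℤ a) ℚᵘ.+ toℚᵘ (fromℤ b) ≈⟨ toℚᵘ-homo-+ (fromℤ a) (fromℤ b) ⟨
   toℚᵘ (fromℤ a + fromℤ b) ∎)
   where open ℚᵘ.≃-Reasoning

 fromℤ-* : ∀ a b → fromℤ (a ℤ.* b) ≡ fromℤ a * fromℤ b
 fromℤ-* a b = toℚᵘ-injective (begin
   toℚᵘ (fromℤ (a ℤ.* b)) ≈⟨ toℚᵘ-fromℤ (a ℤ.* b) ⟩
   ℚᵘ.mkℚᵘ (a ℤ.* b) 0 ≈⟨ ℚᵘ.*≡* refl ⟩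
   ℚᵘ.mkℚᵘ a 0 ℚᵘ.* ℚᵘ.mkℚᵘ b 0 ≈⟨ ℚᵘ.*-cong (toℚᵘ-fromℤ a) (toℚᵘ-fromℤ b) ⟨
   toℚᵘ (fromℤ a) ℚᵘ.* toℚᵘ (fromℤ b) ≈⟨ toℚᵘ-homo-* (fromℤ a) (fromℤ b) ⟨
   toℚᵘ (fromℤ a * fromℤ b) ∎)
   where open ℚᵘ.≃-Reasoning

 fromℤ-neg : ∀ a → fromℤ (ℤ.- a) ≡ - fromℤ a
 fromℤ-neg a = toℚᵘ-injective (begin
   toℚᵘ (fromℤ (ℤ.- a)) ≈⟨ toℚᵘ-fromℤ (ℤ.- a) ⟩
   ℚᵘ.mkℚᵘ (ℤ.- a) 0 ≈⟨ ℚᵘ.-‿cong (toℚᵘ-fromℤ a) ⟨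
   ℚᵘ.- toℚᵘ (fromℤ a) ≈⟨ toℚᵘ-homo‿- (fromℤ a) ⟨
   toℚᵘ (- fromℤ a) ∎)
   where open ℚᵘ.≃-Reasoning

 fromℤ-≤ : ∀ {a b} → a ℤ.≤ b → fromℤ a ≤ fromℤ b
 fromℤ-≤ {a} {b} a≤b = toℚᵘ-cancel-≤ (begin
   toℚᵘ (fromℤ a) ≃⟨ toℚᵘ-fromℤ a ⟩
   ℚᵘ.mkℚᵘ a 0 ≤⟨ ℚᵘ.*≤* (ℤ.*-monoʳ-≤-nonNeg 1ℤ a≤b) ⟩
   ℚᵘ.mkℚᵘ b 0 ≃⟨ toℚᵘ-fromℤ b ⟨
   toℚᵘ (fromℤ b) ∎)
   where open ℚᵘ.≤-Reasoning

 -- Elementary facts on the order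

 0<1 : 0ℚ < 1ℚ
 0<1 = positive⁻¹ 1ℚ

 *-pos : ∀ {p q} → 0ℚ < p → 0ℚ < q → 0ℚ < p * q
 *-pos {p} {q} 0<p 0<q = positive⁻¹ (p * q) {{pos*pos⇒pos p {{positive 0<p}} q {{positive 0<q}}}}

 *-nonneg : ∀ {p q} → 0ℚ ≤ p → 0ℚ ≤ q → 0ℚ ≤ p * q
 *-nonneg {p} {q} 0≤p 0≤q = subst (_≤ p * q) (*-zeroʳ p) (*-monoˡ-≤-nonNeg p {{nonNegative 0≤p}} 0≤q)

 neg*neg : ∀ p q → (- p) * (- q) ≡ p * q
 neg*neg = solve 2 (λ p q → (:- p) :* (:- q) := p :* q) refl

 0≤-p : ∀ {p} → p ≤ 0ℚ → 0ℚ ≤ - p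
 0≤-p = neg-antimono-≤

 0≤p² : ∀ p → 0ℚ ≤ p * p
 0≤p² p with ≤-total 0ℚ p
 ... | inj₁ 0≤p = *-nonneg 0≤p 0≤p
 ... | inj₂ p≤0 = subst (0ℚ ≤_) (neg*neg p p) (*-nonneg (0≤-p p≤0) (0≤-p p≤0))

 0<p⇒-p<0 : ∀ {p} → 0ℚ < p → - p < 0ℚ
 0<p⇒-p<0 = neg-antimono-<

 p-q<0 : ∀ {p q} → p < q → p - q < 0ℚ
 p-q<0 {p} {q} p<q = subst (p - q <_) (+-inverseʳ q) (+-monoˡ-< (- q) p<q)

 0<q-p : ∀ {p q} → p < q → 0ℚ < q - p
 0<q-p {p} {q} p<q = subst (_< q - p) (+-inverseʳ p) (+-monoˡ-< (- p) p<q)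

 0≤q-p : ∀ {p q} → p ≤ q → 0ℚ ≤ q - p
 0≤q-p {p} {q} p≤q = subst (_≤ q - p) (+-inverseʳ p) (+-monoˡ-≤ (- p) p≤q)

 ≤-from-0≤ : ∀ {p q} → 0ℚ ≤ q - p → p ≤ q
 ≤-from-0≤ {p} {q} h = subst₂ _≤_ (+-identityˡ p) (lemma q p) (+-monoˡ-≤ p h)
   where
   lemma : ∀ q p → (q - p) + p ≡ q
   lemma = solve 2 (λ q p → (q :- p) :+ p := q) refl

 +-nonneg : ∀ {p q} → 0ℚ ≤ p → 0ℚ ≤ q → 0ℚ ≤ p + q
 +-nonneg {p} {q} a b = subst (_≤ p + q) (+-identityˡ 0ℚ) (+-mono-≤ a b)

 -- Sums and quadratic forms

 sum : ∀ {n} → (Fin n → ℚ) → ℚ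
 sum {zero} f = 0ℚ
 sum {suc n} f = f zero + sum (f ∘ suc)

 sum-cong : ∀ {n} {f g : Fin n → ℚ} → (∀ i → f i ≡ g i) → sum f ≡ sum g
 sum-cong {zero} e = refl
 sum-cong {suc n} e = cong₂ _+_ (e zero) (sum-cong (e ∘ suc))

 sum-0 : ∀ {n} (f : Fin n → ℚ) → (∀ i → f i ≡ 0ℚ) → sum f ≡ 0ℚ
 sum-0 {zero} f e = refl
 sum-0 {suc n} f e = trans (cong₂ _+_ (e zero) (sum-0 (f ∘ suc) (e ∘ suc))) (+-identityˡ 0ℚ)

 sum-linear : ∀ {n} a b (f g : Fin n → ℚ) → sum (λ i → a * f i + b * g i) ≡ a * sum f + b * sum g
 sum-linear {zero} a b f g = solve 2 (λ a b → con 0ℚ := a :* con 0ℚ :+ b :* con 0ℚ) refl a b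
 sum-linear {suc n} a b f g = trans (cong (a * f zero + b * g zero +_) (sum-linear a b (f ∘ suc) (g ∘ suc)))
   (lemma a b (f zero) (g zero) (sum (f ∘ suc)) (sum (g ∘ suc)))
   where
   lemma : ∀ a b f g s t → a * f + b * g + (a * s + b * t) ≡ a * (f + s) + b * (g + t)
   lemma = solve 6 (λ a b f g s t → a :* f :+ b :* g :+ (a :* s :+ b :* t) := a :* (f :+ s) :+ b :* (g :+ t)) refl

 sum-scale : ∀ {n} a (f : Fin n → ℚ) → sum (λ i → a * f i) ≡ a * sum f
 sum-scale {zero} a f = sym (*-zeroʳ a)
 sum-scale {suc n} a f = trans (cong (a * f zero +_) (sum-scale a (f ∘ suc))) (sym (*-distribˡ-+ a (f zero) (sum (f ∘ suc))))

 sum-nonneg : ∀ {n} {f : Fin n → ℚ} → (∀ i → 0ℚ ≤ f i) → 0ℚ ≤ sum f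
 sum-nonneg {zero} h = ≤-refl
 sum-nonneg {suc n} h = +-nonneg (h zero) (sum-nonneg (h ∘ suc))

 delta : ∀ {n} → Fin n → Fin n → ℚ
 delta zero zero = 1ℚ
 delta zero (suc j) = 0ℚ
 delta (suc i) zero = 0ℚ
 delta (suc i) (suc j) = delta i j

 sum-delta : ∀ {n} (i : Fin n) (f : Fin n → ℚ) → sum (λ j → f j * delta i j) ≡ f i
 sum-delta zero f = trans (cong₂ _+_ (*-identityʳ (f zero)) (sum-0 (λ j → f (suc j) * 0ℚ) (λ j → *-zeroʳ (f (suc j))))) (+-identityʳ (f zero))
 sum-delta (suc i) f = trans (cong₂ _+_ (*-zeroʳ (f zero)) (sum-delta i (f ∘ suc))) (+-identityˡ (f (suc i)))

 Mat : ℕ → Set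
 Mat n = Fin n → Fin n → ℚ

 Symmetric : ∀ {n} → Mat n → Set
 Symmetric S = ∀ i j → S i j ≡ S j i

 dot : ∀ {n} → (Fin n → ℚ) → (Fin n → ℚ) → ℚ
 dot b x = sum λ i → b i * x i

 form : ∀ {n} → Mat n → (Fin n → ℚ) → ℚ
 form S x = sum λ i → x i * dot (S i) x

 square : ∀ {n} → (Fin n → ℚ) → ℚ
 square x = sum λ i → x i * x i

 corner : ∀ {n} → Mat (suc n) → ℚ
 corner S = S zero zero

 border : ∀ {n} → Mat (suc n) → Fin n → ℚ
 border S j = S zero (suc j)

 rest : ∀ {n} → Mat (suc n) → Mat n
 rest S i j = S (suc i) (suc j)

 -- The Schur complement of the corner, multiplied by the corner.
 schur : ∀ {n} → Mat (suc n) → Mat n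
 schur S i j = corner S * rest S i j + - (border S i * border S j)

 schur-symmetric : ∀ {n} {S : Mat (suc n)} → Symmetric S → Symmetric (schur S)
 schur-symmetric {S = S} sy i j = cong₂ (λ a b → corner S * a + - b) (sy (suc i) (suc j)) (*-comm (border S i) (border S j))

 infixr 5 _◂_

 _◂_ : ∀ {n} {A : Set} → A → (Fin n → A) → Fin (suc n) → A
 (a ◂ x) zero = a
 (a ◂ x) (suc i) = x i

 form-split : ∀ {n} (S : Mat (suc n)) → Symmetric S → ∀ x → let x₀ = x zero ; y = x ∘ suc ; d = dot (border S) y in
   form S x ≡ corner S * (x₀ * x₀) + (x₀ * d + x₀ * d) + form (rest S) y
 form-split S sy x = trans
   (cong (x zero * (corner S * x zero + d) +_)
     (trans (sum-cong (λ i → trans (cong (λ s → y i * (s * x zero + dot (rest S i) y)) (sy (suc i) zero))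
                                   (expand (y i) (border S i) (x zero) (dot (rest S i) y))))
            (sum-linear (x zero) 1ℚ (λ i → border S i * y i) (λ i → y i * dot (rest S i) y))))
   (collect (x zero) (corner S) d (form (rest S) y))
   where
   y = x ∘ suc
   d = dot (border S) y
   expand : ∀ y b x r → y * (b * x + r) ≡ x * (b * y) + 1ℚ * (y * r)
   expand = solve 4 (λ y b x r → y :* (b :* x :+ r) := x :* (b :* y) :+ con 1ℚ :* (y :* r)) refl
   collect : ∀ x a d q → x * (a * x + d) + (x * d + 1ℚ * q) ≡ a * (x * x) + (x * d + x * d) + q
   collect = solve 4 (λ x a d q → x :* (a :* x :+ d) :+ (x :* d :+ con 1ℚ :* q) := a :* (x :* x) :+ (x :* d :+ x :* d) :+ q) refl

 dot-schur : ∀ {n} (S : Mat (suc n)) i y → dot (schur S i) y ≡ corner S * dot (rest S i) y - border S i * dot (border S) y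
 dot-schur S i y = trans
   (sum-cong λ j → expand (corner S) (rest S i j) (border S i) (border S j) (y j))
   (trans (sum-linear (corner S) (- border S i) (λ j → rest S i j * y j) (λ j → border S j * y j))
          (cong (corner S * dot (rest S i) y +_) (sym (neg-distribˡ-* (border S i) (dot (border S) y)))))
   where
   expand : ∀ a r b c y → (a * r + - (b * c)) * y ≡ a * (r * y) + (- b) * (c * y)
   expand = solve 5 (λ a r b c y → (a :* r :+ :- (b :* c)) :* y := a :* (r :* y) :+ (:- b) :* (c :* y)) refl

 form-schur : ∀ {n} (S : Mat (suc n)) y → let d = dot (border S) y in
   form (schur S) y ≡ corner S * form (rest S) y - d * d
 form-schur S y = trans
   (sum-cong λ i → trans (cong (y i *_) (dot-schur S i y)) (expand (y i) (corner S) (dot (rest S i) y) (border S i) d))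
   (trans (sum-linear (corner S) (- d) (λ i → y i * dot (rest S i) y) (λ i → border S i * y i))
          (cong (corner S * form (rest S) y +_) (sym (neg-distribˡ-* d d))))
   where
   d = dot (border S) y
   expand : ∀ y a r b d → y * (a * r - b * d) ≡ a * (y * r) + (- d) * (b * y)
   expand = solve 5 (λ y a r b d → y :* (a :* r :- b :* d) := a :* (y :* r) :+ (:- d) :* (b :* y)) refl

 complete-square : ∀ {n} (S : Mat (suc n)) → Symmetric S → ∀ x → let w = corner S * x zero + dot (border S) (x ∘ suc) in
   corner S * form S x ≡ w * w + form (schur S) (x ∘ suc)
 complete-square S sy x = trans (cong (corner S *_) (form-split S sy x))
   (trans (expand (corner S) (x zero) (dot (border S) (x ∘ suc)) (form (rest S) (x ∘ suc)))
          (cong ((corner S * x zero + dot (border S) (x ∘ suc)) * (corner S * x zero + dot (border S) (x ∘ suc)) +_) (sym (form-schur S (x ∘ suc)))))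
   where
   expand : ∀ a x d q → a * (a * (x * x) + (x * d + x * d) + q) ≡ (a * x + d) * (a * x + d) + (a * q - d * d)
   expand = solve 4 (λ a x d q → a :* (a :* (x :* x) :+ (x :* d :+ x :* d) :+ q) := (a :* x :+ d) :* (a :* x :+ d) :+ (a :* q :- d :* d)) refl

 dot-scale : ∀ {n} a (b y : Fin n → ℚ) → dot b (λ i → a * y i) ≡ a * dot b y
 dot-scale a b y = trans (sum-cong λ i → lemma a (b i) (y i)) (sum-scale a (λ i → b i * y i))
   where
   lemma : ∀ a b y → b * (a * y) ≡ a * (b * y)
   lemma = solve 3 (λ a b y → b :* (a :* y) := a :* (b :* y)) refl

 form-scale : ∀ {n} a (S : Mat n) y → form S (λ i → a * y i) ≡ a * a * form S y
 form-scale a S y = trans (sum-cong λ i → trans (cong (a * y i *_) (dot-scale a (S i) y)) (lemma a (y i) (dot (S i) y)))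
   (sum-scale (a * a) (λ i → y i * dot (S i) y))
   where
   lemma : ∀ a y d → a * y * (a * d) ≡ a * a * (y * d)
   lemma = solve 3 (λ a y d → a :* y :* (a :* d) := a :* a :* (y :* d)) refl

 -- The vector that completes y to the critical point of the form in the first
 -- coordinate.
 critical : ∀ {n} → Mat (suc n) → (Fin n → ℚ) → Fin (suc n) → ℚ
 critical S y = - dot (border S) y ◂ λ i → corner S * y i

 form-critical : ∀ {n} (S : Mat (suc n)) → Symmetric S → ∀ y → form S (critical S y) ≡ corner S * form (schur S) y
 form-critical S sy y = trans (form-split S sy (critical S y))
   (trans (cong₂ (λ e q → corner S * (- d * - d) + (- d * e + - d * e) + q) (dot-scale (corner S) (border S) y) (form-scale (corner S) (rest S) y))
   (trans (expand (corner S) d (form (rest S) y)) (cong (corner S *_) (sym (form-schur S y)))))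
   where
   d = dot (border S) y
   expand : ∀ a d q → a * (- d * - d) + (- d * (a * d) + - d * (a * d)) + a * a * q ≡ a * (a * q - d * d)
   expand = solve 3 (λ a d q → a :* (:- d :* :- d) :+ (:- d :* (a :* d) :+ :- d :* (a :* d)) :+ a :* a :* q := a :* (a :* q :- d :* d)) refl

 form-spike : ∀ {n} (S : Mat (suc n)) → Symmetric S → ∀ i p q →
   form S (p ◂ λ j → q * delta i j) ≡ corner S * (p * p) + (p * (q * border S i) + p * (q * border S i)) + q * q * rest S i i
 form-spike S sy i p q = trans (form-split S sy (p ◂ λ j → q * delta i j)) (cong₂ (λ e f → corner S * (p * p) + (p * e + p * e) + f)
   (trans (dot-scale q (border S) (delta i)) (cong (q *_) (sum-delta i (border S))))
   (trans (form-scale q (rest S) (delta i)) (cong (q * q *_) diagonal)))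
   where
   diagonal : form (rest S) (delta i) ≡ rest S i i
   diagonal = trans (sum-cong {f = λ j → delta i j * dot (rest S j) (delta i)} {λ j → dot (rest S j) (delta i) * delta i j}
       λ j → *-comm (delta i j) (dot (rest S j) (delta i)))
     (trans (sum-delta i (λ j → dot (rest S j) (delta i))) (sum-delta i (rest S i)))

 -- Definiteness is decidable

 Definite : ∀ {n} → Mat n → Set
 Definite S = (∀ x → 0ℚ ≤ form S x) ⊎ (∃[ x ] form S x < 0ℚ)

 all-zero? : ∀ {n} (b : Fin n → ℚ) → (∀ i → b i ≡ 0ℚ) ⊎ (∃[ i ] b i ≢ 0ℚ)
 all-zero? b with Fin.any? (λ i → ¬? (b i ≟ 0ℚ))
 ... | yes found = inj₂ found
 ... | no none = inj₁ λ i → decidable-stable (b i ≟ 0ℚ) (λ ne → none (i , ne))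

 0<p² : ∀ {p} → p ≢ 0ℚ → 0ℚ < p * p
 0<p² {p} p≢0 with <-cmp 0ℚ p
 ... | tri< 0<p _ _ = *-pos 0<p 0<p
 ... | tri≈ _ 0≡p _ = contradiction (sym 0≡p) p≢0
 ... | tri> _ _ p<0 = subst (0ℚ <_) (neg*neg p p) (*-pos (neg-antimono-< p<0) (neg-antimono-< p<0))

 -- Makes the linear term in b dominate the quadratic term s b².
 spike-value : ∀ b s → (- (s * s + 1ℚ)) * (b * b) + (- (s * s + 1ℚ)) * (b * b) + b * b * s ≡
   - (b * b * ((s * s + 1ℚ) + ((s - ½) * (s - ½) + (½ + ½ * ½))))
 spike-value = solve 2 (λ b s → (:- (s :* s :+ con 1ℚ)) :* (b :* b) :+ (:- (s :* s :+ con 1ℚ)) :* (b :* b) :+ b :* b :* s :=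
   :- (b :* b :* ((s :* s :+ con 1ℚ) :+ ((s :- con ½) :* (s :- con ½) :+ (con ½ :+ con ½ :* con ½))))) refl

 1≤spike : ∀ s → 1ℚ ≤ (s * s + 1ℚ) + ((s - ½) * (s - ½) + (½ + ½ * ½))
 1≤spike s = subst (_≤ (s * s + 1ℚ) + ((s - ½) * (s - ½) + (½ + ½ * ½))) refl
   (+-mono-≤ {0ℚ + 1ℚ} {s * s + 1ℚ} {0ℚ} (+-monoˡ-≤ 1ℚ (0≤p² s)) (+-nonneg {(s - ½) * (s - ½)} {½ + ½ * ½} (0≤p² (s - ½)) (nonNegative⁻¹ (½ + ½ * ½))))

 definite? : ∀ {n} (S : Mat n) → Symmetric S → Definite S
 definite? {zero} S sy = inj₁ λ x → ≤-refl
 definite? {suc n} S sy with <-cmp (corner S) 0ℚ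
 ... | tri< a<0 _ _ = inj₂ (1ℚ ◂ (λ _ → 0ℚ) , subst (_< 0ℚ) (sym value) a<0)
   where
   value : form S (1ℚ ◂ λ _ → 0ℚ) ≡ corner S
   value = trans (form-split S sy (1ℚ ◂ λ _ → 0ℚ)) (trans (cong₂ (λ d q → corner S * (1ℚ * 1ℚ) + (1ℚ * d + 1ℚ * d) + q)
     (sum-0 (λ i → border S i * 0ℚ) λ i → *-zeroʳ (border S i))
     (sum-0 (λ i → 0ℚ * dot (rest S i) (λ _ → 0ℚ)) λ i → *-zeroˡ (dot (rest S i) (λ _ → 0ℚ)))) (simple (corner S)))
     where
     simple : ∀ a → a * (1ℚ * 1ℚ) + (1ℚ * 0ℚ + 1ℚ * 0ℚ) + 0ℚ ≡ a
     simple = solve 1 (λ a → a :* (con 1ℚ :* con 1ℚ) :+ (con 1ℚ :* con 0ℚ :+ con 1ℚ :* con 0ℚ) :+ con 0ℚ := a) refl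
 ... | tri> _ _ 0<a with definite? (schur S) (schur-symmetric {S = S} sy)
 ... | inj₁ psd = inj₁ λ x → *-cancelˡ-≤-pos (corner S) {{positive 0<a}}
   (subst₂ _≤_ (sym (*-zeroʳ (corner S))) (sym (complete-square S sy x)) (+-nonneg (0≤p² (corner S * x zero + dot (border S) (x ∘ suc))) (psd (x ∘ suc))))
 ... | inj₂ (y , neg) = inj₂ (critical S y , subst₂ _<_ (sym (form-critical S sy y)) (*-zeroʳ (corner S)) (*-monoʳ-<-pos (corner S) {{positive 0<a}} neg))
 definite? {suc n} S sy | tri≈ _ a≡0 _ with all-zero? (border S)
 ... | inj₂ (i , b≢0) = inj₂ ((- (s * s + 1ℚ) ◂ λ j → b * delta i j) , subst (_< 0ℚ) (sym value) (0<p⇒-p<0 (*-pos (0<p² b≢0) (<-≤-trans 0<1 (1≤spike s)))))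
   where
   b = border S i
   s = rest S i i
   value : form S (- (s * s + 1ℚ) ◂ λ j → b * delta i j) ≡ - (b * b * ((s * s + 1ℚ) + ((s - ½) * (s - ½) + (½ + ½ * ½))))
   value = trans (form-spike S sy i (- (s * s + 1ℚ)) b) (trans (cong (λ a → a * (- (s * s + 1ℚ) * - (s * s + 1ℚ)) + (- (s * s + 1ℚ) * (b * b) + - (s * s + 1ℚ) * (b * b)) + b * b * s) a≡0)
     (trans (drop (- (s * s + 1ℚ)) b s) (spike-value b s)))
     where
     drop : ∀ p b s → 0ℚ * (p * p) + (p * (b * b) + p * (b * b)) + b * b * s ≡ p * (b * b) + p * (b * b) + b * b * s
     drop = solve 3 (λ p b s → con 0ℚ :* (p :* p) :+ (p :* (b :* b) :+ p :* (b :* b)) :+ b :* b :* s := p :* (b :* b) :+ p :* (b :* b) :+ b :* b :* s) refl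
 ... | inj₁ b≡0 with definite? (rest S) (λ i j → sy (suc i) (suc j))
 ... | inj₁ psd = inj₁ λ x → subst (0ℚ ≤_) (sym (value x)) (psd (x ∘ suc))
   where
   value : ∀ x → form S x ≡ form (rest S) (x ∘ suc)
   value x = trans (form-split S sy x) (trans (cong₂ (λ a d → a * (x zero * x zero) + (x zero * d + x zero * d) + form (rest S) (x ∘ suc)) a≡0
     (sum-0 (λ i → border S i * x (suc i)) λ i → trans (cong (_* x (suc i)) (b≡0 i)) (*-zeroˡ (x (suc i))))) (simple (x zero) (form (rest S) (x ∘ suc))))
     where
     simple : ∀ x q → 0ℚ * (x * x) + (x * 0ℚ + x * 0ℚ) + q ≡ q
     simple = solve 2 (λ x q → con 0ℚ :* (x :* x) :+ (x :* con 0ℚ :+ x :* con 0ℚ) :+ q := q) refl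
 ... | inj₂ (y , neg) = inj₂ (0ℚ ◂ y , subst (_< 0ℚ) (sym value) neg)
   where
   value : form S (0ℚ ◂ y) ≡ form (rest S) y
   value = trans (form-split S sy (0ℚ ◂ y)) (simple (corner S) (dot (border S) y) (form (rest S) y))
     where
     simple : ∀ a d q → a * (0ℚ * 0ℚ) + (0ℚ * d + 0ℚ * d) + q ≡ q
     simple = solve 3 (λ a d q → a :* (con 0ℚ :* con 0ℚ) :+ (con 0ℚ :* d :+ con 0ℚ :* d) :+ q := q) refl

module Kernels where

 open import Defs using (ℝ; seq; cauchy; module Real)
 open Forms
 open import Data.Rational.Base
 open import Data.Rational.Properties
 open import Data.Rational.Solver using (module +-*-Solver)
 open +-*-Solver using (solve; _:+_; _:*_; _:-_; :-_; con; _:=_)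

 Eventually : (ℕ → Set) → Set
 Eventually P = ∃[ K ] ∀ k → K ℕ.≤ k → P k

 eventually₂ : ∀ {P Q R : ℕ → Set} → (∀ k → P k → Q k → R k) → Eventually P → Eventually Q → Eventually R
 eventually₂ f (K , p) (L , q) = K ℕ.⊔ L , λ k ≤k → f k (p k (ℕ.m⊔n≤o⇒m≤o K L ≤k)) (q k (ℕ.m⊔n≤o⇒n≤o K L ≤k))

 eventually-map : ∀ {P Q : ℕ → Set} → (∀ k → P k → Q k) → Eventually P → Eventually Q
 eventually-map f (K , p) = K , λ k ≤k → f k (p k ≤k)

 eventually-false : ∀ {P : ℕ → Set} → (∀ k → P k → ⊥) → Eventually P → ⊥
 eventually-false f (K , p) = f K (p K ℕ.≤-refl)

 Null NonNeg : (ℕ → ℚ) → Set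
 Null f = ∀ ε → 0ℚ < ε → Eventually λ k → ∣ f k ∣ < ε
 NonNeg f = ∀ ε → 0ℚ < ε → Eventually λ k → - ε < f k

 Null-cong : ∀ {f g} → (∀ k → f k ≡ g k) → Null f → Null g
 Null-cong e n ε 0<ε = eventually-map (λ k → subst (λ q → ∣ q ∣ < ε) (e k)) (n ε 0<ε)

 ½-pos : ∀ {ε} → 0ℚ < ε → 0ℚ < ½ * ε
 ½-pos = *-pos (positive⁻¹ ½)

 ½+½ : ∀ ε → ½ * ε + ½ * ε ≡ ε
 ½+½ = solve 1 (λ ε → con ½ :* ε :+ con ½ :* ε := ε) refl

 ∣∣<⇒< : ∀ {p q} → ∣ p ∣ < q → p < q
 ∣∣<⇒< {p} h with ≤-total 0ℚ p
 ... | inj₁ 0≤p = subst (_< _) (0≤p⇒∣p∣≡p 0≤p) h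
 ... | inj₂ p≤0 = ≤-<-trans p≤0 (≤-<-trans (0≤∣p∣ p) h)

 ∣∣<⇒-< : ∀ {p q} → ∣ p ∣ < q → - q < p
 ∣∣<⇒-< {p} {q} h = subst (- q <_) (lemma p) (neg-antimono-< (∣∣<⇒< (subst (_< q) (sym (∣-p∣≡∣p∣ p)) h)))
   where
   lemma : ∀ p → - - p ≡ p
   lemma = solve 1 (λ p → :- :- p := p) refl

 <⇒∣∣< : ∀ {p q} → p < q → - q < p → ∣ p ∣ < q
 <⇒∣∣< {p} {q} a b with ∣p∣≡p∨∣p∣≡-p p
 ... | inj₁ eq = subst (_< q) (sym eq) a
 ... | inj₂ eq = subst (_< q) (sym eq) (subst (- p <_) (lemma q) (neg-antimono-< b))
   where
   lemma : ∀ q → - - q ≡ q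
   lemma = solve 1 (λ q → :- :- q := q) refl

 square-< : ∀ {p q} → 0ℚ < q → p * p < q * q → ∣ p ∣ < q
 square-< {p} {q} 0<q h with <-cmp ∣ p ∣ q
 ... | tri< lt _ _ = lt
 ... | tri≈ _ eq _ = contradiction h (<-irrefl (trans (sym ∣p∣²) (cong₂ _*_ eq eq)))
   where
   ∣p∣² : ∣ p ∣ * ∣ p ∣ ≡ p * p
   ∣p∣² = trans (sym (∣p*q∣≡∣p∣*∣q∣ p p)) (0≤p⇒∣p∣≡p (0≤p² p))
 ... | tri> _ _ gt = contradiction h (<-asym (<-≤-trans (*-monoʳ-<-pos q {{positive 0<q}} gt)
   (subst (q * ∣ p ∣ ≤_) ∣p∣² (*-monoˡ-≤-nonNeg′ (<⇒≤ gt)))))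
   where
   ∣p∣² : ∣ p ∣ * ∣ p ∣ ≡ p * p
   ∣p∣² = trans (sym (∣p*q∣≡∣p∣*∣q∣ p p)) (0≤p⇒∣p∣≡p (0≤p² p))
   *-monoˡ-≤-nonNeg′ : q ≤ ∣ p ∣ → q * ∣ p ∣ ≤ ∣ p ∣ * ∣ p ∣
   *-monoˡ-≤-nonNeg′ le = *-monoʳ-≤-nonNeg ∣ p ∣ {{∣-∣-nonNeg p}} le

 Null-+ : ∀ {f g} → Null f → Null g → Null (λ k → f k + g k)
 Null-+ {f} {g} a b ε 0<ε = eventually₂
   (λ k p q → ≤-<-trans (∣p+q∣≤∣p∣+∣q∣ (f k) (g k)) (subst (∣ f k ∣ + ∣ g k ∣ <_) (½+½ ε) (+-mono-< p q)))
   (a (½ * ε) (½-pos 0<ε)) (b (½ * ε) (½-pos 0<ε))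

 Bounded : (ℕ → ℚ) → Set
 Bounded g = ∃[ B ] 0ℚ < B × Eventually λ k → ∣ g k ∣ ≤ B

 bounded : ∀ (x : ℝ) → Bounded (seq x)
 bounded x with N , close ← cauchy x 1ℚ 0<1 = 1ℚ + ∣ seq x N ∣ ,
   subst (_< 1ℚ + ∣ seq x N ∣) (+-identityˡ 0ℚ) (+-mono-<-≤ 0<1 (0≤∣p∣ (seq x N))) ,
   N , λ k N≤k → ≤-trans (≤-reflexive (cong ∣_∣ (split (seq x k) (seq x N))))
     (≤-trans (∣p+q∣≤∣p∣+∣q∣ (seq x k - seq x N) (seq x N)) (+-monoˡ-≤ ∣ seq x N ∣ (<⇒≤ (close k N N≤k ℕ.≤-refl))))
   where
   split : ∀ p q → p ≡ (p - q) + q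
   split = solve 2 (λ p q → p := (p :- q) :+ q) refl

 reciprocal : ∀ {B} → 0ℚ < B → ∃[ R ] 0ℚ < R × B * R ≡ 1ℚ
 reciprocal {B} 0<B = 1/ B , positive⁻¹ (1/ B) {{1/pos⇒pos B}} , *-inverseʳ B
   where
   instance
     B-positive : Positive B
     B-positive = positive 0<B
     B-nonZero : NonZero B
     B-nonZero = pos⇒nonZero B

 Null-* : ∀ {f g} → Null f → Bounded g → Null (λ k → f k * g k)
 Null-* {f} {g} n (B , 0<B , bd) ε 0<ε with R , 0<R , BR ← reciprocal 0<B = eventually₂
   (λ k p q → ≤-<-trans (≤-trans (≤-reflexive (∣p*q∣≡∣p∣*∣q∣ (f k) (g k))) (*-monoˡ-≤-nonNeg ∣ f k ∣ {{∣-∣-nonNeg (f k)}} q))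
     (subst (∣ f k ∣ * B <_) (trans (shuffle R ε B) (trans (cong (_* ε) BR) (*-identityˡ ε))) (*-monoˡ-<-pos B {{positive 0<B}} p)))
   (n (R * ε) (*-pos 0<R 0<ε)) bd
   where
   shuffle : ∀ R ε B → R * ε * B ≡ B * R * ε
   shuffle = solve 3 (λ R ε B → R :* ε :* B := B :* R :* ε) refl

 Above : ℚ → (ℕ → ℚ) → Set
 Above ε f = Eventually λ k → ε ≤ f k

 Apart : ℝ → Set
 Apart x = (∃[ ε ] 0ℚ < ε × Above ε (seq x)) ⊎ (∃[ ε ] 0ℚ < ε × Above ε (λ k → - seq x k))

 not-apart : ∀ (x : ℝ) → ¬ Apart x → Null (seq x)
 not-apart x ¬apart = near
   where
   near : ∀ ε → 0ℚ < ε → Eventually λ k → ∣ seq x k ∣ < ε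
   near ε 0<ε = by-cases (½ * ε ≤? seq x N) (½ * ε ≤? - seq x N)
     where
     N = proj₁ (cauchy x (½ * (½ * ε)) (½-pos (½-pos 0<ε)))
     close : ∀ m k → N ℕ.≤ m → N ℕ.≤ k → ∣ seq x m - seq x k ∣ < ½ * (½ * ε)
     close = proj₂ (cauchy x (½ * (½ * ε)) (½-pos (½-pos 0<ε)))
     cancel : ∀ p q → p - q + q ≡ p
     cancel = solve 2 (λ p q → p :- q :+ q := p) refl
     back : ∀ p q → - - q + (p - q) ≡ p
     back = solve 2 (λ p q → :- :- q :+ (p :- q) := p) refl
     expand : ∀ ε → - (½ * ε) + - (½ * (½ * ε)) ≡ - (½ * (½ * ε) + ½ * ε)
     expand = solve 1 (λ ε → :- (con ½ :* ε) :+ :- (con ½ :* (con ½ :* ε)) := :- (con ½ :* (con ½ :* ε) :+ con ½ :* ε)) refl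
     sum-up : ∀ ε → ½ * (½ * ε) + ½ * ε + ½ * (½ * ε) ≡ ε
     sum-up = solve 1 (λ ε → con ½ :* (con ½ :* ε) :+ con ½ :* ε :+ con ½ :* (con ½ :* ε) := ε) refl
     halve : ∀ ε → ½ * ε + - (½ * (½ * ε)) ≡ ½ * (½ * ε)
     halve = solve 1 (λ ε → con ½ :* ε :+ :- (con ½ :* (con ½ :* ε)) := con ½ :* (con ½ :* ε)) refl
     three-quarters : ½ * (½ * ε) + ½ * ε < ε
     three-quarters = subst₂ _<_ (+-identityʳ (½ * (½ * ε) + ½ * ε)) (sum-up ε)
       (+-monoʳ-< (½ * (½ * ε) + ½ * ε) (½-pos (½-pos 0<ε)))
     above : ½ * ε ≤ seq x N → Above (½ * (½ * ε)) (seq x)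
     above le = N , λ k N≤k → subst₂ _≤_ (halve ε) (forth (seq x N) (seq x k)) (+-mono-≤ le (<⇒≤ (∣∣<⇒-< (close k N N≤k ℕ.≤-refl))))
       where
       forth : ∀ p q → p + (q - p) ≡ q
       forth = solve 2 (λ p q → p :+ (q :- p) := q) refl
     below : ½ * ε ≤ - seq x N → Above (½ * (½ * ε)) (λ k → - seq x k)
     below le = N , λ k N≤k → subst₂ _≤_ (halve ε) (forth (seq x N) (seq x k)) (+-mono-≤ le (<⇒≤ (neg-antimono-< (∣∣<⇒< (close k N N≤k ℕ.≤-refl)))))
       where
       forth : ∀ p q → - p + - (q - p) ≡ - q
       forth = solve 2 (λ p q → :- p :+ :- (q :- p) := :- q) refl
     by-cases : Dec (½ * ε ≤ seq x N) → Dec (½ * ε ≤ - seq x N) → Eventually λ k → ∣ seq x k ∣ < ε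
     by-cases (yes le) _ = ⊥-elim (¬apart (inj₁ (½ * (½ * ε) , ½-pos (½-pos 0<ε) , above le)))
     by-cases (no _) (yes le) = ⊥-elim (¬apart (inj₂ (½ * (½ * ε) , ½-pos (½-pos 0<ε) , below le)))
     by-cases (no a) (no b) = N , λ k N≤k → <⇒∣∣<
       (<-trans (subst₂ _<_ (cancel (seq x k) (seq x N)) refl (+-monoˡ-< (seq x N) (∣∣<⇒< (close k N N≤k ℕ.≤-refl))))
         (<-trans (+-monoʳ-< (½ * (½ * ε)) (≰⇒> a)) three-quarters))
       (subst (- ε <_) (back (seq x k) (seq x N)) (<-trans (neg-antimono-< three-quarters)
         (subst₂ _<_ (expand ε) refl (+-mono-< (neg-antimono-< (≰⇒> b)) (∣∣<⇒-< (close k N N≤k ℕ.≤-refl))))))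

 apart : ∀ (x : ℝ) → ¬ Null (seq x) → ¬ ¬ Apart x
 apart x ¬null ¬apart = ¬null (not-apart x ¬apart)

 -- Vectors and matrices of real numbers

 infix 10 _at_

 _at_ : ∀ {n} → (Fin n → ℝ) → ℕ → Fin n → ℚ
 (x at k) i = seq (x i) k

 _mat_ : ∀ {n} → (Fin n → Fin n → ℝ) → ℕ → Mat n
 (S mat k) i j = seq (S i j) k

 sumᴿ : ∀ {n} → (Fin n → ℝ) → ℝ
 sumᴿ {zero} x = Real.fromℚ 0ℚ
 sumᴿ {suc n} x = x zero Real.+ sumᴿ (x ∘ suc)

 seq-sumᴿ : ∀ {n} (x : Fin n → ℝ) k → seq (sumᴿ x) k ≡ sum (λ i → seq (x i) k)
 seq-sumᴿ {zero} x k = refl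
 seq-sumᴿ {suc n} x k = cong (seq (x zero) k +_) (seq-sumᴿ (x ∘ suc) k)

 dot-cong : ∀ {n} (b x y : Fin n → ℚ) → (∀ i → x i ≡ y i) → dot b x ≡ dot b y
 dot-cong b x y e = sum-cong {f = λ i → b i * x i} {λ i → b i * y i} λ i → cong (b i *_) (e i)

 form-cong : ∀ {n} (S : Mat n) (x y : Fin n → ℚ) → (∀ i → x i ≡ y i) → form S x ≡ form S y
 form-cong S x y e = sum-cong {f = λ i → x i * dot (S i) x} {λ i → y i * dot (S i) y} λ i → cong₂ _*_ (e i) (dot-cong (S i) x y e)

 Singular : ∀ {n} → (Fin n → Fin n → ℝ) → Set
 Singular {n} S = Σ[ v ∈ (Fin n → ℝ) ] ¬ (∀ i → Null (seq (v i))) × (∀ i → Null (λ k → dot ((S mat k) i) (v at k)))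

 -- A limit of forms that are not positive semidefinite is singular if it is
 -- itself positive semidefinite.
 singular : ∀ {n} (S : Fin n → Fin n → ℝ) → (∀ k → Symmetric (S mat k)) →
   (∀ x → NonNeg (λ k → form (S mat k) (x at k))) →
   Eventually (λ k → ∃[ x ] form (S mat k) x < 0ℚ) → ¬ ¬ Singular S
 singular {zero} S sy psd neg ¬s = eventually-false (λ { k (x , h) → <-irrefl refl h }) neg
 singular {suc n} S sy psd neg ¬s = lem λ
   { (inj₁ a-null) → by-null a-null
   ; (inj₂ ¬null) → apart a ¬null λ
       { (inj₁ (ε , 0<ε , above)) → by-positive ε 0<ε above
       ; (inj₂ (ε , 0<ε , below)) → by-negative ε 0<ε below } }
   where
   a = S zero zero
   b : Fin n → ℝ
   b j = S zero (suc j)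
   lem : ¬ ¬ (Null (seq a) ⊎ ¬ Null (seq a))
   lem f = f (inj₂ λ x → f (inj₁ x))
   unit-vector : Fin (suc n) → ℝ
   unit-vector = Real.fromℚ 1ℚ ◂ λ _ → Real.fromℚ 0ℚ
   unit-value : ∀ (c : Fin (suc n) → ℚ) k → dot c (unit-vector at k) ≡ c zero
   unit-value c k = trans (cong₂ _+_ (*-identityʳ (c zero)) (sum-0 (λ i → c (suc i) * 0ℚ) (λ i → *-zeroʳ (c (suc i))))) (+-identityʳ (c zero))
   by-negative : ∀ ε → 0ℚ < ε → Above ε (λ k → - seq a k) → ⊥
   by-negative ε 0<ε below = eventually-false {λ k → (- ε < form (S mat k) (unit-vector at k)) × (ε ≤ - seq a k)}
     (λ { k (p , q) → <-irrefl refl (<-≤-trans (subst (- ε <_) (value k) p)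
       (subst (_≤ - ε) (lemma (seq a k)) (neg-antimono-≤ q))) })
     (eventually₂ (λ _ → _,_) (psd unit-vector ε 0<ε) below)
     where
     lemma : ∀ p → - - p ≡ p
     lemma = solve 1 (λ p → :- :- p := p) refl
     value : ∀ k → form (S mat k) (unit-vector at k) ≡ seq a k
     value k = trans (cong₂ _+_ (trans (*-identityˡ (dot ((S mat k) zero) (unit-vector at k))) (unit-value ((S mat k) zero) k))
       (sum-0 (λ i → 0ℚ * dot ((S mat k) (suc i)) (unit-vector at k)) (λ i → *-zeroˡ (dot ((S mat k) (suc i)) (unit-vector at k)))))
       (+-identityʳ (seq a k))
   by-null : Null (seq a) → ⊥
   by-null a-null = ¬s (unit-vector , (λ z → eventually-false (λ k h → <-irrefl refl h) (z zero 1ℚ 0<1)) , rows)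
     where
     b-null : ∀ i → Null (seq (b i))
     b-null i η 0<η = eventually₂ (λ k p q → square-< 0<η (small k p q)) (psd v (½ * (η * η)) (½-pos (*-pos 0<η 0<η)))
         (Null-* {seq a} {λ k → seq (p₀ Real.* p₀) k} a-null (bounded (p₀ Real.* p₀)) (½ * (η * η)) (½-pos (*-pos 0<η 0<η)))
       where
       s = S (suc i) (suc i)
       p₀ = Real.- (s Real.* s Real.+ Real.fromℚ 1ℚ)
       v : Fin (suc n) → ℝ
       v = p₀ ◂ λ j → b i Real.* Real.fromℚ (delta i j)
       small : ∀ k → - (½ * (η * η)) < form (S mat k) (v at k) → ∣ seq a k * (seq p₀ k * seq p₀ k) ∣ < ½ * (η * η) →
         seq (b i) k * seq (b i) k < η * η
       small k h₁ h₂ = ≤-<-trans bound′ (subst₂ _<_ (rearrange ap bc) (½+½ (η * η))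
         (+-mono-< (∣∣<⇒< h₂) (subst (- (ap + - bc) <_) (lemma (½ * (η * η))) (neg-antimono-< (subst (- (½ * (η * η)) <_) value h₁)))))
         where
         B = seq (b i) k
         s′ = seq s k
         p′ = - (s′ * s′ + 1ℚ)
         ap = seq a k * (p′ * p′)
         c = (s′ * s′ + 1ℚ) + ((s′ - ½) * (s′ - ½) + (½ + ½ * ½))
         bc = B * B * c
         lemma : ∀ p → - - p ≡ p
         lemma = solve 1 (λ p → :- :- p := p) refl
         rearrange : ∀ x y → x + - (x + - y) ≡ y
         rearrange = solve 2 (λ x y → x :+ :- (x :+ :- y) := y) refl
         bound′ : B * B ≤ bc
         bound′ = subst (_≤ bc) (*-identityʳ (B * B)) (*-monoˡ-≤-nonNeg (B * B) {{nonNegative (0≤p² B)}} (1≤spike s′))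
         value : form (S mat k) (v at k) ≡ ap + - bc
         value = trans (form-cong (S mat k) (v at k) (p′ ◂ λ j → B * delta i j) (λ { zero → refl ; (suc j) → refl }))
           (trans (form-spike (S mat k) (sy k) i p′ B) (trans (assoc (seq a k * (p′ * p′)) (p′ * (B * B)) (B * B * s′))
             (cong (ap +_) (spike-value B s′))))
           where
           assoc : ∀ x y z → x + (y + y) + z ≡ x + (y + y + z)
           assoc = solve 3 (λ x y z → x :+ (y :+ y) :+ z := x :+ (y :+ y :+ z)) refl
     rows : ∀ i → Null (λ k → dot ((S mat k) i) (unit-vector at k))
     rows zero = Null-cong {seq a} (λ k → sym (unit-value ((S mat k) zero) k)) a-null
     rows (suc i) = Null-cong {seq (b i)} (λ k → trans (sy k zero (suc i)) (sym (unit-value ((S mat k) (suc i)) k))) (b-null i)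
   by-positive : ∀ ε → 0ℚ < ε → Above ε (seq a) → ⊥
   by-positive ε 0<ε above = singular S′ (λ k → schur-symmetric {S = S mat k} (sy k)) psd′ neg′ lift-kernel
     where
     S′ : Fin n → Fin n → ℝ
     S′ i j = a Real.* S (suc i) (suc j) Real.+ Real.- (b i Real.* b j)
     y : (Fin n → ℝ) → Fin (suc n) → ℝ
     y x = Real.- sumᴿ (λ i → b i Real.* x i) ◂ λ i → a Real.* x i
     y-critical : ∀ x k i → (y x at k) i ≡ critical (S mat k) (x at k) i
     y-critical x k zero = cong -_ (seq-sumᴿ (λ i → b i Real.* x i) k)
     y-critical x k (suc i) = refl
     psd′ : ∀ x → NonNeg (λ k → form (S′ mat k) (x at k))
     psd′ x η 0<η = eventually₂ (λ k p q → positive-part k p q) (psd (y x) (ε * η) (*-pos 0<ε 0<η)) above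
       where
       positive-part : ∀ k → - (ε * η) < form (S mat k) (y x at k) → ε ≤ seq a k → - η < form (S′ mat k) (x at k)
       positive-part k p q with <-cmp (- η) (form (S′ mat k) (x at k))
       ... | tri< lt _ _ = lt
       ... | tri≈ _ eq _ = ⊥-elim (<-irrefl refl (<-≤-trans p (too-low (≤-reflexive (sym eq)))))
         where
         too-low : form (S′ mat k) (x at k) ≤ - η → form (S mat k) (y x at k) ≤ - (ε * η)
         too-low le = subst₂ _≤_ (sym (trans (form-cong (S mat k) (y x at k) (critical (S mat k) (x at k)) (y-critical x k)) (form-critical (S mat k) (sy k) (x at k))))
           (sym (neg-distribʳ-* ε η))
           (≤-trans (*-monoˡ-≤-nonNeg (seq a k) {{nonNegative (≤-trans (<⇒≤ 0<ε) q)}} le)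
             (*-monoʳ-≤-nonPos (- η) {{nonPositive (neg-antimono-≤ (<⇒≤ 0<η))}} q))
       ... | tri> _ _ gt = ⊥-elim (<-irrefl refl (<-≤-trans p (too-low (<⇒≤ gt))))
         where
         too-low : form (S′ mat k) (x at k) ≤ - η → form (S mat k) (y x at k) ≤ - (ε * η)
         too-low le = subst₂ _≤_ (sym (trans (form-cong (S mat k) (y x at k) (critical (S mat k) (x at k)) (y-critical x k)) (form-critical (S mat k) (sy k) (x at k))))
           (sym (neg-distribʳ-* ε η))
           (≤-trans (*-monoˡ-≤-nonNeg (seq a k) {{nonNegative (≤-trans (<⇒≤ 0<ε) q)}} le)
             (*-monoʳ-≤-nonPos (- η) {{nonPositive (neg-antimono-≤ (<⇒≤ 0<η))}} q))
     neg′ : Eventually λ k → ∃[ x ] form (S′ mat k) x < 0ℚ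
     neg′ = eventually₂ (λ { k (x , h) q → x ∘ suc , below k x h (<-≤-trans 0<ε q) }) neg above
       where
       below : ∀ k x → form (S mat k) x < 0ℚ → 0ℚ < seq a k → form (S′ mat k) (x ∘ suc) < 0ℚ
       below k x h 0<a = ≤-<-trans
         (subst (_≤ w * w + form (S′ mat k) (x ∘ suc)) (+-identityˡ (form (S′ mat k) (x ∘ suc))) (+-monoˡ-≤ (form (S′ mat k) (x ∘ suc)) (0≤p² w)))
         (subst₂ _<_ (complete-square (S mat k) (sy k) x) (*-zeroʳ (seq a k)) (*-monoʳ-<-pos (seq a k) {{positive 0<a}} h))
         where
         w = seq a k * x zero + dot (border (S mat k)) (x ∘ suc)
     lift-kernel : ¬ Singular S′
     lift-kernel (v , v≢0 , kernel) = ¬s (y v , nonzero , rows)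
       where
       nonzero : ¬ (∀ i → Null (seq (y v i)))
       nonzero z = v≢0 λ i η 0<η → eventually₂ (λ k p q → divide k i p q) (z (suc i) (ε * η) (*-pos 0<ε 0<η)) above
         where
         divide : ∀ {η} k i → ∣ seq a k * seq (v i) k ∣ < ε * η → ε ≤ seq a k → ∣ seq (v i) k ∣ < η
         divide {η} k i p q = *-cancelˡ-<-nonNeg ε {{nonNegative (<⇒≤ 0<ε)}} (≤-<-trans
           (*-monoʳ-≤-nonNeg ∣ seq (v i) k ∣ {{∣-∣-nonNeg (seq (v i) k)}} (≤-trans q (≤-reflexive (sym (0≤p⇒∣p∣≡p (≤-trans (<⇒≤ 0<ε) q))))))
           (subst (_< ε * η) (∣p*q∣≡∣p∣*∣q∣ (seq a k) (seq (v i) k)) p))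
       rows : ∀ i → Null (λ k → dot ((S mat k) i) (y v at k))
       rows i = Null-cong {λ k → row k i} (λ k → trans (row-value k i) (sym (dot-cong ((S mat k) i) (y v at k) (critical (S mat k) (v at k)) (y-critical v k)))) (row-null i)
         where
         row : ℕ → Fin (suc n) → ℚ
         row k zero = 0ℚ
         row k (suc i) = dot ((S′ mat k) i) (v at k)
         row-null : ∀ i → Null (λ k → row k i)
         row-null zero η 0<η = 0 , λ _ _ → 0<η
         row-null (suc i) = kernel i
         row-value : ∀ k i → row k i ≡ dot ((S mat k) i) (critical (S mat k) (v at k))
         row-value k zero = sym (trans (cong (seq a k * - d +_) (dot-scale (seq a k) (border (S mat k)) (v at k))) (vanish (seq a k) d))
           where
           d = dot (border (S mat k)) (v at k)
           vanish : ∀ a d → a * - d + a * d ≡ 0ℚ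
           vanish = solve 2 (λ a d → a :* :- d :+ a :* d := con 0ℚ) refl
         row-value k (suc i) = sym (trans (cong₂ (λ s e → s * - d + e) (sy k (suc i) zero) (dot-scale (seq a k) (rest (S mat k) i) (v at k)))
           (trans (swap (seq (b i) k) d (seq a k * dot (rest (S mat k) i) (v at k))) (sym (dot-schur (S mat k) i (v at k)))))
           where
           d = dot (border (S mat k)) (v at k)
           swap : ∀ b d e → b * - d + e ≡ e - b * d
           swap = solve 3 (λ b d e → b :* :- d :+ e := e :- b :* d) refl

module Eigenvalues where

 open import Defs using (ℝ; mkℝ; seq; IsCauchy; module Real)
 open Forms
 open Kernels
 open import Data.Rational.Base
 open import Data.Rational.Properties
 open import Data.Rational.Solver using (module +-*-Solver)
 open +-*-Solver using (solve; _:+_; _:*_; _:-_; :-_; con; _:=_)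

 shifted : ∀ {n} → ℚ → Mat n → Mat n
 shifted t S i j = t * delta i j + - S i j

 delta-symmetric : ∀ {n} (i j : Fin n) → delta i j ≡ delta j i
 delta-symmetric zero zero = refl
 delta-symmetric zero (suc j) = refl
 delta-symmetric (suc i) zero = refl
 delta-symmetric (suc i) (suc j) = delta-symmetric i j

 shifted-symmetric : ∀ {n} t {S : Mat n} → Symmetric S → Symmetric (shifted t S)
 shifted-symmetric t sy i j = cong₂ (λ d s → t * d + - s) (delta-symmetric i j) (sy i j)

 dot-shifted : ∀ {n} t (S : Mat n) i x → dot (shifted t S i) x ≡ t * x i - dot (S i) x
 dot-shifted t S i x = trans
   (sum-cong {f = λ j → shifted t S i j * x j} {λ j → t * (x j * delta i j) + - 1ℚ * (S i j * x j)} λ j → expand t (delta i j) (S i j) (x j))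
   (trans (sum-linear t (- 1ℚ) (λ j → x j * delta i j) (λ j → S i j * x j))
     (trans (cong (λ e → t * e + - 1ℚ * dot (S i) x) (sum-delta i x)) (finish (t * x i) (dot (S i) x))))
   where
   expand : ∀ t d s x → (t * d + - s) * x ≡ t * (x * d) + - 1ℚ * (s * x)
   expand = solve 4 (λ t d s x → (t :* d :+ :- s) :* x := t :* (x :* d) :+ con (- 1ℚ) :* (s :* x)) refl
   finish : ∀ p q → p + - 1ℚ * q ≡ p - q
   finish = solve 2 (λ p q → p :+ con (- 1ℚ) :* q := p :- q) refl

 form-shifted : ∀ {n} t (S : Mat n) x → form (shifted t S) x ≡ t * square x - form S x
 form-shifted t S x = trans
   (sum-cong {f = λ i → x i * dot (shifted t S i) x} {λ i → t * (x i * x i) + - 1ℚ * (x i * dot (S i) x)}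
     λ i → trans (cong (x i *_) (dot-shifted t S i x)) (expand t (x i) (dot (S i) x)))
   (trans (sum-linear t (- 1ℚ) (λ i → x i * x i) (λ i → x i * dot (S i) x)) (finish (t * square x) (form S x)))
   where
   expand : ∀ t x d → x * (t * x - d) ≡ t * (x * x) + - 1ℚ * (x * d)
   expand = solve 3 (λ t x d → x :* (t :* x :- d) := t :* (x :* x) :+ con (- 1ℚ) :* (x :* d)) refl
   finish : ∀ p q → p + - 1ℚ * q ≡ p - q
   finish = solve 2 (λ p q → p :+ con (- 1ℚ) :* q := p :- q) refl

 square-nonneg : ∀ {n} (x : Fin n → ℚ) → 0ℚ ≤ square x
 square-nonneg x = sum-nonneg {f = λ i → x i * x i} λ i → 0≤p² (x i)

 upper : ∀ {n} (S : Mat n) → Symmetric S → ∃[ T ] ∀ x → form S x ≤ T * square x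
 upper {zero} S sy = 0ℚ , λ x → ≤-refl
 upper {suc n} S sy with upper S⁺ S⁺-symmetric
   where
   S⁺ : Mat n
   S⁺ i j = 1ℚ * rest S i j + border S i * border S j
   S⁺-symmetric : Symmetric S⁺
   S⁺-symmetric i j = cong₂ (λ r c → 1ℚ * r + c) (sy (suc i) (suc j)) (*-comm (border S i) (border S j))
 ... | T , h = M , λ x → ≤-from-0≤ (subst (0ℚ ≤_) (sym (slack x))
     (+-nonneg {(M - (corner S + 1ℚ)) * (x zero * x zero)} {_}
       (*-nonneg (0≤q-p (p≤p⊔q (corner S + 1ℚ) T)) (0≤p² (x zero)))
       (+-nonneg {(M - T) * square (x ∘ suc)} {_} (*-nonneg (0≤q-p (p≤q⊔p (corner S + 1ℚ) T)) (square-nonneg (x ∘ suc)))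
         (+-nonneg {T * square (x ∘ suc) - (form (rest S) (x ∘ suc) + d x * d x)} {_}
           (subst (λ f → 0ℚ ≤ T * square (x ∘ suc) - f) (form-S⁺ (x ∘ suc)) (0≤q-p (h (x ∘ suc)))) (0≤p² (x zero - d x))))))
   where
   M = (corner S + 1ℚ) ⊔ T
   d : (Fin (suc n) → ℚ) → ℚ
   d x = dot (border S) (x ∘ suc)
   form-S⁺ : ∀ y → form (λ i j → 1ℚ * rest S i j + border S i * border S j) y ≡ form (rest S) y + dot (border S) y * dot (border S) y
   form-S⁺ y = trans (sum-cong {f = λ i → y i * dot (λ j → 1ℚ * rest S i j + border S i * border S j) y}
       {λ i → 1ℚ * (y i * dot (rest S i) y) + dot (border S) y * (border S i * y i)} λ i → trans (cong (y i *_) (row i)) (expand (y i) (dot (rest S i) y) (border S i) (dot (border S) y)))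
     (trans (sum-linear 1ℚ (dot (border S) y) (λ i → y i * dot (rest S i) y) (λ i → border S i * y i))
       (cong (_+ dot (border S) y * dot (border S) y) (*-identityˡ (form (rest S) y))))
     where
     row : ∀ i → dot (λ j → 1ℚ * rest S i j + border S i * border S j) y ≡ 1ℚ * dot (rest S i) y + border S i * dot (border S) y
     row i = trans (sum-cong {f = λ j → (1ℚ * rest S i j + border S i * border S j) * y j} {λ j → 1ℚ * (rest S i j * y j) + border S i * (border S j * y j)}
         λ j → distribute (rest S i j) (border S i) (border S j) (y j))
       (sum-linear 1ℚ (border S i) (λ j → rest S i j * y j) (λ j → border S j * y j))
       where
       distribute : ∀ r b c y → (1ℚ * r + b * c) * y ≡ 1ℚ * (r * y) + b * (c * y)
       distribute = solve 4 (λ r b c y → (con 1ℚ :* r :+ b :* c) :* y := con 1ℚ :* (r :* y) :+ b :* (c :* y)) refl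
     expand : ∀ y r b d → y * (1ℚ * r + b * d) ≡ 1ℚ * (y * r) + d * (b * y)
     expand = solve 4 (λ y r b d → y :* (con 1ℚ :* r :+ b :* d) := con 1ℚ :* (y :* r) :+ d :* (b :* y)) refl
   slack : ∀ x → M * square x - form S x ≡ (M - (corner S + 1ℚ)) * (x zero * x zero)
     + ((M - T) * square (x ∘ suc) + ((T * square (x ∘ suc) - (form (rest S) (x ∘ suc) + d x * d x)) + (x zero - d x) * (x zero - d x)))
   slack x = trans (cong (λ f → M * square x - f) (form-split S sy x)) (identity M (corner S) T (x zero) (square (x ∘ suc)) (d x) (form (rest S) (x ∘ suc)))
     where
     identity : ∀ M a T x s d q → M * (x * x + s) - (a * (x * x) + (x * d + x * d) + q) ≡
       (M - (a + 1ℚ)) * (x * x) + ((M - T) * s + ((T * s - (q + d * d)) + (x - d) * (x - d)))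
     identity M a T x s d q = trans (cong (_- (a * (x * x) + (x * d + x * d) + q)) (*-distribˡ-+ M (x * x) s))
       (trans (linear (M * (x * x)) (M * s) (a * (x * x)) (T * s) (x * d) (x * x) (d * d) q)
         (cong₂ _+_ (first-term M a (x * x)) (cong₂ _+_ (second-term M T s) (cong (λ e → (T * s - (q + d * d)) + e) (third-term x d)))))
       where
       linear : ∀ m n α τ e x d q → m + n - (α + (e + e) + q) ≡ (m - (α + x)) + ((n - τ) + ((τ - (q + d)) + (x - (e + e) + d)))
       linear = solve 8 (λ m n α τ e x d q → m :+ n :- (α :+ (e :+ e) :+ q) := (m :- (α :+ x)) :+ ((n :- τ) :+ ((τ :- (q :+ d)) :+ (x :- (e :+ e) :+ d)))) refl
       first-term : ∀ M a y → M * y - (a * y + y) ≡ (M - (a + 1ℚ)) * y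
       first-term = solve 3 (λ M a y → M :* y :- (a :* y :+ y) := (M :- (a :+ con 1ℚ)) :* y) refl
       second-term : ∀ M T s → M * s - T * s ≡ (M - T) * s
       second-term = solve 3 (λ M T s → M :* s :- T :* s := (M :- T) :* s) refl
       third-term : ∀ x d → x * x - (x * d + x * d) + d * d ≡ (x - d) * (x - d)
       third-term = solve 2 (λ x d → x :* x :- (x :* d :+ x :* d) :+ d :* d := (x :- d) :* (x :- d)) refl

 abstract

   ι : ℕ → ℚ
   ι m = fromℤ (ℤ.+ m)

   ι-zero : ι 0 ≡ 0ℚ
   ι-zero = refl

   ι-suc : ∀ m → ι (suc m) ≡ 1ℚ + ι m
   ι-suc m = fromℤ-+ (ℤ.+ 1) (ℤ.+ m)

   ι-≤ : ∀ {m n} → m ℕ.≤ n → ι m ≤ ι n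
   ι-≤ m≤n = fromℤ-≤ (ℤ.+≤+ m≤n)

   ι-pos : ∀ m → 0ℚ < ι (suc m)
   ι-pos m = <-≤-trans 0<1 (ι-≤ {1} {suc m} (ℕ.s≤s ℕ.z≤n))

   archimedean : ∀ q → ∃[ m ] q ≤ ι m
   archimedean q = ℤ.∣ ↥ q ∣ , toℚᵘ-cancel-≤ (begin
     toℚᵘ q ≤⟨ ℚᵘ.*≤* (bound q) ⟩
     ℚᵘ.mkℚᵘ (ℤ.+ ℤ.∣ ↥ q ∣) 0 ≃⟨ toℚᵘ-fromℤ (ℤ.+ ℤ.∣ ↥ q ∣) ⟨
     toℚᵘ (ι ℤ.∣ ↥ q ∣) ∎)
     where
     import Data.Rational.Unnormalised.Base as ℚᵘ
     import Data.Rational.Unnormalised.Properties as ℚᵘP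
     open ℚᵘP.≤-Reasoning
     bound : ∀ q → ℚᵘ.↥ toℚᵘ q ℤ.* ℤ.1ℤ ℤ.≤ ℤ.+ ℤ.∣ ↥ q ∣ ℤ.* ℚᵘ.↧ toℚᵘ q
     bound (mkℚ (ℤ.+ m) d _) = subst₂ ℤ._≤_ (sym (ℤ.*-identityʳ (ℤ.+ m))) (ℤ.pos-* m (suc d)) (ℤ.+≤+ (ℕ.m≤m*n m (suc d)))
     bound (mkℚ ℤ.-[1+ m ] d _) = subst (ℤ._≤ ℤ.+ suc m ℤ.* ℤ.+ suc d) (sym (ℤ.*-identityʳ ℤ.-[1+ m ])) ℤ.-≤+

   step : ℕ → ℚ
   step k = proj₁ (reciprocal (ι-pos k))

   step-pos : ∀ k → 0ℚ < step k
   step-pos k = proj₁ (proj₂ (reciprocal (ι-pos k)))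

   ι*step : ∀ k → ι (suc k) * step k ≡ 1ℚ
   ι*step k = proj₂ (proj₂ (reciprocal (ι-pos k)))

 step-null : ∀ ε → 0ℚ < ε → Eventually λ k → step k < ε
 step-null ε 0<ε with R , 0<R , εR ← reciprocal 0<ε with m , R≤ ← archimedean R = m , λ k m≤k → small k m≤k
   where
   small : ∀ k → m ℕ.≤ k → step k < ε
   small k m≤k = *-cancelˡ-<-nonNeg (ι (suc k)) {{nonNegative (<⇒≤ (ι-pos k))}}
     (subst₂ _<_ (trans εR (sym (ι*step k))) (*-comm ε (ι (suc k)))
       (*-monoʳ-<-pos ε {{positive 0<ε}} (≤-<-trans R≤ (≤-<-trans (ι-≤ m≤k) (subst (ι k <_) (sym (ι-suc k))
         (subst (_< 1ℚ + ι k) (+-identityˡ (ι k)) (+-monoˡ-< (ι k) 0<1)))))))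

 module Grid {n} (S : Mat n) (sy : Symmetric S) (t₀ : ℚ) (start : ∃[ x ] t₀ * square x < form S x) where

   Low High : ℚ → Set
   Low t = ∃[ x ] form (shifted t S) x < 0ℚ
   High t = ∀ x → 0ℚ ≤ form (shifted t S) x

   low<high : ∀ {s t} → Low s → High t → s < t
   low<high {s} {t} (x , low) high with <-cmp s t
   ... | tri< lt _ _ = lt
   ... | tri≈ _ refl _ = contradiction low (λ lt → <-irrefl refl (≤-<-trans (high x) lt))
   ... | tri> _ _ t<s = ⊥-elim (<-irrefl refl (≤-<-trans (high x) (≤-<-trans below low)))
     where
     below : form (shifted t S) x ≤ form (shifted s S) x
     below = subst₂ _≤_ (sym (form-shifted t S x)) (sym (form-shifted s S x))
       (+-monoˡ-≤ (- form S x) (*-monoʳ-≤-nonNeg (square x) {{nonNegative (square-nonneg x)}} (<⇒≤ t<s)))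

   start-low : Low t₀
   start-low = let x , h = start in x , subst (_< 0ℚ) (sym (form-shifted t₀ S x)) (p-q<0 h)

   search : ∀ δ → 0ℚ < δ → ∀ m t → t₀ ≤ t → Low t → High (t + ι m * δ) → ∃[ t ] t₀ ≤ t × Low t × High (t + δ)
   search δ 0<δ zero t t₀≤t low high = ⊥-elim (<-irrefl (sym (trans (cong (λ i → t + i * δ) ι-zero) (trans (cong (t +_) (*-zeroˡ δ)) (+-identityʳ t)))) (low<high low high))
   search δ 0<δ (suc m) t t₀≤t low high with definite? (shifted (t + δ) S) (shifted-symmetric (t + δ) sy)
   ... | inj₁ high′ = t , t₀≤t , low , high′
   ... | inj₂ low′ = search δ 0<δ m (t + δ) (≤-trans t₀≤t (subst (_≤ t + δ) (+-identityʳ t) (+-monoʳ-≤ t (<⇒≤ 0<δ)))) low′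
     (subst High (trans (cong (λ i → t + i * δ) (ι-suc m)) (regroup t (ι m) δ)) high)
     where
     regroup : ∀ t i δ → t + (1ℚ + i) * δ ≡ t + δ + i * δ
     regroup = solve 3 (λ t i δ → t :+ (con 1ℚ :+ i) :* δ := t :+ δ :+ i :* δ) refl

   reach : ∀ T k m → (T - t₀) * ι (suc k) ≤ ι m → T ≤ t₀ + ι m * step k
   reach T k m h = subst (_≤ t₀ + ι m * step k) whole scaled
     where
     scaled : t₀ + (T - t₀) * ι (suc k) * step k ≤ t₀ + ι m * step k
     scaled = +-monoʳ-≤ t₀ (*-monoʳ-≤-nonNeg (step k) {{nonNegative (<⇒≤ (step-pos k))}} h)
     back : ∀ p q → p + (q - p) ≡ q
     back = solve 2 (λ p q → p :+ (q :- p) := q) refl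
     unscaled : (T - t₀) * ι (suc k) * step k ≡ T - t₀
     unscaled = trans (*-assoc (T - t₀) (ι (suc k)) (step k)) (trans (cong ((T - t₀) *_) (ι*step k)) (*-identityʳ (T - t₀)))
     whole : t₀ + (T - t₀) * ι (suc k) * step k ≡ T
     whole = trans (cong (λ e → t₀ + e) unscaled) (back t₀ T)

   high-from : ∀ T t → (∀ x → form S x ≤ T * square x) → T ≤ t → High t
   high-from T t bound T≤t x = subst (0ℚ ≤_) (sym (form-shifted t S x)) (0≤q-p (≤-trans (bound x) scaled))
     where
     scaled : T * square x ≤ t * square x
     scaled = *-monoʳ-≤-nonNeg (square x) {{nonNegative (square-nonneg x)}} T≤t

   Node : ℕ → ℚ → Set
   Node k t = t₀ ≤ t × Low t × High (t + step k)

   abstract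
     grid : ∀ k → Σ ℚ (Node k)
     grid k = search (step k) (step-pos k) (proj₁ enough) t₀ ≤-refl start-low
       (high-from (proj₁ top) (t₀ + ι (proj₁ enough) * step k) (proj₂ top) (reach (proj₁ top) k (proj₁ enough) (proj₂ enough)))
       where
       top : ∃[ T ] ∀ x → form S x ≤ T * square x
       top = upper S sy
       enough : ∃[ m ] (proj₁ top - t₀) * ι (suc k) ≤ ι m
       enough = archimedean ((proj₁ top - t₀) * ι (suc k))

   t : ℕ → ℚ
   t k = proj₁ (grid k)

   t-low : ∀ k → Low (t k)
   t-low k = proj₁ (proj₂ (proj₂ (grid k)))

   t-high : ∀ k → High (t k + step k)
   t-high k = proj₂ (proj₂ (proj₂ (grid k)))

   t-cauchy : IsCauchy t
   t-cauchy ε 0<ε = proj₁ (step-null ε 0<ε) , λ m n K≤m K≤n → <⇒∣∣<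
     (gap {t m} {t n} (<-trans (low<high {t m} {t n + step n} (t-low m) (t-high n)) (+-monoʳ-< (t n) (small n K≤n))))
     (subst (- ε <_) (flip (t m) (t n)) (neg-antimono-< (gap {t n} {t m} (<-trans (low<high {t n} {t m + step m} (t-low n) (t-high m)) (+-monoʳ-< (t m) (small m K≤m))))))
     where
     small = proj₂ (step-null ε 0<ε)
     gap : ∀ {p q} → p < q + ε → p - q < ε
     gap {p} {q} h = subst (p - q <_) (cancel q ε) (+-monoˡ-< (- q) h)
       where
       cancel : ∀ q ε → q + ε - q ≡ ε
       cancel = solve 2 (λ q ε → q :+ ε :- q := ε) refl
     flip : ∀ p q → - (q - p) ≡ p - q
     flip = solve 2 (λ p q → :- (q :- p) := p :- q) refl

   eigenvalue : ℝ
   eigenvalue = mkℝ t t-cauchy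

   t₀≤t : ∀ k → t₀ ≤ t k
   t₀≤t k = proj₁ (proj₂ (grid k))

   matrix : Fin n → Fin n → ℝ
   matrix i j = eigenvalue Real.* Real.fromℚ (delta i j) Real.+ Real.- Real.fromℚ (S i j)

   sumᴿ-square : (Fin n → ℝ) → ℝ
   sumᴿ-square x = sumᴿ λ i → x i Real.* x i

   matrix-nonneg : ∀ x → NonNeg (λ k → form (matrix mat k) (x at k))
   matrix-nonneg x ε 0<ε = within (bounded (sumᴿ-square x))
     where
     within : Bounded (seq (sumᴿ-square x)) → Eventually λ k → - ε < form (matrix mat k) (x at k)
     within (B , 0<B , bd) = within′ (reciprocal 0<B)
       where
       within′ : ∃[ R ] 0ℚ < R × B * R ≡ 1ℚ → Eventually λ k → - ε < form (matrix mat k) (x at k)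
       within′ (R , 0<R , BR) = eventually₂ (λ k p q → above k p (∣∣-≤ (subst (λ e → ∣ e ∣ ≤ B) (seq-sumᴿ (λ i → x i Real.* x i) k) q))) (step-null (ε * R) (*-pos 0<ε 0<R)) bd
         where
         ∣∣-≤ : ∀ {p q} → ∣ p ∣ ≤ q → p ≤ q
         ∣∣-≤ {p} h = ≤-trans (p≤∣p∣ p) h
           where
           p≤∣p∣ : ∀ p → p ≤ ∣ p ∣
           p≤∣p∣ p with ≤-total 0ℚ p
           ... | inj₁ 0≤p = ≤-reflexive (sym (0≤p⇒∣p∣≡p 0≤p))
           ... | inj₂ p≤0 = ≤-trans p≤0 (0≤∣p∣ p)
         above : ∀ k → step k < ε * R → square (x at k) ≤ B → - ε < form (matrix mat k) (x at k)
         above k p q = <-≤-trans (neg-antimono-< (≤-<-trans (*-monoˡ-≤-nonNeg (step k) {{nonNegative (<⇒≤ (step-pos k))}} q)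
             (subst (step k * B <_) (trans (shuffle ε R B) (trans (cong (ε *_) BR) (*-identityʳ ε))) (*-monoˡ-<-pos B {{positive 0<B}} p))))
           (≤-from-0≤ (subst (0ℚ ≤_) (trans (form-shifted (t k + step k) S (x at k))
             (trans (difference (t k) (step k) (square (x at k)) (form S (x at k))) (cong (_- - (step k * square (x at k))) (sym (form-shifted (t k) S (x at k))))))
             (t-high k (x at k))))
           where
           shuffle : ∀ ε R B → ε * R * B ≡ ε * (B * R)
           shuffle = solve 3 (λ ε R B → ε :* R :* B := ε :* (B :* R)) refl
           difference : ∀ t δ s f → (t + δ) * s - f ≡ t * s - f - - (δ * s)
           difference = solve 4 (λ t δ s f → (t :+ δ) :* s :- f := t :* s :- f :- :- (δ :* s)) refl

   matrix-singular : ¬ ¬ Singular matrix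
   matrix-singular = singular matrix (λ k → shifted-symmetric (t k) sy) matrix-nonneg (0 , λ k _ → t-low k)

open import Defs

module FormBound where

 open Forms
 open Kernels
 open Eigenvalues
 open import Data.Fin.Base using (_↑ˡ_; _↑ʳ_; splitAt)
 open import Data.Rational.Base
 open import Data.Rational.Properties
 open import Data.Rational.Solver using (module +-*-Solver)
 open +-*-Solver using (solve; _:+_; _:*_; _:-_; :-_; con; _:=_)

 sum-split : ∀ n {m} (f : Fin (n ℕ.+ m) → ℚ) → sum f ≡ sum (λ i → f (i ↑ˡ m)) + sum (λ j → f (n ↑ʳ j))
 sum-split zero f = sym (+-identityˡ (sum f))
 sum-split (suc n) {m} f = trans (cong (f zero +_) (sum-split n (f ∘ suc)))
   (sym (+-assoc (f zero) (sum (λ i → f (suc (i ↑ˡ m)))) (sum (λ j → f (suc n ↑ʳ j)))))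

 cell : ∀ {n} → Matrix n → Fin n ⊎ Fin n → Fin n ⊎ Fin n → ℚ
 cell A (inj₁ u) (inj₁ v) = fromℤ (re (A u v))
 cell A (inj₁ u) (inj₂ v) = - fromℤ (im (A u v))
 cell A (inj₂ u) (inj₁ v) = fromℤ (im (A u v))
 cell A (inj₂ u) (inj₂ v) = fromℤ (re (A u v))

 -- The real symmetric matrix of the same Hermitian form in the real and
 -- imaginary parts of the coordinates.
 realify : ∀ {n} → Matrix n → Mat (n ℕ.+ n)
 realify {n} A i j = cell A (splitAt n i) (splitAt n j)

 realify-symmetric : ∀ {n} (A : Matrix n) → IsHermitian A → Symmetric (realify A)
 realify-symmetric {n} A h i j = cell-symmetric (splitAt n i) (splitAt n j)
   where
   cell-symmetric : ∀ x y → cell A x y ≡ cell A y x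
   cell-symmetric (inj₁ u) (inj₁ v) = cong (fromℤ ∘ re) (sym (h u v))
   cell-symmetric (inj₁ u) (inj₂ v) = trans (sym (fromℤ-neg (im (A u v)))) (cong (fromℤ ∘ im) (h v u))
   cell-symmetric (inj₂ u) (inj₁ v) = trans (cong (fromℤ ∘ im) (sym (h u v))) (fromℤ-neg (im (A v u)))
   cell-symmetric (inj₂ u) (inj₂ v) = cong (fromℤ ∘ re) (sym (h u v))

 module _ {n} (A : Matrix n) where

   dot-reˡ : ∀ u (x : Fin (n ℕ.+ n) → ℚ) → dot (realify A (u ↑ˡ n)) x ≡
     sum (λ v → fromℤ (re (A u v)) * x (v ↑ˡ n)) + sum (λ v → - fromℤ (im (A u v)) * x (n ↑ʳ v))
   dot-reˡ u x = trans (sum-split n (λ j → realify A (u ↑ˡ n) j * x j)) (cong₂ _+_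
     (sum-cong {f = λ v → realify A (u ↑ˡ n) (v ↑ˡ n) * x (v ↑ˡ n)} {λ v → fromℤ (re (A u v)) * x (v ↑ˡ n)}
       λ v → cong (_* x (v ↑ˡ n)) (cong₂ (cell A) (Fin.splitAt-↑ˡ n u n) (Fin.splitAt-↑ˡ n v n)))
     (sum-cong {f = λ v → realify A (u ↑ˡ n) (n ↑ʳ v) * x (n ↑ʳ v)} {λ v → - fromℤ (im (A u v)) * x (n ↑ʳ v)}
       λ v → cong (_* x (n ↑ʳ v)) (cong₂ (cell A) (Fin.splitAt-↑ˡ n u n) (Fin.splitAt-↑ʳ n n v))))

   dot-imʳ : ∀ u (x : Fin (n ℕ.+ n) → ℚ) → dot (realify A (n ↑ʳ u)) x ≡
     sum (λ v → fromℤ (im (A u v)) * x (v ↑ˡ n)) + sum (λ v → fromℤ (re (A u v)) * x (n ↑ʳ v))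
   dot-imʳ u x = trans (sum-split n (λ j → realify A (n ↑ʳ u) j * x j)) (cong₂ _+_
     (sum-cong {f = λ v → realify A (n ↑ʳ u) (v ↑ˡ n) * x (v ↑ˡ n)} {λ v → fromℤ (im (A u v)) * x (v ↑ˡ n)}
       λ v → cong (_* x (v ↑ˡ n)) (cong₂ (cell A) (Fin.splitAt-↑ʳ n n u) (Fin.splitAt-↑ˡ n v n)))
     (sum-cong {f = λ v → realify A (n ↑ʳ u) (n ↑ʳ v) * x (n ↑ʳ v)} {λ v → fromℤ (re (A u v)) * x (n ↑ʳ v)}
       λ v → cong (_* x (n ↑ʳ v)) (cong₂ (cell A) (Fin.splitAt-↑ʳ n n u) (Fin.splitAt-↑ʳ n n v))))

 seq-sum-re : ∀ {n} (z : Fin n → ℂ) k → seq (re (Complex.sum z)) k ≡ sum (λ x → seq (re (z x)) k)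
 seq-sum-re {zero} z k = refl
 seq-sum-re {suc n} z k = cong (seq (re (z zero)) k +_) (seq-sum-re (z ∘ suc) k)

 seq-sum-im : ∀ {n} (z : Fin n → ℂ) k → seq (im (Complex.sum z)) k ≡ sum (λ x → seq (im (z x)) k)
 seq-sum-im {zero} z k = refl
 seq-sum-im {suc n} z k = cong (seq (im (z zero)) k +_) (seq-sum-im (z ∘ suc) k)

 Null-neg : ∀ {f} → Null f → Null (λ k → - f k)
 Null-neg {f} h ε 0<ε = eventually-map (λ k → subst (_< ε) (sym (∣-p∣≡∣p∣ (f k)))) (h ε 0<ε)

 two : ℚ
 two = ℤ.+ 2 / 1

 no-large-value : ∀ {n} (A : Matrix n) → IsCyclotomic A → ∀ ε → 0ℚ < ε →
   ¬ (∃[ x ] (two + ε) * square x < form (realify A) x)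
 no-large-value {n} A (hermitian , cyclotomic) ε 0<ε start = matrix-singular contradictory
   where
   open Grid (realify A) (realify-symmetric A hermitian) (two + ε) start
   contradictory : ¬ Singular matrix
   contradictory (v , v≢0 , kernel) = too-large (proj₂ (proj₂ (cyclotomic μ (w , w≢0 , eigen))) ε 0<ε)
     where
     μ : ℂ
     μ = eigenvalue +i Real.fromℚ 0ℚ
     w : Fin n → ℂ
     w u = v (u ↑ˡ n) +i v (n ↑ʳ u)
     minus-0 : ∀ p → p - 0ℚ ≡ p
     minus-0 = solve 1 (λ p → p :- con 0ℚ := p) refl
     w≢0 : ¬ (∀ x → w x Complex.≈ Complex.0#)
     w≢0 z = v≢0 λ i → coordinate i (splitAt n i) refl
       where
       coordinate : ∀ i s → splitAt n i ≡ s → Null (seq (v i))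
       coordinate i (inj₁ u) eq = subst (λ i → Null (seq (v i))) (Fin.splitAt⁻¹-↑ˡ eq)
         (Null-cong {λ k → seq (v (u ↑ˡ n)) k - 0ℚ} (λ k → minus-0 (seq (v (u ↑ˡ n)) k)) (proj₁ (z u)))
       coordinate i (inj₂ u) eq = subst (λ i → Null (seq (v i))) (Fin.splitAt⁻¹-↑ʳ eq)
         (Null-cong {λ k → seq (v (n ↑ʳ u)) k - 0ℚ} (λ k → minus-0 (seq (v (n ↑ʳ u)) k)) (proj₂ (z u)))
     eigen : ∀ u → Complex.sum (λ x → Complex.fromℤ[i] (A u x) Complex.* w x) Complex.≈ μ Complex.* w u
     eigen u =
         Null-cong {λ k → - dot ((matrix mat k) (u ↑ˡ n)) (v at k)} re-part
           (Null-neg {λ k → dot ((matrix mat k) (u ↑ˡ n)) (v at k)} (kernel (u ↑ˡ n)))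
       , Null-cong {λ k → - dot ((matrix mat k) (n ↑ʳ u)) (v at k)} im-part
           (Null-neg {λ k → dot ((matrix mat k) (n ↑ʳ u)) (v at k)} (kernel (n ↑ʳ u)))
       where
       finish : ∀ a b c d → - (a - (b + c)) ≡ (b + c) - (a + - (0ℚ * d))
       finish = solve 4 (λ a b c d → :- (a :- (b :+ c)) := (b :+ c) :- (a :+ :- (con 0ℚ :* d))) refl
       finish′ : ∀ a b c d → - (a - (b + c)) ≡ (c + b) - (a + 0ℚ * d)
       finish′ = solve 4 (λ a b c d → :- (a :- (b :+ c)) := (c :+ b) :- (a :+ con 0ℚ :* d)) refl
       re-part : ∀ k → - dot ((matrix mat k) (u ↑ˡ n)) (v at k) ≡
         seq (re (Complex.sum (λ x → Complex.fromℤ[i] (A u x) Complex.* w x))) k - seq (re (μ Complex.* w u)) k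
       re-part k = trans (cong -_ (trans (dot-shifted (t k) (realify A) (u ↑ˡ n) (v at k)) (cong (λ e → t k * p u - e) (dot-reˡ A u (v at k)))))
         (trans (finish (t k * p u) (sum (λ x → X x * p x)) (sum (λ x → - Y x * q x)) (q u))
           (cong (_- (t k * p u + - (0ℚ * q u))) (sym (trans (seq-sum-re (λ x → Complex.fromℤ[i] (A u x) Complex.* w x) k) expand))))
         where
         p q X Y : Fin n → ℚ
         p x = seq (v (x ↑ˡ n)) k
         q x = seq (v (n ↑ʳ x)) k
         X x = fromℤ (re (A u x))
         Y x = fromℤ (im (A u x))
         expand : sum (λ x → X x * p x + - (Y x * q x)) ≡ sum (λ x → X x * p x) + sum (λ x → - Y x * q x)
         expand = trans (sum-cong {f = λ x → X x * p x + - (Y x * q x)} {λ x → 1ℚ * (X x * p x) + 1ℚ * (- Y x * q x)} λ x → units (X x * p x) (Y x) (q x))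
           (trans (sum-linear 1ℚ 1ℚ (λ x → X x * p x) (λ x → - Y x * q x)) (cong₂ _+_ (*-identityˡ (sum (λ x → X x * p x))) (*-identityˡ (sum (λ x → - Y x * q x)))))
           where
           units : ∀ a y q → a + - (y * q) ≡ 1ℚ * a + 1ℚ * (- y * q)
           units = solve 3 (λ a y q → a :+ :- (y :* q) := con 1ℚ :* a :+ con 1ℚ :* (:- y :* q)) refl
       im-part : ∀ k → - dot ((matrix mat k) (n ↑ʳ u)) (v at k) ≡
         seq (im (Complex.sum (λ x → Complex.fromℤ[i] (A u x) Complex.* w x))) k - seq (im (μ Complex.* w u)) k
       im-part k = trans (cong -_ (trans (dot-shifted (t k) (realify A) (n ↑ʳ u) (v at k)) (cong (λ e → t k * q u - e) (dot-imʳ A u (v at k)))))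
         (trans (finish′ (t k * q u) (sum (λ x → Y x * p x)) (sum (λ x → X x * q x)) (p u))
           (cong (_- (t k * q u + 0ℚ * p u)) (sym (trans (seq-sum-im (λ x → Complex.fromℤ[i] (A u x) Complex.* w x) k) expand))))
         where
         p q X Y : Fin n → ℚ
         p x = seq (v (x ↑ˡ n)) k
         q x = seq (v (n ↑ʳ x)) k
         X x = fromℤ (re (A u x))
         Y x = fromℤ (im (A u x))
         expand : sum (λ x → X x * q x + Y x * p x) ≡ sum (λ x → X x * q x) + sum (λ x → Y x * p x)
         expand = trans (sum-cong {f = λ x → X x * q x + Y x * p x} {λ x → 1ℚ * (X x * q x) + 1ℚ * (Y x * p x)} λ x → units (X x * q x) (Y x * p x))
           (trans (sum-linear 1ℚ 1ℚ (λ x → X x * q x) (λ x → Y x * p x)) (cong₂ _+_ (*-identityˡ (sum (λ x → X x * q x))) (*-identityˡ (sum (λ x → Y x * p x)))))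
           where
           units : ∀ a b → a + b ≡ 1ℚ * a + 1ℚ * b
           units = solve 2 (λ a b → a :+ b := con 1ℚ :* a :+ con 1ℚ :* b) refl
     too-large : Eventually (λ k → t k < two + ε) → ⊥
     too-large = eventually-false λ k h → <-irrefl refl (≤-<-trans (t₀≤t k) h)

 form-bound : ∀ {n} (A : Matrix n) → IsCyclotomic A → ∀ x → form (realify A) x ≤ two * square x
 form-bound {n} A cyc x with <-cmp (two * square x) (form (realify A) x)
 ... | tri≈ _ eq _ = ≤-reflexive (sym eq)
 ... | tri> _ _ gt = <⇒≤ gt
 ... | tri< lt _ _ = ⊥-elim (large (reciprocal {square x + 1ℚ} (+-mono-≤-< {0ℚ} {square x} {0ℚ} {1ℚ} (square-nonneg x) 0<1)))
   where
   g = form (realify A) x - two * square x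
   0<g : 0ℚ < g
   0<g = 0<q-p lt
   large : ∃[ R ] 0ℚ < R × (square x + 1ℚ) * R ≡ 1ℚ → ⊥
   large (R , 0<R , eq) = no-large-value A cyc (g * R) (*-pos 0<g 0<R) (x , subst₂ _<_ (sym (expand two g R (square x))) (back (two * square x) (form (realify A) x))
     (+-monoʳ-< (two * square x) (subst (g * (square x * R) <_) (*-identityʳ g) (*-monoʳ-<-pos g {{positive 0<g}} small))))
     where
     small : square x * R < 1ℚ
     small = subst₂ _<_ (+-identityʳ (square x * R)) (trans (sym (factor (square x) R)) eq) (+-monoʳ-< (square x * R) 0<R)
       where
       factor : ∀ s R → (s + 1ℚ) * R ≡ s * R + R
       factor = solve 2 (λ s R → (s :+ con 1ℚ) :* R := s :* R :+ R) refl
     expand : ∀ t g R s → (t + g * R) * s ≡ t * s + g * (s * R)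
     expand = solve 4 (λ t g R s → (t :+ g :* R) :* s := t :* s :+ g :* (s :* R)) refl
     back : ∀ p q → p + (q - p) ≡ q
     back = solve 2 (λ p q → p :+ (q :- p) := q) refl

module AdjoinedRings where

 open import Algebra.Bundles using (CommutativeRing)
 open import Algebra.Bundles.Raw using (RawRing)
 import Algebra.Definitions.RawMonoid as RawMonoidDefinitions
 import Algebra.Properties.Semiring.Sum
 open import Algebra.Structures using (IsCommutativeRing)
 open import Data.Fin.Base using (_↑ˡ_; _↑ʳ_)
 open import Data.Fin.Permutation using (Permutation; _⟨$⟩ʳ_)
 open import Data.Integer.Solver using () renaming (module +-*-Solver to ℤ-Solver)
 import Data.Rational.Base as ℚ
 import Data.Rational.Properties as ℚ
 open import Data.Rational.Solver using () renaming (module +-*-Solver to ℚ-Solver)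
 open import Level using (0ℓ)

 module AdjoinRing (R : RawRing 0ℓ 0ℓ) where

   private
     module R = RawRing R
     module raw = RawRing (Adjoin-i.rawRing R)

   open raw public using (_+_; _*_; -_; 0#; 1#)
   open RawMonoidDefinitions raw.+-rawMonoid public using (sum)

   record Laws : Set where
     field
       isCommutativeRing : IsCommutativeRing _≡_ R._+_ R._*_ R.-_ R.0# R.1#
       assoc-re : ∀ a b c d e f → (a R.* c R.+ R.- (b R.* d)) R.* e R.+ R.- ((a R.* d R.+ b R.* c) R.* f) ≡ a R.* (c R.* e R.+ R.- (d R.* f)) R.+ R.- (b R.* (c R.* f R.+ d R.* e))
       assoc-im : ∀ a b c d e f → (a R.* c R.+ R.- (b R.* d)) R.* f R.+ (a R.* d R.+ b R.* c) R.* e ≡ a R.* (c R.* f R.+ d R.* e) R.+ b R.* (c R.* e R.+ R.- (d R.* f))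
       distrib-re : ∀ a b c d e f → a R.* (c R.+ e) R.+ R.- (b R.* (d R.+ f)) ≡ (a R.* c R.+ R.- (b R.* d)) R.+ (a R.* e R.+ R.- (b R.* f))
       distrib-im : ∀ a b c d e f → a R.* (d R.+ f) R.+ b R.* (c R.+ e) ≡ (a R.* d R.+ b R.* c) R.+ (a R.* f R.+ b R.* e)
       identity-re : ∀ a b → R.1# R.* a R.+ R.- (R.0# R.* b) ≡ a
       identity-im : ∀ a b → R.1# R.* b R.+ R.0# R.* a ≡ b

   module FromLaws (laws : Laws) where
     open Laws laws
     private
       module base = IsCommutativeRing isCommutativeRing

     abstract

       *-comm : ∀ z w → z * w ≡ w * z
       *-comm (a +i b) (c +i d) = cong₂ _+i_ (cong₂ (λ p q → p R.+ R.- q) (base.*-comm a c) (base.*-comm b d))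
         (trans (base.+-comm (a R.* d) (b R.* c)) (cong₂ R._+_ (base.*-comm b c) (base.*-comm a d)))

       *-identityˡ : ∀ z → 1# * z ≡ z
       *-identityˡ (a +i b) = cong₂ _+i_ (identity-re a b) (identity-im a b)

       distribˡ : ∀ z v w → z * (v + w) ≡ z * v + z * w
       distribˡ (a +i b) (c +i d) (e +i f) = cong₂ _+i_ (distrib-re a b c d e f) (distrib-im a b c d e f)

       isRing : IsCommutativeRing _≡_ _+_ _*_ -_ 0# 1#
       isRing = record
         { isRing = record
           { +-isAbelianGroup = record
             { isGroup = record
               { isMonoid = record
                 { isSemigroup = record
                   { isMagma = record { isEquivalence = isEquivalence ; ∙-cong = cong₂ _+_ }
                   ; assoc = λ (a +i b) (c +i d) (e +i f) → cong₂ _+i_ (base.+-assoc a c e) (base.+-assoc b d f) }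
                 ; identity = (λ (a +i b) → cong₂ _+i_ (base.+-identityˡ a) (base.+-identityˡ b))
                            , (λ (a +i b) → cong₂ _+i_ (base.+-identityʳ a) (base.+-identityʳ b)) }
               ; inverse = (λ (a +i b) → cong₂ _+i_ (base.-‿inverseˡ a) (base.-‿inverseˡ b))
                         , (λ (a +i b) → cong₂ _+i_ (base.-‿inverseʳ a) (base.-‿inverseʳ b))
               ; ⁻¹-cong = cong -_ }
             ; comm = λ (a +i b) (c +i d) → cong₂ _+i_ (base.+-comm a c) (base.+-comm b d) }
           ; *-cong = cong₂ _*_
           ; *-assoc = λ (a +i b) (c +i d) (e +i f) → cong₂ _+i_ (assoc-re a b c d e f) (assoc-im a b c d e f)
           ; *-identity = *-identityˡ , λ z → trans (*-comm z 1#) (*-identityˡ z)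
           ; distrib = distribˡ , λ z v w → trans (*-comm (v + w) z) (trans (distribˡ z v w) (cong₂ _+_ (*-comm z v) (*-comm z w)))
           }
         ; *-comm = *-comm
         }

     private
       ring : CommutativeRing 0ℓ 0ℓ
       ring = record { isCommutativeRing = isRing }
       module ring = CommutativeRing ring
       module Sum = Algebra.Properties.Semiring.Sum ring.semiring

     abstract

       +-identityʳ : ∀ z → z + 0# ≡ z
       +-identityʳ = ring.+-identityʳ

       +-identityˡ : ∀ z → 0# + z ≡ z
       +-identityˡ = ring.+-identityˡ

       *-assoc : ∀ z v w → (z * v) * w ≡ z * (v * w)
       *-assoc = ring.*-assoc

       *-identityʳ : ∀ z → z * 1# ≡ z
       *-identityʳ = ring.*-identityʳ

       zeroˡ : ∀ z → 0# * z ≡ 0#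
       zeroˡ = ring.zeroˡ

       zeroʳ : ∀ z → z * 0# ≡ 0#
       zeroʳ = ring.zeroʳ

       sum-cong : ∀ {n} {f g : Fin n → R.Carrier [i]} → (∀ i → f i ≡ g i) → sum f ≡ sum g
       sum-cong = Sum.sum-cong-≗

       sum-+ : ∀ {n} (f g : Fin n → R.Carrier [i]) → sum (λ i → f i + g i) ≡ sum f + sum g
       sum-+ = Sum.∑-distrib-+

       sum-swap : ∀ {m n} (f : Fin m → Fin n → R.Carrier [i]) → sum (λ i → sum (λ j → f i j)) ≡ sum (λ j → sum (λ i → f i j))
       sum-swap = Sum.∑-comm

       *-distribˡ-sum : ∀ {n} z (f : Fin n → R.Carrier [i]) → z * sum f ≡ sum (λ i → z * f i)
       *-distribˡ-sum = Sum.*-distribˡ-sum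

       *-distribʳ-sum : ∀ {n} z (f : Fin n → R.Carrier [i]) → sum f * z ≡ sum (λ i → f i * z)
       *-distribʳ-sum = Sum.*-distribʳ-sum

       sum-permute : ∀ {m n} (f : Fin n → R.Carrier [i]) (π : Permutation m n) → sum f ≡ sum (λ i → f (π ⟨$⟩ʳ i))
       sum-permute = Sum.sum-permute

     sum-zero : ∀ {n} (f : Fin n → R.Carrier [i]) → (∀ i → f i ≡ 0#) → sum f ≡ 0#
     sum-zero {zero} f z = refl
     sum-zero {suc n} f z = trans (cong₂ _+_ (z zero) (sum-zero (f ∘ suc) (z ∘ suc))) (+-identityˡ 0#)

     sum-only : ∀ {n} (f : Fin n → R.Carrier [i]) i → (∀ j → j ≢ i → f j ≡ 0#) → sum f ≡ f i
     sum-only f zero z = trans (cong (f zero +_) (sum-zero (f ∘ suc) λ j → z (suc j) λ ())) (+-identityʳ (f zero))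
     sum-only f (suc i) z = trans (cong₂ _+_ (z zero λ ()) (sum-only (f ∘ suc) i λ j j≢ → z (suc j) λ { refl → j≢ refl })) (+-identityˡ (f (suc i)))

     sum-split : ∀ n {m} (f : Fin (n ℕ.+ m) → R.Carrier [i]) → sum f ≡ sum (λ i → f (i ↑ˡ m)) + sum (λ j → f (n ↑ʳ j))
     sum-split zero f = sym (+-identityˡ (sum f))
     sum-split (suc n) {m} f = trans (cong (f zero +_) (sum-split n (f ∘ suc)))
       (sym (ring.+-assoc (f zero) (sum (λ i → f (suc (i ↑ˡ m)))) (sum (λ j → f (suc n ↑ʳ j)))))

 abstract

   ℤ-laws : AdjoinRing.Laws ℤ.+-*-rawRing
   ℤ-laws = record
     { isCommutativeRing = ℤ.+-*-isCommutativeRing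
     ; assoc-re = solve 6 (λ a b c d e f → (a :* c :+ :- (b :* d)) :* e :+ :- ((a :* d :+ b :* c) :* f) := a :* (c :* e :+ :- (d :* f)) :+ :- (b :* (c :* f :+ d :* e))) refl
     ; assoc-im = solve 6 (λ a b c d e f → (a :* c :+ :- (b :* d)) :* f :+ (a :* d :+ b :* c) :* e := a :* (c :* f :+ d :* e) :+ b :* (c :* e :+ :- (d :* f))) refl
     ; distrib-re = solve 6 (λ a b c d e f → a :* (c :+ e) :+ :- (b :* (d :+ f)) := (a :* c :+ :- (b :* d)) :+ (a :* e :+ :- (b :* f))) refl
     ; distrib-im = solve 6 (λ a b c d e f → a :* (d :+ f) :+ b :* (c :+ e) := (a :* d :+ b :* c) :+ (a :* f :+ b :* e)) refl
     ; identity-re = solve 2 (λ a b → con ℤ.1ℤ :* a :+ :- (con ℤ.0ℤ :* b) := a) refl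
     ; identity-im = solve 2 (λ a b → con ℤ.1ℤ :* b :+ con ℤ.0ℤ :* a := b) refl
     }
     where open ℤ-Solver

 abstract

   ℚ-laws : AdjoinRing.Laws ℚ.+-*-rawRing
   ℚ-laws = record
     { isCommutativeRing = ℚ.+-*-isCommutativeRing
     ; assoc-re = solve 6 (λ a b c d e f → (a :* c :+ :- (b :* d)) :* e :+ :- ((a :* d :+ b :* c) :* f) := a :* (c :* e :+ :- (d :* f)) :+ :- (b :* (c :* f :+ d :* e))) refl
     ; assoc-im = solve 6 (λ a b c d e f → (a :* c :+ :- (b :* d)) :* f :+ (a :* d :+ b :* c) :* e := a :* (c :* f :+ d :* e) :+ b :* (c :* e :+ :- (d :* f))) refl
     ; distrib-re = solve 6 (λ a b c d e f → a :* (c :+ e) :+ :- (b :* (d :+ f)) := (a :* c :+ :- (b :* d)) :+ (a :* e :+ :- (b :* f))) refl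
     ; distrib-im = solve 6 (λ a b c d e f → a :* (d :+ f) :+ b :* (c :+ e) := (a :* d :+ b :* c) :+ (a :* f :+ b :* e)) refl
     ; identity-re = solve 2 (λ a b → con ℚ.1ℚ :* a :+ :- (con ℚ.0ℚ :* b) := a) refl
     ; identity-im = solve 2 (λ a b → con ℚ.1ℚ :* b :+ con ℚ.0ℚ :* a := b) refl
     }
     where open ℚ-Solver

 module G where
   open AdjoinRing ℤ.+-*-rawRing public
   open FromLaws ℤ-laws public

 module H where
   open AdjoinRing ℚ.+-*-rawRing public
   open FromLaws ℚ-laws public

module NegatedMatrix where

 open Forms using (fromℤ; fromℤ-+; fromℤ-*; fromℤ-neg; *-pos; 0≤p²)
 open Kernels using (Null; Null-cong; Null-+; Null-*; Bounded; bounded; Above; Apart; not-apart; Eventually; eventually-map; eventually₂; square-<; ∣∣<⇒<; ∣∣<⇒-<)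
 open FormBound using (Null-neg; two)
 open AdjoinedRings
 open import Data.Rational.Base
 open import Data.Rational.Properties
 open import Data.Rational.Solver using (module +-*-Solver)
 open +-*-Solver using (solve; _:+_; _:*_; _:-_; :-_; con; _:=_)

 Nullᶜ : (ℕ → ℚ [i]) → Set
 Nullᶜ f = Null (re ∘ f) × Null (im ∘ f)

 Boundedᶜ : (ℕ → ℚ [i]) → Set
 Boundedᶜ f = Bounded (re ∘ f) × Bounded (im ∘ f)

 Nullᶜ-cong : ∀ {f g} → (∀ k → f k ≡ g k) → Nullᶜ f → Nullᶜ g
 Nullᶜ-cong {f} {g} e (a , b) = Null-cong {re ∘ f} {re ∘ g} (cong re ∘ e) a , Null-cong {im ∘ f} {im ∘ g} (cong im ∘ e) b

 Nullᶜ-+ : ∀ {f g} → Nullᶜ f → Nullᶜ g → Nullᶜ (λ k → f k H.+ g k)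
 Nullᶜ-+ {f} {g} (a , b) (c , d) = Null-+ {re ∘ f} {re ∘ g} a c , Null-+ {im ∘ f} {im ∘ g} b d

 Nullᶜ-* : ∀ {f g} → Nullᶜ f → Boundedᶜ g → Nullᶜ (λ k → f k H.* g k)
 Nullᶜ-* {f} {g} (a , b) (c , d) =
     Null-+ {λ k → re (f k) * re (g k)} {λ k → - (im (f k) * im (g k))} (Null-* {re ∘ f} {re ∘ g} a c)
       (Null-neg {λ k → im (f k) * im (g k)} (Null-* {im ∘ f} {im ∘ g} b d))
   , Null-+ {λ k → re (f k) * im (g k)} {λ k → im (f k) * re (g k)} (Null-* {re ∘ f} {im ∘ g} a d) (Null-* {im ∘ f} {re ∘ g} b c)

 Null-0 : Null (λ _ → 0ℚ)
 Null-0 ε 0<ε = 0 , λ _ _ → 0<ε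

 embed : ℤ[i] → ℚ [i]
 embed z = fromℤ (re z) +i fromℤ (im z)

 embed-+ : ∀ z w → embed (z Gaussian.+ w) ≡ embed z H.+ embed w
 embed-+ (a +i b) (c +i d) = cong₂ _+i_ (fromℤ-+ a c) (fromℤ-+ b d)

 embed-* : ∀ z w → embed (z Gaussian.* w) ≡ embed z H.* embed w
 embed-* (a +i b) (c +i d) = cong₂ _+i_
   (trans (fromℤ-+ (a ℤ.* c) (ℤ.- (b ℤ.* d))) (cong₂ _+_ (fromℤ-* a c) (trans (fromℤ-neg (b ℤ.* d)) (cong -_ (fromℤ-* b d)))))
   (trans (fromℤ-+ (a ℤ.* d) (b ℤ.* c)) (cong₂ _+_ (fromℤ-* a d) (fromℤ-* b c)))

 embed-sum : ∀ {n} (f : Fin n → ℤ[i]) → embed (Gaussian.sum f) ≡ H.sum (embed ∘ f)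
 embed-sum {zero} f = refl
 embed-sum {suc n} f = trans (embed-+ (f zero) (Gaussian.sum (f ∘ suc))) (cong (embed (f zero) H.+_) (embed-sum (f ∘ suc)))

 stage : ℂ → ℕ → ℚ [i]
 stage z k = seq (re z) k +i seq (im z) k

 stage-bounded : ∀ z → Boundedᶜ (stage z)
 stage-bounded z = bounded (re z) , bounded (im z)

 stage-sum : ∀ {n} (z : Fin n → ℂ) k → stage (Complex.sum z) k ≡ H.sum (λ x → stage (z x) k)
 stage-sum {zero} z k = refl
 stage-sum {suc n} z k = cong (stage (z zero) k H.+_) (stage-sum (z ∘ suc) k)

 negᴹ : ∀ {n} → Matrix n → Matrix n
 negᴹ A u v = Gaussian.- A u v

 sum-negᶜ : ∀ {n} (f : Fin n → ℚ [i]) → H.- H.sum f ≡ H.sum (λ x → H.- f x)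
 sum-negᶜ {zero} f = refl
 sum-negᶜ {suc n} f = trans (cong₂ _+i_ (neg-distrib-+ (re (f zero)) (re (H.sum (f ∘ suc)))) (neg-distrib-+ (im (f zero)) (im (H.sum (f ∘ suc)))))
   (cong (H.- f zero H.+_) (sum-negᶜ (f ∘ suc)))

 neg-cyclotomic : ∀ {n} (A : Matrix n) → IsCyclotomic A → IsCyclotomic (negᴹ A)
 neg-cyclotomic {n} A (hermitian , cyclotomic) = (λ u v → cong Gaussian.-_ (hermitian u v)) , bounds
   where
   module _ (μ : ℂ) (v : Fin n → ℂ) (eq : ∀ u → Complex.sum (λ x → Complex.fromℤ[i] (negᴹ A u x) Complex.* v x) Complex.≈ μ Complex.* v u) where
     -μ : ℂ
     -μ = Real.- re μ +i Real.- im μ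
     eq′ : ∀ u → Complex.sum (λ x → Complex.fromℤ[i] (A u x) Complex.* v x) Complex.≈ -μ Complex.* v u
     eq′ u = Nullᶜ-cong {λ k → H.- (stage (Complex.sum (λ x → Complex.fromℤ[i] (negᴹ A u x) Complex.* v x)) k H.+ H.- (stage μ k H.* stage (v u) k))}
         {λ k → stage (Complex.sum (λ x → Complex.fromℤ[i] (A u x) Complex.* v x)) k H.+ H.- (stage -μ k H.* stage (v u) k)} negated
         (Null-neg (proj₁ (eq u)) , Null-neg (proj₂ (eq u)))
       where
       negate : ∀ z w → H.- (embed (Gaussian.- z) H.* w) ≡ embed z H.* w
       negate (a +i b) (p +i q) = trans (cong₂ (λ a b → H.- ((a +i b) H.* (p +i q))) (fromℤ-neg a) (fromℤ-neg b)) (cong₂ _+i_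
         (solve 4 (λ a b p q → :- (:- a :* p :+ :- (:- b :* q)) := a :* p :+ :- (b :* q)) refl (fromℤ a) (fromℤ b) p q)
         (solve 4 (λ a b p q → :- (:- a :* q :+ :- b :* p) := a :* q :+ b :* p) refl (fromℤ a) (fromℤ b) p q))
       finish : ∀ s m w → H.- (s H.+ H.- (m H.* w)) ≡ H.- s H.+ H.- (H.- m H.* w)
       finish (s +i s′) (m +i m′) (w +i w′) = cong₂ _+i_
         (solve 5 (λ s m m′ w w′ → :- (s :+ :- (m :* w :+ :- (m′ :* w′))) := :- s :+ :- (:- m :* w :+ :- (:- m′ :* w′))) refl s m m′ w w′)
         (solve 5 (λ s m m′ w w′ → :- (s :+ :- (m :* w′ :+ m′ :* w)) := :- s :+ :- (:- m :* w′ :+ :- m′ :* w)) refl s′ m m′ w w′)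
       negated : ∀ k → H.- (stage (Complex.sum (λ x → Complex.fromℤ[i] (negᴹ A u x) Complex.* v x)) k H.+ H.- (stage μ k H.* stage (v u) k)) ≡
         stage (Complex.sum (λ x → Complex.fromℤ[i] (A u x) Complex.* v x)) k H.+ H.- (stage -μ k H.* stage (v u) k)
       negated k = trans (finish (stage (Complex.sum (λ x → Complex.fromℤ[i] (negᴹ A u x) Complex.* v x)) k) (stage μ k) (stage (v u) k)) (cong (H._+ H.- (stage -μ k H.* stage (v u) k))
         (trans (cong H.-_ (stage-sum (λ x → Complex.fromℤ[i] (negᴹ A u x) Complex.* v x) k))
         (trans (sum-negᶜ (λ x → embed (negᴹ A u x) H.* stage (v x) k))
         (trans (H.sum-cong λ x → negate (A u x) (stage (v x) k)) (sym (stage-sum (λ x → Complex.fromℤ[i] (A u x) Complex.* v x) k))))))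
   -2ℚ : ℚ
   -2ℚ = ℤ.- (ℤ.+ 2) / 1
   bounds : ∀ μ → IsEigenvalue (negᴹ A) μ →
     (im μ Real.≈ Real.fromℚ 0ℚ) × (Real.fromℚ -2ℚ Real.≤ re μ) × (re μ Real.≤ Real.fromℚ two)
   bounds μ (v , v≢0 , eq) = turn (cyclotomic (-μ μ v eq) (v , v≢0 , eq′ μ v eq))
     where
     turn : (Real.- im μ Real.≈ Real.fromℚ 0ℚ) × (Real.fromℚ -2ℚ Real.≤ Real.- re μ) × (Real.- re μ Real.≤ Real.fromℚ two) →
       (im μ Real.≈ Real.fromℚ 0ℚ) × (Real.fromℚ -2ℚ Real.≤ re μ) × (re μ Real.≤ Real.fromℚ two)
     turn (a , b , c) = Null-cong {λ k → - (- seq (im μ) k - 0ℚ)} (λ k → zero-case (seq (im μ) k)) (Null-neg {λ k → - seq (im μ) k - 0ℚ} a)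
       , (λ ε 0<ε → eventually-map {λ k → - seq (re μ) k < two + ε} (λ k h → lower (seq (re μ) k) ε h) (c ε 0<ε))
       , (λ ε 0<ε → eventually-map {λ k → -2ℚ < - seq (re μ) k + ε} (λ k h → higher (seq (re μ) k) ε h) (b ε 0<ε))
       where
       zero-case : ∀ p → - (- p - 0ℚ) ≡ p - 0ℚ
       zero-case = solve 1 (λ p → :- (:- p :- con 0ℚ) := p :- con 0ℚ) refl
       lower : ∀ a ε → - a < two + ε → -2ℚ < a + ε
       lower a ε h = subst₂ _<_ (left a) (right a ε) (+-monoʳ-< (a + -2ℚ) h)
         where
         left : ∀ a → a + -2ℚ + - a ≡ -2ℚ
         left = solve 1 (λ a → a :+ con -2ℚ :+ :- a := con -2ℚ) refl
         right : ∀ a ε → a + -2ℚ + (two + ε) ≡ a + ε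
         right = solve 2 (λ a ε → a :+ con -2ℚ :+ (con two :+ ε) := a :+ ε) refl
       higher : ∀ a ε → -2ℚ < - a + ε → a < two + ε
       higher a ε h = subst₂ _<_ (left a) (right a ε) (+-monoʳ-< (a + two) h)
         where
         left : ∀ a → a + two + -2ℚ ≡ a
         left = solve 1 (λ a → a :+ con two :+ con -2ℚ := a) refl
         right : ∀ a ε → a + two + (- a + ε) ≡ two + ε
         right = solve 2 (λ a ε → a :+ con two :+ (:- a :+ ε) := con two :+ ε) refl

module Configuration where

 open import Data.Bool.Base using (not)
 open import Data.List.Base as List using (List; []; _∷_)
 import Data.Maybe.Properties as Maybe

 data C₄ : Set where
   ζ⁰ ζ¹ ζ² ζ³ : C₄

 infixl 7 _∙_

 _∙_ : C₄ → C₄ → C₄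
 ζ⁰ ∙ y = y
 ζ¹ ∙ ζ⁰ = ζ¹
 ζ¹ ∙ ζ¹ = ζ²
 ζ¹ ∙ ζ² = ζ³
 ζ¹ ∙ ζ³ = ζ⁰
 ζ² ∙ ζ⁰ = ζ²
 ζ² ∙ ζ¹ = ζ³
 ζ² ∙ ζ² = ζ⁰
 ζ² ∙ ζ³ = ζ¹
 ζ³ ∙ ζ⁰ = ζ³
 ζ³ ∙ ζ¹ = ζ⁰
 ζ³ ∙ ζ² = ζ¹
 ζ³ ∙ ζ³ = ζ²

 infix 8 _⁻¹

 _⁻¹ : C₄ → C₄
 ζ⁰ ⁻¹ = ζ⁰
 ζ¹ ⁻¹ = ζ³
 ζ² ⁻¹ = ζ²
 ζ³ ⁻¹ = ζ¹

 _≟₄_ : DecidableEquality C₄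
 ζ⁰ ≟₄ ζ⁰ = yes refl
 ζ⁰ ≟₄ ζ¹ = no λ ()
 ζ⁰ ≟₄ ζ² = no λ ()
 ζ⁰ ≟₄ ζ³ = no λ ()
 ζ¹ ≟₄ ζ⁰ = no λ ()
 ζ¹ ≟₄ ζ¹ = yes refl
 ζ¹ ≟₄ ζ² = no λ ()
 ζ¹ ≟₄ ζ³ = no λ ()
 ζ² ≟₄ ζ⁰ = no λ ()
 ζ² ≟₄ ζ¹ = no λ ()
 ζ² ≟₄ ζ² = yes refl
 ζ² ≟₄ ζ³ = no λ ()
 ζ³ ≟₄ ζ⁰ = no λ ()
 ζ³ ≟₄ ζ¹ = no λ ()
 ζ³ ≟₄ ζ² = no λ ()
 ζ³ ≟₄ ζ³ = yes refl

 -- A weight is zero or a unit of ℤ[i].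
 W : Set
 W = Maybe C₄

 _≟ʷ_ : DecidableEquality W
 _≟ʷ_ = Maybe.≡-dec _≟₄_

 pattern 𝟎 = nothing
 pattern 𝟏 = just ζ⁰

 infixr 7 _◃_

 _◃_ : C₄ → W → W
 q ◃ w = Maybe.map (q ∙_) w

 conjʷ negʷ : W → W
 conjʷ = Maybe.map _⁻¹
 negʷ = ζ² ◃_

 ⟦_⟧₄ : C₄ → ℤ[i]
 ⟦ ζ⁰ ⟧₄ = Gaussian.1#
 ⟦ ζ¹ ⟧₄ = Gaussian.𝐢
 ⟦ ζ² ⟧₄ = Gaussian.- Gaussian.1#
 ⟦ ζ³ ⟧₄ = Gaussian.- Gaussian.𝐢

 ⟦_⟧ʷ : W → ℤ[i]
 ⟦ 𝟎 ⟧ʷ = Gaussian.0#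
 ⟦ just q ⟧ʷ = ⟦ q ⟧₄

 rotate : C₄ → ℤ[i] → ℤ[i]
 rotate ζ⁰ z = z
 rotate ζ¹ (a +i b) = ℤ.- b +i a
 rotate ζ² (a +i b) = ℤ.- a +i ℤ.- b
 rotate ζ³ (a +i b) = b +i ℤ.- a

 infixr 7 _·ʷ_

 _·ʷ_ : W → ℤ[i] → ℤ[i]
 𝟎 ·ʷ z = Gaussian.0#
 just q ·ʷ z = rotate q z

 dot : ∀ {s} → Vec W s → Vec ℤ[i] s → ℤ[i]
 dot [] [] = Gaussian.0#
 dot (𝟎 ∷ c) (y ∷ ys) = dot c ys
 dot (just q ∷ c) (y ∷ ys) = rotate q y Gaussian.+ dot c ys

 re⟨_,_⟩ : ℤ[i] → ℤ[i] → ℤ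
 re⟨ a +i b , c +i d ⟩ = a ℤ.* c ℤ.+ b ℤ.* d

 -- A Hermitian matrix with zero diagonal, given by the columns above the
 -- diagonal, the newest vertex first.
 data Conf : ℕ → Set where
   [] : Conf 0
   _∷_ : ∀ {s} → Vec W s → Conf s → Conf (suc s)

 -- Half of the value of the Hermitian form.
 half-form : ∀ {s} → Conf s → Vec ℤ[i] s → ℤ
 half-form [] [] = 0ℤ
 half-form (c ∷ N) (ξ ∷ ys) = half-form N ys ℤ.+ re⟨ ξ , dot c ys ⟩

 norm² : ∀ {s} → Vec ℤ[i] s → ℕ
 norm² [] = 0
 norm² ((a +i b) ∷ ys) = ℤ.∣ a ∣ ℕ.* ℤ.∣ a ∣ ℕ.+ ℤ.∣ b ∣ ℕ.* ℤ.∣ b ∣ ℕ.+ norm² ys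

 refutes : ∀ {s} → Conf s → Vec ℤ[i] s → Bool
 refutes N y = norm² y ℕ.<ᵇ ℤ.∣ half-form N y ∣

 Columns Pool : ℕ → Set
 Columns s = List (Vec W s)
 Pool s = List (Vec ℤ[i] s)

 survives : ∀ {s} → Pool s → Conf s → Bool
 survives [] N = true
 survives (y ∷ P) N = if refutes N y then false else survives P N

 weights : List W
 weights = 𝟎 ∷ 𝟏 ∷ just ζ¹ ∷ just ζ² ∷ just ζ³ ∷ []

 candidates : ∀ {s} → Columns s → Columns (suc s)
 candidates [] = (𝟏 ∷ Vec.replicate _ 𝟎) ∷ []
 candidates (c ∷ L) = List.map (_∷ c) weights List.++ candidates L

 filterᵇ : ∀ {A : Set} → (A → Bool) → List A → List A
 filterᵇ p [] = []
 filterᵇ p (x ∷ xs) = if p x then x ∷ filterᵇ p xs else filterᵇ p xs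

 grow : ∀ {s} → Pool (2 ℕ.+ s) → Conf s → Vec W s → Columns s → Columns (suc s)
 grow P N c L = filterᵇ (λ d → survives P (d ∷ c ∷ N)) (candidates L)

 _≟ᵛ_ : ∀ {s} → DecidableEquality (Vec W s)
 _≟ᵛ_ = Vec.≡-dec _≟ʷ_

 remove : ∀ {s} → Vec W s → Columns s → Columns s
 remove c = filterᵇ (λ d → not (does (c ≟ᵛ d)))

module Certificate where

 open Configuration
 open import Data.Bool.Base using (_∧_; not)
 open import Data.List.Base as List using (List; []; _∷_)
 open import Data.Nat.DivMod using (_/_; _%_)

 _≟ᵍ_ : DecidableEquality ℤ[i]
 (a +i b) ≟ᵍ (c +i d) = map′ (λ { (refl , refl) → refl }) (λ { refl → refl , refl })
   ((a ℤ.≟ c) ×-dec (b ℤ.≟ d))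

 entry : ∀ {s} → Conf s → Fin s → Fin s → W
 entry (c ∷ N) zero zero = 𝟎
 entry (c ∷ N) zero (suc j) = Vec.lookup c j
 entry (c ∷ N) (suc i) zero = conjʷ (Vec.lookup c i)
 entry (c ∷ N) (suc i) (suc j) = entry N i j

 Twist : Set
 Twist = Sign × Automorphism

 twistʷ : Twist → W → W
 twistʷ (Sign.+ , identity) w = w
 twistʷ (Sign.+ , conjugation) w = conjʷ w
 twistʷ (Sign.- , identity) w = negʷ w
 twistʷ (Sign.- , conjugation) w = negʷ (conjʷ w)

 twist : Twist → ℤ[i] → ℤ[i]
 twist (s , σ) z = ± s (⟦ σ ⟧ z)

 between : C₄ → ℤ[i] → C₄ → ℤ[i]
 between p z q = rotate (p ∙ q ⁻¹) z

 unit : ℕ → C₄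
 unit 0 = ζ⁰
 unit 1 = ζ¹
 unit 2 = ζ²
 unit _ = ζ³

 weight : ℕ → W
 weight 0 = 𝟎
 weight (suc k) = just (unit k)

 column : ∀ s → ℕ → Vec W s
 column zero n = []
 column (suc s) n = weight (n % 16) ∷ column s (n / 16)

 gaussian : ℕ → ℤ[i]
 gaussian n = (n / 25) ℤ.⊖ 12 +i (n % 25) ℤ.⊖ 12

 vector : ∀ s → ℕ → Vec ℤ[i] s
 vector zero n = []
 vector (suc s) n = gaussian (n % 625) ∷ vector s (n / 625)

 fin : ∀ {m} → ℕ → Maybe (Fin m)
 fin {zero} n = nothing
 fin {suc m} zero = just zero
 fin {suc m} (suc n) = Maybe.map suc (fin n)

 images : ∀ {m} s → ℕ → Maybe (Vec (Fin m × C₄) s)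
 images zero n = just []
 images (suc s) n = fin ((n % 256) / 4) Maybe.>>= λ v →
   Maybe.map ((v , unit (n % 4)) ∷_) (images s (n / 256))

 -- A list of equally long vectors, given by its length and a number whose
 -- digits in base 625 are the coordinates.
 Pack : Set
 Pack = ℕ × ℕ

 pool : ∀ s → Pack → Pool s
 pool s (k , n) = unpack k n
   where
   drop : ℕ → ℕ → ℕ
   drop zero n = n
   drop (suc s) n = drop s (n / 625)
   unpack : ℕ → ℕ → Pool s
   unpack zero n = []
   unpack (suc k) n = vector s n ∷ unpack k (drop s n)

 State : Set
 State = Σ[ s ∈ ℕ ] Conf s × Columns s

 start : State
 start = 0 , [] , []

 infixl 5 _▸_

 _▸_ : State → ℕ × Pack → State
 (s , N , L) ▸ (c , P) =
   suc s , column s c ∷ N , grow (pool (2 ℕ.+ s) P) N (column s c) L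

 data Tree : Set where
   branch : ℕ → Pack → Tree → Tree → Tree
   exit : ℕ → Twist → ℕ → Tree
   leaf : Pack → ℕ → Twist → ℕ → Tree

 Seed : Set
 Seed = Σ[ s ∈ ℕ ] Conf s

 Target : Set
 Target = Σ[ N ∈ ℕ ] Matrix N

 module _ where

   allᵇ : ∀ {A : Set} → (A → Bool) → List A → Bool
   allᵇ p [] = true
   allᵇ p (x ∷ xs) = if p x then allᵇ p xs else false

   allPairsᵇ : ∀ {A : Set} → (A → A → Bool) → List A → Bool
   allPairsᵇ r [] = true
   allPairsᵇ r (x ∷ xs) = if allᵇ (r x) xs then allPairsᵇ r xs else false

   allFinᵇ : ∀ {s} → (Fin s → Bool) → Bool
   allFinᵇ {zero} p = true
   allFinᵇ {suc s} p = if p zero then allFinᵇ (λ i → p (suc i)) else false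

 exitOk : ∀ {m s} → Conf m → Conf s → Twist → Vec (Fin s × C₄) m → Fin m → Fin m → Bool
 exitOk X N τ g i j = if does (i Fin.≟ j) then true else
   let (v , p) = Vec.lookup g i ; (w , q) = Vec.lookup g j in
   not (does (v Fin.≟ w)) ∧ does (entry X i j ≟ʷ twistʷ τ ((p ∙ q ⁻¹) ◃ entry N v w))

 exits : ∀ {m s} → Conf m → Conf s → Twist → Maybe (Vec (Fin s × C₄) m) → Bool
 exits X N τ nothing = false
 exits X N τ (just g) = allFinᵇ λ i → allFinᵇ (exitOk X N τ g i)

 module Leaf {s} (P : Pool (2 ℕ.+ s)) {m} (M : Matrix m) (τ : Twist) (N : Conf s) where

   value : Fin m × C₄ → Fin m × C₄ → ℤ[i]
   value (v , p) (w , q) = twist τ (between p (M v w) q)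

   distinct : Fin m × C₄ → Fin m × C₄ → Bool
   distinct (v , _) (w , _) = not (does (v Fin.≟ w))

   cellOk : Vec (Fin m × C₄) s → Fin s → Fin s → Bool
   cellOk g i j = if does (i Fin.≟ j) then true else
     distinct (Vec.lookup g i) (Vec.lookup g j)
     ∧ does (⟦ entry N i j ⟧ʷ ≟ᵍ value (Vec.lookup g i) (Vec.lookup g j))

   baseOk : Vec (Fin m × C₄) s → Bool
   baseOk g = allFinᵇ λ i → allFinᵇ (cellOk g i)

   spokeOk : Vec (Fin m × C₄) s → Fin m × C₄ → Vec W s → Fin s → Bool
   spokeOk g x c j = distinct x (Vec.lookup g j)
     ∧ does (⟦ Vec.lookup c j ⟧ʷ ≟ᵍ value x (Vec.lookup g j))

   columnOk : Vec (Fin m × C₄) s → Fin m × C₄ → Vec W s → Bool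
   columnOk g x c = allFinᵇ (spokeOk g x c)

   dead : Vec W s → Vec W s → W → Bool
   dead c d w = not (survives P ((w ∷ d) ∷ c ∷ N))

   Typed : Set
   Typed = Vec W s × Fin m × C₄

   selfOk : Typed → Bool
   selfOk (c , x) = allᵇ (dead c c) weights ∧ dead c (Vec.replicate s 𝟎) 𝟏

   weightOk : Typed → Typed → W → Bool
   weightOk (c , x) (d , y) w = if does (⟦ w ⟧ʷ ≟ᵍ value x y) then true else dead d c w

   pairOk : Typed → Typed → Bool
   pairOk (c , x) (d , y) = distinct x y ∧ allᵇ (weightOk (c , x) (d , y)) weights

   leafOk : Vec (Fin m × C₄) s → List Typed → Bool
   leafOk g T = baseOk g ∧ allᵇ (λ T → columnOk g (proj₂ T) (proj₁ T)) T ∧ allᵇ selfOk T ∧ allPairsᵇ pairOk T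

 zip : ∀ {A B : Set} (xs : List A) → Vec B (List.length xs) → List (A × B)
 zip [] [] = []
 zip (x ∷ xs) (y ∷ ys) = (x , y) ∷ zip xs ys

 leafCheck : ∀ {s} → Pool (2 ℕ.+ s) → ∀ {m} → Matrix m → Twist → Conf s → (L : Columns s) →
   Maybe (Vec (Fin m × C₄) (s ℕ.+ List.length L)) → Bool
 leafCheck P M τ N L nothing = false
 leafCheck {s} P M τ N L (just g) = Leaf.leafOk P M τ N (Vec.take s g) (zip L (Vec.drop s g))

 nth : ∀ {A : Set} → List A → ℕ → Maybe A
 nth [] _ = nothing
 nth (x ∷ xs) zero = just x
 nth (x ∷ xs) (suc n) = nth xs n

 module Check (seeds : List Seed) (targets : List Target) where

   check : State → Tree → Bool
   checkExit : State → Twist → ℕ → Maybe Seed → Bool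
   checkLeaf : State → Pack → Twist → ℕ → Maybe Target → Bool

   check S@(s , N , L) (branch c P T₁ T₀) =
     if check (S ▸ (c , P)) T₁ then check (s , N , remove (column s c) L) T₀ else false
   check S (exit k τ g) = checkExit S τ g (nth seeds k)
   check S (leaf P t τ g) = checkLeaf S P τ g (nth targets t)

   checkExit S τ g nothing = false
   checkExit (s , N , L) τ g (just (m , X)) = exits X N τ (images m g)

   checkLeaf S P τ g nothing = false
   checkLeaf (zero , N , L) P τ g (just (m , M)) = false
   checkLeaf (suc s , N , L) P τ g (just (m , M)) =
     leafCheck (pool (3 ℕ.+ s) P) M τ N L (images (suc s ℕ.+ List.length L) g)

module Gains where

 open Configuration
 open Certificate using (_≟ᵍ_; entry; Twist; twistʷ; twist; between; allFinᵇ)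
 open import Data.Integer.Solver using () renaming (module +-*-Solver to ℤ-Solver)
 open import Data.Vec.Relation.Unary.All using (All; []; _∷_)
 open import Relation.Binary.Construct.Closure.ReflexiveTransitive using (Star)

 all₄? : {P : C₄ → Set} → (∀ p → Dec (P p)) → Dec (∀ p → P p)
 all₄? P? = map′ (λ { (a , b , c , d) → λ { ζ⁰ → a ; ζ¹ → b ; ζ² → c ; ζ³ → d } })
   (λ f → f ζ⁰ , f ζ¹ , f ζ² , f ζ³)
   (P? ζ⁰ ×-dec P? ζ¹ ×-dec P? ζ² ×-dec P? ζ³)

 ∙-assoc : ∀ p q r → (p ∙ q) ∙ r ≡ p ∙ (q ∙ r)
 ∙-assoc = toWitness {a? = all₄? λ p → all₄? λ q → all₄? λ r → ((p ∙ q) ∙ r) ≟₄ (p ∙ (q ∙ r))} tt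

 ∙-comm : ∀ p q → p ∙ q ≡ q ∙ p
 ∙-comm = toWitness {a? = all₄? λ p → all₄? λ q → (p ∙ q) ≟₄ (q ∙ p)} tt

 ∙-identityʳ : ∀ p → p ∙ ζ⁰ ≡ p
 ∙-identityʳ p = ∙-comm p ζ⁰

 ∙-inverseˡ : ∀ p → p ⁻¹ ∙ p ≡ ζ⁰
 ∙-inverseˡ = toWitness {a? = all₄? λ p → (p ⁻¹ ∙ p) ≟₄ ζ⁰} tt

 ⁻¹-distrib : ∀ p q → (p ∙ q) ⁻¹ ≡ p ⁻¹ ∙ q ⁻¹
 ⁻¹-distrib = toWitness {a? = all₄? λ p → all₄? λ q → ((p ∙ q) ⁻¹) ≟₄ (p ⁻¹ ∙ q ⁻¹)} tt

 ⁻¹-involutive : ∀ p → p ⁻¹ ⁻¹ ≡ p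
 ⁻¹-involutive = toWitness {a? = all₄? λ p → (p ⁻¹ ⁻¹) ≟₄ p} tt

 ◃-assoc : ∀ p q w → (p ∙ q) ◃ w ≡ p ◃ q ◃ w
 ◃-assoc p q 𝟎 = refl
 ◃-assoc p q (just r) = cong just (∙-assoc p q r)

 ◃-identity : ∀ w → ζ⁰ ◃ w ≡ w
 ◃-identity 𝟎 = refl
 ◃-identity (just _) = refl

 conjʷ-◃ : ∀ p w → conjʷ (p ◃ w) ≡ p ⁻¹ ◃ conjʷ w
 conjʷ-◃ p 𝟎 = refl
 conjʷ-◃ p (just q) = cong just (⁻¹-distrib p q)

 conjʷ-involutive : ∀ w → conjʷ (conjʷ w) ≡ w
 conjʷ-involutive 𝟎 = refl
 conjʷ-involutive (just q) = cong just (⁻¹-involutive q)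

 ◃-cancel : ∀ p {w} → p ◃ w ≡ 𝟎 → w ≡ 𝟎
 ◃-cancel p {𝟎} _ = refl

 conjʷ-𝟎 : ∀ {w} → conjʷ w ≡ 𝟎 → w ≡ 𝟎
 conjʷ-𝟎 {𝟎} _ = refl

 twist⁴ : Twist → C₄ → C₄
 twist⁴ (_ , identity) p = p
 twist⁴ (_ , conjugation) p = p ⁻¹

 twistʷ-◃ : ∀ τ p w → twistʷ τ (p ◃ w) ≡ twist⁴ τ p ◃ twistʷ τ w
 twistʷ-◃ (Sign.+ , identity) p w = refl
 twistʷ-◃ (Sign.+ , conjugation) p w = conjʷ-◃ p w
 twistʷ-◃ (Sign.- , identity) p w = begin
   ζ² ◃ p ◃ w ≡⟨ ◃-assoc ζ² p w ⟨
   (ζ² ∙ p) ◃ w ≡⟨ cong (_◃ w) (∙-comm ζ² p) ⟩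
   (p ∙ ζ²) ◃ w ≡⟨ ◃-assoc p ζ² w ⟩
   p ◃ ζ² ◃ w ∎
   where open ≡-Reasoning
 twistʷ-◃ (Sign.- , conjugation) p w = begin
   ζ² ◃ conjʷ (p ◃ w) ≡⟨ cong (ζ² ◃_) (conjʷ-◃ p w) ⟩
   ζ² ◃ p ⁻¹ ◃ conjʷ w ≡⟨ twistʷ-◃ (Sign.- , identity) (p ⁻¹) (conjʷ w) ⟩
   p ⁻¹ ◃ ζ² ◃ conjʷ w ∎
   where open ≡-Reasoning

 twist⁴-involutive : ∀ τ p → twist⁴ τ (twist⁴ τ p) ≡ p
 twist⁴-involutive (_ , identity) p = refl
 twist⁴-involutive (_ , conjugation) p = ⁻¹-involutive p

 twist⁴-∙ : ∀ τ p q → twist⁴ τ (p ∙ q) ≡ twist⁴ τ p ∙ twist⁴ τ q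
 twist⁴-∙ (_ , identity) p q = refl
 twist⁴-∙ (_ , conjugation) p q = ⁻¹-distrib p q

 twist⁴-⁻¹ : ∀ τ p → twist⁴ τ (p ⁻¹) ≡ twist⁴ τ p ⁻¹
 twist⁴-⁻¹ (_ , identity) p = refl
 twist⁴-⁻¹ (_ , conjugation) p = refl

 twistʷ-involutive : ∀ τ w → twistʷ τ (twistʷ τ w) ≡ w
 twistʷ-involutive (Sign.+ , identity) w = refl
 twistʷ-involutive (Sign.+ , conjugation) w = conjʷ-involutive w
 twistʷ-involutive (Sign.- , identity) w = trans (sym (◃-assoc ζ² ζ² w)) (◃-identity w)
 twistʷ-involutive (Sign.- , conjugation) w = begin
   ζ² ◃ conjʷ (ζ² ◃ conjʷ w) ≡⟨ cong (ζ² ◃_) (conjʷ-◃ ζ² (conjʷ w)) ⟩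
   ζ² ◃ ζ² ◃ conjʷ (conjʷ w) ≡⟨ twistʷ-involutive (Sign.- , identity) _ ⟩
   conjʷ (conjʷ w) ≡⟨ conjʷ-involutive w ⟩
   w ∎
   where open ≡-Reasoning

 twistʷ-conjʷ : ∀ τ w → twistʷ τ (conjʷ w) ≡ conjʷ (twistʷ τ w)
 twistʷ-conjʷ (Sign.+ , identity) w = refl
 twistʷ-conjʷ (Sign.+ , conjugation) w = refl
 twistʷ-conjʷ (Sign.- , identity) w = sym (conjʷ-◃ ζ² w)
 twistʷ-conjʷ (Sign.- , conjugation) w = sym (conjʷ-◃ ζ² (conjʷ w))

 twistʷ-𝟎 : ∀ τ → twistʷ τ 𝟎 ≡ 𝟎
 twistʷ-𝟎 (Sign.+ , identity) = refl
 twistʷ-𝟎 (Sign.+ , conjugation) = refl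
 twistʷ-𝟎 (Sign.- , identity) = refl
 twistʷ-𝟎 (Sign.- , conjugation) = refl

 rotate-∙ : ∀ p q z → rotate (p ∙ q) z ≡ rotate p (rotate q z)
 rotate-∙ ζ⁰ q z = refl
 rotate-∙ ζ¹ ζ⁰ z = refl
 rotate-∙ ζ¹ ζ¹ z = refl
 rotate-∙ ζ¹ ζ² (a +i b) = cong (_+i ℤ.- a) (sym (ℤ.neg-involutive b))
 rotate-∙ ζ¹ ζ³ (a +i b) = cong (_+i b) (sym (ℤ.neg-involutive a))
 rotate-∙ ζ² ζ⁰ z = refl
 rotate-∙ ζ² ζ¹ (a +i b) = cong (_+i ℤ.- a) (sym (ℤ.neg-involutive b))
 rotate-∙ ζ² ζ² (a +i b) = cong₂ _+i_ (sym (ℤ.neg-involutive a)) (sym (ℤ.neg-involutive b))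
 rotate-∙ ζ² ζ³ (a +i b) = cong (ℤ.- b +i_) (sym (ℤ.neg-involutive a))
 rotate-∙ ζ³ ζ⁰ z = refl
 rotate-∙ ζ³ ζ¹ (a +i b) = cong (a +i_) (sym (ℤ.neg-involutive b))
 rotate-∙ ζ³ ζ² (a +i b) = cong (ℤ.- b +i_) (sym (ℤ.neg-involutive a))
 rotate-∙ ζ³ ζ³ (a +i b) = refl

 ⟦⟧-◃ : ∀ p w → ⟦ p ◃ w ⟧ʷ ≡ rotate p ⟦ w ⟧ʷ
 ⟦⟧-◃ ζ⁰ 𝟎 = refl
 ⟦⟧-◃ ζ¹ 𝟎 = refl
 ⟦⟧-◃ ζ² 𝟎 = refl
 ⟦⟧-◃ ζ³ 𝟎 = refl
 ⟦⟧-◃ p (just q) = toWitness {a? = all₄? λ p → all₄? λ q → _≟ᵍ_ ⟦ p ∙ q ⟧₄ (rotate p ⟦ q ⟧₄)} tt p q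

 ⟦⟧-twist : ∀ τ w → ⟦ twistʷ τ w ⟧ʷ ≡ twist τ ⟦ w ⟧ʷ
 ⟦⟧-twist (Sign.+ , identity) w = refl
 ⟦⟧-twist (Sign.+ , conjugation) 𝟎 = refl
 ⟦⟧-twist (Sign.+ , conjugation) (just ζ⁰) = refl
 ⟦⟧-twist (Sign.+ , conjugation) (just ζ¹) = refl
 ⟦⟧-twist (Sign.+ , conjugation) (just ζ²) = refl
 ⟦⟧-twist (Sign.+ , conjugation) (just ζ³) = refl
 ⟦⟧-twist (Sign.- , identity) 𝟎 = refl
 ⟦⟧-twist (Sign.- , identity) (just ζ⁰) = refl
 ⟦⟧-twist (Sign.- , identity) (just ζ¹) = refl
 ⟦⟧-twist (Sign.- , identity) (just ζ²) = refl
 ⟦⟧-twist (Sign.- , identity) (just ζ³) = refl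
 ⟦⟧-twist (Sign.- , conjugation) 𝟎 = refl
 ⟦⟧-twist (Sign.- , conjugation) (just ζ⁰) = refl
 ⟦⟧-twist (Sign.- , conjugation) (just ζ¹) = refl
 ⟦⟧-twist (Sign.- , conjugation) (just ζ²) = refl
 ⟦⟧-twist (Sign.- , conjugation) (just ζ³) = refl

 conj-rotate : ∀ p z → Gaussian.conj (rotate p z) ≡ rotate (p ⁻¹) (Gaussian.conj z)
 conj-rotate ζ⁰ (a +i b) = refl
 conj-rotate ζ¹ (a +i b) = refl
 conj-rotate ζ² (a +i b) = refl
 conj-rotate ζ³ (a +i b) = cong₂ _+i_ (sym (ℤ.neg-involutive b)) (ℤ.neg-involutive a)

 neg-rotate : ∀ p z → Gaussian.- (rotate p z) ≡ rotate p (Gaussian.- z)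
 neg-rotate ζ⁰ (a +i b) = refl
 neg-rotate ζ¹ (a +i b) = refl
 neg-rotate ζ² (a +i b) = refl
 neg-rotate ζ³ (a +i b) = refl

 twist-rotate : ∀ τ p z → twist τ (rotate p z) ≡ rotate (twist⁴ τ p) (twist τ z)
 twist-rotate (Sign.+ , identity) p z = refl
 twist-rotate (Sign.+ , conjugation) p z = conj-rotate p z
 twist-rotate (Sign.- , identity) p z = neg-rotate p z
 twist-rotate (Sign.- , conjugation) p z =
   trans (cong Gaussian.-_ (conj-rotate p z)) (neg-rotate (p ⁻¹) _)

 conj-involutive : ∀ z → Gaussian.conj (Gaussian.conj z) ≡ z
 conj-involutive (a +i b) = cong (a +i_) (ℤ.neg-involutive b)

 twist-conj : ∀ τ z → twist τ (Gaussian.conj z) ≡ Gaussian.conj (twist τ z)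
 twist-conj (Sign.+ , identity) z = refl
 twist-conj (Sign.+ , conjugation) z = refl
 twist-conj (Sign.- , identity) z = refl
 twist-conj (Sign.- , conjugation) z = refl

 ⟦⟧-conj : ∀ w → ⟦ conjʷ w ⟧ʷ ≡ Gaussian.conj ⟦ w ⟧ʷ
 ⟦⟧-conj = ⟦⟧-twist (Sign.+ , conjugation)

 ⟦⟧-injective : ∀ {v w} → ⟦ v ⟧ʷ ≡ ⟦ w ⟧ʷ → v ≡ w
 ⟦⟧-injective {𝟎} {𝟎} _ = refl
 ⟦⟧-injective {𝟎} {just ζ⁰} ()
 ⟦⟧-injective {𝟎} {just ζ¹} ()
 ⟦⟧-injective {𝟎} {just ζ²} ()
 ⟦⟧-injective {𝟎} {just ζ³} ()
 ⟦⟧-injective {just ζ⁰} {𝟎} ()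
 ⟦⟧-injective {just ζ¹} {𝟎} ()
 ⟦⟧-injective {just ζ²} {𝟎} ()
 ⟦⟧-injective {just ζ³} {𝟎} ()
 ⟦⟧-injective {just p} {just q} eq = cong just (injective p q eq)
   where
   injective : ∀ p q → ⟦ p ⟧₄ ≡ ⟦ q ⟧₄ → p ≡ q
   injective ζ⁰ ζ⁰ _ = refl
   injective ζ¹ ζ¹ _ = refl
   injective ζ² ζ² _ = refl
   injective ζ³ ζ³ _ = refl

 -- A vertex together with a unit by which its row is multiplied.
 module Lift {n : ℕ} (A : Fin n → Fin n → W) where

   ⟪_∣_⟫ : Fin n × C₄ → Fin n × C₄ → W
   ⟪ v , p ∣ w , q ⟫ = (p ∙ q ⁻¹) ◃ A v w

   col : ∀ {s} → Fin n × C₄ → Vec (Fin n × C₄) s → Vec W s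
   col x = Vec.map ⟪ x ∣_⟫

   conf : ∀ {s} → Vec (Fin n × C₄) s → Conf s
   conf [] = []
   conf (x ∷ g) = col x g ∷ conf g

   Fresh : ∀ {s} → Fin n → Vec (Fin n × C₄) s → Set
   Fresh v = All (λ y → v ≢ proj₁ y)

   Distinct : ∀ {s} → Vec (Fin n × C₄) s → Set
   Distinct [] = ⊤
   Distinct (x ∷ g) = Fresh (proj₁ x) g × Distinct g

 record GainGraph (n : ℕ) : Set where
   field
     A : Fin n → Fin n → W
   open Lift A public
   field
     herm : ∀ u v → A v u ≡ conjʷ (A u v)
     diag : ∀ u → A u u ≡ 𝟎
     connected : ∀ u v → Star (λ u v → A u v ≢ 𝟎) u v
     bound : ∀ {s} (g : Vec (Fin n × C₄) s) → Distinct g → ∀ y → refutes (conf g) y ≡ false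

   herm⟪⟫ : ∀ x y → ⟪ y ∣ x ⟫ ≡ conjʷ ⟪ x ∣ y ⟫
   herm⟪⟫ (u , p) (v , q) = begin
     (q ∙ p ⁻¹) ◃ A v u ≡⟨ cong₂ _◃_ (∙-comm q (p ⁻¹)) (herm u v) ⟩
     (p ⁻¹ ∙ q) ◃ conjʷ (A u v) ≡⟨ cong (λ r → (p ⁻¹ ∙ r) ◃ conjʷ (A u v)) (⁻¹-involutive q) ⟨
     (p ⁻¹ ∙ q ⁻¹ ⁻¹) ◃ conjʷ (A u v) ≡⟨ cong (_◃ conjʷ (A u v)) (⁻¹-distrib p (q ⁻¹)) ⟨
     (p ∙ q ⁻¹) ⁻¹ ◃ conjʷ (A u v) ≡⟨ conjʷ-◃ (p ∙ q ⁻¹) (A u v) ⟨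
     conjʷ ((p ∙ q ⁻¹) ◃ A u v) ∎
     where open ≡-Reasoning

   diag⟪⟫ : ∀ v p q → ⟪ (v , p) ∣ (v , q) ⟫ ≡ 𝟎
   diag⟪⟫ v p q = cong ((p ∙ q ⁻¹) ◃_) (diag v)

   entry-conf : ∀ {s} (g : Vec (Fin n × C₄) s) i j →
     entry (conf g) i j ≡ ⟪ Vec.lookup g i ∣ Vec.lookup g j ⟫
   entry-conf (x ∷ g) zero zero = sym (diag⟪⟫ (proj₁ x) (proj₂ x) (proj₂ x))
   entry-conf (x ∷ g) zero (suc j) = Vec.lookup-map j ⟪ x ∣_⟫ g
   entry-conf (x ∷ g) (suc i) zero =
     trans (cong conjʷ (Vec.lookup-map i ⟪ x ∣_⟫ g)) (sym (herm⟪⟫ x (Vec.lookup g i)))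
   entry-conf (x ∷ g) (suc i) (suc j) = entry-conf g i j

   rescale : ∀ q v p y → ⟪ (v , q ∙ p) ∣ y ⟫ ≡ q ◃ ⟪ (v , p) ∣ y ⟫
   rescale q v p (w , r) = trans (cong (_◃ A v w) (∙-assoc q p (r ⁻¹))) (◃-assoc q (p ∙ r ⁻¹) (A v w))

   unlift : ∀ u p v q → A u v ≡ (p ⁻¹ ∙ q) ◃ ⟪ (u , p) ∣ (v , q) ⟫
   unlift u p v q = sym (begin
     (p ⁻¹ ∙ q) ◃ (p ∙ q ⁻¹) ◃ A u v ≡⟨ ◃-assoc (p ⁻¹ ∙ q) (p ∙ q ⁻¹) (A u v) ⟨
     ((p ⁻¹ ∙ q) ∙ (p ∙ q ⁻¹)) ◃ A u v ≡⟨ cong (_◃ A u v) (cancel p q) ⟩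
     ζ⁰ ◃ A u v ≡⟨ ◃-identity (A u v) ⟩
     A u v ∎)
     where
     open ≡-Reasoning
     cancel : ∀ p q → (p ⁻¹ ∙ q) ∙ (p ∙ q ⁻¹) ≡ ζ⁰
     cancel = toWitness {a? = all₄? λ p → all₄? λ q → ((p ⁻¹ ∙ q) ∙ (p ∙ q ⁻¹)) ≟₄ ζ⁰} tt

 record Embeds {n} (G : GainGraph n) {N} (M : Matrix N) : Set where
   open GainGraph G using (A)
   field
     f : Fin n → Fin N
     unitᶠ : Fin n → C₄
     τ : Twist
     injective : ∀ {u v} → u ≢ v → f u ≢ f v
     matches : ∀ {u v} → u ≢ v → ⟦ A u v ⟧ʷ ≡ twist τ (between (unitᶠ u) (M (f u) (f v)) (unitᶠ v))

 toW : ℤ[i] → W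
 toW z with z ≟ᵍ ⟦ ζ⁰ ⟧₄ | z ≟ᵍ ⟦ ζ¹ ⟧₄ | z ≟ᵍ ⟦ ζ² ⟧₄ | z ≟ᵍ ⟦ ζ³ ⟧₄
 ... | yes _ | _ | _ | _ = just ζ⁰
 ... | no _ | yes _ | _ | _ = just ζ¹
 ... | no _ | no _ | yes _ | _ = just ζ²
 ... | no _ | no _ | no _ | yes _ = just ζ³
 ... | no _ | no _ | no _ | no _ = nothing

 toW-⟦⟧ : ∀ w → toW ⟦ w ⟧ʷ ≡ w
 toW-⟦⟧ nothing = refl
 toW-⟦⟧ (just ζ⁰) = refl
 toW-⟦⟧ (just ζ¹) = refl
 toW-⟦⟧ (just ζ²) = refl
 toW-⟦⟧ (just ζ³) = refl

 unit-weight : ∀ z → Gaussian.IsUnit z → ∃[ q ] z ≡ ⟦ q ⟧₄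
 unit-weight (a +i b) (c +i d , eq) = classify a b (ℕ.m*n≡1⇒m≡1 (size a b) (size c d) (trans (sym multiplicative) (cong (λ z → size (re z) (im z)) eq)))
   where
   size : ℤ → ℤ → ℕ
   size a b = ℤ.∣ a ∣ ℕ.* ℤ.∣ a ∣ ℕ.+ ℤ.∣ b ∣ ℕ.* ℤ.∣ b ∣
   square-abs : ∀ a → ℤ.+ (ℤ.∣ a ∣ ℕ.* ℤ.∣ a ∣) ≡ a ℤ.* a
   square-abs (ℤ.+ m) = ℤ.pos-* m m
   square-abs ℤ.-[1+ m ] = refl
   sizes : ∀ a b → ℤ.+ size a b ≡ a ℤ.* a ℤ.+ b ℤ.* b
   sizes a b = cong₂ ℤ._+_ (square-abs a) (square-abs b)
   multiplicative : size (a ℤ.* c ℤ.+ ℤ.- (b ℤ.* d)) (a ℤ.* d ℤ.+ b ℤ.* c) ≡ size a b ℕ.* size c d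
   multiplicative = ℤ.+-injective (trans (sizes (a ℤ.* c ℤ.+ ℤ.- (b ℤ.* d)) (a ℤ.* d ℤ.+ b ℤ.* c)) (trans (brahmagupta a b c d) (sym (trans (ℤ.pos-* (size a b) (size c d)) (cong₂ ℤ._*_ (sizes a b) (sizes c d))))))
     where
     brahmagupta : ∀ a b c d → (a ℤ.* c ℤ.+ ℤ.- (b ℤ.* d)) ℤ.* (a ℤ.* c ℤ.+ ℤ.- (b ℤ.* d)) ℤ.+ (a ℤ.* d ℤ.+ b ℤ.* c) ℤ.* (a ℤ.* d ℤ.+ b ℤ.* c) ≡
       (a ℤ.* a ℤ.+ b ℤ.* b) ℤ.* (c ℤ.* c ℤ.+ d ℤ.* d)
     brahmagupta = solve 4 (λ a b c d → (a :* c :+ :- (b :* d)) :* (a :* c :+ :- (b :* d)) :+ (a :* d :+ b :* c) :* (a :* d :+ b :* c) :=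
       (a :* a :+ b :* b) :* (c :* c :+ d :* d)) refl
       where open ℤ-Solver
   classify : ∀ a b → size a b ≡ 1 → ∃[ q ] (a +i b) ≡ ⟦ q ⟧₄
   classify (ℤ.+ 0) (ℤ.+ 1) _ = ζ¹ , refl
   classify (ℤ.+ 0) ℤ.-[1+ 0 ] _ = ζ³ , refl
   classify (ℤ.+ 1) (ℤ.+ 0) _ = ζ⁰ , refl
   classify ℤ.-[1+ 0 ] (ℤ.+ 0) _ = ζ² , refl
   classify (ℤ.+ 0) (ℤ.+ 0) ()
   classify (ℤ.+ 0) (ℤ.+ suc (suc m)) ()
   classify (ℤ.+ 0) ℤ.-[1+ suc m ] ()
   classify (ℤ.+ 1) (ℤ.+ suc m) ()
   classify (ℤ.+ 1) ℤ.-[1+ m ] ()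
   classify (ℤ.+ suc (suc k)) b ()
   classify ℤ.-[1+ 0 ] (ℤ.+ suc m) ()
   classify ℤ.-[1+ 0 ] ℤ.-[1+ m ] ()
   classify ℤ.-[1+ suc k ] b ()

 does-true : ∀ {P : Set} (P? : Dec P) → does P? ≡ true → P
 does-true (yes p) _ = p

 if-true : ∀ {a b} → (if a then b else false) ≡ true → a ≡ true × b ≡ true
 if-true {true} eq = refl , eq

 allFinᵇ-true : ∀ {s} (p : Fin s → Bool) → allFinᵇ p ≡ true → ∀ i → p i ≡ true
 allFinᵇ-true p eq zero = proj₁ (if-true eq)
 allFinᵇ-true p eq (suc i) = allFinᵇ-true (λ i → p (suc i)) (proj₂ (if-true eq)) i

 re-rotate : ∀ p z w → re⟨ z , rotate p w ⟩ ≡ re⟨ rotate (p ⁻¹) z , w ⟩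
 re-rotate ζ⁰ z w = refl
 re-rotate ζ¹ (a +i b) (c +i d) = solve 4 (λ a b c d → a :* (:- d) :+ b :* c := b :* c :+ (:- a) :* d) refl a b c d
   where open ℤ-Solver
 re-rotate ζ² (a +i b) (c +i d) = solve 4 (λ a b c d → a :* (:- c) :+ b :* (:- d) := (:- a) :* c :+ (:- b) :* d) refl a b c d
   where open ℤ-Solver
 re-rotate ζ³ (a +i b) (c +i d) = solve 4 (λ a b c d → a :* d :+ b :* (:- c) := (:- b) :* c :+ a :* d) refl a b c d
   where open ℤ-Solver

module CyclotomicGains where

 open Configuration using (C₄; ζ⁰; ζ¹; ζ²; ζ³; W; _∙_; _⁻¹; _◃_; ⟦_⟧₄; ⟦_⟧ʷ; rotate; re⟨_,_⟩; Conf; half-form; norm²) renaming (dot to dotʷ)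
 open Gains
 open Certificate using (_≟ᵍ_)
 open Forms
 open Kernels
 open FormBound
 open NegatedMatrix
 open import Data.Bool.Base using (true; false) renaming (T to True)
 open import Data.Fin.Base using (_↑ˡ_; _↑ʳ_; splitAt)
 open import Algebra.Properties.CommutativeSemigroup ℤ.+-commutativeSemigroup using (interchange)
 open import Data.Rational.Base
 open import Data.Rational.Properties
 open import Data.Rational.Solver using (module +-*-Solver)
 open +-*-Solver using (solve; _:+_; _:*_; _:-_; :-_; con; _:=_)
 import Data.Rational.Unnormalised.Base as ℚᵘ
 import Data.Rational.Unnormalised.Properties as ℚᵘP
 open import Data.Vec.Relation.Unary.All using ([]; _∷_)
 open import Relation.Binary.Construct.Closure.ReflexiveTransitive using (Star)
 import Relation.Binary.Construct.Closure.ReflexiveTransitive as Star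

 sum-neg : ∀ {n} (f : Fin n → ℚ) → sum (λ i → - f i) ≡ - sum f
 sum-neg {zero} f = refl
 sum-neg {suc n} f = trans (cong (- f zero +_) (sum-neg (f ∘ suc))) (sym (neg-distrib-+ (f zero) (sum (f ∘ suc))))

 form-neg : ∀ {n} (A : Matrix n) x → form (realify (negᴹ A)) x ≡ - form (realify A) x
 form-neg {n} A x = trans (sum-cong {f = λ i → x i * dot (realify (negᴹ A) i) x} {λ i → - (x i * dot (realify A i) x)} λ i →
     trans (cong (x i *_) (trans (sum-cong {f = λ j → realify (negᴹ A) i j * x j} {λ j → - (realify A i j * x j)} λ j →
         trans (cong (_* x j) (cell-neg (splitAt n i) (splitAt n j))) (sym (neg-distribˡ-* (realify A i j) (x j))))
       (sum-neg (λ j → realify A i j * x j)))) (sym (neg-distribʳ-* (x i) (dot (realify A i) x))))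
   (sum-neg (λ i → x i * dot (realify A i) x))
   where
   cell-neg : ∀ s t → cell (negᴹ A) s t ≡ - cell A s t
   cell-neg (inj₁ u) (inj₁ v) = fromℤ-neg (re (A u v))
   cell-neg (inj₁ u) (inj₂ v) = cong -_ (fromℤ-neg (im (A u v)))
   cell-neg (inj₂ u) (inj₁ v) = fromℤ-neg (im (A u v))
   cell-neg (inj₂ u) (inj₂ v) = fromℤ-neg (re (A u v))

 -- Adding multiples of two basis vectors

 module _ {n} (i j : Fin n) (c e : ℚ) where

   spike : Fin n → ℚ
   spike k = c * delta i k + e * delta j k

   dot-spike : ∀ f → sum (λ k → f k * spike k) ≡ c * f i + e * f j
   dot-spike f = trans (sum-cong {f = λ k → f k * spike k} {λ k → c * (f k * delta i k) + e * (f k * delta j k)} λ k → expand (f k) (delta i k) (delta j k) c e)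
     (trans (sum-linear c e (λ k → f k * delta i k) (λ k → f k * delta j k)) (cong₂ (λ a b → c * a + e * b) (sum-delta i f) (sum-delta j f)))
     where
     expand : ∀ f d d′ c e → f * (c * d + e * d′) ≡ c * (f * d) + e * (f * d′)
     expand = solve 5 (λ f d d′ c e → f :* (c :* d :+ e :* d′) := c :* (f :* d) :+ e :* (f :* d′)) refl

   dot-+-spike : ∀ f x → dot f (λ k → x k + spike k) ≡ dot f x + (c * f i + e * f j)
   dot-+-spike f x = trans (sum-cong {f = λ k → f k * (x k + spike k)} {λ k → 1ℚ * (f k * x k) + 1ℚ * (f k * spike k)} λ k → expand (f k) (x k) (spike k))
     (trans (sum-linear 1ℚ 1ℚ (λ k → f k * x k) (λ k → f k * spike k))
       (cong₂ _+_ (*-identityˡ (dot f x)) (trans (*-identityˡ (sum (λ k → f k * spike k))) (dot-spike f))))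
     where
     expand : ∀ f x s → f * (x + s) ≡ 1ℚ * (f * x) + 1ℚ * (f * s)
     expand = solve 3 (λ f x s → f :* (x :+ s) := con 1ℚ :* (f :* x) :+ con 1ℚ :* (f :* s)) refl

   form-+-spike : ∀ {S : Mat n} → Symmetric S → S i i ≡ 0ℚ → S i j ≡ 0ℚ → S j j ≡ 0ℚ → ∀ x →
     form S (λ k → x k + spike k) ≡ form S x + ((c * dot (S i) x + e * dot (S j) x) + (c * dot (S i) x + e * dot (S j) x))
   form-+-spike {S} sy ii ij jj x = trans
     (sum-cong {f = λ k → (x k + spike k) * dot (S k) (λ k → x k + spike k)}
       {λ k → 1ℚ * (x k * dot (S k) x + (c * (x k * S k i) + e * (x k * S k j))) + 1ℚ * (g k * spike k)}
       λ k → trans (cong ((x k + spike k) *_) (dot-+-spike (S k) x)) (expand (x k) (spike k) (dot (S k) x) c e (S k i) (S k j)))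
     (trans (sum-linear 1ℚ 1ℚ (λ k → x k * dot (S k) x + (c * (x k * S k i) + e * (x k * S k j))) (λ k → g k * spike k))
     (trans (cong₂ (λ a b → 1ℚ * a + 1ℚ * b) first-sum (trans (dot-spike g) second-sum))
       (finish (form S x) (c * dot (S i) x + e * dot (S j) x))))
     where
     g : Fin n → ℚ
     g k = dot (S k) x + (c * S k i + e * S k j)
     expand : ∀ x s d c e a b → (x + s) * (d + (c * a + e * b)) ≡ 1ℚ * (x * d + (c * (x * a) + e * (x * b))) + 1ℚ * ((d + (c * a + e * b)) * s)
     expand x s d c e a b = trans (split x s d (c * a + e * b)) (cong (λ t → 1ℚ * (x * d + t) + 1ℚ * ((d + (c * a + e * b)) * s)) (inner x c e a b))
       where
       split : ∀ x s d m → (x + s) * (d + m) ≡ 1ℚ * (x * d + x * m) + 1ℚ * ((d + m) * s)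
       split = solve 4 (λ x s d m → (x :+ s) :* (d :+ m) := con 1ℚ :* (x :* d :+ x :* m) :+ con 1ℚ :* ((d :+ m) :* s)) refl
       inner : ∀ x c e a b → x * (c * a + e * b) ≡ c * (x * a) + e * (x * b)
       inner = solve 5 (λ x c e a b → x :* (c :* a :+ e :* b) := c :* (x :* a) :+ e :* (x :* b)) refl
     column : ∀ l → sum (λ k → x k * S k l) ≡ dot (S l) x
     column l = sum-cong {f = λ k → x k * S k l} {λ k → S l k * x k} λ k → trans (*-comm (x k) (S k l)) (cong (_* x k) (sy k l))
     first-sum : sum (λ k → x k * dot (S k) x + (c * (x k * S k i) + e * (x k * S k j))) ≡ form S x + (c * dot (S i) x + e * dot (S j) x)
     first-sum = trans (sum-cong {f = λ k → x k * dot (S k) x + (c * (x k * S k i) + e * (x k * S k j))}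
         {λ k → 1ℚ * (x k * dot (S k) x) + 1ℚ * (c * (x k * S k i) + e * (x k * S k j))} λ k → units (x k * dot (S k) x) (c * (x k * S k i) + e * (x k * S k j)))
       (trans (sum-linear 1ℚ 1ℚ (λ k → x k * dot (S k) x) (λ k → c * (x k * S k i) + e * (x k * S k j)))
         (cong₂ _+_ (*-identityˡ (form S x)) (trans (*-identityˡ (sum (λ k → c * (x k * S k i) + e * (x k * S k j))))
           (trans (sum-linear c e (λ k → x k * S k i) (λ k → x k * S k j)) (cong₂ (λ a b → c * a + e * b) (column i) (column j))))))
       where
       units : ∀ a b → a + b ≡ 1ℚ * a + 1ℚ * b
       units = solve 2 (λ a b → a :+ b := con 1ℚ :* a :+ con 1ℚ :* b) refl
     second-sum : c * g i + e * g j ≡ c * dot (S i) x + e * dot (S j) x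
     second-sum = cong₂ (λ a b → c * a + e * b)
       (trans (cong₂ (λ a b → dot (S i) x + (c * a + e * b)) ii ij) (vanish (dot (S i) x) c e))
       (trans (cong₂ (λ a b → dot (S j) x + (c * a + e * b)) (trans (sy j i) ij) jj) (vanish (dot (S j) x) c e))
       where
       vanish : ∀ d c e → d + (c * 0ℚ + e * 0ℚ) ≡ d
       vanish = solve 3 (λ d c e → d :+ (c :* con 0ℚ :+ e :* con 0ℚ) := d) refl
     finish : ∀ f m → 1ℚ * (f + m) + 1ℚ * m ≡ f + (m + m)
     finish = solve 2 (λ f m → con 1ℚ :* (f :+ m) :+ con 1ℚ :* m := f :+ (m :+ m)) refl

   square-+-spike : delta i i ≡ 1ℚ → delta j j ≡ 1ℚ → delta i j ≡ 0ℚ → delta j i ≡ 0ℚ → ∀ x → x i ≡ 0ℚ → x j ≡ 0ℚ →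
     square (λ k → x k + spike k) ≡ square x + (c * c + e * e)
   square-+-spike δii δjj δij δji x xi xj = trans
     (sum-cong {f = λ k → (x k + spike k) * (x k + spike k)} {λ k → 1ℚ * (x k * x k) + 1ℚ * (g k * spike k)} λ k → expand (x k) (spike k))
     (trans (sum-linear 1ℚ 1ℚ (λ k → x k * x k) (λ k → g k * spike k))
       (cong₂ _+_ (*-identityˡ (square x)) (trans (*-identityˡ (sum (λ k → g k * spike k))) (trans (dot-spike g) values))))
     where
     g : Fin n → ℚ
     g k = x k + x k + spike k
     expand : ∀ x s → (x + s) * (x + s) ≡ 1ℚ * (x * x) + 1ℚ * ((x + x + s) * s)
     expand = solve 2 (λ x s → (x :+ s) :* (x :+ s) := con 1ℚ :* (x :* x) :+ con 1ℚ :* ((x :+ x :+ s) :* s)) refl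
     values : c * g i + e * g j ≡ c * c + e * e
     values = cong₂ (λ a b → c * a + e * b)
       (trans (cong₂ (λ a b → a + a + b) xi (cong₂ (λ a b → c * a + e * b) δii δji)) (simple c e))
       (trans (cong₂ (λ a b → a + a + b) xj (cong₂ (λ a b → c * a + e * b) δij δjj)) (simple′ c e))
       where
       simple : ∀ c e → 0ℚ + 0ℚ + (c * 1ℚ + e * 0ℚ) ≡ c
       simple = solve 2 (λ c e → con 0ℚ :+ con 0ℚ :+ (c :* con 1ℚ :+ e :* con 0ℚ) := c) refl
       simple′ : ∀ c e → 0ℚ + 0ℚ + (c * 0ℚ + e * 1ℚ) ≡ e
       simple′ = solve 2 (λ c e → con 0ℚ :+ con 0ℚ :+ (c :* con 0ℚ :+ e :* con 1ℚ) := e) refl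

 delta-refl : ∀ {n} (i : Fin n) → delta i i ≡ 1ℚ
 delta-refl zero = refl
 delta-refl (suc i) = delta-refl i

 delta-≢ : ∀ {n} {i j : Fin n} → i ≢ j → delta i j ≡ 0ℚ
 delta-≢ {i = zero} {zero} ne = contradiction refl ne
 delta-≢ {i = zero} {suc j} ne = refl
 delta-≢ {i = suc i} {zero} ne = refl
 delta-≢ {i = suc i} {suc j} ne = delta-≢ λ eq → ne (cong suc eq)

 -- The rotations of the coordinates

 dotʷ-∷ : ∀ {s} w (c : Vec W s) y ys → dotʷ (w ∷ c) (y ∷ ys) ≡ Configuration._·ʷ_ w y Gaussian.+ dotʷ c ys
 dotʷ-∷ (just q) c y ys = refl
 dotʷ-∷ nothing c y ys = sym (lemma (dotʷ c ys))
   where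
   lemma : ∀ z → Gaussian.0# Gaussian.+ z ≡ z
   lemma (a +i b) = cong₂ _+i_ (ℤ.+-identityˡ a) (ℤ.+-identityˡ b)

 rotate-+ : ∀ p y z → rotate p (y Gaussian.+ z) ≡ rotate p y Gaussian.+ rotate p z
 rotate-+ ζ⁰ y z = refl
 rotate-+ ζ¹ (a +i b) (c +i d) = cong (_+i a ℤ.+ c) (ℤ.neg-distrib-+ b d)
 rotate-+ ζ² (a +i b) (c +i d) = cong₂ _+i_ (ℤ.neg-distrib-+ a c) (ℤ.neg-distrib-+ b d)
 rotate-+ ζ³ (a +i b) (c +i d) = cong (b ℤ.+ d +i_) (ℤ.neg-distrib-+ a c)

 dotʷ-◃ : ∀ {s} p (c : Vec W s) y → dotʷ (Vec.map (p ◃_) c) y ≡ rotate p (dotʷ c y)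
 dotʷ-◃ ζ⁰ [] [] = refl
 dotʷ-◃ ζ¹ [] [] = refl
 dotʷ-◃ ζ² [] [] = refl
 dotʷ-◃ ζ³ [] [] = refl
 dotʷ-◃ p (nothing ∷ c) (y ∷ ys) = dotʷ-◃ p c ys
 dotʷ-◃ p (just q ∷ c) (y ∷ ys) = trans (cong₂ Gaussian._+_ (rotate-∙ p q y) (dotʷ-◃ p c ys)) (sym (rotate-+ p (rotate q y) (dotʷ c ys)))

 scaled-re : ∀ w z → fromℤ (re (Configuration._·ʷ_ w z)) ≡ fromℤ (re z) * fromℤ (re ⟦ w ⟧ʷ) + fromℤ (im z) * - fromℤ (im ⟦ w ⟧ʷ)
 scaled-re nothing (a +i b) = solve 2 (λ a b → con 0ℚ := a :* con 0ℚ :+ b :* con 0ℚ) refl (fromℤ a) (fromℤ b)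
 scaled-re (just ζ⁰) (a +i b) = solve 2 (λ a b → a := a :* con 1ℚ :+ b :* con 0ℚ) refl (fromℤ a) (fromℤ b)
 scaled-re (just ζ¹) (a +i b) = trans (fromℤ-neg b) (solve 2 (λ a b → :- b := a :* con 0ℚ :+ b :* con (- 1ℚ)) refl (fromℤ a) (fromℤ b))
 scaled-re (just ζ²) (a +i b) = trans (fromℤ-neg a) (solve 2 (λ a b → :- a := a :* con (- 1ℚ) :+ b :* con 0ℚ) refl (fromℤ a) (fromℤ b))
 scaled-re (just ζ³) (a +i b) = solve 2 (λ a b → b := a :* con 0ℚ :+ b :* con 1ℚ) refl (fromℤ a) (fromℤ b)

 scaled-im : ∀ w z → fromℤ (im (Configuration._·ʷ_ w z)) ≡ fromℤ (re z) * fromℤ (im ⟦ w ⟧ʷ) + fromℤ (im z) * fromℤ (re ⟦ w ⟧ʷ)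
 scaled-im nothing (a +i b) = solve 2 (λ a b → con 0ℚ := a :* con 0ℚ :+ b :* con 0ℚ) refl (fromℤ a) (fromℤ b)
 scaled-im (just ζ⁰) (a +i b) = solve 2 (λ a b → b := a :* con 0ℚ :+ b :* con 1ℚ) refl (fromℤ a) (fromℤ b)
 scaled-im (just ζ¹) (a +i b) = solve 2 (λ a b → a := a :* con 1ℚ :+ b :* con 0ℚ) refl (fromℤ a) (fromℤ b)
 scaled-im (just ζ²) (a +i b) = trans (fromℤ-neg b) (solve 2 (λ a b → :- b := a :* con 0ℚ :+ b :* con (- 1ℚ)) refl (fromℤ a) (fromℤ b))
 scaled-im (just ζ³) (a +i b) = trans (fromℤ-neg a) (solve 2 (λ a b → :- a := a :* con (- 1ℚ) :+ b :* con 0ℚ) refl (fromℤ a) (fromℤ b))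

 module Coordinates {n} (A : Matrix n) (hermitian : IsHermitian A) (B : Fin n → Fin n → W)
   (value : ∀ u v → ⟦ B u v ⟧ʷ ≡ A u v) (loopless : ∀ u → A u u ≡ Gaussian.0#) where

   open Lift B

   private
     S : Mat (n ℕ.+ n)
     S = realify A

   left right : Fin n → Fin (n ℕ.+ n)
   left v = v ↑ˡ n
   right v = n ↑ʳ v

   coordinates : ∀ {s} → Vec (Fin n × C₄) s → Vec ℤ[i] s → Fin (n ℕ.+ n) → ℚ
   coordinates [] [] = λ _ → 0ℚ
   coordinates ((v , p) ∷ g) (ξ ∷ ys) = λ k → coordinates g ys k +
     spike (left v) (right v) (fromℤ (re (rotate (p ⁻¹) ξ))) (fromℤ (im (rotate (p ⁻¹) ξ))) k

   left≢right : ∀ u v → left u ≢ right v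
   left≢right u v eq with () ← trans (sym (Fin.splitAt-↑ˡ n u n)) (trans (cong (splitAt n) eq) (Fin.splitAt-↑ʳ n n v))

   fresh-zero : ∀ {s v} (g : Vec (Fin n × C₄) s) ys → Fresh v g →
     coordinates g ys (left v) ≡ 0ℚ × coordinates g ys (right v) ≡ 0ℚ
   fresh-zero [] [] [] = refl , refl
   fresh-zero {v = v} ((w , p) ∷ g) (ξ ∷ ys) (v≢w ∷ fresh) =
     let a , b = fresh-zero g ys fresh in
       trans (cong₂ _+_ a (trans (cong₂ (λ d d′ → c * d + e * d′)
         (delta-≢ {i = left w} {left v} λ eq → v≢w (sym (Fin.↑ˡ-injective n w v eq)))
         (delta-≢ {i = right w} {left v} λ eq → left≢right v w (sym eq))) (vanish c e))) (+-identityˡ 0ℚ)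
     , trans (cong₂ _+_ b (trans (cong₂ (λ d d′ → c * d + e * d′)
         (delta-≢ {i = left w} {right v} (left≢right w v))
         (delta-≢ {i = right w} {right v} λ eq → v≢w (sym (Fin.↑ʳ-injective n w v eq)))) (vanish c e))) (+-identityˡ 0ℚ)
     where
     c = fromℤ (re (rotate (p ⁻¹) ξ))
     e = fromℤ (im (rotate (p ⁻¹) ξ))
     vanish : ∀ c e → c * 0ℚ + e * 0ℚ ≡ 0ℚ
     vanish = solve 2 (λ c e → c :* con 0ℚ :+ e :* con 0ℚ := con 0ℚ) refl

   cells : ∀ u v → S (left u) (left v) ≡ fromℤ (re (A u v)) × S (left u) (right v) ≡ - fromℤ (im (A u v))
     × S (right u) (left v) ≡ fromℤ (im (A u v)) × S (right u) (right v) ≡ fromℤ (re (A u v))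
   cells u v = cong₂ (cell A) (Fin.splitAt-↑ˡ n u n) (Fin.splitAt-↑ˡ n v n) , cong₂ (cell A) (Fin.splitAt-↑ˡ n u n) (Fin.splitAt-↑ʳ n n v)
     , cong₂ (cell A) (Fin.splitAt-↑ʳ n n u) (Fin.splitAt-↑ˡ n v n) , cong₂ (cell A) (Fin.splitAt-↑ʳ n n u) (Fin.splitAt-↑ʳ n n v)

   product : ∀ {s} → Fin n → Vec (Fin n × C₄) s → Vec ℤ[i] s → ℤ[i]
   product v g ys = dotʷ (col (v , ζ⁰) g) ys

   product-∷ : ∀ {s} v w p (g : Vec (Fin n × C₄) s) ξ ys →
     product v ((w , p) ∷ g) (ξ ∷ ys) ≡ Configuration._·ʷ_ (B v w) (rotate (p ⁻¹) ξ) Gaussian.+ product v g ys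
   product-∷ v w p g ξ ys = trans (dotʷ-∷ ((ζ⁰ ∙ p ⁻¹) ◃ B v w) (col (v , ζ⁰) g) ξ ys) (cong (Gaussian._+ product v g ys) (turn (B v w)))
     where
     turn : ∀ b → Configuration._·ʷ_ ((ζ⁰ ∙ p ⁻¹) ◃ b) ξ ≡ Configuration._·ʷ_ b (rotate (p ⁻¹) ξ)
     turn nothing = refl
     turn (just q) = trans (cong (λ r → rotate r ξ) (∙-comm (p ⁻¹) q)) (rotate-∙ q (p ⁻¹) ξ)

   dot-product : ∀ {s} v (g : Vec (Fin n × C₄) s) ys →
     dot (S (left v)) (coordinates g ys) ≡ fromℤ (re (product v g ys)) × dot (S (right v)) (coordinates g ys) ≡ fromℤ (im (product v g ys))
   dot-product v [] [] = sum-0 (λ k → S (left v) k * 0ℚ) (λ k → *-zeroʳ (S (left v) k)) , sum-0 (λ k → S (right v) k * 0ℚ) (λ k → *-zeroʳ (S (right v) k))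
   dot-product v ((w , p) ∷ g) (ξ ∷ ys) =
       trans (dot-+-spike (left w) (right w) c e (S (left v)) (coordinates g ys))
         (trans (cong₂ _+_ (proj₁ ih) (cong₂ (λ a b → c * a + e * b) (trans (proj₁ cs) (cong (fromℤ ∘ re) (sym (value v w)))) (trans (proj₁ (proj₂ cs)) (cong (λ z → - fromℤ (im z)) (sym (value v w))))))
           (trans (+-comm (fromℤ (re D)) (c * fromℤ (re ⟦ B v w ⟧ʷ) + e * - fromℤ (im ⟦ B v w ⟧ʷ)))
             (trans (cong (_+ fromℤ (re D)) (sym (scaled-re (B v w) ρ))) (trans (sym (fromℤ-+ (re (Configuration._·ʷ_ (B v w) ρ)) (re D))) (cong (fromℤ ∘ re) (sym (product-∷ v w p g ξ ys)))))))
     , trans (dot-+-spike (left w) (right w) c e (S (right v)) (coordinates g ys))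
         (trans (cong₂ _+_ (proj₂ ih) (cong₂ (λ a b → c * a + e * b) (trans (proj₁ (proj₂ (proj₂ cs))) (cong (fromℤ ∘ im) (sym (value v w)))) (trans (proj₂ (proj₂ (proj₂ cs))) (cong (fromℤ ∘ re) (sym (value v w))))))
           (trans (+-comm (fromℤ (im D)) (c * fromℤ (im ⟦ B v w ⟧ʷ) + e * fromℤ (re ⟦ B v w ⟧ʷ)))
             (trans (cong (_+ fromℤ (im D)) (sym (scaled-im (B v w) ρ))) (trans (sym (fromℤ-+ (im (Configuration._·ʷ_ (B v w) ρ)) (im D))) (cong (fromℤ ∘ im) (sym (product-∷ v w p g ξ ys)))))))
     where
     ρ = rotate (p ⁻¹) ξ
     c = fromℤ (re ρ)
     e = fromℤ (im ρ)
     D = product v g ys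
     ih = dot-product v g ys
     cs = cells v w

   form-coordinates : ∀ {s} (g : Vec (Fin n × C₄) s) ys → form S (coordinates g ys) ≡ fromℤ (half-form (conf g) ys ℤ.+ half-form (conf g) ys)
   form-coordinates [] [] = sum-0 (λ k → 0ℚ * dot (S k) (λ _ → 0ℚ)) (λ k → *-zeroˡ (dot (S k) (λ _ → 0ℚ)))
   form-coordinates ((v , p) ∷ g) (ξ ∷ ys) = trans
     (form-+-spike (left v) (right v) c e {S} (realify-symmetric A hermitian)
       (trans (proj₁ cs) (cong (fromℤ ∘ re) (loopless v))) (trans (proj₁ (proj₂ cs)) (cong (λ z → - fromℤ (im z)) (loopless v)))
       (trans (proj₂ (proj₂ (proj₂ cs))) (cong (fromℤ ∘ re) (loopless v))) (coordinates g ys))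
     (trans (cong₂ (λ f m → f + (m + m)) (form-coordinates g ys) middle)
       (trans (cong (fromℤ (H ℤ.+ H) +_) (sym (fromℤ-+ R R))) (trans (sym (fromℤ-+ (H ℤ.+ H) (R ℤ.+ R))) (cong fromℤ (interchange H H R R)))))
     where
     ρ = rotate (p ⁻¹) ξ
     c = fromℤ (re ρ)
     e = fromℤ (im ρ)
     cs = cells v v
     H = half-form (conf g) ys
     R = re⟨ ξ , dotʷ (col (v , p) g) ys ⟩
     D = product v g ys
     col-scaled : col (v , p) g ≡ Vec.map (p ◃_) (col (v , ζ⁰) g)
     col-scaled = trans (Vec.map-cong (λ { (w , r) → ◃-assoc p (r ⁻¹) (B v w) }) g) (Vec.map-∘ (p ◃_) ⟪ (v , ζ⁰) ∣_⟫ g)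
     middle : c * dot (S (left v)) (coordinates g ys) + e * dot (S (right v)) (coordinates g ys) ≡ fromℤ R
     middle = trans (cong₂ (λ a b → c * a + e * b) (proj₁ (dot-product v g ys)) (proj₂ (dot-product v g ys)))
       (trans (cong₂ _+_ (sym (fromℤ-* (re ρ) (re D))) (sym (fromℤ-* (im ρ) (im D))))
         (trans (sym (fromℤ-+ (re ρ ℤ.* re D) (im ρ ℤ.* im D))) (cong fromℤ (sym (trans
           (cong re⟨ ξ ,_⟩ (trans (cong (λ c → dotʷ c ys) col-scaled) (dotʷ-◃ p (col (v , ζ⁰) g) ys))) (re-rotate p ξ D))))))

   square-coordinates : ∀ {s} (g : Vec (Fin n × C₄) s) ys → Distinct g → square (coordinates g ys) ≡ fromℤ (ℤ.+ norm² ys)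
   square-coordinates [] [] _ = sum-0 {n ℕ.+ n} (λ _ → 0ℚ * 0ℚ) (λ _ → *-zeroˡ 0ℚ)
   square-coordinates ((v , p) ∷ g) (ξ ∷ ys) (fresh , distinct) = trans
     (square-+-spike (left v) (right v) c e (delta-refl (left v)) (delta-refl (right v))
       (delta-≢ (left≢right v v)) (delta-≢ λ eq → left≢right v v (sym eq)) (coordinates g ys)
       (proj₁ (fresh-zero g ys fresh)) (proj₂ (fresh-zero g ys fresh)))
     (trans (cong₂ _+_ (square-coordinates g ys distinct) (rotated p ξ))
       (trans (sym (fromℤ-+ (ℤ.+ norm² ys) (ℤ.+ size ξ))) (cong (λ m → fromℤ (ℤ.+ m)) (ℕ.+-comm (norm² ys) (size ξ)))))
     where
     c = fromℤ (re (rotate (p ⁻¹) ξ))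
     e = fromℤ (im (rotate (p ⁻¹) ξ))
     size : ℤ[i] → ℕ
     size (a +i b) = ℤ.∣ a ∣ ℕ.* ℤ.∣ a ∣ ℕ.+ ℤ.∣ b ∣ ℕ.* ℤ.∣ b ∣
     square-abs : ∀ a → a ℤ.* a ≡ ℤ.+ (ℤ.∣ a ∣ ℕ.* ℤ.∣ a ∣)
     square-abs (ℤ.+ m) = sym (ℤ.pos-* m m)
     square-abs ℤ.-[1+ m ] = refl
     sizes : ∀ z → fromℤ (re z) * fromℤ (re z) + fromℤ (im z) * fromℤ (im z) ≡ fromℤ (ℤ.+ size z)
     sizes (a +i b) = trans (cong₂ _+_ (sym (fromℤ-* a a)) (sym (fromℤ-* b b))) (trans (sym (fromℤ-+ (a ℤ.* a) (b ℤ.* b)))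
       (cong fromℤ (cong₂ ℤ._+_ (square-abs a) (square-abs b))))
     size-rotate : ∀ p z → size (rotate p z) ≡ size z
     size-rotate ζ⁰ (a +i b) = refl
     size-rotate ζ¹ (a +i b) = trans (cong (λ m → m ℕ.* m ℕ.+ ℤ.∣ a ∣ ℕ.* ℤ.∣ a ∣) (ℤ.∣-i∣≡∣i∣ b)) (ℕ.+-comm (ℤ.∣ b ∣ ℕ.* ℤ.∣ b ∣) (ℤ.∣ a ∣ ℕ.* ℤ.∣ a ∣))
     size-rotate ζ² (a +i b) = cong₂ (λ m k → m ℕ.* m ℕ.+ k ℕ.* k) (ℤ.∣-i∣≡∣i∣ a) (ℤ.∣-i∣≡∣i∣ b)
     size-rotate ζ³ (a +i b) = trans (cong (λ m → ℤ.∣ b ∣ ℕ.* ℤ.∣ b ∣ ℕ.+ m ℕ.* m) (ℤ.∣-i∣≡∣i∣ a)) (ℕ.+-comm (ℤ.∣ b ∣ ℕ.* ℤ.∣ b ∣) (ℤ.∣ a ∣ ℕ.* ℤ.∣ a ∣))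
     rotated : ∀ p ξ → fromℤ (re (rotate (p ⁻¹) ξ)) * fromℤ (re (rotate (p ⁻¹) ξ)) + fromℤ (im (rotate (p ⁻¹) ξ)) * fromℤ (im (rotate (p ⁻¹) ξ)) ≡ fromℤ (ℤ.+ size ξ)
     rotated p ξ = trans (sizes (rotate (p ⁻¹) ξ)) (cong (λ m → fromℤ (ℤ.+ m)) (size-rotate (p ⁻¹) ξ))

 fromℤ-cancel-≤ : ∀ {a b} → fromℤ a ≤ fromℤ b → a ℤ.≤ b
 fromℤ-cancel-≤ {a} {b} h = extract (ℚᵘP.≤-respˡ-≃ (toℚᵘ-fromℤ a) (ℚᵘP.≤-respʳ-≃ (toℚᵘ-fromℤ b) (toℚᵘ-mono-≤ h)))
   where
   extract : ℚᵘ.mkℚᵘ a 0 ℚᵘ.≤ ℚᵘ.mkℚᵘ b 0 → a ℤ.≤ b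
   extract (ℚᵘ.*≤* le) = subst₂ ℤ._≤_ (ℤ.*-identityʳ a) (ℤ.*-identityʳ b) le

 double-≤ : ∀ {a b} → a ℤ.+ a ℤ.≤ b ℤ.+ b → a ℤ.≤ b
 double-≤ {a} {b} h = ℤ.≮⇒≥ λ b<a → ℤ.<-irrefl refl (ℤ.<-≤-trans (ℤ.+-mono-< b<a b<a) h)

 abs-≤ : ∀ {a m} → a ℤ.≤ ℤ.+ m → ℤ.- a ℤ.≤ ℤ.+ m → ℤ.∣ a ∣ ℕ.≤ m
 abs-≤ {ℤ.+ k} (ℤ.+≤+ h) _ = h
 abs-≤ {ℤ.-[1+ k ]} _ (ℤ.+≤+ h) = h

 module FromMatrix {n} (A : Matrix n) (cyclotomic : IsCyclotomic A) (indecomposable : IsIndecomposable A)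
   (loopless : ∀ u → A u u ≡ Gaussian.0#) (units : ∀ u v → A u v ≢ Gaussian.0# → Gaussian.IsUnit (A u v)) where

   B : Fin n → Fin n → W
   B u v = toW (A u v)

   value : ∀ u v → ⟦ B u v ⟧ʷ ≡ A u v
   value u v = by-cases (A u v ≟ᵍ Gaussian.0#)
     where
     by-cases : Dec (A u v ≡ Gaussian.0#) → ⟦ B u v ⟧ʷ ≡ A u v
     by-cases (yes eq) = trans (cong (λ z → ⟦ toW z ⟧ʷ) eq) (sym eq)
     by-cases (no ne)  = let q , eq = unit-weight (A u v) (units u v ne) in
       trans (cong (λ z → ⟦ toW z ⟧ʷ) eq) (trans (cong ⟦_⟧ʷ (toW-⟦⟧ (just q))) (sym eq))

   open Lift B
   open Coordinates A (proj₁ cyclotomic) B value loopless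

   half-bound : ∀ {s} (g : Vec (Fin n × C₄) s) → Distinct g → ∀ y → ℤ.∣ half-form (conf g) y ∣ ℕ.≤ norm² y
   half-bound g d y = abs-≤ {H} {norm² y} (double-≤ {H} {ℤ.+ norm² y} (fromℤ-cancel-≤ {H ℤ.+ H} {ℤ.+ norm² y ℤ.+ ℤ.+ norm² y} (subst₂ _≤_ (form-coordinates g y) twice (form-bound A cyclotomic x))))
     (double-≤ {ℤ.- H} {ℤ.+ norm² y} (fromℤ-cancel-≤ {ℤ.- H ℤ.+ ℤ.- H} {ℤ.+ norm² y ℤ.+ ℤ.+ norm² y} (subst₂ _≤_ negated-form twice (form-bound (negᴹ A) (neg-cyclotomic A cyclotomic) x))))
     where
     x = coordinates g y
     H = half-form (conf g) y
     twice : two * square x ≡ fromℤ (ℤ.+ norm² y ℤ.+ ℤ.+ norm² y)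
     twice = trans (cong (two *_) (square-coordinates g y d)) (trans (double (fromℤ (ℤ.+ norm² y))) (sym (fromℤ-+ (ℤ.+ norm² y) (ℤ.+ norm² y))))
       where
       double : ∀ p → two * p ≡ p + p
       double = solve 1 (λ p → con two :* p := p :+ p) refl
     negated-form : form (realify (negᴹ A)) x ≡ fromℤ (ℤ.- H ℤ.+ ℤ.- H)
     negated-form = trans (form-neg A x) (trans (cong -_ (form-coordinates g y)) (trans (sym (fromℤ-neg (H ℤ.+ H))) (cong fromℤ (ℤ.neg-distrib-+ H H))))

   graph : GainGraph n
   graph = record
     { A = B
     ; herm = λ u v → ⟦⟧-injective (trans (value v u) (trans (sym (proj₁ cyclotomic v u))
         (sym (trans (⟦⟧-conj (B u v)) (cong Gaussian.conj (value u v))))))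
     ; diag = λ u → cong toW (loopless u)
     ; connected = λ u v → Star.map (λ { {u} {v} (_ , ne) eq → ne (trans (sym (value u v)) (cong ⟦_⟧ʷ eq)) }) (indecomposable u v)
     ; bound = λ g d y → not-refuted (half-bound g d y)
     }
     where
     not-refuted : ∀ {m k} → k ℕ.≤ m → (m ℕ.<ᵇ k) ≡ false
     not-refuted {m} {k} k≤m with m ℕ.<ᵇ k in eq
     ... | false = refl
     ... | true = contradiction (ℕ.<ᵇ⇒< m k (subst True (sym eq) tt)) (ℕ.≤⇒≯ k≤m)

module Soundness (IsTarget : ∀ {N} → Matrix N → Set)
   (target-hermitian : ∀ {N} {M : Matrix N} → IsTarget M → IsHermitian M) where

 open Configuration
 open Certificate
 open Gains
 open import Data.Bool.Base using (_∧_; not)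
 open import Data.List.Base as List using (List; []; _∷_)
 open import Data.List.Membership.Propositional using (_∈_)
 open import Data.List.Membership.Propositional.Properties using (∈-++⁺ˡ; ∈-++⁺ʳ; ∈-map⁺)
 open import Data.List.Relation.Unary.Any using (here; there)
 import Data.List.Relation.Unary.All as LAll
 open import Data.Vec.Relation.Unary.All as All using (All; []; _∷_)
 open import Relation.Binary.Construct.Closure.ReflexiveTransitive using (Star; ε; _◅_)
 import Relation.Binary.Construct.Closure.ReflexiveTransitive as Star
 open import Relation.Nullary.Decidable using (_⊎-dec_)
 open import Algebra.Properties.CommutativeSemigroup ℤ.+-commutativeSemigroup using (interchange)

 Fits : ∀ {n} → GainGraph n → Set
 Fits G = Σ[ N ∈ ℕ ] Σ[ M ∈ Matrix N ] IsTarget M × Embeds G M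

 -- Twisting a graph

 dot-neg : ∀ {s} (c : Vec W s) y → dot (Vec.map negʷ c) y ≡ Gaussian.- dot c y
 dot-neg [] [] = refl
 dot-neg (𝟎 ∷ c) (y ∷ ys) = dot-neg c ys
 dot-neg (just q ∷ c) (y ∷ ys) = trans
   (cong₂ Gaussian._+_ (rotate-∙ ζ² q y) (dot-neg c ys)) (lemma (rotate q y) (dot c ys))
   where
   lemma : ∀ z w → rotate ζ² z Gaussian.+ Gaussian.- w ≡ Gaussian.- (z Gaussian.+ w)
   lemma (a +i b) (c +i d) = cong₂ _+i_ (sym (ℤ.neg-distrib-+ a c)) (sym (ℤ.neg-distrib-+ b d))

 dot-conj : ∀ {s} (c : Vec W s) y →
   dot (Vec.map conjʷ c) y ≡ Gaussian.conj (dot c (Vec.map Gaussian.conj y))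
 dot-conj [] [] = refl
 dot-conj (𝟎 ∷ c) (y ∷ ys) = dot-conj c ys
 dot-conj (just q ∷ c) (y ∷ ys) = begin
   rotate (q ⁻¹) y + dot (Vec.map conjʷ c) ys
     ≡⟨ cong₂ _+_ (cong (rotate (q ⁻¹)) (sym (conj-involutive y))) (dot-conj c ys) ⟩
   rotate (q ⁻¹) (conj (conj y)) + conj (dot c (Vec.map conj ys))
     ≡⟨ cong (_+ _) (conj-rotate q (conj y)) ⟨
   conj (rotate q (conj y)) + conj (dot c (Vec.map conj ys))
     ≡⟨ lemma (rotate q (conj y)) (dot c (Vec.map conj ys)) ⟩
   conj (rotate q (conj y) + dot c (Vec.map conj ys)) ∎
   where
   open ≡-Reasoning
   open Gaussian
   lemma : ∀ z w → conj z + conj w ≡ conj (z + w)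
   lemma (a +i b) (c +i d) = cong (λ e → a ℤ.+ c +i e) (sym (ℤ.neg-distrib-+ b d))

 mapConf : (W → W) → ∀ {s} → Conf s → Conf s
 mapConf h [] = []
 mapConf h (c ∷ N) = Vec.map h c ∷ mapConf h N

 re-neg : ∀ z w → re⟨ z , Gaussian.- w ⟩ ≡ ℤ.- re⟨ z , w ⟩
 re-neg (a +i b) (c +i d) = trans
   (cong₂ ℤ._+_ (sym (ℤ.neg-distribʳ-* a c)) (sym (ℤ.neg-distribʳ-* b d)))
   (sym (ℤ.neg-distrib-+ (a ℤ.* c) (b ℤ.* d)))

 re-conj : ∀ z w → re⟨ z , Gaussian.conj w ⟩ ≡ re⟨ Gaussian.conj z , w ⟩
 re-conj (a +i b) (c +i d) = cong (λ e → a ℤ.* c ℤ.+ e)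
   (trans (sym (ℤ.neg-distribʳ-* b d)) (ℤ.neg-distribˡ-* b d))

 half-form-neg : ∀ {s} (N : Conf s) y → half-form (mapConf negʷ N) y ≡ ℤ.- half-form N y
 half-form-neg [] [] = refl
 half-form-neg (c ∷ N) (ξ ∷ ys) = trans
   (cong₂ ℤ._+_ (half-form-neg N ys) (trans (cong re⟨ ξ ,_⟩ (dot-neg c ys)) (re-neg ξ (dot c ys))))
   (sym (ℤ.neg-distrib-+ (half-form N ys) _))

 half-form-conj : ∀ {s} (N : Conf s) y →
   half-form (mapConf conjʷ N) y ≡ half-form N (Vec.map Gaussian.conj y)
 half-form-conj [] [] = refl
 half-form-conj (c ∷ N) (ξ ∷ ys) = cong₂ ℤ._+_ (half-form-conj N ys)
   (trans (cong re⟨ ξ ,_⟩ (dot-conj c ys)) (re-conj ξ _))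

 norm²-conj : ∀ {s} (y : Vec ℤ[i] s) → norm² (Vec.map Gaussian.conj y) ≡ norm² y
 norm²-conj [] = refl
 norm²-conj ((a +i b) ∷ ys) = cong₂ (λ k l → ℤ.∣ a ∣ ℕ.* ℤ.∣ a ∣ ℕ.+ k ℕ.* k ℕ.+ l)
   (ℤ.∣-i∣≡∣i∣ b) (norm²-conj ys)

 module _ {n} (G : GainGraph n) where
   open GainGraph G

   negG : GainGraph n
   negG = record
     { A = A⁻
     ; herm = λ u v → trans (cong negʷ (herm u v)) (twistʷ-conjʷ (Sign.- , identity) (A u v))
     ; diag = λ u → cong negʷ (diag u)
     ; connected = λ u v → Star.gmap (λ z → z) (λ A≢0 eq → A≢0 (◃-cancel ζ² eq)) (connected u v)
     ; bound = λ g fresh y → trans (cong (λ N → refutes N y) (conf⁻ g))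
         (trans (cong (norm² y ℕ.<ᵇ_) (trans (cong ℤ.∣_∣ (half-form-neg (conf g) y)) (ℤ.∣-i∣≡∣i∣ (half-form (conf g) y))))
           (bound g (distinct g fresh) y))
     }
     where
     A⁻ : Fin n → Fin n → W
     A⁻ u v = negʷ (A u v)
     module A⁻ = Lift A⁻
     conf⁻ : ∀ {s} (g : Vec _ s) → A⁻.conf g ≡ mapConf negʷ (conf g)
     conf⁻ [] = refl
     conf⁻ (x ∷ g) = cong₂ _∷_
       (trans (Vec.map-cong (λ y → sym (twistʷ-◃ (Sign.- , identity) (proj₂ x ∙ proj₂ y ⁻¹) (A (proj₁ x) (proj₁ y)))) g)
              (Vec.map-∘ negʷ ⟪ x ∣_⟫ g))
       (conf⁻ g)
     distinct : ∀ {s} (g : Vec _ s) → A⁻.Distinct g → Distinct g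
     distinct [] _ = tt
     distinct (x ∷ g) (p , q) = p , distinct g q

   conjG : GainGraph n
   conjG = record
     { A = Aᶜ
     ; herm = λ u v → cong conjʷ (herm u v)
     ; diag = λ u → cong conjʷ (diag u)
     ; connected = λ u v → Star.gmap (λ z → z) (λ A≢0 eq → A≢0 (conjʷ-𝟎 eq)) (connected u v)
     ; bound = λ g fresh y → trans (cong (λ N → refutes N y) (confᶜ g))
         (trans (cong₂ (λ k l → k ℕ.<ᵇ ℤ.∣ l ∣) (sym (norm²-conj y)) (half-form-conj (conf (lifts g)) y))
           (bound (lifts g) (distinct g fresh) (Vec.map Gaussian.conj y)))
     }
     where
     Aᶜ : Fin n → Fin n → W
     Aᶜ u v = conjʷ (A u v)
     module Aᶜ = Lift Aᶜ
     lift : Fin n × C₄ → Fin n × C₄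
     lift (v , p) = v , p ⁻¹
     lifts : ∀ {s} → Vec (Fin n × C₄) s → Vec (Fin n × C₄) s
     lifts = Vec.map lift
     ⟪⟫ᶜ : ∀ x y → Aᶜ.⟪ x ∣ y ⟫ ≡ conjʷ ⟪ lift x ∣ lift y ⟫
     ⟪⟫ᶜ (u , p) (v , q) = sym (trans (conjʷ-◃ (p ⁻¹ ∙ q ⁻¹ ⁻¹) (A u v)) (cong (_◃ conjʷ (A u v))
       (trans (⁻¹-distrib (p ⁻¹) (q ⁻¹ ⁻¹)) (cong₂ _∙_ (⁻¹-involutive p) (⁻¹-involutive (q ⁻¹))))))
     confᶜ : ∀ {s} (g : Vec _ s) → Aᶜ.conf g ≡ mapConf conjʷ (conf (lifts g))
     confᶜ [] = refl
     confᶜ (x ∷ g) = cong₂ _∷_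
       (trans (Vec.map-cong (⟪⟫ᶜ x) g)
         (trans (Vec.map-∘ (λ y → conjʷ ⟪ lift x ∣ y ⟫) lift g) (Vec.map-∘ conjʷ ⟪ lift x ∣_⟫ (lifts g))))
       (confᶜ g)
     fresh : ∀ {s} v (g : Vec _ s) → Aᶜ.Fresh v g → Fresh v (lifts g)
     fresh v [] [] = []
     fresh v (x ∷ g) (p ∷ ps) = p ∷ fresh v g ps
     distinct : ∀ {s} (g : Vec _ s) → Aᶜ.Distinct g → Distinct (lifts g)
     distinct [] _ = tt
     distinct (x ∷ g) (p , q) = fresh _ g p , distinct g q

 twistG : ∀ {n} → Twist → GainGraph n → GainGraph n
 twistG (Sign.+ , identity) G = G
 twistG (Sign.+ , conjugation) G = conjG G
 twistG (Sign.- , identity) G = negG G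
 twistG (Sign.- , conjugation) G = negG (conjG G)

 twistG-A : ∀ {n} τ (G : GainGraph n) u v → GainGraph.A (twistG τ G) u v ≡ twistʷ τ (GainGraph.A G u v)
 twistG-A (Sign.+ , identity) G u v = refl
 twistG-A (Sign.+ , conjugation) G u v = refl
 twistG-A (Sign.- , identity) G u v = refl
 twistG-A (Sign.- , conjugation) G u v = refl

 _⊙_ : Twist → Twist → Twist
 τ ⊙ (Sign.+ , identity) = τ
 (s , identity) ⊙ (Sign.+ , conjugation) = s , conjugation
 (s , conjugation) ⊙ (Sign.+ , conjugation) = s , identity
 (s , σ) ⊙ (Sign.- , identity) = Sign.opposite s , σ
 (s , identity) ⊙ (Sign.- , conjugation) = Sign.opposite s , conjugation
 (s , conjugation) ⊙ (Sign.- , conjugation) = Sign.opposite s , identity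

 twist-⊙ : ∀ τ₁ τ₂ z → twist τ₁ (twist τ₂ z) ≡ twist (τ₁ ⊙ τ₂) z
 twist-⊙ (Sign.+ , identity) (Sign.+ , identity) z = refl
 twist-⊙ (Sign.+ , conjugation) (Sign.+ , identity) z = refl
 twist-⊙ (Sign.- , identity) (Sign.+ , identity) z = refl
 twist-⊙ (Sign.- , conjugation) (Sign.+ , identity) z = refl
 twist-⊙ (Sign.+ , identity) (Sign.+ , conjugation) z = refl
 twist-⊙ (Sign.+ , conjugation) (Sign.+ , conjugation) z = conj-involutive z
 twist-⊙ (Sign.- , identity) (Sign.+ , conjugation) z = refl
 twist-⊙ (Sign.- , conjugation) (Sign.+ , conjugation) z = cong Gaussian.-_ (conj-involutive z)
 twist-⊙ (Sign.+ , identity) (Sign.- , identity) z = refl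
 twist-⊙ (Sign.+ , conjugation) (Sign.- , identity) z = refl
 twist-⊙ (Sign.- , identity) (Sign.- , identity) (a +i b) =
   cong₂ _+i_ (ℤ.neg-involutive a) (ℤ.neg-involutive b)
 twist-⊙ (Sign.- , conjugation) (Sign.- , identity) (a +i b) =
   cong₂ _+i_ (ℤ.neg-involutive a) (cong ℤ.-_ (ℤ.neg-involutive b))
 twist-⊙ (Sign.+ , identity) (Sign.- , conjugation) z = refl
 twist-⊙ (Sign.+ , conjugation) (Sign.- , conjugation) (a +i b) =
   cong (ℤ.- a +i_) (cong ℤ.-_ (ℤ.neg-involutive b))
 twist-⊙ (Sign.- , identity) (Sign.- , conjugation) (a +i b) =
   cong₂ _+i_ (ℤ.neg-involutive a) (ℤ.neg-involutive (ℤ.- b))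
 twist-⊙ (Sign.- , conjugation) (Sign.- , conjugation) (a +i b) =
   cong₂ _+i_ (ℤ.neg-involutive a) (trans (ℤ.neg-involutive (ℤ.- (ℤ.- b))) (ℤ.neg-involutive b))

 Fits-twist : ∀ {n} τ (G : GainGraph n) → Fits (twistG τ G) → Fits G
 Fits-twist τ G (N , M , isT , E) = N , M , isT , record
   { f = f ; unitᶠ = unitᶠ ; τ = τ ⊙ τ′ ; injective = injective ; matches = λ {u} {v} u≢v → begin
       ⟦ A u v ⟧ʷ ≡⟨ cong ⟦_⟧ʷ (twistʷ-involutive τ (A u v)) ⟨
       ⟦ twistʷ τ (twistʷ τ (A u v)) ⟧ʷ ≡⟨ ⟦⟧-twist τ _ ⟩
       twist τ ⟦ twistʷ τ (A u v) ⟧ʷ ≡⟨ cong (λ w → twist τ ⟦ w ⟧ʷ) (twistG-A τ G u v) ⟨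
       twist τ ⟦ A′ u v ⟧ʷ ≡⟨ cong (twist τ) (matches u≢v) ⟩
       twist τ (twist τ′ _) ≡⟨ twist-⊙ τ τ′ _ ⟩
       twist (τ ⊙ τ′) _ ∎ }
   where
   open ≡-Reasoning
   open GainGraph G using (A)
   open GainGraph (twistG τ G) using () renaming (A to A′)
   open Embeds E renaming (τ to τ′)

 -- Reading off the truth of the checks

 ∧-true : ∀ a {b} → a ∧ b ≡ true → a ≡ true × b ≡ true
 ∧-true true eq = refl , eq

 either : ∀ {P : Set} (P? : Dec P) {b} → (if does P? then true else b) ≡ true → P ⊎ b ≡ true
 either (yes p) _ = inj₁ p
 either (no _) eq = inj₂ eq

 does-false : ∀ {P : Set} (P? : Dec P) → not (does P?) ≡ true → ¬ P
 does-false (no ¬p) _ = ¬p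

 allᵇ-true : ∀ {A : Set} (p : A → Bool) {xs} → allᵇ p xs ≡ true → ∀ {x} → x ∈ xs → p x ≡ true
 allᵇ-true p {_ ∷ _} eq (here refl) = proj₁ (if-true eq)
 allᵇ-true p {_ ∷ _} eq (there x∈) = allᵇ-true p (proj₂ (if-true eq)) x∈

 allPairsᵇ-true : ∀ {A : Set} (r : A → A → Bool) {xs} → allPairsᵇ r xs ≡ true →
   ∀ {x y} → x ∈ xs → y ∈ xs → x ≡ y ⊎ r x y ≡ true ⊎ r y x ≡ true
 allPairsᵇ-true r {_ ∷ _} eq (here refl) (here refl) = inj₁ refl
 allPairsᵇ-true r {_ ∷ _} eq (here refl) (there y∈) = inj₂ (inj₁ (allᵇ-true (r _) (proj₁ (if-true eq)) y∈))
 allPairsᵇ-true r {_ ∷ _} eq (there x∈) (here refl) = inj₂ (inj₂ (allᵇ-true (r _) (proj₁ (if-true eq)) x∈))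
 allPairsᵇ-true r {_ ∷ _} eq (there x∈) (there y∈) = allPairsᵇ-true r (proj₂ (if-true eq)) x∈ y∈

 filterᵇ-∈ : ∀ {A : Set} (p : A → Bool) {xs x} → x ∈ xs → p x ≡ true → x ∈ filterᵇ p xs
 filterᵇ-∈ p {y ∷ xs} (here refl) px rewrite px = here refl
 filterᵇ-∈ p {y ∷ xs} (there x∈) px with p y
 ... | true = there (filterᵇ-∈ p x∈ px)
 ... | false = filterᵇ-∈ p x∈ px

 weights-complete : ∀ w → w ∈ weights
 weights-complete 𝟎 = here refl
 weights-complete (just ζ⁰) = there (here refl)
 weights-complete (just ζ¹) = there (there (here refl))
 weights-complete (just ζ²) = there (there (there (here refl)))
 weights-complete (just ζ³) = there (there (there (there (here refl))))

 zeros : ∀ {s} → Vec W s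
 zeros = Vec.replicate _ 𝟎

 candidates-∷ : ∀ {s} {L : Columns s} {c} w → c ∈ L → (w ∷ c) ∈ candidates L
 candidates-∷ {L = d ∷ L} w (here refl) = ∈-++⁺ˡ (∈-map⁺ (_∷ d) (weights-complete w))
 candidates-∷ {L = d ∷ L} w (there c∈) = ∈-++⁺ʳ (List.map (_∷ d) weights) (candidates-∷ w c∈)

 candidates-zeros : ∀ {s} (L : Columns s) → (𝟏 ∷ zeros) ∈ candidates L
 candidates-zeros [] = here refl
 candidates-zeros (d ∷ L) = ∈-++⁺ʳ (List.map (_∷ d) weights) (candidates-zeros L)

 conf-ext : ∀ {s} (N N′ : Conf s) → (∀ i j → i ≢ j → entry N i j ≡ entry N′ i j) → N ≡ N′
 conf-ext [] [] eq = refl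
 conf-ext (c ∷ N) (c′ ∷ N′) eq = cong₂ _∷_
   (trans (sym (Vec.tabulate∘lookup c)) (trans (Vec.tabulate-cong (λ j → eq zero (suc j) λ ())) (Vec.tabulate∘lookup c′)))
   (conf-ext N N′ λ i j i≢j → eq (suc i) (suc j) (λ { refl → i≢j refl }))

 any₄? : {P : C₄ → Set} → (∀ p → Dec (P p)) → Dec (∃[ p ] P p)
 any₄? P? = map′
   (λ { (inj₁ x) → ζ⁰ , x ; (inj₂ (inj₁ x)) → ζ¹ , x ; (inj₂ (inj₂ (inj₁ x))) → ζ² , x ; (inj₂ (inj₂ (inj₂ x))) → ζ³ , x })
   (λ { (ζ⁰ , x) → inj₁ x ; (ζ¹ , x) → inj₂ (inj₁ x) ; (ζ² , x) → inj₂ (inj₂ (inj₁ x)) ; (ζ³ , x) → inj₂ (inj₂ (inj₂ x)) })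
   (P? ζ⁰ ⊎-dec P? ζ¹ ⊎-dec P? ζ² ⊎-dec P? ζ³)

 -- Soundness of certificates

 Claim : Seed → Set
 Claim (m , X) = ∀ {n} (G : GainGraph n) →
   (g : Vec (Fin n × C₄) m) → GainGraph.Distinct G g → GainGraph.conf G g ≡ X → Fits G

 module InGraph {n} (G : GainGraph n) where
   open GainGraph G

   X : Set
   X = Fin n × C₄

   Complete : ∀ {s} → Vec X s → Columns s → Set
   Complete g L = ∀ v → Fresh v g → ∃[ p ] (col (v , p) g ∈ L ⊎ col (v , p) g ≡ zeros)

   col-rescale : ∀ {s} q v p (g : Vec X s) → col (v , q ∙ p) g ≡ Vec.map (q ◃_) (col (v , p) g)
   col-rescale q v p g = trans (Vec.map-cong (rescale q v p) g) (Vec.map-∘ (q ◃_) ⟪ (v , p) ∣_⟫ g)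

   map-zeros : ∀ {s} q → Vec.map (q ◃_) (zeros {s}) ≡ zeros
   map-zeros q = Vec.map-replicate (q ◃_) 𝟎 _

   col-zeros : ∀ {s} q {v p} {g : Vec X s} → col (v , p) g ≡ zeros → col (v , q ∙ p) g ≡ zeros
   col-zeros q {v} {p} {g} eq = trans (col-rescale q v p g) (trans (cong (Vec.map (q ◃_)) eq) (map-zeros q))

   survives-conf : ∀ {s} (P : Pool s) (g : Vec X s) → Distinct g → survives P (conf g) ≡ true
   survives-conf [] g d = refl
   survives-conf (y ∷ P) g d rewrite bound g d y = survives-conf P g d

   grow-complete : ∀ {s} (P : Pool (2 ℕ.+ s)) {x} {g : Vec X s} {L} → Distinct (x ∷ g) →
     Complete g L → Complete (x ∷ g) (grow P (conf g) (col x g) L)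
   grow-complete P {x} {g} {L} d complete v (v≢x ∷ fresh) with complete v fresh
   ... | p , inj₁ c∈ = p , inj₁ (filterᵇ-∈ _ (candidates-∷ _ c∈)
     (survives-conf P ((v , p) ∷ x ∷ g) (v≢x ∷ fresh , d)))
   ... | p , inj₂ c≡ with ⟪ (v , p) ∣ x ⟫ in eq
   ... | 𝟎 = p , inj₂ (cong₂ _∷_ eq c≡)
   ... | just q = q ⁻¹ ∙ p , inj₁ (subst (_∈ grow P (conf g) (col x g) L) (sym eq′)
     (filterᵇ-∈ _ (candidates-zeros L)
       (subst (λ c → survives P (c ∷ col x g ∷ conf g) ≡ true) eq′
         (survives-conf P ((v , q ⁻¹ ∙ p) ∷ x ∷ g) (v≢x ∷ fresh , d)))))
     where
     eq′ : col (v , q ⁻¹ ∙ p) (x ∷ g) ≡ 𝟏 ∷ zeros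
     eq′ = cong₂ _∷_
       (trans (rescale (q ⁻¹) v p x) (trans (cong (q ⁻¹ ◃_) eq) (cong just (∙-inverseˡ q))))
       (col-zeros (q ⁻¹) c≡)

   remove-complete : ∀ {s} c {g : Vec X s} {L} → Complete g L →
     ¬ (∃[ v ] Fresh v g × ∃[ p ] col (v , p) g ≡ c) → Complete g (remove c L)
   remove-complete c {g} {L} complete none v fresh with complete v fresh
   ... | p , inj₂ c≡ = p , inj₂ c≡
   ... | p , inj₁ c∈ = p , inj₁ (filterᵇ-∈ _ c∈ kept)
     where
     kept : not (does (c ≟ᵛ col (v , p) g)) ≡ true
     kept with c ≟ᵛ col (v , p) g
     ... | yes eq = contradiction (v , fresh , p , sym eq) none
     ... | no _ = refl

   locate : ∀ {s} v (g : Vec X s) → Fresh v g ⊎ ∃[ i ] v ≡ proj₁ (Vec.lookup g i)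
   locate v [] = inj₁ []
   locate v (x ∷ g) with v Fin.≟ proj₁ x
   ... | yes eq = inj₂ (zero , eq)
   ... | no v≢x with locate v g
   ... | inj₁ fresh = inj₁ (v≢x ∷ fresh)
   ... | inj₂ (i , eq) = inj₂ (suc i , eq)

   fresh-lookup : ∀ {s v} {g : Vec X s} → Fresh v g → ∀ i → v ≢ proj₁ (Vec.lookup g i)
   fresh-lookup (v≢x ∷ _) zero = v≢x
   fresh-lookup (_ ∷ fresh) (suc i) = fresh-lookup fresh i

   distinct-lookup : ∀ {s} {g : Vec X s} → Distinct g → ∀ {i j} → i ≢ j →
     proj₁ (Vec.lookup g i) ≢ proj₁ (Vec.lookup g j)
   distinct-lookup {g = x ∷ g} (fresh , d) {zero} {zero} i≢j = ⊥-elim (i≢j refl)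
   distinct-lookup {g = x ∷ g} (fresh , d) {zero} {suc j} i≢j = fresh-lookup fresh j
   distinct-lookup {g = x ∷ g} (fresh , d) {suc i} {zero} i≢j = λ eq → fresh-lookup fresh i (sym eq)
   distinct-lookup {g = x ∷ g} (fresh , d) {suc i} {suc j} i≢j = distinct-lookup d (λ eq → i≢j (cong suc eq))

   distinct-from-lookup : ∀ {s} (g : Vec X s) →
     (∀ {i j} → i ≢ j → proj₁ (Vec.lookup g i) ≢ proj₁ (Vec.lookup g j)) → Distinct g
   distinct-from-lookup [] h = tt
   distinct-from-lookup (x ∷ g) h = fresh g (λ i → h {zero} {suc i} λ ()) ,
     distinct-from-lookup g (λ {i} {j} i≢j → h {suc i} {suc j} (λ { refl → i≢j refl }))
     where
     fresh : ∀ {t} (g′ : Vec X t) → (∀ i → proj₁ x ≢ proj₁ (Vec.lookup g′ i)) → Fresh (proj₁ x) g′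
     fresh [] h = []
     fresh (y ∷ g′) h = h zero ∷ fresh g′ (λ i → h (suc i))

 exits-sound : ∀ {n m s} (G : GainGraph n) →
   (seed : Conf m) → Claim (m , seed) → ∀ τ im (g : Vec (Fin n × C₄) s) → GainGraph.Distinct G g →
   exits seed (GainGraph.conf G g) τ im ≡ true → Fits G
 exits-sound {n} {m} G seed claim τ (just h) g d ok = Fits-twist τ G
   (claim (twistG τ G) g′ (In′.distinct-from-lookup g′ distinct′) (conf-ext _ _ entries))
   where
   open GainGraph G
   open InGraph G
   module G′ = GainGraph (twistG τ G)
   module In′ = InGraph (twistG τ G)
   move : Fin _ × C₄ → X
   move (v , p) = proj₁ (Vec.lookup g v) , twist⁴ τ (p ∙ proj₂ (Vec.lookup g v))
   g′ : Vec X m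
   g′ = Vec.map move h
   pairs : ∀ {i j} → i ≢ j → let (v , p) = Vec.lookup h i ; (w , q) = Vec.lookup h j in
     v ≢ w × entry seed i j ≡ twistʷ τ ((p ∙ q ⁻¹) ◃ entry (conf g) v w)
   pairs {i} {j} i≢j
     with i Fin.≟ j | allFinᵇ-true (exitOk seed (conf g) τ h i) (allFinᵇ-true (λ i → allFinᵇ (exitOk seed (conf g) τ h i)) ok i) j
   ... | yes eq | _ = contradiction eq i≢j
   ... | no  _  | okij = let a , b = ∧-true (not _) okij in does-false (_ Fin.≟ _) a , does-true (_ ≟ʷ _) b
   distinct′ : ∀ {i j} → i ≢ j → proj₁ (Vec.lookup g′ i) ≢ proj₁ (Vec.lookup g′ j)
   distinct′ {i} {j} i≢j rewrite Vec.lookup-map i move h | Vec.lookup-map j move h =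
     distinct-lookup d (proj₁ (pairs i≢j))
   regroup : ∀ p a q b → (p ∙ a) ∙ (q ∙ b) ⁻¹ ≡ (p ∙ q ⁻¹) ∙ (a ∙ b ⁻¹)
   regroup p a q b = trans (cong ((p ∙ a) ∙_) (⁻¹-distrib q b)) (rearrange p a (q ⁻¹) (b ⁻¹))
     where
     rearrange : ∀ p a q b → (p ∙ a) ∙ (q ∙ b) ≡ (p ∙ q) ∙ (a ∙ b)
     rearrange p a q b = trans (∙-assoc p a (q ∙ b)) (trans (cong (p ∙_)
       (trans (sym (∙-assoc a q b)) (trans (cong (_∙ b) (∙-comm a q)) (∙-assoc q a b)))) (sym (∙-assoc p q (a ∙ b))))
   moved : ∀ x y → G′.⟪ move x ∣ move y ⟫ ≡ twistʷ τ ((proj₂ x ∙ proj₂ y ⁻¹) ◃ entry (conf g) (proj₁ x) (proj₁ y))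
   moved (v , p) (w , q) = begin
     (t (p ∙ a) ∙ t (q ∙ b) ⁻¹) ◃ G′.A v′ w′
       ≡⟨ cong₂ _◃_ (trans (cong (t (p ∙ a) ∙_) (sym (twist⁴-⁻¹ τ (q ∙ b)))) (sym (twist⁴-∙ τ (p ∙ a) _))) (twistG-A τ G v′ w′) ⟩
     t ((p ∙ a) ∙ (q ∙ b) ⁻¹) ◃ twistʷ τ (A v′ w′)
       ≡⟨ twistʷ-◃ τ _ (A v′ w′) ⟨
     twistʷ τ (((p ∙ a) ∙ (q ∙ b) ⁻¹) ◃ A v′ w′)
       ≡⟨ cong (twistʷ τ) (trans (cong (_◃ A v′ w′) (regroup p a q b)) (◃-assoc (p ∙ q ⁻¹) (a ∙ b ⁻¹) (A v′ w′))) ⟩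
     twistʷ τ ((p ∙ q ⁻¹) ◃ ⟪ Vec.lookup g v ∣ Vec.lookup g w ⟫)
       ≡⟨ cong (λ e → twistʷ τ ((p ∙ q ⁻¹) ◃ e)) (entry-conf g v w) ⟨
     twistʷ τ ((p ∙ q ⁻¹) ◃ entry (conf g) v w) ∎
     where
     open ≡-Reasoning
     t = twist⁴ τ
     a = proj₂ (Vec.lookup g v)
     b = proj₂ (Vec.lookup g w)
     v′ = proj₁ (Vec.lookup g v)
     w′ = proj₁ (Vec.lookup g w)
   entries : ∀ i j → i ≢ j → entry (G′.conf g′) i j ≡ entry seed i j
   entries i j i≢j = trans (G′.entry-conf g′ i j)
     (trans (cong₂ G′.⟪_∣_⟫ (Vec.lookup-map i move h) (Vec.lookup-map j move h))
       (trans (moved (Vec.lookup h i) (Vec.lookup h j)) (sym (proj₂ (pairs i≢j)))))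

 zip-∈ : ∀ {A B : Set} {xs : List A} (ys : Vec B (List.length xs)) {x} → x ∈ xs → ∃[ y ] (x , y) ∈ zip xs ys
 zip-∈ (y ∷ ys) (here refl) = y , here refl
 zip-∈ (y ∷ ys) (there x∈)  = let z , z∈ = zip-∈ ys x∈ in z , there z∈

 module LeafSound {n} (G : GainGraph n) {m} (M : Matrix m) (hermitian : IsHermitian M) (τ : Twist) where
   open GainGraph G
   open InGraph G

   module _ {s} (P : Pool (3 ℕ.+ s)) (h : Vec X (suc s)) (d : Distinct h)
     (im : Vec (Fin m × C₄) (suc s)) (typed : List (Vec W (suc s) × Fin m × C₄))
     (ok : Leaf.leafOk P M τ (conf h) im typed ≡ true)
     (complete : ∀ v → Fresh v h →
       ∃[ p ] ((∃[ y ] (col (v , p) h , y) ∈ typed) ⊎ col (v , p) h ≡ zeros)) where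

     open Leaf P M τ (conf h)

     private
       base-ok : ∀ i j → cellOk im i j ≡ true
       base-ok i = allFinᵇ-true (cellOk im i)
         (allFinᵇ-true (λ i → allFinᵇ (cellOk im i)) (proj₁ (∧-true (baseOk im) ok)) i)

       rest₁ = ∧-true (allᵇ (λ T → columnOk im (proj₂ T) (proj₁ T)) typed) (proj₂ (∧-true (baseOk im) ok))
       rest₂ = ∧-true (allᵇ selfOk typed) (proj₂ rest₁)

       column-ok : ∀ {c a} → (c , a) ∈ typed → ∀ j → spokeOk im a c j ≡ true
       column-ok {c} {a} ∈typed = allFinᵇ-true (spokeOk im a c)
         (allᵇ-true (λ T → columnOk im (proj₂ T) (proj₁ T)) (proj₁ rest₁) ∈typed)

       self-ok : ∀ {c a} → (c , a) ∈ typed → (∀ w → dead c c w ≡ true) × dead c zeros 𝟏 ≡ true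
       self-ok {c} ∈typed =
         let a , b = ∧-true (allᵇ (dead c c) weights) (allᵇ-true selfOk (proj₁ rest₂) ∈typed)
         in (λ w → allᵇ-true (dead c c) a (weights-complete w)) , b

       pair-ok : ∀ {T U} → T ∈ typed → U ∈ typed → T ≡ U ⊎ pairOk T U ≡ true ⊎ pairOk U T ≡ true
       pair-ok = allPairsᵇ-true pairOk (proj₂ rest₂)

     -- A realised weight passes every test of the pool.
     alive : ∀ x y → proj₁ x ≢ proj₁ y → Fresh (proj₁ x) h → Fresh (proj₁ y) h →
       dead (col y h) (col x h) ⟪ x ∣ y ⟫ ≢ true
     alive x y x≢y fx fy eq with () ←
       trans (sym eq) (cong not (survives-conf P (x ∷ y ∷ h) ((x≢y ∷ fx) , fy , d)))

     -- Relates the weight of a pair to the weight in M.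
     Agree : X → Fin m × C₄ → X → Fin m × C₄ → Set
     Agree x a y b = proj₁ a ≢ proj₁ b × ⟦ ⟪ x ∣ y ⟫ ⟧ʷ ≡ value a b

     value-conj : ∀ a b → value b a ≡ Gaussian.conj (value a b)
     value-conj (v , p) (w , q) = begin
       twist τ (rotate (q ∙ p ⁻¹) (M w v))
         ≡⟨ cong (twist τ) (cong₂ rotate (sym r) (sym (hermitian w v))) ⟩
       twist τ (rotate ((p ∙ q ⁻¹) ⁻¹) (Gaussian.conj (M v w)))
         ≡⟨ cong (twist τ) (conj-rotate (p ∙ q ⁻¹) (M v w)) ⟨
       twist τ (Gaussian.conj (rotate (p ∙ q ⁻¹) (M v w)))
         ≡⟨ twist-conj τ _ ⟩
       Gaussian.conj (twist τ (rotate (p ∙ q ⁻¹) (M v w))) ∎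
       where
       open ≡-Reasoning
       r : (p ∙ q ⁻¹) ⁻¹ ≡ q ∙ p ⁻¹
       r = trans (⁻¹-distrib p (q ⁻¹)) (trans (cong (p ⁻¹ ∙_) (⁻¹-involutive q)) (∙-comm (p ⁻¹) q))

     swap : ∀ x a y b → Agree x a y b → Agree y b x a
     swap x a y b (a≢b , eq) = (λ b≡a → a≢b (sym b≡a)) ,
       trans (cong ⟦_⟧ʷ (herm⟪⟫ x y)) (trans (⟦⟧-conj ⟪ x ∣ y ⟫)
         (trans (cong Gaussian.conj eq) (sym (value-conj a b))))

     data Located (v : Fin n) : Set where
       base : ∀ i → v ≡ proj₁ (Vec.lookup h i) → Located v
       typ : Fresh v h → ∀ p a → (col (v , p) h , a) ∈ typed → Located v

     lift : ∀ {v} → Located v → C₄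
     lift (base i _) = proj₂ (Vec.lookup h i)
     lift (typ _ p _ _) = p

     image : ∀ {v} → Located v → Fin m × C₄
     image (base i _) = Vec.lookup im i
     image (typ _ _ a _) = a

     base-typ : ∀ {v} i → Fresh v h → ∀ p a → (col (v , p) h , a) ∈ typed →
       Agree (v , p) a (Vec.lookup h i) (Vec.lookup im i)
     base-typ {v} i fv p a ∈typed =
       let okc = ∧-true (distinct a (Vec.lookup im i)) (column-ok ∈typed i) in
       does-false (proj₁ a Fin.≟ _) (proj₁ okc) ,
       trans (cong ⟦_⟧ʷ (sym (Vec.lookup-map i ⟪ (v , p) ∣_⟫ h))) (does-true (_ ≟ᵍ _) (proj₂ okc))

     pair-agree : ∀ x a y b → proj₁ x ≢ proj₁ y → Fresh (proj₁ x) h → Fresh (proj₁ y) h →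
       pairOk (col x h , a) (col y h , b) ≡ true → Agree x a y b
     pair-agree x a y b x≢y fx fy okp with ∧-true (distinct a b) okp
     ... | a≢b , okw with either (⟦ ⟪ x ∣ y ⟫ ⟧ʷ ≟ᵍ value a b)
       (allᵇ-true (weightOk (col x h , a) (col y h , b)) okw (weights-complete ⟪ x ∣ y ⟫))
     ... | inj₁ eq = does-false (_ Fin.≟ _) a≢b , eq
     ... | inj₂ isDead = ⊥-elim (alive x y x≢y fx fy isDead)

     agree : ∀ {u v} → u ≢ v → (k : Located u) (l : Located v) →
       Agree (u , lift k) (image k) (v , lift l) (image l)
     agree u≢v (base i refl) (base j refl) with i Fin.≟ j | base-ok i j
     ... | yes refl | _ = ⊥-elim (u≢v refl)
     ... | no  _    | okb = let a , b = ∧-true (distinct (Vec.lookup im i) (Vec.lookup im j)) okb in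
       does-false (_ Fin.≟ _) a ,
       trans (cong ⟦_⟧ʷ (sym (entry-conf h i j))) (does-true (_ ≟ᵍ _) b)
     agree u≢v (base i refl) (typ fv q b v∈) = swap (_ , q) b (Vec.lookup h i) (Vec.lookup im i) (base-typ i fv q b v∈)
     agree u≢v (typ fu p a u∈) (base j refl) = base-typ j fu p a u∈
     agree {u} {v} u≢v (typ fu p a u∈) (typ fv q b v∈) with pair-ok u∈ v∈
     ... | inj₂ (inj₁ okp) = pair-agree (u , p) a (v , q) b u≢v fu fv okp
     ... | inj₂ (inj₂ okp) = swap (v , q) b (u , p) a (pair-agree (v , q) b (u , p) a (λ v≡u → u≢v (sym v≡u)) fv fu okp)
     ... | inj₁ eq = ⊥-elim (alive (u , p) (v , q) u≢v fu fv
       (subst (λ c → dead (col (v , q) h) c ⟪ (u , p) ∣ (v , q) ⟫ ≡ true) (sym (cong proj₁ eq))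
         (proj₁ (self-ok v∈) ⟪ (u , p) ∣ (v , q) ⟫)))

     Isolated : Fin n → Set
     Isolated v = Fresh v h × col (v , ζ⁰) h ≡ zeros

     isolated-zero : ∀ {v} → Isolated v → ∀ i → A v (proj₁ (Vec.lookup h i)) ≡ 𝟎
     isolated-zero {v} (_ , eq) i = ◃-cancel (ζ⁰ ∙ proj₂ (Vec.lookup h i) ⁻¹)
       (trans (sym (Vec.lookup-map i ⟪ (v , ζ⁰) ∣_⟫ h)) (trans (cong (λ c → Vec.lookup c i) eq) (Vec.lookup-replicate i 𝟎)))

     isolated-step : ∀ {u v} → ¬ Isolated u → A u v ≢ 𝟎 → ¬ Isolated v
     isolated-step {u} {v} ¬iu Auv iv@(fv , eq) with locate u h
     ... | inj₂ (i , refl) = Auv (trans (herm v u) (cong conjʷ (isolated-zero iv i)))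
     ... | inj₁ fu with complete u fu
     ... | p , inj₂ c≡ = ¬iu (fu , subst (λ r → col (u , r) h ≡ zeros) (∙-inverseˡ p) (col-zeros (p ⁻¹) c≡))
     ... | p , inj₁ (a , u∈) with ⟪ (v , ζ⁰) ∣ (u , p) ⟫ in weight
     ... | 𝟎 = Auv (trans (herm v u) (cong conjʷ (◃-cancel (ζ⁰ ∙ p ⁻¹) {A v u} weight)))
     ... | just q = alive (v , q ⁻¹ ∙ ζ⁰) (u , p) v≢u fv fu
       (subst₂ (λ c w → dead (col (u , p) h) c w ≡ true) (sym (col-zeros (q ⁻¹) eq)) (sym normalised)
         (proj₂ (self-ok u∈)))
       where
       v≢u : v ≢ u
       v≢u refl = Auv (diag v)
       normalised : ⟪ (v , q ⁻¹ ∙ ζ⁰) ∣ (u , p) ⟫ ≡ 𝟏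
       normalised = trans (rescale (q ⁻¹) v ζ⁰ (u , p)) (trans (cong (q ⁻¹ ◃_) weight) (cong just (∙-inverseˡ q)))

     none-isolated : ∀ v → ¬ Isolated v
     none-isolated v = along (connected (proj₁ (Vec.head h)) v) λ { (f , _) → fresh-lookup f zero (head-lookup h) }
       where
       head-lookup : ∀ {t} (g : Vec X (suc t)) → proj₁ (Vec.head g) ≡ proj₁ (Vec.lookup g zero)
       head-lookup (x ∷ g) = refl
       along : ∀ {u v} → Star (λ u v → A u v ≢ 𝟎) u v → ¬ Isolated u → ¬ Isolated v
       along ε ¬iu = ¬iu
       along (e ◅ es) ¬iu = along es (isolated-step ¬iu e)

     located : ∀ v → Located v
     located v with locate v h
     ... | inj₂ (i , eq) = base i eq
     ... | inj₁ fv with complete v fv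
     ... | p , inj₁ (a , v∈) = typ fv p a v∈
     ... | p , inj₂ c≡ = ⊥-elim (none-isolated v
       (fv , subst (λ r → col (v , r) h ≡ zeros) (∙-inverseˡ p) (col-zeros (p ⁻¹) c≡)))

     embeds : Embeds G M
     embeds = record
       { f = λ v → proj₁ (image (located v))
       ; unitᶠ = λ v → twist⁴ τ (lift (located v) ⁻¹) ∙ proj₂ (image (located v))
       ; τ = τ
       ; injective = λ {u} {v} u≢v → proj₁ (agree u≢v (located u) (located v))
       ; matches = λ {u} {v} u≢v → matches u v (lift (located u)) (lift (located v))
           (image (located u)) (image (located v)) (proj₂ (agree u≢v (located u) (located v)))
       }
       where
       open ≡-Reasoning
       matches : ∀ u v p q (x y : Fin m × C₄) → ⟦ ⟪ (u , p) ∣ (v , q) ⟫ ⟧ʷ ≡ value x y →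
         ⟦ A u v ⟧ʷ ≡ twist τ (between (twist⁴ τ (p ⁻¹) ∙ proj₂ x) (M (proj₁ x) (proj₁ y)) (twist⁴ τ (q ⁻¹) ∙ proj₂ y))
       matches u v p q (x , a) (y , b) eq = begin
         ⟦ A u v ⟧ʷ ≡⟨ cong ⟦_⟧ʷ (unlift u p v q) ⟩
         ⟦ (p ⁻¹ ∙ q) ◃ ⟪ (u , p) ∣ (v , q) ⟫ ⟧ʷ ≡⟨ ⟦⟧-◃ (p ⁻¹ ∙ q) ⟪ (u , p) ∣ (v , q) ⟫ ⟩
         rotate (p ⁻¹ ∙ q) ⟦ ⟪ (u , p) ∣ (v , q) ⟫ ⟧ʷ ≡⟨ cong (rotate (p ⁻¹ ∙ q)) eq ⟩
         rotate (p ⁻¹ ∙ q) (twist τ (rotate (a ∙ b ⁻¹) (M x y))) ≡⟨ cong (λ r → rotate r (twist τ _)) (twist⁴-involutive τ (p ⁻¹ ∙ q)) ⟨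
         rotate (twist⁴ τ (twist⁴ τ (p ⁻¹ ∙ q))) (twist τ (rotate (a ∙ b ⁻¹) (M x y)))
                                                                 ≡⟨ twist-rotate τ (twist⁴ τ (p ⁻¹ ∙ q)) _ ⟨
         twist τ (rotate (twist⁴ τ (p ⁻¹ ∙ q)) (rotate (a ∙ b ⁻¹) (M x y)))
                                                                 ≡⟨ cong (twist τ) (rotate-∙ (twist⁴ τ (p ⁻¹ ∙ q)) (a ∙ b ⁻¹) (M x y)) ⟨
         twist τ (rotate (twist⁴ τ (p ⁻¹ ∙ q) ∙ (a ∙ b ⁻¹)) (M x y))
                                                                 ≡⟨ cong (λ r → twist τ (rotate r (M x y))) (units τ p q a b) ⟩
         twist τ (rotate ((twist⁴ τ (p ⁻¹) ∙ a) ∙ (twist⁴ τ (q ⁻¹) ∙ b) ⁻¹) (M x y)) ∎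
         where
         units : ∀ τ p q a b → twist⁴ τ (p ⁻¹ ∙ q) ∙ (a ∙ b ⁻¹) ≡ (twist⁴ τ (p ⁻¹) ∙ a) ∙ (twist⁴ τ (q ⁻¹) ∙ b) ⁻¹
         units (_ , identity) = toWitness {a? = all₄? λ p → all₄? λ q → all₄? λ a → all₄? λ b →
           ((p ⁻¹ ∙ q) ∙ (a ∙ b ⁻¹)) ≟₄ ((p ⁻¹ ∙ a) ∙ (q ⁻¹ ∙ b) ⁻¹)} tt
         units (_ , conjugation) = toWitness {a? = all₄? λ p → all₄? λ q → all₄? λ a → all₄? λ b →
           ((p ⁻¹ ∙ q) ⁻¹ ∙ (a ∙ b ⁻¹)) ≟₄ ((p ⁻¹ ⁻¹ ∙ a) ∙ (q ⁻¹ ⁻¹ ∙ b) ⁻¹)} tt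

 nth-all : ∀ {A : Set} {P : A → Set} {xs} → LAll.All P xs → ∀ k {x} → nth xs k ≡ just x → P x
 nth-all (p LAll.∷ ps) zero refl = p
 nth-all (p LAll.∷ ps) (suc k) eq = nth-all ps k eq

 module CheckSound (seeds : List Seed) (claims : LAll.All Claim seeds)
   (targets : List Target) (valid : LAll.All (λ T → IsTarget (proj₂ T)) targets) where

   open Check seeds targets

   check-sound : ∀ s N L T → check (s , N , L) T ≡ true → ∀ {n} (G : GainGraph n) →
     (g : Vec (Fin n × C₄) s) → GainGraph.Distinct G g → GainGraph.conf G g ≡ N → InGraph.Complete G g L → Fits G
   check-sound s N L (branch c P T₁ T₀) ok G g d refl complete
     with Fin.any? (λ v → All.all? (λ y → ¬? (v Fin.≟ proj₁ y)) g ×-dec any₄? λ p → GainGraph.col G (v , p) g ≟ᵛ column s c)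
   ... | yes (v , fresh , p , eq) = check-sound (suc s) _ _ T₁ (proj₁ (if-true ok)) G ((v , p) ∷ g) (fresh , d)
     (cong (_∷ _) eq) (subst (λ c → Complete ((v , p) ∷ g) (grow (pool (2 ℕ.+ s) P) (conf g) c L)) eq
       (grow-complete (pool (2 ℕ.+ s) P) (fresh , d) complete))
     where
     open GainGraph G
     open InGraph G
   ... | no none = check-sound s N _ T₀ (proj₂ (if-true ok)) G g d refl (remove-complete (column s c) complete none)
     where open InGraph G
   check-sound s N L (exit k τ im) ok G g d refl complete with nth seeds k in eq
   ... | just (m , X) = exits-sound G X (nth-all claims k eq) τ (images m im) g d ok
   check-sound zero N L (leaf P k τ im) ok G g d refl complete with nth targets k
   check-sound zero N L (leaf P k τ im) () G g d refl complete | nothing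
   check-sound zero N L (leaf P k τ im) () G g d refl complete | just _
   check-sound (suc s) N L (leaf P k τ im) ok G g d refl complete with nth targets k in eq
   ... | just (m , M) = m , M , nth-all valid k eq ,
     leaf-embeds (images (suc s ℕ.+ List.length L) im) ok
     where
     open GainGraph G
     leaf-embeds : ∀ im → leafCheck (pool (3 ℕ.+ s) P) M τ (conf g) L im ≡ true → Embeds G M
     leaf-embeds (just im) ok = LeafSound.embeds G M (target-hermitian (nth-all valid k eq)) τ
       (pool (3 ℕ.+ s) P) g d (Vec.take (suc s) im) (zip L (Vec.drop (suc s) im)) ok
       λ v fresh → typed (complete v fresh)
       where
       typed : ∀ {v} → ∃[ p ] (col (v , p) g ∈ L ⊎ col (v , p) g ≡ zeros) →
         ∃[ p ] ((∃[ y ] (col (v , p) g , y) ∈ zip L (Vec.drop (suc s) im)) ⊎ col (v , p) g ≡ zeros)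
       typed (p , inj₁ c∈) = p , inj₁ (zip-∈ (Vec.drop (suc s) im) c∈)
       typed (p , inj₂ c≡) = p , inj₂ c≡

module TargetGraphs where

 open import Data.Fin.Base using (_↑ˡ_; _↑ʳ_)
 open import Data.Fin using (#_)
 open import Data.Integer.Base using (+_; -[1+_])
 open import Data.List.Base using (List; []; _∷_)
 open Vertices

 adjacency : ∀ {N} (G : Graph) → Fin N ↔ Graph.Vertex G → Matrix N
 adjacency G E u v = Graph.weight G (Inverse.to E u) (Inverse.to E v)

 module _ {k : ℕ} where

   private
     toTB : Fin k ⊎ Fin k → TB × Fin k
     toTB (inj₁ j) = t , j
     toTB (inj₂ j) = b , j

     toON : Fin k ⊎ Fin k → ON × Fin k
     toON (inj₁ j) = o , j
     toON (inj₂ j) = n , j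

     fromTB : TB × Fin k → Fin (k ℕ.+ k)
     fromTB (t , j) = j ↑ˡ k
     fromTB (b , j) = k ↑ʳ j

     fromON : ON × Fin k → Fin (k ℕ.+ k)
     fromON (o , j) = j ↑ˡ k
     fromON (n , j) = k ↑ʳ j

   enumTB : Fin (k ℕ.+ k) ↔ (TB × Fin k)
   enumTB = mk↔ₛ′ (λ i → toTB (Fin.splitAt k i)) fromTB
     (λ { (t , j) → cong toTB (Fin.splitAt-↑ˡ k j k) ; (b , j) → cong toTB (Fin.splitAt-↑ʳ k k j) })
     inverse
     where
     inverse : ∀ i → fromTB (toTB (Fin.splitAt k i)) ≡ i
     inverse i with Fin.splitAt k i in eq
     ... | inj₁ j = Fin.splitAt⁻¹-↑ˡ eq
     ... | inj₂ j = Fin.splitAt⁻¹-↑ʳ eq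

   enumON : Fin (k ℕ.+ k) ↔ (ON × Fin k)
   enumON = mk↔ₛ′ (λ i → toON (Fin.splitAt k i)) fromON
     (λ { (o , j) → cong toON (Fin.splitAt-↑ˡ k j k) ; (n , j) → cong toON (Fin.splitAt-↑ʳ k k j) })
     inverse
     where
     inverse : ∀ i → fromON (toON (Fin.splitAt k i)) ≡ i
     inverse i with Fin.splitAt k i in eq
     ... | inj₁ j = Fin.splitAt⁻¹-↑ˡ eq
     ... | inj₂ j = Fin.splitAt⁻¹-↑ʳ eq

 letters : Vec Letter 8
 letters = a ∷ b ∷ c ∷ d ∷ e ∷ f ∷ g ∷ h ∷ []

 enumLetter : Fin 8 ↔ Letter
 enumLetter = mk↔ₛ′ (Vec.lookup letters) index
   (λ { a → refl ; b → refl ; c → refl ; d → refl ; e → refl ; f → refl ; g → refl ; h → refl })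
   (λ { zero → refl ; (suc zero) → refl ; (suc (suc zero)) → refl ; (suc (suc (suc zero))) → refl
      ; (suc (suc (suc (suc zero)))) → refl ; (suc (suc (suc (suc (suc zero))))) → refl
      ; (suc (suc (suc (suc (suc (suc zero)))))) → refl
      ; (suc (suc (suc (suc (suc (suc (suc zero))))))) → refl })
   where
   index : Letter → Fin 8
   index a = # 0
   index b = # 1
   index c = # 2
   index d = # 3
   index e = # 4
   index f = # 5
   index g = # 6
   index h = # 7

 -- A maximal graph with some weights of norm 2; it contains a graph with unit
 -- weights that is contained in none of the graphs of the theorem.
 X₈ : Graph
 X₈ = record { Vertex = ON × Fin 4 ; weight = hermitian listed }
   where
   open Gaussian

   table : Vec (Vec ℤ[i] 4) 4
   table = (1# ∷ 0# ∷ 1# ∷ (+ 1 +i + 1) ∷ [])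
         ∷ (1# ∷ 1# ∷ - 𝐢 ∷ - 1# ∷ [])
         ∷ (1# ∷ - 𝐢 ∷ 𝐢 ∷ - 𝐢 ∷ [])
         ∷ (1# ∷ (-[1+ 0 ] +i + 1) ∷ - 1# ∷ 0# ∷ [])
         ∷ []

   listed : ON × Fin 4 → ON × Fin 4 → ℤ[i]
   listed (o , j) (n , l) = Vec.lookup (Vec.lookup table j) l
   listed _ _ = 0#

 T : ℤ[i] → (k : ℕ) → Matrix (k ℕ.+ k)
 T ζ k = adjacency (T-graph ζ k) enumTB

 Σ-target : Set
 Σ-target = Σ[ N ∈ ℕ ] Matrix N

 targets : List Σ-target
 targets = (8 , adjacency S₈† enumLetter) ∷ (14 , adjacency S₁₄ enumON) ∷ (16 , adjacency S₁₆ enumON)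
   ∷ (8 , adjacency X₈ enumON)
   ∷ (6 , T Gaussian.1# 3) ∷ (6 , T Gaussian.𝐢 3) ∷ (8 , T Gaussian.1# 4) ∷ (8 , T Gaussian.𝐢 4)
   ∷ (10 , T Gaussian.1# 5) ∷ (10 , T Gaussian.𝐢 5) ∷ []

module Certificates where

 open Certificate
 open TargetGraphs using (targets)
 open import Data.List.Base using (List; []; _∷_)

 τ₊ τ₋ τ̄₊ τ̄₋ : Twist
 τ₊ = Sign.+ , identity
 τ₋ = Sign.- , identity
 τ̄₊ = Sign.+ , conjugation
 τ̄₋ = Sign.- , conjugation

 seed : State → Seed
 seed (s , N , _) = s , N

 P1-step : ℕ × Pack
 P1-step = 0 , 0 , 0

 P1 : State
 P1 = start ▸ P1-step

 P2-step : ℕ × Pack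
 P2-step = 1 , 0 , 0

 P2 : State
 P2 = P1 ▸ P2-step

 P3-step : ℕ × Pack
 P3-step = 1 , 7 , 0x7a734a6e8de0fd83074efada218c944811d23a0a18f7b8bd82debce61a5818419

 P3 : State
 P3 = P2 ▸ P3-step

 P4-step : ℕ × Pack
 P4-step = 1 , 18 , 0x80e28863c4eb47c5d99c4cb1434a60e1406bf82b322e11112b30406bebb4c21e7d54e20ca868efbb41657cc53a54611ebc21056d514fb0bc780a1cca1f977728320809b79d8c137f13f4dccbd980b5069b64f3d3d715c8e179792a338ecaf3dc9cf8af5264c200c05

 P4 : State
 P4 = P3 ▸ P4-step

 P5-step : ℕ × Pack
 P5-step = 1 , 47 , 0x57d95e2137cad4c0b7bec31916c9ea0feff0b01e3b70dcf61433db5f67ab5a5e85275b230847555aa6b7866bcf60695c3a36419879d4b020a979ceacbe56efcb10fa8ba5c888a9fafe76622cdfd2e73a6a459ddadda2edbbc3ffd56239062f8bbe8e02cb8788b07ab4652d412a267de739b09cdc7578ab18cf45b288771cc91483ecc78f14279234e7722ce0d1183c1e137d6bfdfa2d762519e6103c4b8de3f1821ef8bc33aa78337a7908af90e6e5cb263548d5b37631f11d66fd5f57a56510b01c5d612b76564edb90068ddced95bb0066f7dc851245738a06218b1458c6e01ea83f52e6a2e7cff40d639494bfca8a9c9ce5e6fab11e2889318ed07675e9aff71054a8a4c126950cea56c0c3cd1c42d632b09f2eb0656c2b4f92ed51c7b4d6f8908eb1491d3ab31db5e0341429ee98bb0f049af10107fc749104aeea4889ab4b1346e784ea51d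

 P5 : State
 P5 = P4 ▸ P5-step

 E6-step : ℕ × Pack
 E6-step = 0x100 , 18 , 0x2bf06ece9db7e9ccf46736308585c38d986e5a63c78c6d1800de4ccb12b2606c17a2f9cd48775d739cc876bc0f6e461cc9503735bf5569af81dd12e4ffe412a7d4b64372dfff7b879135c3d606498e662ba42c0bb662cf3e524584ef1e677e83cc995a465e9d41878c6b2f27a6a7600b9e9e76b734ebb237f3b2d200dda13347f8986e474900127ab1741ea748afac32be0d6

 E6 : State
 E6 = P5 ▸ E6-step

 F6-step : ℕ × Pack
 F6-step = 0x10301 , 13 , 0xf3f60dbe85880c7ab0d0a7dd59ebe80fc30dffb382f90964de68288bcc539b4a3d072696fe319d147015825f77376d7d20ca217ffd5bab6aa4f048b6621665ecc0f4d8ea19389ea3d788e00359f848966ad44b893a6c94d83199979a862084ef5ce89ad7be567db6c0e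

 F6 : State
 F6 = P5 ▸ F6-step

 G0-step : ℕ × Pack
 G0-step = 0x10 , 18 , 0x1924efd6579f86467ac03db03e385d9bafe59be76464941fa1aa39d705cd40ca12f7d0873299c95dbdc819aff39c0c6d1350512ad92c3ad09505fe29856f8d933d7fdb7546e8515723a9dccc1104efcdddcaaf4c62df8c0cb235a2dc5a72d4a433bfd704a97a9a5ff7acc7a3d5d91c8577d153d3d245c301ca7cfd1dc6b7491ecd6b0bca7b4455268f6aa1a6c365167aa7383123c99e4b4fb7670aaaf84984fc26b90ff89d30161

 G0 : State
 G0 = E6 ▸ G0-step

 G1-step : ℕ × Pack
 G1-step = 0x103 , 20 , 0x18e984f51a922e7867578a5507e30793bdd881e59239a4e8fd8eeece578149ef6b14375ddaa9b77fdade765b5518431d83c109465554f35403ebbf2141d2c6f21dd8835f611d80d99764d899132854e066d61257d4e9bf45f5cb45e8c93d30b903445653a7a266a42128a81f308c3c3c3dab27ebf2eb3f051847c16538c2f6e3d2e99eb1ceda536a68996a70215917a5cc845dee819be4fa29f4b765e9e82b4d6f66316f6973c843058c1885a105e4ce840a5df0fbf9da6d41df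

 G1 : State
 G1 = E6 ▸ G1-step

 G2-step : ℕ × Pack
 G2-step = 0x10300 , 15 , 0x2a636374170654c29c0ecc8d8e7617bbd14c2f3c217e520979e27e856944675d64be47bd7eb0007a6ab00503b6487bdbe20438e38b3514c9631e4a66c16d6a748e1731facf293e22ff84b4427482254273fb105afcea3b285af4b5ef855162b5a83aeefa17d74c8f4fd8d85641c8fa8332887a4223897258dc5d787f77688291c612de37ca823eba521fc64

 G2 : State
 G2 = E6 ▸ G2-step

 G3-step : ℕ × Pack
 G3-step = 0x100030 , 18 , 0x1abc01567d497a8135d01acca550f711fb8d4269b53637a9083721609462c5be79423a738253b067734706717a9a9e850bafbd45a51b8a87fa7eda98eb393be493f4910635b0cf3ce42a8e1b699c2270c97bcbe3ba76af6d8e83da7ebdd18af9c0ca05d3897ea076b9b0773337f3e3408a99aaa11f26014ebb8fd976277f83fbce17939c90915469d51385b07a6e5b27b861bb4edad138c05ccc315eea0fa9d9feb5e0d29db63a6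

 G3 : State
 G3 = E6 ▸ G3-step

 G4-step : ℕ × Pack
 G4-step = 0x10 , 17 , 0x4bcd7ab9ecfe6fcc5fa3331d6db4f1d33fe5fc2d5f3303f0f1c2b7e9f1d88e35e426ad29c4db4d7a72230235cbbf60a7694f6d7bdbce4f8a96d3ea40ae1c8e772becab050c26d0ad5802aac3d3f09dca24d92e3aa6b096fa3b6d7f7ae8e7b8654d680870da60478013555ae7c5412ef2bc45cba864e5b68d8f8484a42be1b430096379f84d12d7179ceabdbe8523fffe030081d2c035befd05a7a92b7c2d

 G4 : State
 G4 = F6 ▸ G4-step

 G5-step : ℕ × Pack
 G5-step = 0x10300 , 15 , 0x2a61d2e497ac24f440f04acc343d5a6c93f804e38e25a131b816100761e13e2644ae2444e70d3225f061308a2863a5e4103ed868b4c31215202b1d8df9a51fa6151ce814ab18222aff949a95e6e6a7a95da064407290609ec0c93381ca050d42e53db3a0e342812cf2cdc84f594c81b350dd3a4acfd59a2236000553d91b6f34b4dafb100620a1e5a45338b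

 G5 : State
 G5 = F6 ▸ G5-step

 H0′-step : ℕ × Pack
 H0′-step = 0x14 , 4 , 0xa3676868653b3b2555562fd45eccac8d058d2

 H0′ : State
 H0′ = P2 ▸ H0′-step

 H0-step : ℕ × Pack
 H0-step = 0x124 , 6 , 0x319354acdab9fa2c19560fe426ed2ee44b4414e0b37c4464e8bbf4a9e6cf32118b7064

 H0 : State
 H0 = H0′ ▸ H0-step

 H1-step : ℕ × Pack
 H1-step = 0x113 , 6 , 0x2d98e927877e87920f18dda2698f88a71274139557423348976d9d86943c57ae1af84c

 H1 : State
 H1 = P3 ▸ H1-step

 H2-step : ℕ × Pack
 H2-step = 0x143 , 5 , 0x87109ee8d12107b9a5483074004a6e9b6c58d4f21d76f00a92c40b1a51

 H2 : State
 H2 = P3 ▸ H2-step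

 H3-step : ℕ × Pack
 H3-step = 0x14 , 8 , 0x62a7aea4384361201a381e1ad8f118089cf2debe73fdbd72c305ec4c5dfadfab005101679f6dfee582f9a6c480e24

 H3 : State
 H3 = P3 ▸ H3-step

 H4-step : ℕ × Pack
 H4-step = 0x101 , 4 , 0x1f7c63d52c78ac8d7b96ee1201d0e20e0a1f0e1bfe9657c

 H4 : State
 H4 = P3 ▸ H4-step

 H5-step : ℕ × Pack
 H5-step = 0x104 , 9 , 0x213850cd8b0a6fb757d4d0dca7f33f36d3bd623dd610a7920e7448692d35b8f75bfd2e210118e537962280e945e5870531ffa259d

 H5 : State
 H5 = P3 ▸ H5-step

 H6-step : ℕ × Pack
 H6-step = 0x103 , 15 , 0xbf1b5b8d8ea3b7a07b60b51ac30327cdd7c41444b9362efb5c72dcecc4950bd8ebdaa19ebd5100e079b47537db9b3e8d5afd4676eed34bfde30ca747d1aa9239caf65b747d6d05598d3ccf2e54a9354014a09775ef19a0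

 H6 : State
 H6 = P3 ▸ H6-step

 H7-step : ℕ × Pack
 H7-step = 0x10 , 10 , 0xc20523be6adb96f203ee83f89e91907d18e3d27b2434bab5f0452ef51e5494b0f1f95cdf2bd20c553bea53393a10474c54b13aba4a54f747e684

 H7 : State
 H7 = P3 ▸ H7-step

 H8-step : ℕ × Pack
 H8-step = 0x11 , 4 , 0xb2dca098ff6261a1228f5abfb25efaa649787

 H8 : State
 H8 = P2 ▸ H8-step

 H9-step : ℕ × Pack
 H9-step = 0x14 , 4 , 0xa3676868653b3b2555562fd45eccac8d058d2

 H9 : State
 H9 = P2 ▸ H9-step

 G0-tree : Tree
 G0-tree =
   branch 0x100030 (23 , 0x369d6fdf922ab0945d8d303264520b901b539d52e62c97acf7452a33b17eb58f845724fd861d5517aadbe938b66b9000c62e24f19bc87782a9e7842b2dbd6ea08c1fe1aa9557f80f011497ca49aef01c33affddf5be0308235d49a8c5a023a78f632b32b34d120d6b2c5ae9a91d27edc513b80a1459bfc2082367dda7732ca48ae2719c3ca41cee74197e841e64321f6dff77fbb72c7b5bfa8957d8dafc2e1416016f53dbb4b1788c30c538f673929bf505d933233ec75d10e619fbc469073e1a644352aeb8676b79b2b927742646be87eb5a9edefdfd6135dc102beaa7ac04b7f2d0d2e509c79165d25baa91e0fb0d99)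
     (leaf (55 , 0xc7a2d3c2e9d800bd22677243e00de9f698586a0ee21419d512e8a0b4df1b6fe53bc5300ddc0af56244e17943bb8520a7d95ef4f3bc3ae80ebbdf1e8b96a56d5ef2cddb534913f0d2c02a51191a81a9e2cf8929bdc6732750b68430ffee40d316d971d98804260111de1962e8b33a4ca78aeb77db23f4fd139897b399225740dea3b218186c2bfd0a6d5f969cc21a09654bf67bc001c59a39bb2f37054e49fe21f24741f3a21d4acb57782abc639aff6f21c247bff15eb88bdea8490dbb803895b2b2c24ac6054ad299a5447e88549f2497bcb923ae96e489267c6d44da903d1b4541ee657b6f0ad3de9d4beda336fefbb0c6450d2431b1f6116ba213f1af250a3c5f727593fa128dd751c47ce1dccb2f61511027abd7144889d48274b3b58c2733700090ac07f39ac3dbf115347028f60e047b667b4c32a406b680391e7c244fb0ec40b3392e0b5d2c35d7be33b680e10bffce2b824ae36b5de3b53ea760b31e46de22ec33b0263060457bd1139ccf3fc4a955554a63f052405909adfca3aa00b8f02bcc19ca4a0fedebaa795d1cdd830d457ab15206739178235d63d873a7925d5e88b5ce5889fc55b6cdaf53d9c55a917658a1c8e3c2bf0a77feafaaa31b1fb88e69ff655b1c0b24d9e2678094bdbb4eca8a02684c0227d08abbafa7c94e934a7eee36d732c45795b8d59974b5758ff809d5af183badcc050453a456eedbcb90ea30a9aed0bd5844d038caa586065e951fd0bcfbe74a08063b8338c6eeb766d3f294d4e651516b020904ffdf3c425d7fede40975e470fa3465b3681a8a0e95b23f5d33d0e4a1ca1a3e6054b818c4388a3234253f3cb7882ee5b547d9d17b3e6a8c72872f5b56af40ea562017e3423fc403e3a27c8a40d32f0bcc70aa441)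 2 τ₊ 0x341a3a102a263c1c0004080c322e1620)
   (branch 0x103000 (16 , 0x1748b96c6996235f689272157afee287e768536a10cc0395a40ce7598265ef9220b9f08730646da1b78ad7f81b063dee6d3a9922a5e16e3242580e322e2aa1955b9ddefe791fe3fe9d6a726374cfc89ae3407cf63cf5f659b5b7f6e3fa98991e2393c8bcc8fd0badaf527c1adc87e950b7d8be7fbc1663373994ec314e1650aaf1c5ae47019e4ca17063c44b139f01ecf857626090b5ac41c124cd8d1ef85117d9bb1423e48a0fe)
     (leaf (41 , 0x54e098577337ef056fbc8b30800a65fadaad8fbc4593382e11f28cff96e5fdaf4377956c13c6679a2f6411f21efa3ada7ec8308cd243f2d3b8767522ce45ea5de94258dce4e5e0cef0b632b6923d8229940f9ad07fe887035efeb5610536e556707eaa4d58ded2f344c8386b43ec73a68542962b11d65c9fcb0f9b7005b10616a3bd4154e7d2dae1ff410e0b2f34601623e857ad124d4d720ebed4fff97d8a7c8e8befcbfd0d77c62825f55e44ded89986051f2be7066c2e5a7fae23ac29bb8b5fe27c799fb2ba20b3c34436adde5ee37573faf975ffda30df7c0a8a0243ddc3ae96171e55a135436f237ed7a9a4b1f4ac6f3f672d43b8c28783d23981b4387bc95f42a9d91fd9527ccc1afc1e75c72516a28310413bc7082ad5e4a500571a7865a7c1b354d87fc2460f3b4d13d58d20ba5aaede674deea4da4f88fbecd4df5cfb8af5a2ab0ece74ad516fce56ceb4d5e75e20aef3361f219e8f350b7bef5ad4349f737816a1ab353fb347362310959ec1965a25701099269cf9c6479cf525d9090b6a1994a81e37fbf03118f7c79fa54a16db5f723bc93fce8b6806e0bc36fd72177b5b404927f42535b4b6772465f991a109c085069b57030ecb066bf07d265c728741d91cd3441d30ac164d567f8b392da1e51c6910f879a7dcd6)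 2 τ₊ 0x361a3a10263c1c0004080c322e162a)
   (branch 0x1033 (14 , 0x2619df9561fae11bc7abcb1b42fe16d55c4dd0723f4f7cf9221df16221595d8b58d65f2250f8e02ebfb60972b23d0d60bf261fc414cde9a82ac9d706bb07db7e2d45a627cb19b81d1c00c0f5b741fa050ae613f5ddfb08c4923dbdbb5c946674bd3ba181b066b62e21adc9fdd9ed2e2b165c0d10fbbd7ae0f44d83426eb4c1641508ef863bcd8e4b3573b54ff6db985902a3f)
     (leaf (27 , 0x877d70a64f60206b5388fce9faa91bf101d4d0980811bc9400f6b5275c6ffd7e3f5666996c775c46fcb8970491474968208a464b3823b65fe1914e15914a565657e25aa1f39870046d316e3526f8fa84856d4d924dbbef454a27f904234f41b791bbfbcb43c3b30783172c1ec0458232f76514fc418f74c7b0b5b75ed5f269dbdecea317fbc1e702c795ba356e4fac48b9acbd59fd5c7f0ca268736404d090153fcd312191cd1cd9bcb680fd76cd57898c1735c6eb49e78df9f218225b5b212c1e3b9f7014311eeba48d520051853a7b455c283e285e91809968fbf72115f2171facb58eeec124089b69a8773c24ded0457237d061e65bf51196725a1410898c58ec940ece8e13d932a4086ebec0a99f2da8c8308b5ef88959a19b6afa3ae3e4a80162248770b3da08f04658117c35ef63d2f5d50826475aa72) 2 τ₊ 0x361a3a263c1c0004080c322e1610)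
   (branch 1 (14 , 0x230c52a548316fa09736abe2c4f20545066405a758ad32c8671b65136342e8b1f01828ce61e4d97ffb3a6c41d5edc7c087c73ba699da01cbfd0f0aaa7d7d2a957ba35a6c397339c8afeda1d1e9f9513530bae1af71f29b158c25b5e9d2ef0ed596e2e47d3ddc319f2c0052c875fac590921a8cc51ec4f070881b80ddb55e03fe364227bb6d1a94cd17064846e9672722bbeb7)
     (leaf (25 , 0x14afba31dd9cef18d34ebab3a1cfe14c7776b5ec8a60b65ecccbe236ff7f90c9a1a81d4f93832d00d96bd1c7dfc468acd4e37f0251b6fadf13d715a24a996139f7909bbb279ac369da574e076902c2a5063cce9bc3ff8ea40d942f492823c6f4e936e3fd462ad214f72d90de9a99e26cbb6116c14f5bdd3e65316cfb6dc9b9f58577506c31df818fbbc4481b54d0b1e5eac561d7a0b4b61d3c52f4d66e7d191fff72d4ea3682e94a705229dd6ec2f788d2350387b0e3cc41e04e92aeb939ba9ecf785453e21f86cc301566e3692f025723934390d786f0041144ed6f2cac30c17478b0c714dd7b491fa3094fd1b9305927c78d03069564f820198145fc7425bfdfa387c9e41cbc323843b99b760d4b5e18a24b94e33f2456febb06be2812fc3bb12aa) 2 τ₊ 0x363a263c1c0004080c322e161a)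
   (leaf (44 , 0x2860a68f01afca1840f3edc4bf533900b7eb63ce71556511ca12cb57d3e173d30a121b5ba6a310206130d7979defa9314d7fb329cc7ceef69e687ee7c2d827d1f36f263d662e606c88e0df8e2fc8730d8661f70d130c11a18a5141ae1ab4779177a059bd0511de0ec9894f8bd3afa912b3411503d8e5d0523fd7de8f7e7c48a851684589eb63a37cb37194c1326b94a98092a3e107204647319c37d443b4923f5d940756446a96c83b645a36ea34ec6bda24ae22c637605847252a6bd24a1b7b5d28ca9b5ced8b7e9f1df20f2a9287d2773653900b9f847f4eb3935c5bb52948805492c58a43ee5e72459050a7e94a837e663f2c854e9ef221b2d7baeaacc73f2a263c7a87bfbf0e0fb4198a22695d516224bbf8aa8dc165b77a04784d331e0c4ecda1a16fcc56e088921012d55e3325f5f4bc7de7f04700db657d0b36e0504b9142be16faa86644980d39ee60633ab5547203ad2a8fd73f0d24ed6a233549edd060e16c8ca4a3fe207a3dbc2297a7c7092a437014bfaaa926cdc830e56686b18351d98f30e2ce15542e7f38e4e7d9e71f475487f80e2a48e5c09111da7b0a36aa39c141d06db79b9a2a273d5bf5272011e964b8a6df5c8d312480fcf5476eade3f1ba3dbef8cb4f7804ca6a) 1 τ₊ 0x140c1810202836001c06260a2e32))))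

 G1-tree : Tree
 G1-tree =
   branch 0x1000000 (0 , 0)
     (exit 0 τ₊ 0xc1014181c0800)
   (branch 0x1000003 (0 , 0)
     (exit 0 τ₊ 0xc1014181c0800)
   (branch 0x103000 (0 , 0)
     (exit 0 τ₊ 0x8061200180e1c)
   (branch 0x100 (0 , 0)
     (exit 0 τ₊ 0x1c1814100c0800)
   (branch 0x103 (0 , 0)
     (exit 0 τ₊ 0x1c1814100c0800)
   (branch 1 (0 , 0)
     (exit 0 τ₊ 0x41014180c1c)
   (branch 0x1000300 (10 , 0x76ed3e17dae4d1365ab9e8a7c95853e068d20b853d8189a93aa436ac82184e63eb4c90891705be496dd2f775479800da54a17af7a631fa50604f9023f8d17c0400534bfd011cfde6bc70644c4f76ab441adb2d4a26294f092ac21c3f46a61c99ed8492643a007857f)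
     (leaf (15 , 0x10688d1951bf1d62b7bc479af9259efbb3093ee8642b181fc5ca318327f133ee22293b492365a0210d88b31923f21c01bd21674b15d8197d680bb0bd813e9c33f89c544e00bc05b466eb04f421182f54740ac490d0abb30d4b2cdae7c696aae5a5479df1161b7b629ba34143b13fb7423167a0782c81c8b2094f3886f0b8061283ed68f84efc61e2bf30781f3751bce22753fdaa082189baf37792eff6995a255cade5a1b7f9ab4b0a56e5c5a994f) 2 τ₊ 0x1a3a20260004080c322e103c)
   (leaf (15 , 0x1817ac3a892d7b9433db2c27c36e5d776103e0f94862f0e0614f5ecb00371580179c0978b614bd99b5e7850196b52e86eaff6d46f02693ff181f21b134472e0f25b672b7a8dba5edaa0c31c2a903a47e83eb8ef06e8f771c501b4964a72176908b841566842bbecada6226e54088b4f71c9925768953a84680c22a689418713cb195bfaf20fcbac28897f1b10b984efd11209ba26b3a1c8c78b797043c) 1 τ₊ 0x14102028001c06260a2e0c)))))))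

 G2-tree : Tree
 G2-tree =
   branch 0x1000000 (0 , 0)
     (exit 1 τ₊ 0xc1014181c0800)
   (branch 0x1000003 (0 , 0)
     (exit 1 τ₊ 0xc1014181c0800)
   (branch 0x1000300 (0 , 0)
     (exit 1 τ₊ 0x814181c00040e)
   (branch 0x100030 (0 , 0)
     (exit 1 τ₊ 0x8021a06101e0c)
   (branch 0x1030 (0 , 0)
     (exit 1 τ₊ 0x8021204180e1c)
   (branch 0x100 (0 , 0)
     (exit 1 τ₊ 0x1c1814100c0800)
   (branch 0x101 (0 , 0)
     (exit 1 τ₊ 0x1c1814100c0800)
   (branch 0x10 (0 , 0)
     (exit 0 τ₊ 0x814181c1004)
   (branch 0x1000303 (7 , 0x101e313dbe46e1563235dcdcc4ad5e12146ae17d1aeb91f98255dd04f4b870936329a5cdacb38f281045882c00da8243dc1c1b169deb9f3fbcbc5cfd9382cdd6bfd1ecb8f722fc580e1)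
     (leaf (8 , 0x366598edc78c3c057c1288ef8ea00ba9f0439909a03150010f4af7296ed9189e3287032b92bca57e658f592627c680b76f97605d5db9f3a1140348cb603d0f95806e51d0c283e3b924d7d8cd07a38a3fec3c47218d8774b10edb919f37) 2 τ₊ 0x1a36260004080c322e2a3c)
   (branch 1 (5 , 0x1c611f800298ad576865470ab62dd4f455ad4df4627323a6ec384e149e9bbd5cadf10b05f19d0b7fc5bdd23f27b4afd5a8ad0d0cf)
     (leaf (6 , 0x13231c75444fef1aaf7be85241a0548dbed3ce02f197fecbdacd0fd3da5dd66401a279657a36bd35494fbde697598bb316b579581f4e28e6ef32ae857f4a90d37a8e4e1b74ac) 2 τ₊ 0x1a260004080c322e2a36)
   (leaf (1 , 0x589aed3a5a158aea95161) 1 τ₊ 0x20001c06260a2e18))))))))))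

 G3-tree : Tree
 G3-tree =
   branch 0x1000000 (0 , 0)
     (exit 2 τ₊ 0xc1014181c0800)
   (branch 0x100030 (0 , 0)
     (exit 1 τ₊ 0xc1014181c0800)
   (branch 0x100033 (0 , 0)
     (exit 1 τ₊ 0x100c06000a1e18)
   (branch 0x103000 (0 , 0)
     (exit 2 τ₊ 0x814181c04000e)
   (branch 0x103003 (0 , 0)
     (exit 0 τ₊ 0x1c1814100c0800)
   (branch 0x1030 (0 , 0)
     (exit 1 τ₊ 0x1c1814100c0800)
   (branch 0x1031 (0 , 0)
     (exit 1 τ₊ 0x1c1814100c0800)
   (branch 0x100 (0 , 0)
     (exit 2 τ₊ 0x1c1814100c0800)
   (branch 0x10 (0 , 0)
     (exit 2 τ₊ 0x814181c1004)
   (branch 1 (6 , 0x137e5e27ae30830596643a3c1649485a6c25081be572461057f7647b39f3d9a226b0ae45ea63fcabdda29656c90694df79439660a2c616d549116c3f215242)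
     (leaf (6 , 0x11a918e2fe7d52f9d2a561610d583d4399fb18a2213e10fbffa4dbfb7ccd4e3626b9c04b5be196e2afb1a5c43df229aa11025c83496ff55874fd2b65cacc50918c504642236c) 2 τ₊ 0x36260004080c322e3c1a)
   (leaf (2 , 0x42a3fc5cb8be0538d5f6487619c978ae14e249ceb9) 1 τ₊ 0x20001c06260a2e28))))))))))

 G4-tree : Tree
 G4-tree =
   branch 0x1000000 (0 , 0)
     (exit 2 τ₊ 0x40c081c001618)
   (branch 0x1000300 (0 , 0)
     (exit 0 τ₊ 0x1c000e12160618)
   (branch 0x100003 (0 , 0)
     (exit 2 τ₊ 0x4021a16121e08)
   (branch 0x103000 (0 , 0)
     (exit 1 τ₊ 0x1c080c10020416)
   (branch 0x10000 (0 , 0)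
     (exit 3 τ₊ 0x1c1814100c0004)
   (branch 0x1000 (0 , 0)
     (exit 3 τ₊ 0x40c101418001c)
   (branch 0x13 (0 , 0)
     (exit 2 τ₊ 0x181c080c100004)
   (branch 1 (0 , 0)
     (exit 3 τ₊ 0x40c081c1018)
   (branch 0x100000 (6 , 0x155b281a199abe896bfedaa284911692267027ef8ef529323b5f596be9c88d88055aafeecfbb2e202c4da05834590aae737f601ef5b3b7217b1d242761622a)
     (leaf (5 , 0xdce7793f88c1e4a926d692c87f10d6a6a33b15096602a8df302680003e79ab91a50ca343e0c4bae236ad3bd7c3023d01565e81ea603a95a66bf7) 2 τ₊ 0x34100004080c32261620)
   (branch 0x1003 (4 , 0x2900ae71308025b31a3806e4420a79bbef2b44ce75beca16e06b3567ff3b5859c9b680913f18b39755fe)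
     (leaf (2 , 0x1afceef55c0b79a23436ff34c73a415df7d6a7ec747e1a5) 2 τ₊ 0x360004080c32261610)
   (leaf (1 , 0x6fba84c99f98e31256b1d) 1 τ₊ 0x18001c06260a2032))))))))))

 G5-tree : Tree
 G5-tree =
   branch 0x1000000 (0 , 0)
     (exit 2 τ₊ 0xc081c18040016)
   (branch 0x1000003 (0 , 0)
     (exit 0 τ₊ 0xc1014181c0800)
   (branch 0x1000300 (0 , 0)
     (exit 0 τ₊ 0x418140a0e1200)
   (branch 0x100000 (0 , 0)
     (exit 1 τ₊ 0x10061a1e0a020c)
   (branch 0x10000 (0 , 0)
     (exit 2 τ₊ 0x1c1814100c0004)
   (branch 0x1000 (0 , 0)
     (exit 1 τ₊ 0x1804120e0a021c)
   (branch 0x100 (0 , 0)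
     (exit 2 τ₊ 0x1c080c10060016)
   (branch 0x101 (0 , 0)
     (exit 0 τ₊ 0x1c1814100c0800)
   (branch 0x10 (0 , 0)
     (exit 1 τ₊ 0x181c080c100004)
   (branch 1 (0 , 0)
     (exit 2 τ₊ 0x1c1804120e0014)
   (branch 0x1000303 (2 , 0x487207df7538603b72f7952f511ccb550f7204393b)
     (leaf (1 , 0x110b6f5e247197b1ca97786d) 2 τ₊ 0x1a0004080c32262a3c)
   (leaf (0 , 0) 1 τ₊ 0x1c06260a2018)))))))))))

 E6-tree : Tree
 E6-tree =
   branch 0x100000 (0 , 0)
     (exit 5 τ₊ 0x80c1014180400)
   (branch 0x100030 (0 , 0)
     (exit 2 τ₊ 0x1814100c080400)
   (branch 0x10003 (0 , 0)
     (exit 4 τ₊ 0x80c1014180400)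
   (branch 0x10300 (0 , 0)
     (exit 3 τ₊ 0x1814100c080400)
   (branch 0x103 (0 , 0)
     (exit 4 τ₊ 0x1814100c080400)
   (branch 0x10 (0 , 0)
     (exit 5 τ₊ 0x1814100c080400)
   (leaf (4 , 0x10fc8003d5edc300e8d71c41fcef3300143ad0002ee3782f78b7d0a681cff35baeb9dba58de) 1 τ₊ 0x1420001c06260a2e))))))

 F6-tree : Tree
 F6-tree =
   branch 0x100000 (0 , 0)
     (exit 2 τ₊ 0x80c1014180400)
   (branch 0x100030 (0 , 0)
     (exit 1 τ₊ 0x141804080c1000)
   (branch 0x10000 (0 , 0)
     (exit 2 τ₊ 0xc080418141000)
   (branch 0x10300 (0 , 0)
     (exit 1 τ₊ 0x1814100c080400)
   (branch 0x1000 (0 , 0)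
     (exit 0 τ₊ 0x1814100c0800)
   (branch 0x100 (0 , 0)
     (exit 2 τ₊ 0x141804080c1000)
   (branch 0x10 (0 , 0)
     (exit 2 τ₊ 0x1814100c080400)
   (leaf (1 , 0x2dc100a9663ca1d1b61) 1 τ₊ 0x14001c06260a20)))))))

 H0-tree : Tree
 H0-tree =
   leaf (8 , 0x1790e9f3a0b34aa2337e6b705bd0b4fc8756a87d7f6b21329f04c8a6cb2d4e022387ac363ec6b2109a268647b670e203903e7d05dc49ef06) 0 τ₊ 0x1c170c0400081318

 H1-tree : Tree
 H1-tree =
   leaf (3 , 0x42a3f780ea1cd817454062f26eab2e1fd8ed12337c) 4 τ₊ 0x161000040e08

 H2-tree : Tree
 H2-tree =
   leaf (3 , 0x42e410c6c723f9ca5711c40ddccb014d67377ffa82) 5 τ₊ 0x151000040e0b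

 H3-tree : Tree
 H3-tree =
   leaf (15 , 0x94b1795b52c86341afdc438dd584c687bd6dd82437fabc70ee7a0c7babff8d859919465234a10c021471446f6eb8a6d261d4d9efb38e79a3b27ee59dea49fcabb4bd3561b54132a2705afb6c8ab3ed26f7b0f1845d6b2f20f8d03f91752a181ccf7ccbb4849fc2208) 0 τ₊ 0x1508181300040e1e

 H4-tree : Tree
 H4-tree =
   branch 0x1133 (0 , 0)
     (exit 2 τ₊ 0x100c0800)
   (branch 0x1234 (0 , 0)
     (exit 1 τ₊ 0x10040800)
   (branch 0x1331 (0 , 0)
     (exit 2 τ₊ 0x10040800)
   (branch 0x1432 (0 , 0)
     (exit 1 τ₊ 0x100c0800)
   (branch 0x1030 (2 , 0x504b5f2701bd1e3363919485b6e0)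
     (branch 0x1030 (10 , 0x2341f9bfc283fd4ad885e2b2b0aa5dedf3a251f39ded169bf2aaa10bc8ed55392adb31e5d5d3b85880decc24612961d14e40957f3556bf2a30e2e7f2c240ed663166c3a76daa62404a9601912f051a2a9c4)
     (branch 0x10 (0 , 0)
     (exit 4 τ₊ 0x414180800)
     (branch 1 (0 , 0)
     (exit 4 τ₊ 0x818140400)
     (branch 0x12 (4 , 0x1276132ab5640935a2f33cb0cae54b5cc8f71a47130bd95fdec97df2f7d5eff14ec67c11532)
     (leaf (7 , 0xeaa5004cefbcb97da1ef0d0755498a169f8bf9f3e0b17310c9b5e520c6aa59f085b589c329f9b74d9e8a4bc31a64afaafafb41c0ad60c4faa090bc232f918ab63b08fcab778e28a996) 9 τ₊ 0xf1c2500041618130821)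
     (branch 0x14 (3 , 0x3beceac5b142e62870ffb2233d7f797fa938dd585bbde5cb4922526b)
     (leaf (4 , 0x25b900b751a5258bb09444e05971eb9acdeb1445c3e11537601603e5d390327433aefcdda163137944b7) 9 τ₊ 0x1c250004161813080f)
     (leaf (12 , 0x625c7ee2a1db5fcd845b5e7c40ebed9117714640086005f6a968f32b86410fc8d23299ef7e82827c491af0fe5673dd355d3d08bb0c4e3d7d0ce8eff3ec81bfe9b3f06161bd2d1696382ce04576ab350977297ab908b171aeae20212e12d50dc87dcb77fa9b19d9dddcd0e6162ec8e81) 8 τ₊ 0x220c1c26000416181008)))))
     (branch 1 (7 , 0x39c590a3a8c01acb73776aa6f6ab472c0a9f6ddbdbdfaa101a3eb410b9865999a875d9b172e03726e41ce2dd110922b67d47d606342fe56814)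
     (branch 1 (0 , 0)
     (exit 4 τ₊ 0x1418080400)
     (leaf (3 , 0x3256606ad35de45edd56801f9e46302a1c3ed189477140d89a63b203) 8 τ₊ 0x222600041618100c))
     (branch 0x1032 (4 , 0x8513e0e0b86f1dfd573d211cb6392712244a281aba6b47a8ea4b526627a3d3d7a)
     (leaf (4 , 0xf82e5ad5d94167246301250a2f7e1dcfef37a30686dab367487e267d9cb56ba547b400a655) 7 τ₊ 0x181d000412140f08)
     (branch 0x1034 (3 , 0x41e15b906de5f1614b9db5f103bfed5201f901f1d69895eef)
     (leaf (1 , 0x2121c8ee900e1c97b41) 7 τ₊ 0x1d000412140f18)
     (leaf (7 , 0x3988f74c4375e2fef8282f538fe38f90c352870bbc85ce28c872223cb8d3cee2e20665d961098c0f6ed82cfdc6dc69bd933bdd19bfe9da9d3c) 6 τ₊ 0x18081e000412140c)))))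
   (branch 0x103 (2 , 0x5791ca70c4fb41771a03d885dee0)
     (branch 1 (3 , 0x41e15b906d4dd42a7d72a4e0e82a57eda05b534b5e26249b3)
     (branch 1 (0 , 0)
     (exit 4 τ₊ 0x1814080400)
     (leaf (3 , 0x3be8fd6478a95ac4c646d8fac83a612b2a9c00d8bf2177965fa53803) 8 τ₊ 0x201c00041618080c))
     (leaf (1 , 0x1026d8225c148412b) 6 τ₊ 0x180004121408))
   (leaf (0 , 0) 4 τ₊ 0x40e10))))))

 H5-tree : Tree
 H5-tree =
   branch 0x1000 (8 , 0x274ba4d84e628d592e1f9f5e2abcb60f035ead855e82452340566e97dedcf277dc05fa81d5588ae9897d4a3880b2cf7488876a1a0b894a49)
     (leaf (1 , 0xedd12f4f4145510b) 3 τ₊ 0x1b1004140800)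
   (branch 0x100 (8 , 0x198ac050d7d07f8678e5e25ad665c6a8089442cb944a2456e95215b39b9a301ae0d481b16ee8912eb55be2591907e7b156f1d6c0c5e1a97c)
     (leaf (1 , 0xd922e72ee40ffbcd) 3 τ₊ 0x810041b0c1e)
   (branch 0x10 (9 , 0x1d00a519e08376d607fbbc97bdbea97037a3850442bf8eb0aa464793137c7e7d39d09ac2808b1954c71ea5077450d7969bae20a015b0d0422da5609b7e7cc5)
     (leaf (1 , 0x102874904cc5c264f) 3 τ₊ 0x40010081817)
   (branch 1 (8 , 0x153d56f08b98740ca91abba53ed633d7783b1d545d89f046e7100d2d4202edcb369369a01567491f0f528fe68b239725338e4587c46287dc)
     (leaf (1 , 0x12be27dc463279ed7) 3 τ₊ 0x81000180414)
   (leaf (13 , 0xc999e26644f864430369763d87ffff422a1688052dbda789d3d31d4759bbd5ee541969dbafd28f4943e4d58e863ae1ad3148cbf24ffefa7909ecaa6ef0a1cf1eadd7809065060306e55c2abb8fef615e4bfb424a7f20835b03fd8) 7 τ₊ 0x1812141d0004080f))))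

 H6-tree : Tree
 H6-tree =
   branch 0x1002 (0 , 0)
     (exit 2 τ₊ 0xc100004)
   (branch 0x1004 (0 , 0)
     (exit 2 τ₊ 0xc100400)
   (branch 0x1010 (0 , 0)
     (exit 1 τ₊ 0x100c0800)
   (branch 0x1020 (0 , 0)
     (exit 0 τ₊ 0x10040a00)
   (branch 0x1030 (0 , 0)
     (exit 1 τ₊ 0x10040a00)
   (branch 0x1040 (0 , 0)
     (exit 0 τ₊ 0x100c0800)
   (branch 0x1200 (0 , 0)
     (exit 2 τ₊ 0x80c1003)
   (branch 0x1400 (0 , 0)
     (exit 2 τ₊ 0x80c0110)
   (branch 0x101 (0 , 0)
     (exit 1 τ₊ 0x100c0004)
   (branch 0x102 (0 , 0)
     (exit 0 τ₊ 0x100c0004)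
   (branch 0x103 (0 , 0)
     (exit 1 τ₊ 0xc080600)
   (branch 0x104 (0 , 0)
     (exit 0 τ₊ 0x1004010c)
   (branch 0x120 (0 , 0)
     (exit 2 τ₊ 0x100c0008)
   (branch 0x140 (0 , 0)
     (exit 2 τ₊ 0x100c0800)
   (branch 0x12 (0 , 0)
     (exit 2 τ₊ 0x1004030a)
   (branch 0x14 (0 , 0)
     (exit 2 τ₊ 0x10040a01)
   (branch 0x1000 (7 , 0x2f812e7e09767b79359e0664f4a34de6ad09f727958880a0646b31c3fb839e4a088b3efd3affc2717bc0e41d80f0c47f33)
     (branch 0x1003 (0 , 0)
     (exit 7 τ₊ 0xc0a16060010)
     (branch 0x100 (0 , 0)
     (exit 6 τ₊ 0x414100c00)
     (branch 0x13 (0 , 0)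
     (exit 7 τ₊ 0x100c0a020414)
     (branch 1 (0 , 0)
     (exit 6 τ₊ 0xc10140400)
     (branch 0x1000 (14 , 0x2abc935b753d87613001616dde58717e7c7a4a293a0ef4fc426bf803d1b6727c028e28ffb48aef4a4c1681a0d8f1311c91d891f2fbea848435dc54a489fea9755c7e6e2ac85c9b3cbbc31d47e8e556d74c226e699cefcf9ff4b289bb7f9e77fa607529cf043bdc07717bfdd5639ed4408ec0)
     (branch 0x100003 (0 , 0)
     (exit 8 τ₊ 0x100e1a02040a)
     (branch 0x100 (0 , 0)
     (exit 12 τ₊ 0x414180c000810)
     (branch 1 (0 , 0)
     (exit 13 τ₊ 0x4141808100c)
     (leaf (0 , 0) 1 τ₊ 0x1c06202818))))
     (branch 0x10 (10 , 0x28e748d8a7d8042d8e61897f5f1d9ee4360193a7ddd3d9daf81b3245e12d0f415b71ce88b0e5f644f7b0a80bede07987c57e5b4864457c5bf71647157c620335521871515db39260fa43931601eb612f91a)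
     (branch 0x100003 (0 , 0)
     (exit 8 τ₊ 0x101418000608)
     (branch 1 (0 , 0)
     (exit 13 τ₊ 0x40c18081214)
     (leaf (0 , 0) 1 τ₊ 0x1c06202814)))
     (branch 0x102 (4 , 0x7a6a97652c306b6467d3f0ac6af441fee78927eb4ab1b2cf50e2b4f582413829d)
     (leaf (3 , 0x3258698b5d314bf849e05c3597a5886eff5e499579f2425e4a488675) 9 τ₊ 0x202500040818130c)
     (branch 0x104 (3 , 0x41e3836db718280df617e443f75546de2d1e67c268f526ba6)
     (leaf (1 , 0x34133b0cd838904d5ac) 9 τ₊ 0x25000408181320)
     (leaf (6 , 0x1f4fc7f89de27e8fd529d0abf3918472cf47e38607f6a61b2255cfca46f7d695ee825d01bfa729f1a3235f767b99bcc1fd) 8 τ₊ 0x200c260004081810)))))))))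
   (branch 0x10 (8 , 0x1e6859ccf7629738c7de564c2b5fec5e06f340c09effef22dfbed69a4135dd7fddc6a4b8b07594e6b60cc35950884df3e803df1b90b735a7)
     (branch 0x1003 (0 , 0)
     (exit 7 τ₊ 0x14080e060010)
     (branch 0x11 (0 , 0)
     (exit 7 τ₊ 0x14100c040008)
     (branch 1 (0 , 0)
     (exit 6 τ₊ 0x14100c0400)
     (branch 0x1000 (7 , 0x4a334faf1ff7a95aee9e01bf864a713d2dfbcfbf8b8f76e22a5e0d33f1930f93f68e565f8021a263ab806a551ba55981fcbb74f85f00a9cd3a)
     (branch 0x1003 (0 , 0)
     (exit 8 τ₊ 0x180c1202040a)
     (branch 0x100 (0 , 0)
     (exit 12 τ₊ 0x414100e020818)
     (branch 1 (0 , 0)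
     (exit 13 τ₊ 0x4141008180e)
     (leaf (0 , 0) 1 τ₊ 0x1c06202610))))
     (branch 0x10 (3 , 0x3c9e1e6ab7274e619bc01348817496f87deb7f7d0966c80e3)
     (branch 0x1001 (0 , 0)
     (exit 8 τ₊ 0x181410000408)
     (branch 1 (0 , 0)
     (exit 13 τ₊ 0x40c120a1816)
     (leaf (0 , 0) 1 τ₊ 0x1c06202614)))
     (leaf (1 , 0x1026d74450a9499c7) 1 τ₊ 0x2e001c062026))))))
   (branch 0x100 (2 , 0x5ee428747f6e9a683eea1edac7c8)
     (branch 0x10 (0 , 0)
     (exit 6 τ₊ 0x410140800)
     (branch 1 (0 , 0)
     (exit 6 τ₊ 0x814100400)
     (branch 0x12 (4 , 0x850b4fc5492789c8115be273fac697e8abf4d4a5785bc24068d2575f3b80b2ebb)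
     (leaf (3 , 0x375294b18877d2cfb7932e5ecbda8a187b611e605c85161c53e42932) 9 τ₊ 0xf1c000416130821)
     (branch 0x14 (3 , 0x41e38446b42a699a7cc7524dbfef0e9bad23e7bc2ca8b34b8)
     (leaf (1 , 0x2a5861720c7bc751e1e) 9 τ₊ 0x1c00041613080f)
     (leaf (6 , 0x1f351b337a69923c6eed6ce80fe5e0d5e3f46c3955bbdba912b356eb9346b91902388093115dd9d47cbadc46da066b568b) 8 τ₊ 0x220c1c0004161008)))))
   (branch 1 (2 , 0x504b5f2801b0f6acd50297e1b5a4)
     (branch 1 (0 , 0)
     (exit 6 τ₊ 0x1014080400)
     (leaf (1 , 0xd922906e381ff587) 1 τ₊ 0x14001c06200a))
   (leaf (0 , 0) 0 τ₊ 0x40e08))))))))))))))))))))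

 P4-tree : Tree
 P4-tree =
   branch 0x1000 (0 , 0)
     (exit 7 τ₊ 0x4080c1000)
   (branch 0x1020 (0 , 0)
     (exit 1 τ₊ 0x1000090c)
   (branch 0x1030 (0 , 0)
     (exit 0 τ₊ 0x100c0800)
   (branch 0x1032 (0 , 0)
     (exit 3 τ₊ 0x10000a05)
   (branch 0x1034 (0 , 0)
     (exit 3 τ₊ 0x1000070a)
   (branch 0x1040 (0 , 0)
     (exit 1 τ₊ 0x100c0800)
   (branch 0x1200 (0 , 0)
     (exit 3 τ₊ 0x80c1003)
   (branch 0x1204 (0 , 0)
     (exit 3 τ₊ 0x80c1003)
   (branch 0x1400 (0 , 0)
     (exit 3 τ₊ 0x80c0110)
   (branch 0x1402 (0 , 0)
     (exit 3 τ₊ 0x80c0110)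
   (branch 0x102 (0 , 0)
     (exit 1 τ₊ 0xc000508)
   (branch 0x103 (0 , 0)
     (exit 0 τ₊ 0xc080400)
   (branch 0x104 (0 , 0)
     (exit 1 τ₊ 0xc080400)
   (branch 0x12 (0 , 0)
     (exit 3 τ₊ 0xc080004)
   (branch 0x14 (0 , 0)
     (exit 3 τ₊ 0xc080400)
   (branch 1 (0 , 0)
     (exit 7 τ₊ 0x100c080400)
   (branch 0x100 (8 , 0x19d1636b5b5d00bf1066558bca2fbe1629a7f4a7e66476e43629b2695d3e712680f75d25858280dbfde93dbfe9ce8a63c9065b63173b04e9)
     (branch 0x10013 (0 , 0)
     (exit 0 τ₊ 0x14100400)
     (branch 0x10023 (0 , 0)
     (exit 0 τ₊ 0x14100400)
     (branch 0x10033 (0 , 0)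
     (exit 0 τ₊ 0x14100400)
     (branch 0x10043 (0 , 0)
     (exit 0 τ₊ 0x14100400)
     (branch 0x103 (0 , 0)
     (exit 0 τ₊ 0x100c0004)
     (branch 1 (0 , 0)
     (exit 9 τ₊ 0x80c10040014)
     (leaf (2 , 0x1b6c46e63dfa0e2f08339f96f1d93be10) 8 τ₊ 0x200004080c16)))))))
   (branch 0x10 (5 , 0x3d2c786dab7ed52e67fa72c364f6369e55ce024f6b6a0fdbd9b82ffa50dbb06db4967e)
     (branch 0x10013 (0 , 0)
     (exit 0 τ₊ 0xc080004)
     (branch 0x10024 (0 , 0)
     (exit 0 τ₊ 0xc080304)
     (branch 0x10031 (0 , 0)
     (exit 0 τ₊ 0xc080204)
     (branch 0x10042 (0 , 0)
     (exit 0 τ₊ 0xc080104)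
     (branch 1 (0 , 0)
     (exit 9 τ₊ 0x14100c040008)
     (leaf (0 , 0) 1 τ₊ 0x1c06262e))))))
   (branch 0x1002 (4 , 0x458375edcdbd861f2ccb4e80481aa9f512ebaa82ef09f35aedd7add2)
     (leaf (1 , 0x119a8b29b455ef17a) 9 τ₊ 0x130004080c25)
   (branch 0x1004 (2 , 0x73ec04da671f0125e339c92c7c95)
     (leaf (0 , 0) 9 τ₊ 0x4080c13)
   (leaf (6 , 0x25da7b8d489f786b44c56be79b362e71dcdecc6d0d11b1653374d3f1c1561c03253729c58e4cbdaa3a3e) 8 τ₊ 0x26100004080c))))))))))))))))))))

 H7-tree : Tree
 H7-tree =
   branch 0x1000 (0 , 0)
     (exit 0 τ₊ 0x80c1000)
   (branch 0x1002 (0 , 0)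
     (exit 2 τ₊ 0x1000050c)
   (branch 0x1003 (0 , 0)
     (exit 1 τ₊ 0x100c0400)
   (branch 0x1004 (0 , 0)
     (exit 2 τ₊ 0x100c0400)
   (branch 0x1013 (0 , 0)
     (exit 3 τ₊ 0x100c0800)
   (branch 0x1020 (0 , 0)
     (exit 2 τ₊ 0x1000090c)
   (branch 0x1023 (0 , 0)
     (exit 2 τ₊ 0x1000090c)
   (branch 0x1024 (0 , 0)
     (exit 2 τ₊ 0x100c0400)
   (branch 0x1030 (0 , 0)
     (exit 1 τ₊ 0x100c0800)
   (branch 0x1031 (0 , 0)
     (exit 3 τ₊ 0x100c0400)
   (branch 0x1032 (0 , 0)
     (exit 2 τ₊ 0x1000050c)
   (branch 0x1033 (0 , 0)
     (exit 3 τ₊ 0xc080204)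
   (branch 0x1034 (0 , 0)
     (exit 2 τ₊ 0x100c0400)
   (branch 0x1040 (0 , 0)
     (exit 2 τ₊ 0x100c0800)
   (branch 0x1042 (0 , 0)
     (exit 2 τ₊ 0x100c0800)
   (branch 0x1043 (0 , 0)
     (exit 2 τ₊ 0x100c0800)
   (branch 0x10 (0 , 0)
     (exit 0 τ₊ 0x100c0800)
   (branch 0x12 (0 , 0)
     (exit 2 τ₊ 0xc080004)
   (branch 0x13 (0 , 0)
     (exit 1 τ₊ 0xc080004)
   (branch 0x14 (0 , 0)
     (exit 2 τ₊ 0xc040108)
   (branch 1 (0 , 0)
     (exit 0 τ₊ 0x100c0400)
   (leaf (1 , 0x7adfc07d2af7b5) 1 τ₊ 0x18001c0610)))))))))))))))))))))

 H8-tree : Tree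
 H8-tree =
   leaf (6 , 0x29a35c656ec5d0017999463339434b827805d174a9c895a52b46cac8a83801567781e4) 4 τ₊ 0xe1610000408

 H9-tree : Tree
 H9-tree =
   branch 0x100 (0 , 0)
     (exit 6 τ₊ 0xc0804)
   (branch 0x104 (0 , 0)
     (exit 7 τ₊ 0x805020c)
   (branch 0x120 (0 , 0)
     (exit 7 τ₊ 0x40c000b)
   (branch 0x124 (0 , 0)
     (exit 9 τ₊ 0xc080400)
   (branch 0x10 (0 , 0)
     (exit 6 τ₊ 0x8050c)
   (branch 0x13 (0 , 0)
     (exit 7 τ₊ 0xc080004)
   (branch 1 (0 , 0)
     (exit 6 τ₊ 0x40c0b)
   (leaf (0 , 0) 0 τ₊ 0x813)))))))

 P3-tree : Tree
 P3-tree =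
   branch 0x100 (0 , 0)
     (exit 3 τ₊ 0x4080c00)
   (branch 0x101 (0 , 0)
     (exit 6 τ₊ 0xc080400)
   (branch 0x102 (0 , 0)
     (exit 5 τ₊ 0xc000508)
   (branch 0x103 (0 , 0)
     (exit 4 τ₊ 0xc080400)
   (branch 0x104 (0 , 0)
     (exit 5 τ₊ 0xc080400)
   (branch 0x113 (0 , 0)
     (exit 9 τ₊ 0xc080400)
   (branch 0x120 (0 , 0)
     (exit 7 τ₊ 0x4080c03)
   (branch 0x123 (0 , 0)
     (exit 8 τ₊ 0xc000608)
   (branch 0x133 (0 , 0)
     (exit 9 τ₊ 0x4080c02)
   (branch 0x140 (0 , 0)
     (exit 7 τ₊ 0x408010c)
   (branch 0x143 (0 , 0)
     (exit 8 τ₊ 0xc080400)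
   (branch 0x10 (0 , 0)
     (exit 2 τ₊ 0xc080400)
   (branch 0x12 (0 , 0)
     (exit 7 τ₊ 0xc080004)
   (branch 0x14 (0 , 0)
     (exit 7 τ₊ 0xc080400)
   (branch 1 (0 , 0)
     (exit 3 τ₊ 0xc080400)
   (leaf (0 , 0) 0 τ₊ 0x40e)))))))))))))))

 P2-tree : Tree
 P2-tree =
   branch 0x10 (0 , 0)
     (exit 0 τ₊ 0x40800)
   (branch 0x11 (0 , 0)
     (exit 2 τ₊ 0x80400)
   (branch 0x12 (0 , 0)
     (exit 1 τ₊ 0x80004)
   (branch 0x13 (0 , 0)
     (exit 2 τ₋ 0x80602)
   (branch 0x14 (0 , 0)
     (exit 1 τ₊ 0x80400)
   (branch 1 (0 , 0)
     (exit 0 τ₊ 0x80400)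
   (leaf (0 , 0) 0 τ₊ 0x4))))))

 P1-tree : Tree
 P1-tree =
   branch 1 (0 , 0)
     (exit 0 τ₊ 0x400)
   (leaf (0 , 0) 0 τ₊ 0x0)

 seeds-G0 : List Seed
 seeds-G0 = []

 G0-check : Check.check seeds-G0 targets G0 G0-tree ≡ true
 G0-check = refl

 seeds-G1 : List Seed
 seeds-G1 = seed G0 ∷ seeds-G0

 G1-check : Check.check seeds-G1 targets G1 G1-tree ≡ true
 G1-check = refl

 seeds-G2 : List Seed
 seeds-G2 = seed G1 ∷ seeds-G1

 G2-check : Check.check seeds-G2 targets G2 G2-tree ≡ true
 G2-check = refl

 seeds-G3 : List Seed
 seeds-G3 = seed G2 ∷ seeds-G2

 G3-check : Check.check seeds-G3 targets G3 G3-tree ≡ true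
 G3-check = refl

 seeds-G4 : List Seed
 seeds-G4 = seed G3 ∷ seeds-G3

 G4-check : Check.check seeds-G4 targets G4 G4-tree ≡ true
 G4-check = refl

 seeds-G5 : List Seed
 seeds-G5 = seed G4 ∷ seeds-G4

 G5-check : Check.check seeds-G5 targets G5 G5-tree ≡ true
 G5-check = refl

 seeds-E6 : List Seed
 seeds-E6 = seed G5 ∷ seeds-G5

 E6-check : Check.check seeds-E6 targets E6 E6-tree ≡ true
 E6-check = refl

 seeds-F6 : List Seed
 seeds-F6 = seed E6 ∷ seeds-E6

 F6-check : Check.check seeds-F6 targets F6 F6-tree ≡ true
 F6-check = refl

 seeds-P5 : List Seed
 seeds-P5 = seed F6 ∷ seeds-F6

 seeds-H0 : List Seed
 seeds-H0 = seed P5 ∷ seeds-P5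

 H0-check : Check.check seeds-H0 targets H0 H0-tree ≡ true
 H0-check = refl

 seeds-H1 : List Seed
 seeds-H1 = seed H0 ∷ seeds-H0

 H1-check : Check.check seeds-H1 targets H1 H1-tree ≡ true
 H1-check = refl

 seeds-H2 : List Seed
 seeds-H2 = seed H1 ∷ seeds-H1

 H2-check : Check.check seeds-H2 targets H2 H2-tree ≡ true
 H2-check = refl

 seeds-H3 : List Seed
 seeds-H3 = seed H2 ∷ seeds-H2

 H3-check : Check.check seeds-H3 targets H3 H3-tree ≡ true
 H3-check = refl

 seeds-H4 : List Seed
 seeds-H4 = seed H3 ∷ seeds-H3

 H4-check : Check.check seeds-H4 targets H4 H4-tree ≡ true
 H4-check = refl

 seeds-H5 : List Seed
 seeds-H5 = seed H4 ∷ seeds-H4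

 H5-check : Check.check seeds-H5 targets H5 H5-tree ≡ true
 H5-check = refl

 seeds-H6 : List Seed
 seeds-H6 = seed H5 ∷ seeds-H5

 H6-check : Check.check seeds-H6 targets H6 H6-tree ≡ true
 H6-check = refl

 seeds-P4 : List Seed
 seeds-P4 = seed H6 ∷ seeds-H6

 P4-check : Check.check seeds-P4 targets P4 P4-tree ≡ true
 P4-check = refl

 seeds-H7 : List Seed
 seeds-H7 = seed P4 ∷ seeds-P4

 H7-check : Check.check seeds-H7 targets H7 H7-tree ≡ true
 H7-check = refl

 seeds-H8 : List Seed
 seeds-H8 = seed H7 ∷ seeds-H7

 H8-check : Check.check seeds-H8 targets H8 H8-tree ≡ true
 H8-check = refl

 seeds-H9 : List Seed
 seeds-H9 = seed H8 ∷ seeds-H8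

 H9-check : Check.check seeds-H9 targets H9 H9-tree ≡ true
 H9-check = refl

 seeds-P3 : List Seed
 seeds-P3 = seed H9 ∷ seeds-H9

 P3-check : Check.check seeds-P3 targets P3 P3-tree ≡ true
 P3-check = refl

 seeds-P2 : List Seed
 seeds-P2 = seed P3 ∷ seeds-P3

 P2-check : Check.check seeds-P2 targets P2 P2-tree ≡ true
 P2-check = refl

 seeds-P1 : List Seed
 seeds-P1 = seed P2 ∷ seeds-P2

 P1-check : Check.check seeds-P1 targets P1 P1-tree ≡ true
 P1-check = refl

module ShortPaths where

 open Configuration
 open Gains
 open import Data.Nat.Base
 open import Data.Nat.Properties

 zero? : ∀ (w : W) → w ≡ 𝟎 ⊎ w ≢ 𝟎
 zero? 𝟎 = inj₁ refl
 zero? (just _) = inj₂ λ ()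

 negʷ-𝟎 : ∀ {w} → negʷ w ≡ 𝟎 → w ≡ 𝟎
 negʷ-𝟎 {𝟎} _ = refl

 data Ends (k : ℕ) : ℕ → Set where
   first : Ends k 0
   second : Ends k 1
   penult : Ends k (3 + k)
   last : Ends k (4 + k)

 Ends-< : ∀ {k j} → Ends k j → j < 5 + k
 Ends-< first = s≤s z≤n
 Ends-< second = s≤s (s≤s z≤n)
 Ends-< penult = n≤1+n _
 Ends-< last = ≤-refl

 -- The possible weights between a vertex and the vertices of an induced path
 -- with 5 + k vertices.
 data Pat (k : ℕ) (c : ℕ → W) : Set where
   none : (∀ i → i < 5 + k → c i ≡ 𝟎) → Pat k c
   end : ∀ j → Ends k j → c j ≢ 𝟎 → (∀ i → i < 5 + k → i ≢ j → c i ≡ 𝟎) → Pat k c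
   twin : ∀ j → j < 3 + k → c j ≢ 𝟎 → c (2 + j) ≡ negʷ (c j) →
           (∀ i → i < 5 + k → i ≢ j → i ≢ 2 + j → c i ≡ 𝟎) → Pat k c
   close : c 0 ≢ 𝟎 → c (4 + k) ≢ 𝟎 → (∀ i → i < 5 + k → i ≢ 0 → i ≢ 4 + k → c i ≡ 𝟎) → Pat k c

 n≢2+n : ∀ {n} → n ≢ 2 + n
 n≢2+n ()

 n≢k+n : ∀ k {n} → n ≢ suc k + n
 n≢k+n k {n} eq = <⇒≢ (s≤s (m≤n+m n k)) eq

 Pair : ∀ k → ℕ → ℕ → Set
 Pair k i j = j ≡ 2 + i ⊎ (i ≡ 0 × j ≡ 4 + k)

 two-nonzero : ∀ {k c} → Pat k c → ∀ {i j} → i < j → j < 5 + k → c i ≢ 𝟎 → c j ≢ 𝟎 →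
   (j ≡ 2 + i × c j ≡ negʷ (c i)) ⊎ (i ≡ 0 × j ≡ 4 + k)
 two-nonzero (none z) {i} i<j j<m ci cj = contradiction (z i (<-trans i<j j<m)) ci
 two-nonzero (end l _ _ z) {i} {j} i<j j<m ci cj with i ≟ l | j ≟ l
 ... | yes refl | yes refl = contradiction i<j (<-irrefl refl)
 ... | no i≢l | _ = contradiction (z i (<-trans i<j j<m) i≢l) ci
 ... | yes _ | no j≢l = contradiction (z j j<m j≢l) cj
 two-nonzero (twin l _ _ neg z) {i} {j} i<j j<m ci cj with i ≟ l | i ≟ 2 + l | j ≟ l | j ≟ 2 + l
 ... | yes refl | _ | _ | yes refl = inj₁ (refl , neg)
 ... | yes refl | _ | yes refl | no _ = contradiction i<j (<-irrefl refl)
 ... | yes _ | _ | no j≢l | no j≢2+l = contradiction (z j j<m j≢l j≢2+l) cj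
 ... | no i≢l | no i≢2+l | _ | _ = contradiction (z i (<-trans i<j j<m) i≢l i≢2+l) ci
 ... | no _ | yes refl | yes refl | _ = contradiction i<j (≤⇒≯ (m≤n+m l 2))
 ... | no _ | yes refl | no _ | yes refl = contradiction i<j (<-irrefl refl)
 ... | no _ | yes refl | no j≢l | no j≢2+l = contradiction (z j j<m j≢l j≢2+l) cj
 two-nonzero {k} (close _ _ z) {i} {j} i<j j<m ci cj with i ≟ 0 | i ≟ 4 + k | j ≟ 0 | j ≟ 4 + k
 ... | yes refl | _ | _ | yes refl = inj₂ (refl , refl)
 ... | yes refl | _ | yes refl | no _ = contradiction i<j (<-irrefl refl)
 ... | yes _ | _ | no j≢0 | no j≢l = contradiction (z j j<m j≢0 j≢l) cj
 ... | no i≢0 | no i≢l | _ | _ = contradiction (z i (<-trans i<j j<m) i≢0 i≢l) ci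
 ... | no _ | yes refl | _ | _ = contradiction (≤-trans j<m i<j) (<-irrefl refl)

 three-nonzero : ∀ {k c} → Pat k c → ∀ {h i j} → h < i → i < j → j < 5 + k →
   c h ≢ 𝟎 → c i ≢ 𝟎 → c j ≢ 𝟎 → ⊥
 three-nonzero p {h} {i} h<i i<j j<m ch ci cj
   with two-nonzero p h<i (<-trans i<j j<m) ch ci | two-nonzero p i<j j<m ci cj | two-nonzero p (<-trans h<i i<j) j<m ch cj
 ... | inj₂ (_ , refl) | _ | _ = contradiction (≤-trans j<m i<j) (<-irrefl refl)
 ... | inj₁ (refl , _) | inj₂ (() , _) | _
 ... | inj₁ (refl , _) | inj₁ (refl , _) | inj₁ (() , _)
 three-nonzero (none z) {h} h<i i<j j<m ch ci cj | inj₁ (refl , _) | inj₁ (refl , _) | inj₂ (refl , refl) = ch (z 0 (s≤s z≤n))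
 three-nonzero (end l e _ z) h<i i<j j<m ch ci cj | inj₁ (refl , _) | inj₁ (refl , _) | inj₂ (refl , refl) with 0 ≟ l
 ... | yes refl = ci (z 2 (s≤s (s≤s (s≤s z≤n))) λ ())
 ... | no 0≢l = ch (z 0 (s≤s z≤n) 0≢l)
 three-nonzero (twin l _ _ _ z) h<i i<j j<m ch ci cj | inj₁ (refl , _) | inj₁ (refl , _) | inj₂ (refl , refl) with l
 ... | 0 = cj (z 4 j<m (λ ()) λ ())
 ... | suc _ = ch (z 0 (s≤s z≤n) (λ ()) λ ())
 three-nonzero (close _ _ z) h<i i<j j<m ch ci cj | inj₁ (refl , _) | inj₁ (refl , _) | inj₂ (refl , refl) =
   ci (z 2 (s≤s (s≤s (s≤s z≤n))) (λ ()) λ ())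

 adjacent-zero : ∀ {k c} → Pat k c → ∀ {i} → suc i < 5 + k → c i ≢ 𝟎 → c (suc i) ≡ 𝟎
 adjacent-zero {c = c} p {i} i<m ci with zero? (c (suc i))
 ... | inj₁ eq = eq
 ... | inj₂ cj with two-nonzero p ≤-refl i<m ci cj
 ... | inj₁ (() , _)
 ... | inj₂ (refl , ())

 interior : ∀ {k c} → Pat k c → ∀ {j} → 2 ≤ j → j < 3 + k → c j ≢ 𝟎 →
   (∀ i → i < 5 + k → i ≢ j → c i ≡ 𝟎) → ⊥
 interior {k} (none z) {j} _ j< cj _ = cj (z j (≤-trans j< (m≤n+m (3 + k) 2)))
 interior {k} (end l e cl _) {j} 2≤j j< cj z with l ≟ j
 interior (end .0 first _ _) () _ _ _ | yes refl
 interior (end .1 second _ _) (s≤s ()) _ _ _ | yes refl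
 interior (end _ penult _ _) _ j< _ _ | yes refl = <-irrefl refl j<
 interior (end _ last _ _) _ j< _ _ | yes refl = <⇒≱ j< (n≤1+n _)
 interior {k} (end l e cl _) {j} 2≤j j< cj z | no l≢j = cl (z l (Ends-< e) l≢j)
 interior {k} {c} (twin l l< cl neg _) {j} _ _ _ z with l ≟ j
 ... | no l≢j = cl (z l (≤-trans l< (m≤n+m (3 + k) 2)) l≢j)
 ... | yes refl = cl (negʷ-𝟎 (trans (sym neg) (z (2 + l) (s≤s (s≤s l<)) λ eq → n≢2+n (sym eq))))
 interior {k} (close c0 _ _) {j} (s≤s _) _ _ z = c0 (z 0 (s≤s z≤n) λ ())

 data Merged (k : ℕ) (c : ℕ → W) : Set where
   pat : Pat (suc k) c → Merged k c
   bad₁ : c 1 ≢ 𝟎 → c (5 + k) ≢ 𝟎 → (∀ i → i < 6 + k → i ≢ 1 → i ≢ 5 + k → c i ≡ 𝟎) → Merged k c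
   bad₂ : c 0 ≢ 𝟎 → c (4 + k) ≢ 𝟎 → (∀ i → i < 6 + k → i ≢ 0 → i ≢ 4 + k → c i ≡ 𝟎) → Merged k c

 merge : ∀ k c → Pat k c → Pat k (λ i → c (suc i)) → Merged k c
 merge k c F S = go F S (zero? (c (5 + k)))
   where
   split : ∀ {i} → i < 6 + k → i < 5 + k ⊎ i ≡ 5 + k
   split (s≤s i≤) with m≤n⇒m<n∨m≡n i≤
   ... | inj₁ i< = inj₁ i<
   ... | inj₂ eq = inj₂ eq
   more : ∀ {Q : ℕ → Set} → c (5 + k) ≡ 𝟎 → (∀ i → i < 5 + k → Q i → c i ≡ 𝟎) → ∀ i → i < 6 + k → Q i → c i ≡ 𝟎
   more z zs i i< q with split i<
   ... | inj₁ i<′ = zs i i<′ q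
   ... | inj₂ refl = z
   but : ∀ {Q : ℕ → Set} → (∀ i → i < 5 + k → Q i → c i ≡ 𝟎) → ∀ i → i < 6 + k → Q i → i ≢ 5 + k → c i ≡ 𝟎
   but zs i i< q i≢ with split i<
   ... | inj₁ i<′ = zs i i<′ q
   ... | inj₂ eq = contradiction eq i≢
   go : Pat k c → Pat k (λ i → c (suc i)) → c (5 + k) ≡ 𝟎 ⊎ c (5 + k) ≢ 𝟎 → Merged k c
   go (none z) S (inj₁ l) = pat (none λ i i< → more {λ _ → ℕ} l (λ i i< _ → z i i<) i i< 0)
   go (none z) S (inj₂ l) = pat (end (5 + k) last l λ i i< → but {λ _ → ℕ} (λ i i< _ → z i i<) i i< 0)
   go (end .0 first c0 z) S (inj₁ l) = pat (end 0 first c0 (more l z))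
   go (end .0 first c0 z) S (inj₂ l) = pat (close c0 l (but z))
   go (end .1 second c1 z) S (inj₁ l) = pat (end 1 second c1 (more l z))
   go (end .1 second c1 z) S (inj₂ l) = bad₁ c1 l (but z)
   go (end _ penult cj z) S l with S
   ... | none z′ = contradiction (z′ (2 + k) (m≤n+m (3 + k) 2)) cj
   ... | close _ _ z′ = contradiction (z′ (2 + k) (m≤n+m (3 + k) 2) (λ ()) (n≢2+n)) cj
   ... | end i e ci z′ with i ≟ 2 + k
   ... | no i≢ = contradiction (z′ (2 + k) (m≤n+m (3 + k) 2) (λ eq → i≢ (sym eq))) cj
   ... | yes i≡ = contradiction e (no-end i≡)
     where
     no-end : i ≡ 2 + k → ¬ Ends k i
     no-end () first
     no-end () second
     no-end eq penult = contradiction (sym eq) (n≢k+n 0)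
     no-end eq last = contradiction (sym eq) n≢2+n
   go (end _ penult cj z) S l | twin i i< ci neg z′ with i ≟ 2 + k
   ... | yes refl = pat (twin (3 + k) ≤-refl cj neg (λ i i< a b → but z i i< a b))
   ... | no i≢ with i ≟ k
   ... | yes refl = contradiction (z (suc i) (m≤n+m (2 + i) 3) n≢2+n) ci
   ... | no i≢k = contradiction (z′ (2 + k) (m≤n+m (3 + k) 2) (λ eq → i≢ (sym eq)) (λ { refl → i≢k refl })) cj
   go (end _ last cj z) S (inj₁ l) = pat (end (4 + k) penult cj (more l z))
   go (end _ last cj z) S (inj₂ l) = contradiction (adjacent-zero S ≤-refl cj) l
   go (close c0 c4 z) S (inj₁ l) = bad₂ c0 c4
     λ i i< a b → more {λ i → i ≢ 0 × i ≢ 4 + k} l (λ i i< (a , b) → z i i< a b) i i< (a , b)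
   go (close c0 c4 z) S (inj₂ l) = contradiction (adjacent-zero S ≤-refl c4) l
   go (twin j j< cj neg z) S (inj₁ l) = pat (twin j (m≤n⇒m≤1+n j<) cj neg
     λ i i< a b → more {λ i → i ≢ j × i ≢ 2 + j} l (λ i i< (a , b) → z i i< a b) i i< (a , b))
   go (twin j j< cj neg z) S (inj₂ l)
     with two-nonzero S {suc j} {4 + k} (s≤s j<) ≤-refl (λ eq → cj (negʷ-𝟎 (trans (sym neg) eq))) l
   ... | inj₂ (() , _)
   ... | inj₁ (refl , _) = ⊥-elim (three-nonzero S {k} {2 + k} {4 + k} (s≤s (n≤1+n k)) (n≤1+n _) ≤-refl cj
     (λ eq → cj (negʷ-𝟎 (trans (sym neg) eq))) l)

 ◃-≢𝟎 : ∀ q {w} → w ≢ 𝟎 → q ◃ w ≢ 𝟎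
 ◃-≢𝟎 q w≢ eq = w≢ (◃-cancel q eq)

 ◃-negʷ : ∀ q w → q ◃ negʷ w ≡ negʷ (q ◃ w)
 ◃-negʷ q w = sym (twistʷ-◃ (Sign.- , identity) q w)

 Pat-scale : ∀ {k c} q → Pat k c → Pat k (λ i → q ◃ c i)
 Pat-scale q (none z) = none λ i i< → cong (q ◃_) (z i i<)
 Pat-scale q (end j e cj z) = end j e (◃-≢𝟎 q cj) λ i i< a → cong (q ◃_) (z i i< a)
 Pat-scale {c = c} q (twin j j< cj n z) = twin j j< (◃-≢𝟎 q cj)
   (trans (cong (q ◃_) n) (◃-negʷ q (c j))) λ i i< a b → cong (q ◃_) (z i i< a b)
 Pat-scale q (close a b z) = close (◃-≢𝟎 q a) (◃-≢𝟎 q b) λ i i< e f → cong (q ◃_) (z i i< e f)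

 Pat-cong : ∀ {k c d} → (∀ i → i < 5 + k → c i ≡ d i) → Pat k c → Pat k d
 Pat-cong e (none z) = none λ i i< → trans (sym (e i i<)) (z i i<)
 Pat-cong e (end j p cj z) = end j p (λ d → cj (trans (e j (Ends-< p)) d)) λ i i< a → trans (sym (e i i<)) (z i i< a)
 Pat-cong {k} e (twin j j< cj n z) = twin j j< (λ d → cj (trans (e j j<′) d))
   (trans (sym (e (2 + j) (s≤s (s≤s j<)))) (trans n (cong negʷ (e j j<′)))) λ i i< a b → trans (sym (e i i<)) (z i i< a b)
   where
   j<′ : j < 5 + k
   j<′ = ≤-trans j< (m≤n+m (3 + k) 2)
 Pat-cong {k} e (close a b z) = close (λ d → a (trans (e 0 (s≤s z≤n)) d)) (λ d → b (trans (e (4 + k) ≤-refl) d))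
   λ i i< p q → trans (sym (e i i<)) (z i i< p q)

 module Paths {n} (G : GainGraph n) where
   open GainGraph G public

   X : Set
   X = Fin n × C₄

   infixr 7 _⋆_

   _⋆_ : C₄ → X → X
   q ⋆ (v , p) = v , q ∙ p

   ⟪⟫-⋆ˡ : ∀ q x y → ⟪ q ⋆ x ∣ y ⟫ ≡ q ◃ ⟪ x ∣ y ⟫
   ⟪⟫-⋆ˡ q (v , p) y = rescale q v p y

   ⟪⟫-⋆ʳ : ∀ q x y → ⟪ x ∣ q ⋆ y ⟫ ≡ q ⁻¹ ◃ ⟪ x ∣ y ⟫
   ⟪⟫-⋆ʳ q x y = begin
     ⟪ x ∣ q ⋆ y ⟫ ≡⟨ herm⟪⟫ (q ⋆ y) x ⟩
     conjʷ ⟪ q ⋆ y ∣ x ⟫ ≡⟨ cong conjʷ (⟪⟫-⋆ˡ q y x) ⟩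
     conjʷ (q ◃ ⟪ y ∣ x ⟫) ≡⟨ conjʷ-◃ q ⟪ y ∣ x ⟫ ⟩
     q ⁻¹ ◃ conjʷ ⟪ y ∣ x ⟫ ≡⟨ cong (q ⁻¹ ◃_) (herm⟪⟫ y x) ⟨
     q ⁻¹ ◃ ⟪ x ∣ y ⟫ ∎
     where open ≡-Reasoning

   ⟪⟫-⋆⋆ : ∀ q x y → ⟪ q ⋆ x ∣ q ⋆ y ⟫ ≡ ⟪ x ∣ y ⟫
   ⟪⟫-⋆⋆ q x y = begin
     ⟪ q ⋆ x ∣ q ⋆ y ⟫ ≡⟨ ⟪⟫-⋆ˡ q x (q ⋆ y) ⟩
     q ◃ ⟪ x ∣ q ⋆ y ⟫ ≡⟨ cong (q ◃_) (⟪⟫-⋆ʳ q x y) ⟩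
     q ◃ q ⁻¹ ◃ ⟪ x ∣ y ⟫ ≡⟨ ◃-assoc q (q ⁻¹) ⟪ x ∣ y ⟫ ⟨
     (q ∙ q ⁻¹) ◃ ⟪ x ∣ y ⟫ ≡⟨ cong (_◃ ⟪ x ∣ y ⟫) (trans (∙-comm q (q ⁻¹)) (∙-inverseˡ q)) ⟩
     ζ⁰ ◃ ⟪ x ∣ y ⟫ ≡⟨ ◃-identity ⟪ x ∣ y ⟫ ⟩
     ⟪ x ∣ y ⟫ ∎
     where open ≡-Reasoning

   flip : ∀ {x y w} → ⟪ x ∣ y ⟫ ≡ w → ⟪ y ∣ x ⟫ ≡ conjʷ w
   flip {x} {y} eq = trans (herm⟪⟫ x y) (cong conjʷ eq)

   flip-≢ : ∀ {x y} → ⟪ x ∣ y ⟫ ≢ 𝟎 → ⟪ y ∣ x ⟫ ≢ 𝟎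
   flip-≢ {x} {y} ne eq = ne (flip {y} {x} eq)

   -- Multiplies y by a unit so that its weight to x becomes 1.
   normaliser : W → C₄
   normaliser 𝟎 = ζ⁰
   normaliser (just q) = q

   normalised : ∀ {x y} → ⟪ x ∣ y ⟫ ≢ 𝟎 → ⟪ x ∣ normaliser ⟪ x ∣ y ⟫ ⋆ y ⟫ ≡ 𝟏
   normalised {x} {y} ne with ⟪ x ∣ y ⟫ in eq
   ... | 𝟎 = contradiction refl ne
   ... | just q = trans (⟪⟫-⋆ʳ q x y) (trans (cong (q ⁻¹ ◃_) eq) (cong just (∙-inverseˡ q)))

   record IsPath (m : ℕ) (p : ℕ → X) : Set where
     field
       adj : ∀ i → suc i < m → ⟪ p i ∣ p (suc i) ⟫ ≡ 𝟏
       far : ∀ i j → 2 + i ≤ j → j < m → ⟪ p i ∣ p j ⟫ ≡ 𝟎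
       dist : ∀ i j → i < j → j < m → proj₁ (p i) ≢ proj₁ (p j)

   open IsPath public

   Off : ℕ → (ℕ → X) → X → Set
   Off m p x = ∀ i → i < m → proj₁ x ≢ proj₁ (p i)

   far′ : ∀ {m p} → IsPath m p → ∀ i j → 2 + i ≤ j → j < m → ⟪ p j ∣ p i ⟫ ≡ 𝟎
   far′ {m} {p} P i j i<j j<m = flip {p i} {p j} (far P i j i<j j<m)

   adj′ : ∀ {m p} → IsPath m p → ∀ i → suc i < m → ⟪ p (suc i) ∣ p i ⟫ ≡ 𝟏
   adj′ {m} {p} P i i<m = flip {p i} {p (suc i)} (adj P i i<m)

   shorten : ∀ {m p} → IsPath (suc m) p → IsPath m p
   shorten P = record
     { adj = λ i i< → adj P i (m≤n⇒m≤1+n i<)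
     ; far = λ i j i<j j< → far P i j i<j (m≤n⇒m≤1+n j<)
     ; dist = λ i j i<j j< → dist P i j i<j (m≤n⇒m≤1+n j<) }

   shift : ∀ {m p} → IsPath (suc m) p → IsPath m (λ i → p (suc i))
   shift P = record
     { adj = λ i i< → adj P (suc i) (s≤s i<)
     ; far = λ i j i<j j< → far P (suc i) (suc j) (s≤s i<j) (s≤s j<)
     ; dist = λ i j i<j j< → dist P (suc i) (suc j) (s≤s i<j) (s≤s j<) }

   cons : X → (ℕ → X) → ℕ → X
   cons x p zero = x
   cons x p (suc i) = p i

   cons-path : ∀ {m p x} → IsPath m p → Off m p x → ⟪ x ∣ p 0 ⟫ ≡ 𝟏 →
     (∀ i → suc i < m → ⟪ x ∣ p (suc i) ⟫ ≡ 𝟎) → IsPath (suc m) (cons x p)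
   cons-path {m} {p} {x} P off a z = record { adj = adj′′ ; far = far′′ ; dist = dist′′ }
     where
     adj′′ : ∀ i → suc i < suc m → ⟪ cons x p i ∣ cons x p (suc i) ⟫ ≡ 𝟏
     adj′′ zero _ = a
     adj′′ (suc i) (s≤s i<) = adj P i i<
     far′′ : ∀ i j → 2 + i ≤ j → j < suc m → ⟪ cons x p i ∣ cons x p j ⟫ ≡ 𝟎
     far′′ zero (suc (suc j)) _ (s≤s j<) = z j j<
     far′′ zero (suc zero) (s≤s ()) _
     far′′ (suc i) (suc j) (s≤s i<j) (s≤s j<) = far P i j i<j j<
     dist′′ : ∀ i j → i < j → j < suc m → proj₁ (cons x p i) ≢ proj₁ (cons x p j)
     dist′′ zero (suc j) _ (s≤s j<) = off j j<
     dist′′ (suc i) (suc j) (s≤s i<j) (s≤s j<) = dist P i j i<j j<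

   snoc : ℕ → (ℕ → X) → X → ℕ → X
   snoc m p x i with i <? m
   ... | yes _ = p i
   ... | no _ = x

   snoc-< : ∀ {m p x i} → i < m → snoc m p x i ≡ p i
   snoc-< {m} {i = i} i< with i <? m
   ... | yes _ = refl
   ... | no i≮ = contradiction i< i≮

   snoc-≡ : ∀ m {p x} → snoc m p x m ≡ x
   snoc-≡ m with m <? m
   ... | yes m< = contradiction m< (<-irrefl refl)
   ... | no _ = refl

   snoc-path : ∀ {m p x} → IsPath (suc m) p → Off (suc m) p x → ⟪ p m ∣ x ⟫ ≡ 𝟏 →
     (∀ i → i < m → ⟪ p i ∣ x ⟫ ≡ 𝟎) → IsPath (2 + m) (snoc (suc m) p x)
   snoc-path {m} {p} {x} P off a z = record { adj = adj′′ ; far = far′′ ; dist = dist′′ }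
     where
     q = snoc (suc m) p x
     old : ∀ {i} → i < suc m → q i ≡ p i
     old = snoc-<
     adj′′ : ∀ i → suc i < 2 + m → ⟪ q i ∣ q (suc i) ⟫ ≡ 𝟏
     adj′′ i (s≤s (s≤s i≤)) with m≤n⇒m<n∨m≡n i≤
     ... | inj₁ i< = trans (cong₂ ⟪_∣_⟫ (old (m≤n⇒m≤1+n i<)) (old (s≤s i<))) (adj P i (s≤s i<))
     ... | inj₂ refl = trans (cong₂ ⟪_∣_⟫ (old ≤-refl) (snoc-≡ (suc m))) a
     far′′ : ∀ i j → 2 + i ≤ j → j < 2 + m → ⟪ q i ∣ q j ⟫ ≡ 𝟎
     far′′ i j i<j (s≤s j≤) with m≤n⇒m<n∨m≡n j≤
     ... | inj₁ j< = trans (cong₂ ⟪_∣_⟫ (old (<-trans (≤-trans (n≤1+n _) i<j) j<)) (old j<)) (far P i j i<j j<)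
     ... | inj₂ refl = trans (cong₂ ⟪_∣_⟫ (old (≤-trans (n≤1+n _) i<j)) (snoc-≡ (suc m))) (z i (s≤s⁻¹ i<j))
     dist′′ : ∀ i j → i < j → j < 2 + m → proj₁ (q i) ≢ proj₁ (q j)
     dist′′ i j i<j (s≤s j≤) with m≤n⇒m<n∨m≡n j≤
     ... | inj₁ j< = λ eq → dist P i j i<j j< (trans (cong proj₁ (sym (old (<-trans i<j j<)))) (trans eq (cong proj₁ (old j<))))
     ... | inj₂ refl = λ eq → off i i<j (trans (cong proj₁ (sym (snoc-≡ (suc m)))) (trans (sym eq) (cong proj₁ (old i<j))))

   reverse : ℕ → (ℕ → X) → ℕ → X
   reverse m p i = p (m ∸ i)

   reverse-path : ∀ {m p} → IsPath (suc m) p → IsPath (suc m) (reverse m p)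
   reverse-path {m} {p} P = record { adj = adj′′ ; far = far′′ ; dist = dist′′ }
     where
     adj′′ : ∀ i → suc i < suc m → ⟪ p (m ∸ i) ∣ p (m ∸ suc i) ⟫ ≡ 𝟏
     adj′′ i (s≤s i<) rewrite +-∸-assoc 1 i< = adj′ P (m ∸ suc i) (s≤s (≤-trans (≤-reflexive (sym (+-∸-assoc 1 i<))) (m∸n≤m m i)))
     far′′ : ∀ i j → 2 + i ≤ j → j < suc m → ⟪ p (m ∸ i) ∣ p (m ∸ j) ⟫ ≡ 𝟎
     far′′ i j i<j (s≤s j≤) = far′ P (m ∸ j) (m ∸ i)
       (≤-trans (≤-reflexive (sym (+-∸-assoc 2 j≤))) (∸-monoʳ-≤ (2 + m) i<j)) (s≤s (m∸n≤m m i))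
     dist′′ : ∀ i j → i < j → j < suc m → proj₁ (p (m ∸ i)) ≢ proj₁ (p (m ∸ j))
     dist′′ i j i<j (s≤s j≤) eq = dist P (m ∸ j) (m ∸ i) (∸-monoʳ-< i<j j≤) (s≤s (m∸n≤m m i)) (sym eq)

   module _ {Out : Set}
     (window : ∀ {p} → IsPath 5 p → ∀ x → Off 5 p x → Out ⊎ Pat 0 (λ i → ⟪ x ∣ p i ⟫)) where

     private
       Pattern : ℕ → Set
       Pattern k = ∀ {p} → IsPath (5 + k) p → ∀ x → Off (5 + k) p x → Out ⊎ Pat k (λ i → ⟪ x ∣ p i ⟫)

     -- A cycle with a pendant vertex: going around the cycle, the pendant vertex
     -- is attached to the third vertex of an induced path.
     around : ∀ {k p x} → Pattern k → IsPath (6 + k) p → Off (6 + k) p x →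
       ⟪ x ∣ p 0 ⟫ ≢ 𝟎 → ⟪ x ∣ p (4 + k) ⟫ ≢ 𝟎 →
       (∀ i → i < 6 + k → i ≢ 0 → i ≢ 4 + k → ⟪ x ∣ p i ⟫ ≡ 𝟎) → Out
     around {k} {p} {x} patterns P off x0 x4 z = conclude (patterns {q} Q (p (5 + k)) offQ)
       where
       x′ : X
       x′ = normaliser ⟪ p (4 + k) ∣ x ⟫ ⋆ x
       x′z : ∀ i → i < 6 + k → i ≢ 0 → i ≢ 4 + k → ⟪ x′ ∣ p i ⟫ ≡ 𝟎
       x′z i i< a b = trans (⟪⟫-⋆ˡ (normaliser ⟪ p (4 + k) ∣ x ⟫) x (p i)) (cong (_ ◃_) (z i i< a b))
       s : C₄
       s = normaliser ⟪ x′ ∣ p 0 ⟫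
       q : ℕ → X
       q 0 = p (2 + k)
       q 1 = p (3 + k)
       q 2 = p (4 + k)
       q 3 = x′
       q (suc (suc (suc (suc i)))) = s ⋆ p i
       x′0 : ⟪ x′ ∣ p 0 ⟫ ≢ 𝟎
       x′0 eq = x0 (◃-cancel _ (trans (sym (⟪⟫-⋆ˡ (normaliser ⟪ p (4 + k) ∣ x ⟫) x (p 0))) eq))
       s⋆ : ∀ y i → ⟪ y ∣ p i ⟫ ≡ 𝟎 → ⟪ y ∣ s ⋆ p i ⟫ ≡ 𝟎
       s⋆ y i eq = trans (⟪⟫-⋆ʳ s y (p i)) (cong (s ⁻¹ ◃_) eq)
       below : ∀ {i} a → suc (4 + i) ≤ 5 + k → i < a + suc k
       below {i} a (s≤s (s≤s (s≤s (s≤s i<)))) = ≤-trans i< (m≤n+m (suc k) a)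
       below′ : ∀ {i} → suc (4 + i) ≤ 5 + k → i < 6 + k
       below′ i< = ≤-trans (below 0 i<) (m≤n+m (suc k) 5)
       Q : IsPath (5 + k) q
       Q = record { adj = adj′′ ; far = far′′ ; dist = dist′′ }
         where
         adj′′ : ∀ i → suc i < 5 + k → ⟪ q i ∣ q (suc i) ⟫ ≡ 𝟏
         adj′′ 0 _ = adj P (2 + k) (m≤n+m (4 + k) 2)
         adj′′ 1 _ = adj P (3 + k) (m≤n+m (5 + k) 1)
         adj′′ 2 _ = normalised (flip-≢ {x} {p (4 + k)} x4)
         adj′′ 3 _ = normalised x′0
         adj′′ (suc (suc (suc (suc i)))) i< = trans (⟪⟫-⋆⋆ s (p i) (p (suc i))) (adj P i (below′ i<))
         far′′ : ∀ i j → 2 + i ≤ j → j < 5 + k → ⟪ q i ∣ q j ⟫ ≡ 𝟎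
         far′′ 0 2 _ _ = far P (2 + k) (4 + k) ≤-refl (n≤1+n _)
         far′′ 0 3 _ _ = flip {x′} {p (2 + k)} (x′z (2 + k) (m≤n+m (3 + k) 3) (λ ()) n≢2+n)
         far′′ 0 (suc (suc (suc (suc j)))) _ j< =
           s⋆ _ j (far′ P j (2 + k) (s≤s (below 0 j<)) (m≤n+m (3 + k) 3))
         far′′ 1 3 _ _ = flip {x′} {p (3 + k)} (x′z (3 + k) (m≤n+m (4 + k) 2) (λ ()) (n≢k+n 0))
         far′′ 1 (suc (suc (suc (suc j)))) _ j< =
           s⋆ _ j (far′ P j (3 + k) (s≤s (below 1 j<)) (m≤n+m (4 + k) 2))
         far′′ 2 (suc (suc (suc (suc j)))) _ j< =
           s⋆ _ j (far′ P j (4 + k) (s≤s (below 2 j<)) (m≤n+m (5 + k) 1))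
         far′′ 3 (suc (suc (suc (suc (suc j))))) _ j< =
           s⋆ _ (suc j) (x′z (suc j) (below′ j<) (λ ()) λ { refl → <⇒≱ (below 0 j<) (m≤n+m (suc k) 3) })
         far′′ (suc (suc (suc (suc i)))) (suc (suc (suc (suc j)))) (s≤s (s≤s (s≤s (s≤s i<j)))) j< =
           trans (⟪⟫-⋆⋆ s (p i) (p j)) (far P i j i<j (below′ j<))
         far′′ 0 0 () _
         far′′ 0 1 (s≤s ()) _
         far′′ 1 0 () _
         far′′ 1 1 (s≤s ()) _
         far′′ 1 2 (s≤s (s≤s ())) _
         far′′ 2 0 () _
         far′′ 2 1 (s≤s ()) _
         far′′ 2 2 (s≤s (s≤s ())) _
         far′′ 2 3 (s≤s (s≤s (s≤s ()))) _
         far′′ 3 0 () _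
         far′′ 3 1 (s≤s ()) _
         far′′ 3 2 (s≤s (s≤s ())) _
         far′′ 3 3 (s≤s (s≤s (s≤s ()))) _
         far′′ 3 4 (s≤s (s≤s (s≤s (s≤s ())))) _
         far′′ (suc (suc (suc (suc i)))) 0 () _
         far′′ (suc (suc (suc (suc i)))) 1 (s≤s ()) _
         far′′ (suc (suc (suc (suc i)))) 2 (s≤s (s≤s ())) _
         far′′ (suc (suc (suc (suc i)))) 3 (s≤s (s≤s (s≤s ()))) _
         dist′′ : ∀ i j → i < j → j < 5 + k → proj₁ (q i) ≢ proj₁ (q j)
         dist′′ 0 1 _ _ = dist P (2 + k) (3 + k) ≤-refl (m≤n+m (4 + k) 2)
         dist′′ 0 2 _ _ = dist P (2 + k) (4 + k) (n≤1+n _) (n≤1+n _)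
         dist′′ 0 3 _ _ = λ eq → off (2 + k) (m≤n+m (3 + k) 3) (sym eq)
         dist′′ 0 (suc (suc (suc (suc j)))) _ j< = λ eq → dist P j (2 + k) (below 1 j<) (m≤n+m (3 + k) 3) (sym eq)
         dist′′ 1 2 _ _ = dist P (3 + k) (4 + k) ≤-refl (n≤1+n _)
         dist′′ 1 3 _ _ = λ eq → off (3 + k) (m≤n+m (4 + k) 2) (sym eq)
         dist′′ 1 (suc (suc (suc (suc j)))) _ j< = λ eq → dist P j (3 + k) (below 2 j<) (m≤n+m (4 + k) 2) (sym eq)
         dist′′ 2 3 _ _ = λ eq → off (4 + k) (n≤1+n _) (sym eq)
         dist′′ 2 (suc (suc (suc (suc j)))) _ j< = λ eq → dist P j (4 + k) (below 3 j<) (n≤1+n _) (sym eq)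
         dist′′ 3 (suc (suc (suc (suc j)))) _ j< = off j (below′ j<)
         dist′′ (suc (suc (suc (suc i)))) (suc (suc (suc (suc j)))) (s≤s (s≤s (s≤s (s≤s i<j)))) j< =
           dist P i j i<j (below′ j<)
         dist′′ 1 1 (s≤s ()) _
         dist′′ 2 1 (s≤s ()) _
         dist′′ 2 2 (s≤s (s≤s ())) _
         dist′′ 3 1 (s≤s ()) _
         dist′′ 3 2 (s≤s (s≤s ())) _
         dist′′ 3 3 (s≤s (s≤s (s≤s ()))) _
         dist′′ (suc (suc (suc (suc i)))) 1 (s≤s ()) _
         dist′′ (suc (suc (suc (suc i)))) 2 (s≤s (s≤s ())) _
         dist′′ (suc (suc (suc (suc i)))) 3 (s≤s (s≤s (s≤s ()))) _
       offQ : Off (5 + k) q (p (5 + k))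
       offQ 0 _ eq = dist P (2 + k) (5 + k) (m≤n+m (3 + k) 2) ≤-refl (sym eq)
       offQ 1 _ eq = dist P (3 + k) (5 + k) (n≤1+n _) ≤-refl (sym eq)
       offQ 2 _ eq = dist P (4 + k) (5 + k) ≤-refl ≤-refl (sym eq)
       offQ 3 _ eq = off (5 + k) ≤-refl (sym eq)
       offQ (suc (suc (suc (suc i)))) i< eq = dist P i (5 + k) (below 4 i<) ≤-refl (sym eq)
       pendant : ∀ i → i < 5 + k → i ≢ 2 → ⟪ p (5 + k) ∣ q i ⟫ ≡ 𝟎
       pendant 0 _ _ = far′ P (2 + k) (5 + k) (n≤1+n _) ≤-refl
       pendant 1 _ _ = far′ P (3 + k) (5 + k) ≤-refl ≤-refl
       pendant 2 _ i≢2 = contradiction refl i≢2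
       pendant 3 _ _ = flip {x′} {p (5 + k)} (x′z (5 + k) ≤-refl (λ ()) λ eq → n≢k+n 0 (sym eq))
       pendant (suc (suc (suc (suc i)))) i< _ = s⋆ _ i (far′ P i (5 + k) (s≤s (below 3 i<)) ≤-refl)
       conclude : Out ⊎ Pat k (λ i → ⟪ p (5 + k) ∣ q i ⟫) → Out
       conclude (inj₁ out) = out
       conclude (inj₂ found) = ⊥-elim (interior found {2} ≤-refl (s≤s (s≤s (s≤s z≤n)))
         (λ eq → contradiction (trans (sym (adj′ P (4 + k) ≤-refl)) eq) λ ()) pendant)

     all-patterns : ∀ k → Pattern k
     all-patterns zero = window
     all-patterns (suc k) {p} P x off with all-patterns k (shorten P) x (λ i i< → off i (m≤n⇒m≤1+n i<))
                                         | all-patterns k (shift P) x (λ i i< → off (suc i) (s≤s i<))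
     ... | inj₁ out | _ = inj₁ out
     ... | inj₂ _ | inj₁ out = inj₁ out
     ... | inj₂ F | inj₂ S with merge k (λ i → ⟪ x ∣ p i ⟫) F S
     ... | pat q = inj₂ q
     ... | bad₂ x0 x4 z = inj₁ (around (all-patterns k) P off x0 x4 z)
     ... | bad₁ x1 x5 z = inj₁ (around {p = reverse (5 + k) p} (all-patterns k) (reverse-path P)
       (λ i i< → off (5 + k ∸ i) (s≤s (m∸n≤m (5 + k) i))) x5
       (subst (λ j → ⟪ x ∣ p j ⟫ ≢ 𝟎) (sym one) x1)
       λ i i< i≢0 i≢4 → z (5 + k ∸ i) (s≤s (m∸n≤m (5 + k) i))
         (λ eq → i≢4 (∸-cancelˡ-≡ (s≤s⁻¹ i<) (n≤1+n (4 + k)) (trans eq (sym one))))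
         (λ eq → i≢0 (∸-cancelˡ-≡ (s≤s⁻¹ i<) z≤n eq)))
       where
       one : 5 + k ∸ (4 + k) ≡ 1
       one = m+n∸n≡m 1 (4 + k)

module PathReplacement where

 open Configuration
 open Gains
 open ShortPaths
 open import Data.Integer.Base using (+_)
 open import Data.Maybe.Properties using (just-injective)
 open import Data.Nat.Base
 open import Data.Nat.Properties
 open import Data.Vec.Relation.Unary.All using ([]; _∷_)

 just-≢ : ∀ {w : W} {q} → w ≡ just q → w ≢ 𝟎
 just-≢ refl ()

 unit-of : ∀ {w : W} → w ≢ 𝟎 → ∃[ q ] w ≡ just q
 unit-of {𝟎}      ne = contradiction refl ne
 unit-of {just q} _  = q , refl

 module Replacement {n} (G : GainGraph n) where
   open Paths G public

   ⋆-zeroʳ : ∀ q {y x} → ⟪ y ∣ x ⟫ ≡ 𝟎 → ⟪ y ∣ q ⋆ x ⟫ ≡ 𝟎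
   ⋆-zeroʳ q {y} {x} eq = trans (⟪⟫-⋆ʳ q y x) (cong (q ⁻¹ ◃_) eq)

   ⋆-zeroˡ : ∀ q {y x} → ⟪ y ∣ x ⟫ ≡ 𝟎 → ⟪ q ⋆ y ∣ x ⟫ ≡ 𝟎
   ⋆-zeroˡ q {y} {x} eq = trans (⟪⟫-⋆ˡ q y x) (cong (q ◃_) eq)

   ⋆-nonzeroʳ : ∀ q {y x} → ⟪ y ∣ x ⟫ ≢ 𝟎 → ⟪ y ∣ q ⋆ x ⟫ ≢ 𝟎
   ⋆-nonzeroʳ q {y} {x} ne eq = ne (◃-cancel (q ⁻¹) (trans (sym (⟪⟫-⋆ʳ q y x)) eq))

   ⋆-nonzeroˡ : ∀ q {y x} → ⟪ q ⋆ y ∣ x ⟫ ≢ 𝟎 → ⟪ y ∣ x ⟫ ≢ 𝟎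
   ⋆-nonzeroˡ q ne eq = ne (⋆-zeroˡ q eq)

   flip-𝟎 : ∀ {x y} → ⟪ x ∣ y ⟫ ≡ 𝟎 → ⟪ y ∣ x ⟫ ≡ 𝟎
   flip-𝟎 {x} {y} eq = flip {x} {y} eq

   module _ (k : ℕ) (q : ℕ → X) where

     record Twin (t : ℕ) (x : X) : Set where
       field
         t< : t < 5 + k
         left : ∀ {i} → suc i ≡ t → ⟪ q i ∣ x ⟫ ≡ 𝟏
         right : suc t < 5 + k → ⟪ x ∣ q (suc t) ⟫ ≡ just ζ²
         rest : ∀ i → i < 5 + k → suc i ≢ t → i ≢ suc t → ⟪ x ∣ q i ⟫ ≡ 𝟎
         off : Off (5 + k) q x

     record Closer (ζ : C₄) (z : X) : Set where
       field
         left : ⟪ q (4 + k) ∣ z ⟫ ≡ 𝟏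
         right : ⟪ z ∣ q 0 ⟫ ≡ just ζ
         rest : ∀ i → i < 5 + k → i ≢ 0 → i ≢ 4 + k → ⟪ z ∣ q i ⟫ ≡ 𝟎
         off : Off (5 + k) q z

   replace : (ℕ → X) → ℕ → X → ℕ → X
   replace q t x i with <-cmp i t
   ... | tri< _ _ _ = q i
   ... | tri≈ _ _ _ = x
   ... | tri> _ _ _ = ζ² ⋆ q i

   replace-< : ∀ {q t x i} → i < t → replace q t x i ≡ q i
   replace-< {t = t} {i = i} i<t with <-cmp i t
   ... | tri< _ _ _ = refl
   ... | tri≈ i≮t _ _ = contradiction i<t i≮t
   ... | tri> i≮t _ _ = contradiction i<t i≮t

   replace-≡ : ∀ {q} t {x} → replace q t x t ≡ x
   replace-≡ t with <-cmp t t
   ... | tri< _ t≢t _ = contradiction refl t≢t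
   ... | tri≈ _ _ _ = refl
   ... | tri> _ t≢t _ = contradiction refl t≢t

   replace-> : ∀ {q t x i} → t < i → replace q t x i ≡ ζ² ⋆ q i
   replace-> {t = t} {i = i} t<i with <-cmp i t
   ... | tri< _ _ t≮i = contradiction t<i t≮i
   ... | tri≈ _ _ t≮i = contradiction t<i t≮i
   ... | tri> _ _ _ = refl

   replace-𝟎 : ∀ {q t x} y i → (i ≢ t → ⟪ y ∣ q i ⟫ ≡ 𝟎) → (i ≡ t → ⟪ y ∣ x ⟫ ≡ 𝟎) →
     ⟪ y ∣ replace q t x i ⟫ ≡ 𝟎
   replace-𝟎 {q} {t} y i a b with <-cmp i t
   ... | tri< _ i≢t _ = a i≢t
   ... | tri≈ _ i≡t _ = b i≡t
   ... | tri> _ i≢t _ = ⋆-zeroʳ ζ² {y} {q i} (a i≢t)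

   replace-≢𝟎 : ∀ {q t x} y i → i ≢ t → ⟪ y ∣ q i ⟫ ≢ 𝟎 → ⟪ y ∣ replace q t x i ⟫ ≢ 𝟎
   replace-≢𝟎 {q} {t} y i i≢t ne with <-cmp i t
   ... | tri< _ _ _ = ne
   ... | tri≈ _ i≡t _ = contradiction i≡t i≢t
   ... | tri> _ _ _ = ⋆-nonzeroʳ ζ² {y} {q i} ne

   replace-at : ∀ {q t x} y → ⟪ y ∣ replace q t x t ⟫ ≡ ⟪ y ∣ x ⟫
   replace-at {q} {t} {x} y = cong ⟪ y ∣_⟫ (replace-≡ {q} t {x})

   replace-off : ∀ {m q t x y} → (∀ i → i < m → i ≢ t → proj₁ y ≢ proj₁ (q i)) → proj₁ y ≢ proj₁ x →
     Off m (replace q t x) y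
   replace-off {t = t} off y≢x i i< with <-cmp i t
   ... | tri< _ i≢t _ = off i i< i≢t
   ... | tri≈ _ _ _ = y≢x
   ... | tri> _ i≢t _ = off i i< i≢t

   replace-path : ∀ {k q t x} → IsPath (5 + k) q → Twin k q t x → IsPath (5 + k) (replace q t x)
   replace-path {k} {q} {t} {x} Q T = record { adj = adj″ ; far = far″ ; dist = dist″ }
     where
     open Twin T
     adj″ : ∀ i → suc i < 5 + k → ⟪ replace q t x i ∣ replace q t x (suc i) ⟫ ≡ 𝟏
     adj″ i i< with <-cmp i t | <-cmp (suc i) t
     ... | tri< _ _ _ | tri< _ _ _ = adj Q i i<
     ... | tri< _ _ _ | tri≈ _ si≡t _ = left si≡t
     ... | tri< i<t _ _ | tri> _ _ t<si = contradiction t<si (≤⇒≯ i<t)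
     ... | tri≈ _ refl _ | tri< si<t _ _ = contradiction si<t (≤⇒≯ (n≤1+n i))
     ... | tri≈ _ refl _ | tri> _ _ _ =
       trans (⟪⟫-⋆ʳ ζ² x (q (suc i))) (cong (ζ² ◃_) (right i<))
     ... | tri> _ _ t<i | tri< si<t _ _ = contradiction si<t (≤⇒≯ (≤-trans (<⇒≤ t<i) (n≤1+n i)))
     ... | tri> _ _ t<i | tri≈ _ refl _ = contradiction t<i (≤⇒≯ (n≤1+n i))
     ... | tri> _ _ _ | tri> _ _ _ = trans (⟪⟫-⋆⋆ ζ² (q i) (q (suc i))) (adj Q i i<)
     far″ : ∀ i j → 2 + i ≤ j → j < 5 + k → ⟪ replace q t x i ∣ replace q t x j ⟫ ≡ 𝟎
     far″ i j i<j j< with <-cmp i t | <-cmp j t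
     ... | tri< _ _ _ | tri< _ _ _ = far Q i j i<j j<
     ... | tri< _ _ _ | tri≈ _ refl _ = flip-𝟎 {x} {q i} (rest i (<-trans (≤-trans (n≤1+n _) i<j) j<)
       (λ { refl → <-irrefl refl i<j }) (λ { refl → <⇒≱ i<j (m≤n+m _ 2) }))
     ... | tri< _ _ _ | tri> _ _ _ = ⋆-zeroʳ ζ² {q i} {q j} (far Q i j i<j j<)
     ... | tri≈ _ refl _ | tri< j<t _ _ = contradiction j<t (≤⇒≯ (≤-trans (m≤n+m i 2) i<j))
     ... | tri≈ _ refl _ | tri≈ _ refl _ = contradiction i<j (<⇒≱ (n≤1+n _))
     ... | tri≈ _ refl _ | tri> _ _ _ = ⋆-zeroʳ ζ² {x} {q j} (rest j j<
       (λ { refl → <⇒≱ i<j (≤-trans (n≤1+n _) (n≤1+n _)) }) (λ { refl → <-irrefl refl i<j }))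
     ... | tri> _ _ t<i | tri< j<t _ _ = contradiction (≤-trans (m≤n+m i 2) i<j) (<⇒≱ (<-trans j<t t<i))
     ... | tri> _ _ t<i | tri≈ _ refl _ = contradiction (≤-trans (m≤n+m i 2) i<j) (<⇒≱ t<i)
     ... | tri> _ _ _ | tri> _ _ _ = trans (⟪⟫-⋆⋆ ζ² (q i) (q j)) (far Q i j i<j j<)
     dist″ : ∀ i j → i < j → j < 5 + k → proj₁ (replace q t x i) ≢ proj₁ (replace q t x j)
     dist″ i j i<j j< with <-cmp i t | <-cmp j t
     ... | tri< _ _ _ | tri< _ _ _ = dist Q i j i<j j<
     ... | tri< _ _ _ | tri≈ _ refl _ = λ eq → off i (<-trans i<j j<) (sym eq)
     ... | tri< _ _ _ | tri> _ _ _ = dist Q i j i<j j<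
     ... | tri≈ _ refl _ | tri< _ _ _ = off j j<
     ... | tri≈ _ refl _ | tri≈ _ refl _ = contradiction i<j (<-irrefl refl)
     ... | tri≈ _ refl _ | tri> _ _ _ = off j j<
     ... | tri> _ _ _ | tri< _ _ _ = dist Q i j i<j j<
     ... | tri> _ _ _ | tri≈ _ refl _ = λ eq → off i (<-trans i<j j<) (sym eq)
     ... | tri> _ _ _ | tri> _ _ _ = dist Q i j i<j j<

   private
     test-vector : Vec ℤ[i] 6
     test-vector = (+ 4 +i + 0) ∷ (+ 2 +i + 0) ∷ (+ 2 +i + 0) ∷ (+ 2 +i + 0) ∷ (+ 2 +i + 0) ∷ (+ 1 +i + 0) ∷ []

   no-star : ∀ {c a b d e f} → Distinct (c ∷ a ∷ b ∷ d ∷ e ∷ f ∷ []) →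
     ⟪ c ∣ a ⟫ ≡ 𝟏 → ⟪ c ∣ b ⟫ ≡ 𝟏 → ⟪ c ∣ d ⟫ ≡ 𝟏 → ⟪ c ∣ e ⟫ ≡ 𝟏 → ⟪ c ∣ f ⟫ ≡ 𝟎 →
     ⟪ a ∣ b ⟫ ≡ 𝟎 → ⟪ a ∣ d ⟫ ≡ 𝟎 → ⟪ a ∣ e ⟫ ≡ 𝟎 → ⟪ a ∣ f ⟫ ≡ 𝟎 →
     ⟪ b ∣ d ⟫ ≡ 𝟎 → ⟪ b ∣ e ⟫ ≡ 𝟎 → ⟪ b ∣ f ⟫ ≡ 𝟎 →
     ⟪ d ∣ e ⟫ ≡ 𝟎 → ⟪ d ∣ f ⟫ ≡ 𝟎 → ⟪ e ∣ f ⟫ ≡ 𝟏 → ⊥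
   no-star {c} {a} {b} {d} {e} {f} distinct ca cb cd ce cf ab ad ae af bd be bf de df ef
     = clash (trans (sym (bound (c ∷ a ∷ b ∷ d ∷ e ∷ f ∷ []) distinct test-vector))
                    (cong (λ N → refutes N test-vector) shape))
     where
     clash : false ≡ true → ⊥
     clash ()
     shape : conf (c ∷ a ∷ b ∷ d ∷ e ∷ f ∷ []) ≡
       (𝟏 ∷ 𝟏 ∷ 𝟏 ∷ 𝟏 ∷ 𝟎 ∷ []) ∷ (𝟎 ∷ 𝟎 ∷ 𝟎 ∷ 𝟎 ∷ []) ∷ (𝟎 ∷ 𝟎 ∷ 𝟎 ∷ []) ∷ (𝟎 ∷ 𝟎 ∷ []) ∷ (𝟏 ∷ []) ∷ [] ∷ []
     shape rewrite ca | cb | cd | ce | cf | ab | ad | ae | af | bd | be | bf | de | df | ef = refl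

   five-path : ∀ {a b c d e} →
     ⟪ a ∣ b ⟫ ≡ 𝟏 → ⟪ b ∣ c ⟫ ≡ 𝟏 → ⟪ c ∣ d ⟫ ≡ 𝟏 → ⟪ d ∣ e ⟫ ≡ 𝟏 →
     ⟪ a ∣ c ⟫ ≡ 𝟎 → ⟪ a ∣ d ⟫ ≡ 𝟎 → ⟪ a ∣ e ⟫ ≡ 𝟎 → ⟪ b ∣ d ⟫ ≡ 𝟎 → ⟪ b ∣ e ⟫ ≡ 𝟎 → ⟪ c ∣ e ⟫ ≡ 𝟎 →
     Distinct (a ∷ b ∷ c ∷ d ∷ e ∷ []) → IsPath 5 (cons a (cons b (cons c (cons d λ _ → e))))
   five-path ab bc cd de ac ad ae bd be ce
     ((a≢b ∷ a≢c ∷ a≢d ∷ a≢e ∷ []) , (b≢c ∷ b≢d ∷ b≢e ∷ []) , (c≢d ∷ c≢e ∷ []) , (d≢e ∷ []) , _) =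
     cons-path (cons-path (cons-path (cons-path base (λ _ _ → d≢e) de λ i lt → ⊥-elim (<⇒≱ lt (s≤s z≤n)))
       (λ { 0 _ → c≢d ; (suc _) _ → c≢e }) cd λ _ _ → ce)
       (λ { 0 _ → b≢c ; 1 _ → b≢d ; (suc (suc _)) _ → b≢e }) bc λ { 0 _ → bd ; (suc _) _ → be })
       (λ { 0 _ → a≢b ; 1 _ → a≢c ; 2 _ → a≢d ; (suc (suc (suc _))) _ → a≢e }) ab
       λ { 0 _ → ac ; 1 _ → ad ; (suc (suc _)) _ → ae }
     where
     base : IsPath 1 _
     base = record
       { adj = λ i i< → ⊥-elim (<⇒≱ i< (s≤s z≤n))
       ; far = λ i j i<j j< → ⊥-elim (<⇒≱ (≤-trans (s≤s z≤n) i<j) (s≤s⁻¹ j<))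
       ; dist = λ i j i<j j< → ⊥-elim (<⇒≱ (≤-trans (s≤s z≤n) i<j) (s≤s⁻¹ j<)) }

 module Extremal {n} (G : GainGraph n) (k : ℕ) where
   open Replacement G public

   module _ {Out : Set}
     (window : ∀ {p} → IsPath 5 p → ∀ x → Off 5 p x → Out ⊎ Pat 0 (λ i → ⟪ x ∣ p i ⟫))
     (longer : ∀ q → IsPath (6 + k) q → Out) where

     pattern-of : ∀ {p} → IsPath (5 + k) p → ∀ x → Off (5 + k) p x → Out ⊎ Pat k (λ i → ⟪ x ∣ p i ⟫)
     pattern-of = all-patterns window k

     data Kind (q : ℕ → X) (x : X) : Set where
       isolated : (∀ i → i < 5 + k → ⟪ x ∣ q i ⟫ ≡ 𝟎) → Kind q x
       twin : ∀ a t → Twin k q t (a ⋆ x) → Kind q x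
       closer : ∀ a ζ → Closer k q ζ (a ⋆ x) → Kind q x

     classify : ∀ {q} → IsPath (5 + k) q → ∀ x → Off (5 + k) q x → Out ⊎ Kind q x
     classify {q} Q x off with pattern-of Q x off
     ... | inj₁ out = inj₁ out
     ... | inj₂ (none z) = inj₂ (isolated z)
     ... | inj₂ (end .0 first c0 z) with a , eq ← unit-of c0 =
       inj₁ (longer (cons (a ⁻¹ ⋆ x) q) (cons-path Q off
         (trans (⟪⟫-⋆ˡ (a ⁻¹) x (q 0)) (trans (cong (a ⁻¹ ◃_) eq) (cong just (∙-inverseˡ a))))
         λ i i< → ⋆-zeroˡ (a ⁻¹) {x} {q (suc i)} (z (suc i) i< λ ())))
     ... | inj₂ (end _ last c4 z) with a , eq ← unit-of c4 =
       inj₁ (longer (snoc (5 + k) q (a ⁻¹ ⋆ x)) (snoc-path Q off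
         (flip {a ⁻¹ ⋆ x} {q (4 + k)} (trans (⟪⟫-⋆ˡ (a ⁻¹) x (q (4 + k))) (trans (cong (a ⁻¹ ◃_) eq) (cong just (∙-inverseˡ a)))))
         λ i i< → flip-𝟎 {a ⁻¹ ⋆ x} {q i} (⋆-zeroˡ (a ⁻¹) {x} {q i} (z i (m≤n⇒m≤1+n i<) (<⇒≢ i<)))))
     ... | inj₂ (end .1 second c1 z) with a , eq ← unit-of c1 = inj₂ (twin (ζ² ∙ a ⁻¹) 0 record
       { t< = s≤s z≤n
       ; left = λ ()
       ; right = λ _ → trans (⟪⟫-⋆ˡ (ζ² ∙ a ⁻¹) x (q 1)) (trans (cong ((ζ² ∙ a ⁻¹) ◃_) eq)
           (cong just (trans (∙-assoc ζ² (a ⁻¹) a) (cong (ζ² ∙_) (∙-inverseˡ a)))))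
       ; rest = λ i i< _ i≢1 → ⋆-zeroˡ (ζ² ∙ a ⁻¹) {x} {q i} (z i i< i≢1)
       ; off = off })
     ... | inj₂ (end _ penult c3 z) with a , eq ← unit-of c3 = inj₂ (twin (a ⁻¹) (4 + k) record
       { t< = ≤-refl
       ; left = λ { refl → flip {a ⁻¹ ⋆ x} {q (3 + k)}
           (trans (⟪⟫-⋆ˡ (a ⁻¹) x (q (3 + k))) (trans (cong (a ⁻¹ ◃_) eq) (cong just (∙-inverseˡ a)))) }
       ; right = λ lt → contradiction lt (<-irrefl refl)
       ; rest = λ i i< si≢ _ → ⋆-zeroˡ (a ⁻¹) {x} {q i} (z i i< λ { refl → si≢ refl })
       ; off = off })
     ... | inj₂ (twin j j< cj neg z) with a , eq ← unit-of cj = inj₂ (twin (a ⁻¹) (suc j) record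
       { t< = s≤s (≤-trans j< (n≤1+n _))
       ; left = λ { refl → flip {a ⁻¹ ⋆ x} {q j}
           (trans (⟪⟫-⋆ˡ (a ⁻¹) x (q j)) (trans (cong (a ⁻¹ ◃_) eq) (cong just (∙-inverseˡ a)))) }
       ; right = λ _ → trans (⟪⟫-⋆ˡ (a ⁻¹) x (q (2 + j))) (trans (cong (a ⁻¹ ◃_) (trans neg (cong negʷ eq)))
           (trans (◃-negʷ (a ⁻¹) (just a)) (cong (λ r → negʷ (just r)) (∙-inverseˡ a))))
       ; rest = λ i i< si≢ i≢ → ⋆-zeroˡ (a ⁻¹) {x} {q i} (z i i< (λ { refl → si≢ refl }) i≢)
       ; off = off })
     ... | inj₂ (close c0 c4 z) with a , eq ← unit-of c4 | b , eq′ ← unit-of c0 = inj₂ (closer (a ⁻¹) (a ⁻¹ ∙ b) record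
       { left = flip {a ⁻¹ ⋆ x} {q (4 + k)}
           (trans (⟪⟫-⋆ˡ (a ⁻¹) x (q (4 + k))) (trans (cong (a ⁻¹ ◃_) eq) (cong just (∙-inverseˡ a))))
       ; right = trans (⟪⟫-⋆ˡ (a ⁻¹) x (q 0)) (cong (a ⁻¹ ◃_) eq′)
       ; rest = λ i i< i≢0 i≢ → ⋆-zeroˡ (a ⁻¹) {x} {q i} (z i i< i≢0 i≢)
       ; off = off })

     twin-left-≢ : ∀ {q t x} → Twin k q (suc t) x → ⟪ x ∣ q t ⟫ ≢ 𝟎
     twin-left-≢ {q} {t} {x} T = flip-≢ {q t} {x} (just-≢ (Twin.left T refl))

     twin-right-≢ : ∀ {q t x} → Twin k q t x → suc t < 5 + k → ⟪ x ∣ q (suc t) ⟫ ≢ 𝟎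
     twin-right-≢ T t< = just-≢ (Twin.right T t<)

     closer-last-≢ : ∀ {q ζ z} → Closer k q ζ z → ⟪ z ∣ q (4 + k) ⟫ ≢ 𝟎
     closer-last-≢ {q} {ζ} {z} C = flip-≢ {q (4 + k)} {z} (just-≢ (Closer.left C))

     module _ {p : ℕ → X} (P : IsPath (5 + k) p) where

       module _ where
         -- y is attached to an induced path only at the twin of its vertex t.
         only-at-twin : ∀ {t x y} → Twin k p t x → Off (5 + k) p y → proj₁ y ≢ proj₁ x →
           (∀ i → i < 5 + k → ⟪ y ∣ p i ⟫ ≡ 𝟎) → ⟪ y ∣ x ⟫ ≢ 𝟎 → Out
         only-at-twin {t} {x} {y} T off y≢x z yx with classify Q y offQ
           where
           q = replace p t x
           Q = replace-path P T
           offQ = replace-off {q = p} {t} {x} {y} (λ i i< _ → off i i<) y≢x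
         ... | inj₁ out = out
         ... | inj₂ kind = by-kind kind
           where
           q = replace p t x
           Q : IsPath (5 + k) q
           Q = replace-path P T
           at-t : ∀ {i} → i < 5 + k → ⟪ y ∣ q i ⟫ ≢ 𝟎 → i ≡ t
           at-t {i} i< ne = decide (i ≟ t)
             where
             decide : Dec (i ≡ t) → i ≡ t
             decide (yes eq) = eq
             decide (no i≢t) =
               contradiction (replace-𝟎 {p} {t} {x} y i (λ _ → z i i<) (λ eq → contradiction eq i≢t)) ne
           by-kind : Kind q y → Out
           by-kind (isolated z′) = contradiction (trans (sym (replace-at {p} {t} {x} y)) (z′ t (Twin.t< T))) yx
           by-kind (closer a ζ C) = contradiction
             (trans (at-t (s≤s z≤n) (⋆-nonzeroˡ a {y} {q 0} (just-≢ (Closer.right C))))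
                    (sym (at-t ≤-refl (⋆-nonzeroˡ a {y} {q (4 + k)} (closer-last-≢ C))))) λ ()
           by-kind (twin a (suc t′) T′) with suc (suc t′) <? 5 + k
           ... | yes t< = contradiction
             (trans (at-t (<-trans (n<1+n t′) (Twin.t< T′)) (⋆-nonzeroˡ a {y} {q t′} (twin-left-≢ T′)))
                    (sym (at-t t< (⋆-nonzeroˡ a {y} {q (2 + t′)} (twin-right-≢ T′ t<))))) n≢2+n
           ... | no t≮ with refl ← suc-injective (≤-antisym (Twin.t< T′) (≮⇒≥ t≮))
             with refl ← at-t (n≤1+n _) (⋆-nonzeroˡ a {y} {q t′} (twin-left-≢ T′)) = at-end
             where
             r = replace q (4 + k) (a ⋆ y)
             at-end : Out
             at-end with pattern-of (replace-path Q T′) (p (3 + k)) (replace-off {q = q} {4 + k} {a ⋆ y} {p (3 + k)}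
               (λ i i< i≢ → replace-off {4 + k} {q = p} {3 + k} {x} {p (3 + k)}
                 (λ j j< j≢ eq → dist P j (3 + k) (≤∧≢⇒< (s≤s⁻¹ j<) j≢) (n≤1+n _) (sym eq))
                 (λ eq → Twin.off T (3 + k) (n≤1+n _) (sym eq)) i (≤∧≢⇒< (s≤s⁻¹ i<) i≢))
               (λ eq → off (3 + k) (n≤1+n _) (sym eq)))
             ... | inj₁ out = out
             ... | inj₂ found = ⊥-elim (interior found {2 + k} (s≤s (s≤s z≤n)) ≤-refl
               (replace-≢𝟎 {q} {4 + k} {a ⋆ y} (p (3 + k)) (2 + k) n≢2+n
                 (replace-≢𝟎 {p} {3 + k} {x} (p (3 + k)) (2 + k) (n≢k+n 0)
                   (just-≢ (adj′ P (2 + k) (n≤1+n _)))))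
               λ i i< i≢ → replace-𝟎 {q} {4 + k} {a ⋆ y} (p (3 + k)) i
                 (λ i≢4 → replace-𝟎 {p} {3 + k} {x} (p (3 + k)) i
                   (λ i≢3 → far′ P i (3 + k) (s≤s (≤∧≢⇒< (s≤s⁻¹ (≤∧≢⇒< (s≤s⁻¹ (≤∧≢⇒< (s≤s⁻¹ i<) i≢4)) i≢3)) i≢)) (n≤1+n _))
                   (λ _ → flip-𝟎 {x} {p (3 + k)} (Twin.rest T (3 + k) (n≤1+n _) (λ eq → n≢k+n 0 (sym eq)) (n≢k+n 0))))
                 (λ _ → flip-𝟎 {a ⋆ y} {p (3 + k)} (⋆-zeroˡ a {y} {p (3 + k)} (z (3 + k) (n≤1+n _)))))
           by-kind (twin a zero T′)
             with refl ← at-t (s≤s (s≤s z≤n)) (⋆-nonzeroˡ a {y} {q 1} (twin-right-≢ T′ (s≤s (s≤s z≤n)))) = at-start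
             where
             r = replace q 0 (a ⋆ y)
             at-start : Out
             at-start with pattern-of (replace-path Q T′) (p 1) (replace-off {q = q} {0} {a ⋆ y} {p 1}
               (λ i i< i≢0 → away i i< i≢0) (λ eq → off 1 (s≤s (s≤s z≤n)) (sym eq)))
               where
               away : ∀ i → i < 5 + k → i ≢ 0 → proj₁ (p 1) ≢ proj₁ (q i)
               away zero _ ne = contradiction refl ne
               away (suc i) i< _ with <-cmp (suc i) 1
               ... | tri< (s≤s ()) _ _
               ... | tri≈ _ _ _ = λ eq → Twin.off T 1 (s≤s (s≤s z≤n)) (sym eq)
               ... | tri> _ _ 1<i = dist P 1 (suc i) 1<i i<
             ... | inj₁ out = out
             ... | inj₂ found = ⊥-elim (interior found {2} ≤-refl (s≤s (s≤s (s≤s z≤n)))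
               (replace-≢𝟎 {q} {0} {a ⋆ y} (p 1) 2 (λ ())
                 (replace-≢𝟎 {p} {1} {x} (p 1) 2 (λ ()) (just-≢ (adj P 1 (s≤s (s≤s (s≤s z≤n)))))))
               λ i i< i≢ → replace-𝟎 {q} {0} {a ⋆ y} (p 1) i
                 (λ i≢0 → replace-𝟎 {p} {1} {x} (p 1) i
                   (λ i≢1 → away i i< i≢0 i≢1 i≢)
                   (λ _ → flip-𝟎 {x} {p 1} (Twin.rest T 1 (s≤s (s≤s z≤n)) (λ ()) (λ ()))))
                 (λ _ → flip-𝟎 {a ⋆ y} {p 1} (⋆-zeroˡ a {y} {p 1} (z 1 (s≤s (s≤s z≤n))))))
               where
               away : ∀ i → i < 5 + k → i ≢ 0 → i ≢ 1 → i ≢ 2 → ⟪ p 1 ∣ p i ⟫ ≡ 𝟎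
               away 0 _ ne _ _ = contradiction refl ne
               away 1 _ _ ne _ = contradiction refl ne
               away 2 _ _ _ ne = contradiction refl ne
               away (suc (suc (suc i))) i< _ _ _ = far P 1 (3 + i) (s≤s (s≤s (s≤s z≤n))) i<

     module _ {p : ℕ → X} (P : IsPath (5 + k) p) where

       -- The path with its first vertex moved to the other side, where a closer
       -- takes its place.
       turnʳ : X → ℕ → X
       turnʳ z = snoc (4 + k) (λ i → p (suc i)) z

       turnʳ-path : ∀ {ζ z} → Closer k p ζ z → IsPath (5 + k) (turnʳ z)
       turnʳ-path {ζ} {z} C = snoc-path (shift P) (λ i i< → off (suc i) (s≤s i<)) left
         λ i i< → flip-𝟎 {z} {p (suc i)} (rest (suc i) (s≤s (m≤n⇒m≤1+n i<)) (λ ()) (<⇒≢ (s≤s i<)))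
         where open Closer C

       turnʳ-< : ∀ {z i} → i < 4 + k → turnʳ z i ≡ p (suc i)
       turnʳ-< = snoc-<

       turnʳ-≡ : ∀ {z} → turnʳ z (4 + k) ≡ z
       turnʳ-≡ = snoc-≡ (4 + k)

       turnʳ-off : ∀ {y z} → Off (5 + k) p y → proj₁ y ≢ proj₁ z → Off (5 + k) (turnʳ z) y
       turnʳ-off {y} {z} off y≢z i i< eq with m≤n⇒m<n∨m≡n (s≤s⁻¹ i<)
       ... | inj₁ i<4 = off (suc i) (s≤s i<4) (trans eq (cong proj₁ (turnʳ-< {z} i<4)))
       ... | inj₂ refl = y≢z (trans eq (cong proj₁ (turnʳ-≡ {z})))

       turnˡ : C₄ → X → ℕ → X
       turnˡ ζ z = cons (ζ ⁻¹ ⋆ z) p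

       turnˡ-path : ∀ {ζ z} → Closer k p ζ z → IsPath (5 + k) (turnˡ ζ z)
       turnˡ-path {ζ} {z} C = cons-path (shorten P) (λ i i< → off i (m≤n⇒m≤1+n i<))
         (trans (⟪⟫-⋆ˡ (ζ ⁻¹) z (p 0)) (trans (cong (ζ ⁻¹ ◃_) right) (cong just (∙-inverseˡ ζ))))
         λ i i< → ⋆-zeroˡ (ζ ⁻¹) {z} {p (suc i)} (rest (suc i) (m≤n⇒m≤1+n i<) (λ ()) (<⇒≢ i<))
         where open Closer C

       turnˡ-off : ∀ {y z} ζ → Off (5 + k) p y → proj₁ y ≢ proj₁ z → Off (5 + k) (turnˡ ζ z) y
       turnˡ-off ζ off y≢z zero _ = y≢z
       turnˡ-off ζ off y≢z (suc i) i< = off i (≤-trans (n≤1+n _) i<)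

       only-at-closer : ∀ {ζ z y} → Closer k p ζ z → Off (5 + k) p y → proj₁ y ≢ proj₁ z →
         (∀ i → i < 5 + k → ⟪ y ∣ p i ⟫ ≡ 𝟎) → ⟪ y ∣ z ⟫ ≢ 𝟎 → Out
       only-at-closer {ζ} {z} {y} C off y≢z zs yz = longer _ (snoc-path {x = y′} (turnʳ-path C) (turnʳ-off {y} {z} off y≢z)
         (trans (cong ⟪_∣ y′ ⟫ (turnʳ-≡ {z})) (normalised {z} {y} (flip-≢ {y} {z} yz)))
         λ i i< → trans (cong ⟪_∣ y′ ⟫ (turnʳ-< {z} i<))
           (⋆-zeroʳ (normaliser ⟪ z ∣ y ⟫) {p (suc i)} {y} (flip-𝟎 {y} {p (suc i)} (zs (suc i) (s≤s i<)))))
         where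
         y′ = normaliser ⟪ z ∣ y ⟫ ⋆ y

       private
         𝟏≢ζ² : ∀ {w} → w ≡ 𝟏 → w ≡ just ζ² → ⊥
         𝟏≢ζ² refl ()

         negʷ-injective : ∀ {w} q → just q ≡ negʷ w → w ≡ just (ζ² ∙ q)
         negʷ-injective {just r} q eq =
           cong just (trans (sym (trans (sym (∙-assoc ζ² ζ² r)) refl)) (cong (ζ² ∙_) (sym (just-injective eq))))

       replaced-twin-off : ∀ {s t x y} → Twin k p s x → Twin k p t y → proj₁ y ≢ proj₁ x → Off (5 + k) (replace p s x) y
       replaced-twin-off {s} {t} {x} {y} T U y≢x = replace-off {q = p} {s} {x} {y} (λ i i< _ → Twin.off U i i<) y≢x

       twin-unique : ∀ {t x y} → Twin k p t x → Twin k p t y → proj₁ y ≢ proj₁ x → Out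
       twin-unique {t} {x} {y} T U y≢x with pattern-of (replace-path P T) y (replaced-twin-off T U y≢x)
       ... | inj₁ out = out
       ... | inj₂ found = ⊥-elim (by-position t T U found)
         where
         x≢y : proj₁ x ≢ proj₁ y
         x≢y eq = y≢x (sym eq)
         by-position : ∀ t → Twin k p t x → Twin k p t y → Pat k (λ i → ⟪ y ∣ replace p t x i ⟫) → ⊥
         by-position zero T U found = no-star {p 1} {p 0} {ζ² ⋆ x} {ζ² ⋆ y} {p 2} {p 3}
           ( ((λ eq → dist P 0 1 (s≤s z≤n) (s≤s (s≤s z≤n)) (sym eq))
               ∷ (λ eq → Twin.off T 1 (s≤s (s≤s z≤n)) (sym eq)) ∷ (λ eq → Twin.off U 1 (s≤s (s≤s z≤n)) (sym eq))
               ∷ dist P 1 2 (s≤s (s≤s z≤n)) (s≤s (s≤s (s≤s z≤n))) ∷ dist P 1 3 (s≤s (s≤s z≤n)) 3< ∷ [])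
           , ((λ eq → Twin.off T 0 (s≤s z≤n) (sym eq)) ∷ (λ eq → Twin.off U 0 (s≤s z≤n) (sym eq))
               ∷ dist P 0 2 (s≤s z≤n) 2< ∷ dist P 0 3 (s≤s z≤n) 3< ∷ [])
           , (x≢y ∷ Twin.off T 2 2< ∷ Twin.off T 3 3< ∷ [])
           , (Twin.off U 2 2< ∷ Twin.off U 3 3< ∷ [])
           , (dist P 2 3 (s≤s (s≤s (s≤s z≤n))) 3< ∷ [])
           , ([] , tt) )
           (adj′ P 0 (s≤s (s≤s z≤n)))
           (turned T) (turned U)
           (adj P 1 2<) (far P 1 3 (s≤s (s≤s (s≤s z≤n))) 3<)
           (⋆-zeroʳ ζ² {p 0} {x} (flip-𝟎 {x} {p 0} (Twin.rest T 0 (s≤s z≤n) (λ ()) (λ ()))))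
           (⋆-zeroʳ ζ² {p 0} {y} (flip-𝟎 {y} {p 0} (Twin.rest U 0 (s≤s z≤n) (λ ()) (λ ()))))
           (far P 0 2 (s≤s (s≤s z≤n)) 2<) (far P 0 3 (s≤s (s≤s z≤n)) 3<)
           (trans (⟪⟫-⋆⋆ ζ² x y) (flip-𝟎 {y} {x} yx))
           (⋆-zeroˡ ζ² {x} {p 2} (Twin.rest T 2 2< (λ ()) (λ ()))) (⋆-zeroˡ ζ² {x} {p 3} (Twin.rest T 3 3< (λ ()) (λ ())))
           (⋆-zeroˡ ζ² {y} {p 2} (Twin.rest U 2 2< (λ ()) (λ ()))) (⋆-zeroˡ ζ² {y} {p 3} (Twin.rest U 3 3< (λ ()) (λ ())))
           (adj P 2 3<)
           where
           2< : 2 < 5 + k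
           2< = s≤s (s≤s (s≤s z≤n))
           3< : 3 < 5 + k
           3< = s≤s (s≤s (s≤s (s≤s z≤n)))
           turned : ∀ {u} → Twin k p 0 u → ⟪ p 1 ∣ ζ² ⋆ u ⟫ ≡ 𝟏
           turned {u} V = trans (⟪⟫-⋆ʳ ζ² (p 1) u) (cong (ζ² ◃_) (flip {u} {p 1} (Twin.right V (s≤s (s≤s z≤n)))))
           yx : ⟪ y ∣ x ⟫ ≡ 𝟎
           yx with zero? ⟪ y ∣ x ⟫
           ... | inj₁ eq = eq
           ... | inj₂ ne = contradiction
             (adjacent-zero found {0} (s≤s (s≤s z≤n)) (λ eq → ne (trans (sym (replace-at {p} {0} {x} y)) eq)))
             (replace-≢𝟎 {p} {0} {x} y 1 (λ ()) (twin-right-≢ U (s≤s (s≤s z≤n))))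
         by-position (suc t) T U found with 2 + t <? 5 + k
         ... | yes t< with two-nonzero found {t} {2 + t} (n≤1+n _) t<
           (replace-≢𝟎 {p} {suc t} {x} y t (<⇒≢ ≤-refl) (twin-left-≢ U))
           (replace-≢𝟎 {p} {suc t} {x} y (2 + t) (λ eq → <⇒≢ ≤-refl (sym eq)) (twin-right-≢ U t<))
         ... | inj₂ (refl , ())
         ... | inj₁ (_ , eq) = 𝟏≢ζ²
           (trans (cong ⟪ y ∣_⟫ (replace-> {p} {suc t} {x} ≤-refl)) (trans (⟪⟫-⋆ʳ ζ² y (p (2 + t))) (cong (ζ² ◃_) (Twin.right U t<))))
           (trans eq (cong negʷ (trans (cong ⟪ y ∣_⟫ (replace-< {p} {suc t} {x} ≤-refl)) (flip {p t} {y} (Twin.left U refl)))))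
         by-position (suc t) T U found | no t≮ with refl ← suc-injective (≤-antisym (Twin.t< T) (≮⇒≥ t≮)) =
           no-star {p (3 + k)} {p (4 + k)} {x} {y} {p (2 + k)} {p (1 + k)}
           ( (dist P (3 + k) (4 + k) ≤-refl ≤-refl
               ∷ (λ eq → Twin.off T (3 + k) 3< (sym eq)) ∷ (λ eq → Twin.off U (3 + k) 3< (sym eq))
               ∷ (λ eq → dist P (2 + k) (3 + k) ≤-refl 3< (sym eq)) ∷ (λ eq → dist P (1 + k) (3 + k) (n≤1+n _) 3< (sym eq)) ∷ [])
           , ((λ eq → Twin.off T (4 + k) ≤-refl (sym eq)) ∷ (λ eq → Twin.off U (4 + k) ≤-refl (sym eq))
               ∷ (λ eq → dist P (2 + k) (4 + k) (n≤1+n _) ≤-refl (sym eq))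
               ∷ (λ eq → dist P (1 + k) (4 + k) (m≤n+m _ 2) ≤-refl (sym eq)) ∷ [])
           , (x≢y ∷ Twin.off T (2 + k) 2< ∷ Twin.off T (1 + k) 1< ∷ [])
           , (Twin.off U (2 + k) 2< ∷ Twin.off U (1 + k) 1< ∷ [])
           , ((λ eq → dist P (1 + k) (2 + k) ≤-refl 2< (sym eq)) ∷ [])
           , ([] , tt) )
           (adj P (3 + k) ≤-refl) (Twin.left T refl) (Twin.left U refl)
           (adj′ P (2 + k) 3<) (far′ P (1 + k) (3 + k) ≤-refl 3<)
           (flip-𝟎 {x} {p (4 + k)} (Twin.rest T (4 + k) ≤-refl (λ eq → <⇒≢ ≤-refl (sym eq)) (<⇒≢ ≤-refl)))
           (flip-𝟎 {y} {p (4 + k)} (Twin.rest U (4 + k) ≤-refl (λ eq → <⇒≢ ≤-refl (sym eq)) (<⇒≢ ≤-refl)))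
           (far′ P (2 + k) (4 + k) ≤-refl ≤-refl) (far′ P (1 + k) (4 + k) (n≤1+n _) ≤-refl)
           (flip-𝟎 {y} {x} yx)
           (Twin.rest T (2 + k) 2< (<⇒≢ ≤-refl) (λ ())) (Twin.rest T (1 + k) 1< (<⇒≢ (n≤1+n _)) (λ ()))
           (Twin.rest U (2 + k) 2< (<⇒≢ ≤-refl) (λ ())) (Twin.rest U (1 + k) 1< (<⇒≢ (n≤1+n _)) (λ ()))
           (adj′ P (1 + k) 2<)
           where
           3< : 3 + k < 5 + k
           3< = n≤1+n _
           2< : 2 + k < 5 + k
           2< = m≤n+m _ 2
           1< : 1 + k < 5 + k
           1< = m≤n+m _ 3
           yx : ⟪ y ∣ x ⟫ ≡ 𝟎
           yx = trans (sym (replace-at {p} {4 + k} {x} y))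
             (adjacent-zero found {3 + k} ≤-refl (replace-≢𝟎 {p} {4 + k} {x} y (3 + k) (<⇒≢ ≤-refl) (twin-left-≢ U)))

       twins-far : ∀ {s t x y} → Twin k p s x → Twin k p t y → 2 + s ≤ t → proj₁ y ≢ proj₁ x → Out ⊎ ⟪ x ∣ y ⟫ ≡ 𝟎
       twins-far {s} {suc t} {x} {y} T U s<t y≢x
         with zero? ⟪ x ∣ y ⟫ | pattern-of (replace-path P T) y (replaced-twin-off T U y≢x)
            | pattern-of (replace-path P U) x (replaced-twin-off U T (λ eq → y≢x (sym eq)))
       ... | inj₁ eq | _ | _ = inj₂ eq
       ... | inj₂ _ | inj₁ out | _ = inj₁ out
       ... | inj₂ _ | inj₂ _ | inj₁ out = inj₁ out
       ... | inj₂ ne | inj₂ found | inj₂ found′ = ⊥-elim (contra s T s<t found found′)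
         where
         contra : ∀ s → Twin k p s x → 2 + s ≤ suc t → Pat k (λ i → ⟪ y ∣ replace p s x i ⟫) →
           Pat k (λ i → ⟪ x ∣ replace p (suc t) y i ⟫) → ⊥
         contra s T s<t found found′ with 2 + t <? 5 + k
         ... | yes t< = three-nonzero found {s} {t} {2 + t} (s≤s⁻¹ s<t) (n≤1+n _) t<
           (λ eq → flip-≢ {x} {y} ne (trans (sym (replace-at {p} {s} {x} y)) eq))
           (replace-≢𝟎 {p} {s} {x} y t (λ { refl → <-irrefl refl s<t }) (twin-left-≢ U))
           (replace-≢𝟎 {p} {s} {x} y (2 + t) (λ { refl → <⇒≱ s<t (m≤n+m (suc t) 2) }) (twin-right-≢ U t<))
         contra (suc s) T s<t found found′ | no _ = three-nonzero found′ {s} {2 + s} {suc t} (n≤1+n _) s<t (Twin.t< U)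
           (replace-≢𝟎 {p} {suc t} {y} x s (λ { refl → <⇒≱ s<t (m≤n+m (suc t) 2) }) (twin-left-≢ T))
           (replace-≢𝟎 {p} {suc t} {y} x (2 + s) (λ { refl → <-irrefl refl s<t }) (twin-right-≢ T (<-trans s<t (Twin.t< U))))
           (λ eq → ne (trans (sym (replace-at {p} {suc t} {y} x)) eq))
         contra zero T s<t found found′ | no t≮ with refl ← suc-injective (≤-antisym (Twin.t< U) (≮⇒≥ t≮))
           with two-nonzero found {0} {3 + k} (s≤s z≤n) (n≤1+n _)
             (λ eq → flip-≢ {x} {y} ne (trans (sym (replace-at {p} {0} {x} y)) eq))
             (replace-≢𝟎 {p} {0} {x} y (3 + k) (λ ()) (twin-left-≢ U))
         ... | inj₁ (() , _)
         ... | inj₂ (_ , eq) = contradiction eq (n≢k+n 0)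

       twins-next : ∀ {s x y} → Twin k p s x → Twin k p (suc s) y → proj₁ y ≢ proj₁ x → Out ⊎ ⟪ x ∣ y ⟫ ≡ just ζ²
       twins-next {zero} {x} {y} T U y≢x with pattern-of (replace-path P T) y (replaced-twin-off T U y≢x)
       ... | inj₁ out = inj₁ out
       ... | inj₂ found = inj₂ (decide (zero? ⟪ y ∣ x ⟫))
         where
         2< : 2 < 5 + k
         2< = s≤s (s≤s (s≤s z≤n))
         at-2 : ⟪ y ∣ replace p 0 x 2 ⟫ ≡ 𝟏
         at-2 = trans (cong ⟪ y ∣_⟫ (replace-> {p} {0} {x} (s≤s z≤n))) (trans (⟪⟫-⋆ʳ ζ² y (p 2)) (cong (ζ² ◃_) (Twin.right U 2<)))
         decide : ⟪ y ∣ x ⟫ ≡ 𝟎 ⊎ ⟪ y ∣ x ⟫ ≢ 𝟎 → ⟪ x ∣ y ⟫ ≡ just ζ²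
         decide (inj₁ yx) = ⊥-elim (interior found {2} ≤-refl (s≤s (s≤s (s≤s z≤n))) (just-≢ at-2)
           λ i i< i≢2 → replace-𝟎 {p} {0} {x} y i (λ i≢0 → Twin.rest U i i< (λ { refl → i≢0 refl }) i≢2) (λ _ → yx))
         decide (inj₂ yx) with two-nonzero found {0} {2} (s≤s z≤n) 2<
           (λ eq → yx (trans (sym (replace-at {p} {0} {x} y)) eq)) (just-≢ at-2)
         ... | inj₂ (_ , ())
         ... | inj₁ (_ , eq) = flip {y} {x} (negʷ-injective ζ⁰ (trans (sym at-2) (trans eq (cong negʷ (replace-at {p} {0} {x} y)))))
       twins-next {suc s} {x} {y} T U y≢x
         with pattern-of (replace-path P U) x (replaced-twin-off U T (λ eq → y≢x (sym eq)))
       ... | inj₁ out = inj₁ out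
       ... | inj₂ found = decide (zero? ⟪ x ∣ y ⟫) (3 + s <? 5 + k)
         where
         t< : 2 + s < 5 + k
         t< = Twin.t< U
         s< : suc s < 5 + k
         s< = Twin.t< T
         at-s : ⟪ x ∣ replace p (2 + s) y s ⟫ ≡ 𝟏
         at-s = trans (cong ⟪ x ∣_⟫ (replace-< {p} {2 + s} {y} (n≤1+n _))) (flip {p s} {x} (Twin.left T refl))
         decide : ⟪ x ∣ y ⟫ ≡ 𝟎 ⊎ ⟪ x ∣ y ⟫ ≢ 𝟎 → Dec (3 + s < 5 + k) → Out ⊎ ⟪ x ∣ y ⟫ ≡ just ζ²
         decide (inj₂ xy) _ with two-nonzero found {s} {2 + s} (n≤1+n _) t< (just-≢ at-s)
           (λ eq → xy (trans (sym (replace-at {p} {2 + s} {y} x)) eq))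
         ... | inj₂ (refl , ())
         ... | inj₁ (_ , eq) = inj₂ (trans (sym (replace-at {p} {2 + s} {y} x)) (trans eq (cong negʷ at-s)))
         decide (inj₁ xy) (no s≮) with refl ← suc-injective (suc-injective (≤-antisym t< (≮⇒≥ s≮))) =
           ⊥-elim (interior found {2 + k} (s≤s (s≤s z≤n)) ≤-refl (just-≢ at-s)
             λ i i< i≢ → replace-𝟎 {p} {4 + k} {y} x i (λ i≢4 → Twin.rest T i i< (λ { refl → i≢ refl }) i≢4) (λ _ → xy))
         decide (inj₁ xy) (yes 3+s<) with window
           (five-path {x} {p s} {p (suc s)} {y} {ζ² ⋆ p (3 + s)}
             (flip {p s} {x} (Twin.left T refl)) (adj P s s<) (Twin.left U refl)
             (trans (⟪⟫-⋆ʳ ζ² y (p (3 + s))) (cong (ζ² ◃_) (Twin.right U 3+s<)))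
             (Twin.rest T (suc s) s< (λ eq → <⇒≢ ≤-refl (sym eq)) (<⇒≢ ≤-refl)) xy
             (⋆-zeroʳ ζ² {x} {p (3 + s)} (Twin.rest T (3 + s) 3+s< (λ eq → <⇒≢ (≤-trans (n≤1+n _) (n≤1+n _)) (sym eq)) (λ eq → <⇒≢ ≤-refl (sym eq))))
             (flip-𝟎 {y} {p s} (Twin.rest U s (<-trans ≤-refl s<) (<⇒≢ ≤-refl) (<⇒≢ (≤-trans (n≤1+n _) (n≤1+n _)))))
             (⋆-zeroʳ ζ² {p s} {p (3 + s)} (far P s (3 + s) (n≤1+n _) 3+s<))
             (⋆-zeroʳ ζ² {p (suc s)} {p (3 + s)} (far P (suc s) (3 + s) ≤-refl 3+s<))
             ( (Twin.off T s (<-trans ≤-refl s<) ∷ Twin.off T (suc s) s< ∷ (λ eq → y≢x (sym eq)) ∷ Twin.off T (3 + s) 3+s< ∷ [])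
             , (dist P s (suc s) ≤-refl s< ∷ (λ eq → Twin.off U s (<-trans ≤-refl s<) (sym eq)) ∷ dist P s (3 + s) (m≤n+m _ 2) 3+s< ∷ [])
             , ((λ eq → Twin.off U (suc s) s< (sym eq)) ∷ dist P (suc s) (3 + s) (n≤1+n _) 3+s< ∷ [])
             , (Twin.off U (3 + s) 3+s< ∷ []) , [] , tt ))
           (p (2 + s))
           (λ { 0 _ eq → Twin.off T (2 + s) t< (sym eq)
              ; 1 _ eq → dist P s (2 + s) (n≤1+n _) t< (sym eq)
              ; 2 _ eq → dist P (suc s) (2 + s) ≤-refl t< (sym eq)
              ; 3 _ eq → Twin.off U (2 + s) t< (sym eq)
              ; (suc (suc (suc (suc _)))) _ eq → dist P (2 + s) (3 + s) ≤-refl 3+s< eq })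
         ... | inj₁ out = inj₁ out
         ... | inj₂ found′ = ⊥-elim (three-nonzero found′ {0} {2} {4} (s≤s z≤n) (s≤s (s≤s (s≤s z≤n))) ≤-refl
           (flip-≢ {x} {p (2 + s)} (twin-right-≢ T t<))
           (just-≢ (adj′ P (suc s) t<))
           (⋆-nonzeroʳ ζ² {p (2 + s)} {p (3 + s)} (just-≢ (adj P (2 + s) 3+s<))))

       closer-twin-first : ∀ {ζ z x} → Closer k p ζ z → Twin k p 0 x → proj₁ x ≢ proj₁ z → Out ⊎ ⟪ z ∣ x ⟫ ≡ just ζ
       closer-twin-first {ζ} {z} {x} C T x≢z
         with pattern-of (turnˡ-path C) x (turnˡ-off {x} {z} ζ (Twin.off T) x≢z)
       ... | inj₁ out = inj₁ out
       ... | inj₂ found = inj₂ (decide (zero? ⟪ x ∣ ζ ⁻¹ ⋆ z ⟫))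
         where
         2< : 2 < 5 + k
         2< = s≤s (s≤s (s≤s z≤n))
         at-2 : ⟪ x ∣ p 1 ⟫ ≡ just ζ²
         at-2 = Twin.right T (s≤s (s≤s z≤n))
         decide : ⟪ x ∣ ζ ⁻¹ ⋆ z ⟫ ≡ 𝟎 ⊎ ⟪ x ∣ ζ ⁻¹ ⋆ z ⟫ ≢ 𝟎 → ⟪ z ∣ x ⟫ ≡ just ζ
         decide (inj₁ xz) = ⊥-elim (interior found {2} ≤-refl (s≤s (s≤s (s≤s z≤n))) (just-≢ at-2)
           λ { 0 _ _ → xz
             ; 1 _ _ → Twin.rest T 0 (s≤s z≤n) (λ ()) (λ ())
             ; 2 _ ne → contradiction refl ne
             ; (suc (suc (suc i))) i< _ → Twin.rest T (2 + i) (≤-trans (n≤1+n _) i<) (λ ()) (λ ()) })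
         decide (inj₂ xz) with two-nonzero found {0} {2} (s≤s z≤n) 2< xz (just-≢ at-2)
         ... | inj₂ (_ , ())
         ... | inj₁ (_ , eq) = begin
           ⟪ z ∣ x ⟫ ≡⟨ ◃-identity ⟪ z ∣ x ⟫ ⟨
           ζ⁰ ◃ ⟪ z ∣ x ⟫ ≡⟨ cong (_◃ ⟪ z ∣ x ⟫) (trans (∙-comm ζ (ζ ⁻¹)) (∙-inverseˡ ζ)) ⟨
           (ζ ∙ ζ ⁻¹) ◃ ⟪ z ∣ x ⟫ ≡⟨ ◃-assoc ζ (ζ ⁻¹) ⟪ z ∣ x ⟫ ⟩
           ζ ◃ ζ ⁻¹ ◃ ⟪ z ∣ x ⟫ ≡⟨ cong (ζ ◃_) (⟪⟫-⋆ˡ (ζ ⁻¹) z x) ⟨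
           ζ ◃ ⟪ ζ ⁻¹ ⋆ z ∣ x ⟫ ≡⟨ cong (ζ ◃_) (flip {x} {ζ ⁻¹ ⋆ z} (negʷ-injective ζ² (trans (sym at-2) eq))) ⟩
           just (ζ ∙ ζ⁰) ≡⟨ cong just (∙-identityʳ ζ) ⟩
           just ζ ∎
           where open ≡-Reasoning

       closer-twin-last : ∀ {ζ z x} → Closer k p ζ z → Twin k p (4 + k) x → proj₁ x ≢ proj₁ z → Out ⊎ ⟪ x ∣ z ⟫ ≡ just ζ²
       closer-twin-last {ζ} {z} {x} C T x≢z with pattern-of (turnʳ-path C) x (turnʳ-off {x} {z} (Twin.off T) x≢z)
       ... | inj₁ out = inj₁ out
       ... | inj₂ found = inj₂ (decide (zero? ⟪ x ∣ z ⟫))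
         where
         at-end : ⟪ x ∣ turnʳ z (2 + k) ⟫ ≡ 𝟏
         at-end = trans (cong ⟪ x ∣_⟫ (turnʳ-< {z} (n≤1+n _))) (flip {p (3 + k)} {x} (Twin.left T refl))
         decide : ⟪ x ∣ z ⟫ ≡ 𝟎 ⊎ ⟪ x ∣ z ⟫ ≢ 𝟎 → ⟪ x ∣ z ⟫ ≡ just ζ²
         decide (inj₁ xz) = ⊥-elim (interior found {2 + k} (s≤s (s≤s z≤n)) ≤-refl (just-≢ at-end) others)
           where
           others : ∀ i → i < 5 + k → i ≢ 2 + k → ⟪ x ∣ turnʳ z i ⟫ ≡ 𝟎
           others i i< ne with m≤n⇒m<n∨m≡n (s≤s⁻¹ i<)
           ... | inj₁ i<4 = trans (cong ⟪ x ∣_⟫ (turnʳ-< {z} i<4))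
             (Twin.rest T (suc i) (s≤s i<4) (λ { refl → ne refl }) (λ { refl → <-irrefl refl i<4 }))
           ... | inj₂ refl = trans (cong ⟪ x ∣_⟫ (turnʳ-≡ {z})) xz
         decide (inj₂ xz) with two-nonzero found {2 + k} {4 + k} (n≤1+n _) ≤-refl (just-≢ at-end)
           (λ eq → xz (trans (sym (cong ⟪ x ∣_⟫ (turnʳ-≡ {z}))) eq))
         ... | inj₂ (() , _)
         ... | inj₁ (_ , eq) = trans (sym (cong ⟪ x ∣_⟫ (turnʳ-≡ {z}))) (trans eq (cong negʷ at-end))

       closer-twin-far : ∀ {ζ z t x} → Closer k p ζ z → Twin k p (suc t) x → suc t < 4 + k → proj₁ x ≢ proj₁ z →
         Out ⊎ ⟪ x ∣ z ⟫ ≡ 𝟎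
       closer-twin-far {ζ} {z} {zero} {x} C T t< x≢z
         with zero? ⟪ x ∣ z ⟫ | pattern-of (turnˡ-path C) x (turnˡ-off {x} {z} ζ (Twin.off T) x≢z)
       ... | inj₁ eq | _ = inj₂ eq
       ... | inj₂ _ | inj₁ out = inj₁ out
       ... | inj₂ xz | inj₂ found = ⊥-elim (three-nonzero found {0} {1} {3} (s≤s z≤n) (s≤s (s≤s z≤n)) (s≤s (s≤s (s≤s (s≤s z≤n))))
         (⋆-nonzeroʳ (ζ ⁻¹) {x} {z} xz) (twin-left-≢ T) (twin-right-≢ T (s≤s (s≤s (s≤s z≤n)))))
       closer-twin-far {ζ} {z} {suc t} {x} C T t< x≢z
         with zero? ⟪ x ∣ z ⟫ | pattern-of (turnʳ-path C) x (turnʳ-off {x} {z} (Twin.off T) x≢z)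
       ... | inj₁ eq | _ = inj₂ eq
       ... | inj₂ _ | inj₁ out = inj₁ out
       ... | inj₂ xz | inj₂ found = ⊥-elim (three-nonzero found {t} {2 + t} {4 + k} (n≤1+n _) t< ≤-refl
         (λ eq → twin-left-≢ T (trans (sym (cong ⟪ x ∣_⟫ (turnʳ-< {z} (<-trans (n≤1+n _) t<)))) eq))
         (λ eq → twin-right-≢ T (s≤s t<) (trans (sym (cong ⟪ x ∣_⟫ (turnʳ-< {z} t<))) eq))
         (λ eq → xz (trans (sym (cong ⟪ x ∣_⟫ (turnʳ-≡ {z}))) eq)))

       closers : ∀ {ζ η z y} → Closer k p ζ z → Closer k p η y → proj₁ y ≢ proj₁ z →
         Out ⊎ (⟪ z ∣ y ⟫ ≡ 𝟎 × η ≡ ζ ∙ ζ²)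
       closers {ζ} {η} {z} {y} C D y≢z
         with pattern-of (turnʳ-path C) y (turnʳ-off {y} {z} (Closer.off D) y≢z)
            | pattern-of turned y (turned-off)
         where
         turned : IsPath (5 + k) (snoc (4 + k) (λ i → turnʳ z (suc i)) (ζ ⋆ p 0))
         turned = snoc-path (shift (turnʳ-path C)) away
           (trans (cong ⟪_∣ ζ ⋆ p 0 ⟫ (turnʳ-≡ {z})) (trans (⟪⟫-⋆ʳ ζ z (p 0)) (trans (cong (ζ ⁻¹ ◃_) (Closer.right C)) (cong just (∙-inverseˡ ζ)))))
           λ i i< → trans (cong ⟪_∣ ζ ⋆ p 0 ⟫ (turnʳ-< {z} (s≤s i<)))
             (⋆-zeroʳ ζ {p (2 + i)} {p 0} (far′ P 0 (2 + i) (s≤s (s≤s z≤n)) (s≤s (s≤s i<))))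
           where
           away : Off (4 + k) (λ i → turnʳ z (suc i)) (ζ ⋆ p 0)
           away i i< with m≤n⇒m<n∨m≡n (s≤s⁻¹ i<)
           ... | inj₁ i<3 = λ eq → dist P 0 (2 + i) (s≤s z≤n) (s≤s (s≤s i<3)) (trans eq (cong proj₁ (turnʳ-< {z} (s≤s i<3))))
           ... | inj₂ refl = λ eq → Closer.off C 0 (s≤s z≤n) (sym (trans eq (cong proj₁ (turnʳ-≡ {z}))))
         turned-off : Off (5 + k) (snoc (4 + k) (λ i → turnʳ z (suc i)) (ζ ⋆ p 0)) y
         turned-off i i< with m≤n⇒m<n∨m≡n (s≤s⁻¹ i<)
         ... | inj₁ i<4 = λ eq → turnʳ-off {y} {z} (Closer.off D) y≢z (suc i) (s≤s i<4) (trans eq (cong proj₁ (snoc-< i<4)))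
         ... | inj₂ refl = λ eq → Closer.off D 0 (s≤s z≤n) (trans eq (cong proj₁ (snoc-≡ (4 + k))))
       ... | inj₁ out | _ = inj₁ out
       ... | inj₂ _ | inj₁ out = inj₁ out
       ... | inj₂ found | inj₂ found′ = inj₂ (zy , opposite)
         where
         last-one : ⟪ y ∣ p (4 + k) ⟫ ≡ 𝟏
         last-one = flip {p (4 + k)} {y} (Closer.left D)
         zy : ⟪ z ∣ y ⟫ ≡ 𝟎
         zy = flip-𝟎 {y} {z} (trans (sym (cong ⟪ y ∣_⟫ (turnʳ-≡ {z})))
           (adjacent-zero found {3 + k} ≤-refl (just-≢ (trans (cong ⟪ y ∣_⟫ (turnʳ-< {z} ≤-refl)) last-one))))
         r : ℕ → X
         r = snoc (4 + k) (λ i → turnʳ z (suc i)) (ζ ⋆ p 0)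
         at-2 : ⟪ y ∣ r (2 + k) ⟫ ≡ 𝟏
         at-2 = trans (cong ⟪ y ∣_⟫ (trans (snoc-< {4 + k} {λ i → turnʳ z (suc i)} {ζ ⋆ p 0} {2 + k} (n≤1+n _)) (turnʳ-< {z} {3 + k} ≤-refl))) last-one
         at-4 : ⟪ y ∣ r (4 + k) ⟫ ≡ just (ζ ⁻¹ ∙ η)
         at-4 = trans (cong ⟪ y ∣_⟫ (snoc-≡ (4 + k))) (trans (⟪⟫-⋆ʳ ζ y (p 0)) (cong (ζ ⁻¹ ◃_) (Closer.right D)))
         opposite : η ≡ ζ ∙ ζ²
         opposite with two-nonzero found′ {2 + k} {4 + k} (n≤1+n _) ≤-refl (just-≢ at-2) (just-≢ at-4)
         ... | inj₂ (() , _)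
         ... | inj₁ (_ , eq) = begin
           η ≡⟨ cong (_∙ η) (trans (∙-comm ζ (ζ ⁻¹)) (∙-inverseˡ ζ)) ⟨
           (ζ ∙ ζ ⁻¹) ∙ η ≡⟨ ∙-assoc ζ (ζ ⁻¹) η ⟩
           ζ ∙ (ζ ⁻¹ ∙ η) ≡⟨ cong (ζ ∙_) (just-injective (trans (sym at-4) (trans eq (cong negʷ at-2)))) ⟩
           ζ ∙ ζ² ∎
           where open ≡-Reasoning

module WheelWeights where

 open Configuration
 open Gains
 open import Data.Nat.Base hiding (_*_)
 open import Data.Nat.DivMod
 open import Data.Nat.Properties
 open Vertices

 toℕ-next : ∀ {k} (j : Fin (suc k)) → suc (toℕ j) < suc k → toℕ (j ⊕ 1) ≡ suc (toℕ j)
 toℕ-next {k} j j< = begin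
   toℕ ((toℕ j + 1) mod suc k) ≡⟨ Fin.toℕ-fromℕ< _ ⟩
   (toℕ j + 1) % suc k ≡⟨ m<n⇒m%n≡m (subst (_< suc k) (+-comm 1 (toℕ j)) j<) ⟩
   toℕ j + 1 ≡⟨ +-comm (toℕ j) 1 ⟩
   suc (toℕ j) ∎
   where open ≡-Reasoning

 toℕ-wrap : ∀ {k} (j : Fin (suc k)) → suc (toℕ j) ≡ suc k → toℕ (j ⊕ 1) ≡ 0
 toℕ-wrap {k} j j≡ = begin
   toℕ ((toℕ j + 1) mod suc k) ≡⟨ Fin.toℕ-fromℕ< _ ⟩
   (toℕ j + 1) % suc k ≡⟨ cong (_% suc k) (trans (+-comm (toℕ j) 1) j≡) ⟩
   suc k % suc k ≡⟨ n%n≡0 (suc k) ⟩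
   0 ∎
   where open ≡-Reasoning

 if-yes : ∀ {P A : Set} (P? : Dec P) {x y : A} → P → (if does P? then x else y) ≡ x
 if-yes (yes _) _ = refl
 if-yes (no ¬p) p = contradiction p ¬p

 if-no : ∀ {P A : Set} (P? : Dec P) {x y : A} → ¬ P → (if does P? then x else y) ≡ y
 if-no (yes p) ¬p = contradiction p ¬p
 if-no (no _) _ = refl

 layer : TB → C₄
 layer t = ζ⁰
 layer b = ζ²

 -- The weight from position i to position j listed for T₂ₖ, where k is suc m.
 arrow : ℕ → C₄ → TB → ℕ → ℕ → W
 arrow m ζ x i j with j ≟ suc i | i ≟ m | j ≟ 0
 ... | yes _ | _ | _ = just (layer x)
 ... | no _ | yes _ | yes _ = just (layer x ∙ ζ)
 ... | no _ | _ | _ = 𝟎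

 arrow-next : ∀ {m ζ} x i → arrow m ζ x i (suc i) ≡ just (layer x)
 arrow-next x i with suc i ≟ suc i
 ... | yes _ = refl
 ... | no i≢i = contradiction refl i≢i

 arrow-wrap : ∀ {m ζ} x → arrow m ζ x m 0 ≡ just (layer x ∙ ζ)
 arrow-wrap {m} x with m ≟ m
 ... | yes _ = refl
 ... | no m≢m = contradiction refl m≢m

 arrow-𝟎 : ∀ {m ζ} x i j → j ≢ suc i → ¬ (i ≡ m × j ≡ 0) → arrow m ζ x i j ≡ 𝟎
 arrow-𝟎 {m} x i j j≢ ¬wrap with j ≟ suc i | i ≟ m | j ≟ 0
 ... | yes eq | _ | _ = contradiction eq j≢
 ... | no _ | yes i≡ | yes j≡ = contradiction (i≡ , j≡) ¬wrap
 ... | no _ | yes _ | no _ = refl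
 ... | no _ | no _ | _ = refl

 T-weight : ∀ m ζ x y (i j : Fin (suc m)) → Graph.weight (T-graph ⟦ ζ ⟧₄ (suc m)) (x , i) (y , j) ≡
   ⟦ arrow m ζ x (toℕ i) (toℕ j) ⟧ʷ Gaussian.+ Gaussian.conj ⟦ arrow m ζ y (toℕ j) (toℕ i) ⟧ʷ
 T-weight m ζ x y i j = trans (weight-refl x y)
   (cong₂ (λ v w → v Gaussian.+ Gaussian.conj w) (listed x i j) (listed y j i))
   where
   open Gaussian using (_*_; 1#; 0#)
   sign : TB → ℤ[i]
   sign x = ⟦ layer x ⟧₄
   factor : Fin (suc m) → ℤ[i]
   factor j = if does (suc (toℕ j) ≟ suc m) then ⟦ ζ ⟧₄ else 1#
   term : TB → Fin (suc m) → Fin (suc m) → ℤ[i]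
   term x i j = [ j ≡ i ⊕ 1 ] * (sign x * factor i)
   weight-refl : ∀ x y → Graph.weight (T-graph ⟦ ζ ⟧₄ (suc m)) (x , i) (y , j) ≡
     term x i j Gaussian.+ Gaussian.conj (term y j i)
   weight-refl t t = refl
   weight-refl t b = refl
   weight-refl b t = refl
   weight-refl b b = refl
   unit-product : ∀ x p → 1# * (sign x * ⟦ p ⟧₄) ≡ ⟦ layer x ∙ p ⟧₄
   unit-product t ζ⁰ = refl
   unit-product t ζ¹ = refl
   unit-product t ζ² = refl
   unit-product t ζ³ = refl
   unit-product b ζ⁰ = refl
   unit-product b ζ¹ = refl
   unit-product b ζ² = refl
   unit-product b ζ³ = refl
   zero-product : ∀ z → 0# * z ≡ 0#
   zero-product (_ +i _) = refl
   indicator-yes : ∀ {u v : Fin (suc m)} → u ≡ v → [ u ≡ v ] ≡ 1#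
   indicator-yes {u} {v} = if-yes (u Fin.≟ v)
   indicator-no : ∀ {u v : Fin (suc m)} → u ≢ v → [ u ≡ v ] ≡ 0#
   indicator-no {u} {v} = if-no (u Fin.≟ v)
   listed : ∀ x (i j : Fin (suc m)) → term x i j ≡ ⟦ arrow m ζ x (toℕ i) (toℕ j) ⟧ʷ
   listed x i j with toℕ j ≟ suc (toℕ i) | toℕ i ≟ m | toℕ j ≟ 0
   ... | yes eq | yes i≡m | _ = contradiction (Fin.toℕ<n j) (≤⇒≯ (≤-reflexive (trans (cong suc (sym i≡m)) (sym eq))))
   ... | yes eq | no i≢m | _ = trans
     (cong₂ (λ v w → v * (sign x * w)) (indicator-yes {j} {i ⊕ 1} (Fin.toℕ-injective (trans eq (sym (toℕ-next i (s≤s i<m)))))) factor-1)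
     (trans (unit-product x ζ⁰) (cong ⟦_⟧₄ (∙-identityʳ (layer x))))
     where
     i<m : toℕ i < m
     i<m = ≤∧≢⇒< (s≤s⁻¹ (Fin.toℕ<n i)) i≢m
     factor-1 : factor i ≡ 1#
     factor-1 = if-no (suc (toℕ i) ≟ suc m) λ eq → i≢m (suc-injective eq)
   ... | no _ | yes i≡m | yes j≡0 = trans
     (cong₂ (λ v w → v * (sign x * w)) (indicator-yes {j} {i ⊕ 1} (Fin.toℕ-injective (trans j≡0 (sym (toℕ-wrap i (cong suc i≡m)))))) factor-ζ)
     (unit-product x ζ)
     where
     factor-ζ : factor i ≡ ⟦ ζ ⟧₄
     factor-ζ = if-yes (suc (toℕ i) ≟ suc m) (cong suc i≡m)
   ... | no j≢ | yes i≡m | no j≢0 = trans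
     (cong (_* (sign x * factor i)) (indicator-no {j} {i ⊕ 1} λ { refl → j≢0 (toℕ-wrap i (cong suc i≡m)) })) (zero-product (sign x * factor i))
   ... | no j≢ | no i≢m | _ = trans
     (cong (_* (sign x * factor i)) (indicator-no {j} {i ⊕ 1} λ { refl → j≢ (toℕ-next i (s≤s (≤∧≢⇒< (s≤s⁻¹ (Fin.toℕ<n i)) i≢m))) }))
     (zero-product (sign x * factor i))

module Assembling where

 open Configuration
 open Gains
 open ShortPaths
 open PathReplacement
 open WheelWeights
 open TargetGraphs using (T; enumTB)
 open Certificate using (between)
 open import Data.Fin.Base using (fromℕ<)
 open import Data.Nat.Base
 open import Data.Nat.Properties
 open import Relation.Binary.Construct.Closure.ReflexiveTransitive using (Star; ε; _◅_)
 open Vertices using (TB; t; b)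

 collect : ∀ {n} {Out : Set} {Q : Fin n → Set} → (∀ v → Out ⊎ Q v) → Out ⊎ (∀ v → Q v)
 collect {zero} f = inj₂ λ ()
 collect {suc n} f with f Fin.zero | collect (λ v → f (Fin.suc v))
 ... | inj₁ out | _ = inj₁ out
 ... | inj₂ _ | inj₁ out = inj₁ out
 ... | inj₂ q | inj₂ qs = inj₂ λ { Fin.zero → q ; (Fin.suc v) → qs v }

 -- Closers come in two layers, whose weights to the first vertex are ±ζ.
 side : C₄ → TB
 side ζ⁰ = t
 side ζ¹ = t
 side ζ² = b
 side ζ³ = b

 representative : C₄ → C₄
 representative ζ⁰ = ζ⁰
 representative ζ¹ = ζ¹
 representative ζ² = ζ⁰
 representative ζ³ = ζ¹

 layer-representative : ∀ ζ → layer (side ζ) ∙ representative ζ ≡ ζ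
 layer-representative ζ⁰ = refl
 layer-representative ζ¹ = refl
 layer-representative ζ² = refl
 layer-representative ζ³ = refl

 representative-opposite : ∀ ζ → representative (ζ ∙ ζ²) ≡ representative ζ
 representative-opposite ζ⁰ = refl
 representative-opposite ζ¹ = refl
 representative-opposite ζ² = refl
 representative-opposite ζ³ = refl

 side-opposite : ∀ ζ → side (ζ ∙ ζ²) ≢ side ζ
 side-opposite ζ⁰ ()
 side-opposite ζ¹ ()
 side-opposite ζ² ()
 side-opposite ζ³ ()

 module Assembly {n} (G : GainGraph n) (k : ℕ) where
   open Extremal G k

   data Role (p : ℕ → X) (v : Fin n) : Set where
     on-path : ∀ i → i < 5 + k → proj₁ (p i) ≡ v → Role p v
     twinned : ∀ t a → Twin k p t (v , a) → Role p v
     closing : ∀ ζ a → Closer k p ζ (v , a) → Role p v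

   module _ {Out : Set}
     (window : ∀ {p} → IsPath 5 p → ∀ x → Off 5 p x → Out ⊎ Pat 0 (λ i → ⟪ x ∣ p i ⟫))
     (longer : ∀ q → IsPath (6 + k) q → Out)
     {p : ℕ → X} (P : IsPath (5 + k) p) where

     role-step : ∀ {u v} → Role p u → A u v ≢ 𝟎 → Out ⊎ Role p v
     role-step {u} {v} r uv with anyUpTo? (λ i → proj₁ (p i) Fin.≟ v) (5 + k)
     ... | yes (i , i< , eq) = inj₂ (on-path i i< eq)
     ... | no absent with classify window longer P (v , ζ⁰) (λ i i< eq → absent (i , i< , sym eq))
     ... | inj₁ out = inj₁ out
     ... | inj₂ (twin a s T) = inj₂ (twinned s (a ∙ ζ⁰) T)
     ... | inj₂ (closer a ζ C) = inj₂ (closing ζ (a ∙ ζ⁰) C)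
     ... | inj₂ (isolated z) = inj₁ (by-role r)
       where
       off : Off (5 + k) p (v , ζ⁰)
       off i i< eq = absent (i , i< , sym eq)
       v≢u : v ≢ u
       v≢u refl = uv (diag v)
       vu : ∀ q → ⟪ (v , ζ⁰) ∣ (u , q) ⟫ ≢ 𝟎
       vu q eq = uv (trans (herm v u) (cong conjʷ (◃-cancel (ζ⁰ ∙ q ⁻¹) {A v u} eq)))
       by-role : Role p u → Out
       by-role (on-path i i< refl) = contradiction (z i i<) (vu (proj₂ (p i)))
       by-role (twinned s a T) = only-at-twin window longer P T off v≢u z (vu a)
       by-role (closing ζ a C) = only-at-closer window longer P C off v≢u z (vu a)

     roles : Out ⊎ (∀ v → Role p v)
     roles = collect λ v → along (connected (proj₁ (p 0)) v) (on-path 0 (s≤s z≤n) refl)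
       where
       along : ∀ {u v} → Star (λ u v → A u v ≢ 𝟎) u v → Role p u → Out ⊎ Role p v
       along ε r = inj₂ r
       along (e ◅ es) r with role-step r e
       ... | inj₁ out = inj₁ out
       ... | inj₂ r′ = along es r′

     lift : ∀ {v} → Role p v → X
     lift (on-path i _ _) = p i
     lift {v} (twinned _ a _) = v , a
     lift {v} (closing _ a _) = v , a

     lift-vertex : ∀ {v} (r : Role p v) → proj₁ (lift r) ≡ v
     lift-vertex (on-path _ _ eq) = eq
     lift-vertex (twinned _ _ _) = refl
     lift-vertex (closing _ _ _) = refl

     place : ∀ {v} → Role p v → TB × ℕ
     place (on-path i _ _) = t , i
     place (twinned i _ _) = b , i
     place (closing ζ _ _) = side ζ , 5 + k

     place-< : ∀ {v} (r : Role p v) → proj₂ (place r) < 6 + k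
     place-< (on-path i i< _) = m≤n⇒m≤1+n i<
     place-< (twinned i _ T) = m≤n⇒m≤1+n (Twin.t< T)
     place-< (closing _ _ _) = ≤-refl

     module _ (ζ₀ : C₄) where

       Consistent : ∀ {v} → Role p v → Set
       Consistent (closing ζ _ _) = representative ζ ≡ ζ₀
       Consistent _ = ⊤

       arr : TB × ℕ → TB × ℕ → W
       arr (x , i) (_ , j) = arrow (5 + k) ζ₀ x i j

       data Match (x : X) (a : TB × ℕ) (y : X) (c : TB × ℕ) : Set where
         forth : ⟪ x ∣ y ⟫ ≡ arr a c → arr c a ≡ 𝟎 → Match x a y c
         back : ⟪ y ∣ x ⟫ ≡ arr c a → arr a c ≡ 𝟎 → Match x a y c

       swap : ∀ {x a y c} → Match x a y c × a ≢ c → Match y c x a × c ≢ a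
       swap (forth e z , ne) = back e z , λ eq → ne (sym eq)
       swap (back e z , ne) = forth e z , λ eq → ne (sym eq)

       no-arrow : ∀ x {i j} → i < 5 + k → j ≢ suc i → arrow (5 + k) ζ₀ x i j ≡ 𝟎
       no-arrow x {i} {j} i< j≢ = arrow-𝟎 x i j j≢ λ { (refl , _) → <-irrefl refl i< }

       Related : X → TB × ℕ → X → TB × ℕ → Set
       Related x a y c = Out ⊎ (Match x a y c × a ≢ c)

       path-path : ∀ {i j} → i < j → j < 5 + k → Related (p i) (t , i) (p j) (t , j)
       path-path {i} {j} i<j j< with m≤n⇒m<n∨m≡n i<j
       ... | inj₁ si<j = inj₂ (forth (trans (far P i j si<j j<) (sym (no-arrow t (<-trans i<j j<) λ { refl → <-irrefl refl si<j })))
                           (no-arrow t j< λ { refl → <⇒≱ i<j (n≤1+n _) }) , λ { refl → <-irrefl refl i<j })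
       ... | inj₂ refl = inj₂ (forth (trans (adj P i j<) (sym (arrow-next t i))) (no-arrow t j< (λ ())) , λ ())

       path-twin : ∀ {i s y} → i < 5 + k → Twin k p s y → Related (p i) (t , i) y (b , s)
       path-twin {i} {s} {y} i< T with suc i ≟ s | i ≟ suc s
       ... | yes refl | _ = inj₂ (forth (trans (Twin.left T refl) (sym (arrow-next t i))) (no-arrow b (Twin.t< T) λ ()) , λ ())
       ... | no _ | yes refl = inj₂ (back (trans (Twin.right T i<) (sym (arrow-next b s))) (no-arrow t i< λ ()) , λ ())
       ... | no si≢ | no i≢ = inj₂ (back (trans (Twin.rest T i i< si≢ i≢) (sym (no-arrow b (Twin.t< T) i≢)))
                                     (no-arrow t i< λ eq → si≢ (sym eq)) , λ ())

       path-closer : ∀ {i ζ z} → i < 5 + k → representative ζ ≡ ζ₀ → Closer k p ζ z → Related (p i) (t , i) z (side ζ , 5 + k)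
       path-closer {i} {ζ} {z} i< refl C with i ≟ 0 | i ≟ 4 + k
       ... | yes refl | _ = inj₂ (back (trans (Closer.right C) (sym (trans (arrow-wrap (side ζ)) (cong just (layer-representative ζ)))))
                                     (no-arrow t {0} {5 + k} i< λ ()) , λ ())
       ... | no _ | yes refl = inj₂ (forth (trans (Closer.left C) (sym (arrow-next t (4 + k))))
                                     (arrow-𝟎 (side ζ) (5 + k) (4 + k) (λ ()) λ { (_ , ()) }) , λ ())
       ... | no i≢0 | no i≢4 = inj₂ (back (trans (Closer.rest C i i< i≢0 i≢4)
                                       (sym (arrow-𝟎 (side ζ) (5 + k) i (λ { refl → <⇒≱ i< (n≤1+n _) }) λ { (_ , eq) → i≢0 eq })))
                                     (no-arrow t i< λ { refl → i≢4 refl }) , λ eq → <⇒≢ i< (cong proj₂ eq))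

       twin-twin : ∀ {i s x y} → i ≤ s → Twin k p i x → Twin k p s y → proj₁ y ≢ proj₁ x → Related x (b , i) y (b , s)
       twin-twin {i} {s} {x} {y} i≤s T U y≢x with m≤n⇒m<n∨m≡n i≤s
       ... | inj₂ refl = inj₁ (twin-unique window longer P T U y≢x)
       ... | inj₁ i<s with m≤n⇒m<n∨m≡n i<s
       ... | inj₂ refl with twins-next window longer P T U y≢x
       ... | inj₁ out = inj₁ out
       ... | inj₂ eq = inj₂ (forth (trans eq (sym (arrow-next b i))) (no-arrow b (Twin.t< U) λ ()) , λ ())
       twin-twin {i} {s} {x} {y} i≤s T U y≢x | inj₁ i<s | inj₁ si<s with twins-far window longer P T U si<s y≢x
       ... | inj₁ out = inj₁ out
       ... | inj₂ eq = inj₂ (forth (trans eq (sym (no-arrow b (Twin.t< T) λ { refl → <-irrefl refl si<s })))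
                          (no-arrow b (Twin.t< U) λ { refl → <⇒≱ i<s (n≤1+n _) }) , λ { refl → <-irrefl refl i<s })

       twin-closer : ∀ {i ζ x z} → representative ζ ≡ ζ₀ → Twin k p i x → Closer k p ζ z → proj₁ x ≢ proj₁ z →
         Related x (b , i) z (side ζ , 5 + k)
       twin-closer {zero} {ζ} refl T C x≢z with closer-twin-first window longer P C T x≢z
       ... | inj₁ out = inj₁ out
       ... | inj₂ eq = inj₂ (back (trans eq (sym (trans (arrow-wrap (side ζ)) (cong just (layer-representative ζ)))))
                          (no-arrow b {0} {5 + k} (s≤s z≤n) λ ()) , λ ())
       twin-closer {suc i} {ζ} {x} {z} refl T C x≢z with m≤n⇒m<n∨m≡n (s≤s⁻¹ (Twin.t< T))
       ... | inj₂ refl with closer-twin-last window longer P C T x≢z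
       ... | inj₁ out = inj₁ out
       ... | inj₂ eq = inj₂ (forth (trans eq (sym (arrow-next b (4 + k))))
                            (arrow-𝟎 (side ζ) (5 + k) (4 + k) (λ ()) λ { (_ , ()) }) , λ ())
       twin-closer {suc i} {ζ} {x} {z} refl T C x≢z | inj₁ i<4 with closer-twin-far window longer P C T i<4 x≢z
       ... | inj₁ out = inj₁ out
       ... | inj₂ eq = inj₂ (forth (trans eq (sym (no-arrow b (Twin.t< T) λ { refl → <-irrefl refl i<4 })))
                          (arrow-𝟎 (side ζ) (5 + k) (suc i) (λ { refl → <⇒≱ (Twin.t< T) (n≤1+n _) }) λ { (_ , ()) }) ,
                          λ eq → <⇒≢ (m≤n⇒m≤1+n i<4) (cong proj₂ eq))

       closer-closer : ∀ {ζ η y z} → Closer k p ζ z → Closer k p η y → proj₁ y ≢ proj₁ z →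
         Related z (side ζ , 5 + k) y (side η , 5 + k)
       closer-closer {ζ} C D y≢z with closers window longer P C D y≢z
       ... | inj₁ out = inj₁ out
       ... | inj₂ (zy , refl) = inj₂ (forth (trans zy (sym (no-loop (side ζ)))) (no-loop (side (ζ ∙ ζ²))) ,
         λ eq → side-opposite ζ (sym (cong proj₁ eq)))
         where
         no-loop : ∀ x → arrow (5 + k) ζ₀ x (5 + k) (5 + k) ≡ 𝟎
         no-loop x = arrow-𝟎 x (5 + k) (5 + k) (λ eq → <⇒≢ ≤-refl eq) λ { (_ , ()) }

       swapᵒ : ∀ {x a y c} → Related x a y c → Related y c x a
       swapᵒ (inj₁ out) = inj₁ out
       swapᵒ (inj₂ m) = inj₂ (swap m)

       related : ∀ {u v} → u ≢ v → (r : Role p u) (s : Role p v) → Consistent r → Consistent s →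
         Related (lift r) (place r) (lift s) (place s)
       related u≢v (on-path i i< refl) (on-path j j< refl) _ _ with <-cmp i j
       ... | tri< i<j _ _ = path-path i<j j<
       ... | tri≈ _ refl _ = ⊥-elim (u≢v refl)
       ... | tri> _ _ j<i = swapᵒ (path-path j<i i<)
       related u≢v (on-path i i< refl) (twinned s c T) _ _ = path-twin i< T
       related u≢v (on-path i i< refl) (closing ζ c C) _ eq = path-closer i< eq C
       related u≢v (twinned s a T) (on-path i i< refl) _ _ = swapᵒ (path-twin i< T)
       related u≢v (twinned i a T) (twinned s c U) _ _ with ≤-total i s
       ... | inj₁ i≤s = twin-twin i≤s T U (λ eq → u≢v (sym eq))
       ... | inj₂ s≤i = swapᵒ (twin-twin s≤i U T u≢v)
       related u≢v (twinned i a T) (closing ζ c C) _ eq = twin-closer eq T C u≢v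
       related u≢v (closing ζ a C) (on-path i i< refl) eq _ = swapᵒ (path-closer i< eq C)
       related u≢v (closing ζ a C) (twinned i c T) eq _ = swapᵒ (twin-closer eq T C (λ eq → u≢v (sym eq)))
       related u≢v (closing ζ a C) (closing η c D) _ _ = closer-closer C D (λ eq → u≢v (sym eq))

       embedding : (r : ∀ v → Role p v) → (∀ v → Consistent (r v)) → Out ⊎ Embeds G (T ⟦ ζ₀ ⟧₄ (6 + k))
       embedding r consistent with collect {n} {Out} (λ u → collect {n} {Out} {λ v → u ≡ v ⊎ (Match (lift (r u)) (place (r u)) (lift (r v)) (place (r v)) × place (r u) ≢ place (r v))} (pair u))
         where
         pair : ∀ u v → Out ⊎ (u ≡ v ⊎ (Match (lift (r u)) (place (r u)) (lift (r v)) (place (r v)) × place (r u) ≢ place (r v)))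
         pair u v with u Fin.≟ v
         ... | yes eq = inj₂ (inj₁ eq)
         ... | no u≢v with related u≢v (r u) (r v) (consistent u) (consistent v)
         ... | inj₁ out = inj₁ out
         ... | inj₂ m = inj₂ (inj₂ m)
       ... | inj₁ out = inj₁ out
       ... | inj₂ pairs = inj₂ record
         { f = λ v → Inverse.from enumTB (seat v)
         ; unitᶠ = λ v → proj₂ (lift (r v)) ⁻¹
         ; τ = Sign.+ , identity
         ; injective = λ {u} {v} u≢v eq → proj₂ (match u≢v) (seat-injective
             (trans (sym (Inverse.strictlyInverseˡ enumTB (seat u))) (trans (cong (Inverse.to enumTB) eq) (Inverse.strictlyInverseˡ enumTB (seat v)))))
         ; matches = λ {u} {v} u≢v → begin
             ⟦ A u v ⟧ʷ ≡⟨ cong₂ (λ u v → ⟦ A u v ⟧ʷ) (lift-vertex (r u)) (lift-vertex (r v)) ⟨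
             ⟦ A (proj₁ (lift (r u))) (proj₁ (lift (r v))) ⟧ʷ ≡⟨ cong ⟦_⟧ʷ (unlift _ (proj₂ (lift (r u))) _ (proj₂ (lift (r v)))) ⟩
             ⟦ (proj₂ (lift (r u)) ⁻¹ ∙ proj₂ (lift (r v))) ◃ ⟪ lift (r u) ∣ lift (r v) ⟫ ⟧ʷ
               ≡⟨ ⟦⟧-◃ (proj₂ (lift (r u)) ⁻¹ ∙ proj₂ (lift (r v))) ⟪ lift (r u) ∣ lift (r v) ⟫ ⟩
             rotate (proj₂ (lift (r u)) ⁻¹ ∙ proj₂ (lift (r v))) ⟦ ⟪ lift (r u) ∣ lift (r v) ⟫ ⟧ʷ
               ≡⟨ cong₂ (λ q w → rotate (proj₂ (lift (r u)) ⁻¹ ∙ q) w) (sym (⁻¹-involutive (proj₂ (lift (r v))))) (value u v u≢v) ⟩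
             between (proj₂ (lift (r u)) ⁻¹) (Graph.weight (T-graph ⟦ ζ₀ ⟧₄ (6 + k)) (seat u) (seat v)) (proj₂ (lift (r v)) ⁻¹)
               ≡⟨ cong₂ (λ a c → between (proj₂ (lift (r u)) ⁻¹) (Graph.weight (T-graph ⟦ ζ₀ ⟧₄ (6 + k)) a c) (proj₂ (lift (r v)) ⁻¹))
                    (Inverse.strictlyInverseˡ enumTB (seat u)) (Inverse.strictlyInverseˡ enumTB (seat v)) ⟨
             between (proj₂ (lift (r u)) ⁻¹) (T ⟦ ζ₀ ⟧₄ (6 + k) (Inverse.from enumTB (seat u)) (Inverse.from enumTB (seat v))) (proj₂ (lift (r v)) ⁻¹) ∎
         }
         where
         open ≡-Reasoning
         seat : Fin n → TB × Fin (6 + k)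
         seat v = proj₁ (place (r v)) , fromℕ< (place-< (r v))
         seat-injective : ∀ {u v} → seat u ≡ seat v → place (r u) ≡ place (r v)
         seat-injective {u} {v} eq = cong₂ _,_ (cong proj₁ eq)
           (trans (sym (Fin.toℕ-fromℕ< (place-< (r u)))) (trans (cong (λ s → toℕ (proj₂ s)) eq) (Fin.toℕ-fromℕ< (place-< (r v)))))
         match : ∀ {u v} → u ≢ v → Match (lift (r u)) (place (r u)) (lift (r v)) (place (r v)) × place (r u) ≢ place (r v)
         match {u} {v} u≢v with pairs u v
         ... | inj₁ eq = contradiction eq u≢v
         ... | inj₂ m = m
         +-0 : ∀ z → z Gaussian.+ Gaussian.0# ≡ z
         +-0 (a +i c) = cong₂ _+i_ (ℤ.+-identityʳ a) (ℤ.+-identityʳ c)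
         0-+ : ∀ z → Gaussian.0# Gaussian.+ z ≡ z
         0-+ (a +i c) = cong₂ _+i_ (ℤ.+-identityˡ a) (ℤ.+-identityˡ c)
         value : ∀ u v → u ≢ v → ⟦ ⟪ lift (r u) ∣ lift (r v) ⟫ ⟧ʷ ≡ Graph.weight (T-graph ⟦ ζ₀ ⟧₄ (6 + k)) (seat u) (seat v)
         value u v u≢v = trans (sum (proj₁ (match u≢v))) (sym (trans
           (T-weight (5 + k) ζ₀ (proj₁ (place (r u))) (proj₁ (place (r v))) (fromℕ< (place-< (r u))) (fromℕ< (place-< (r v))))
           (cong₂ (λ i j → ⟦ arrow (5 + k) ζ₀ (proj₁ (place (r u))) i j ⟧ʷ Gaussian.+ Gaussian.conj ⟦ arrow (5 + k) ζ₀ (proj₁ (place (r v))) j i ⟧ʷ)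
             (Fin.toℕ-fromℕ< (place-< (r u))) (Fin.toℕ-fromℕ< (place-< (r v))))))
           where
           sum : ∀ {x a y c} → Match x a y c → ⟦ ⟪ x ∣ y ⟫ ⟧ʷ ≡ ⟦ arr a c ⟧ʷ Gaussian.+ Gaussian.conj ⟦ arr c a ⟧ʷ
           sum {x} {a} {y} {c} (forth e z) = trans (cong ⟦_⟧ʷ e) (sym (trans (cong (λ w → ⟦ arr a c ⟧ʷ Gaussian.+ Gaussian.conj ⟦ w ⟧ʷ) z) (+-0 _)))
           sum {x} {a} {y} {c} (back e z) = trans (cong ⟦_⟧ʷ (flip {y} {x} e)) (trans (⟦⟧-conj (arr c a))
             (sym (trans (cong (λ w → ⟦ w ⟧ʷ Gaussian.+ Gaussian.conj ⟦ arr c a ⟧ʷ) z) (0-+ _))))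

     assembled : Out ⊎ Embeds G (T Gaussian.1# (6 + k)) ⊎ Embeds G (T Gaussian.𝐢 (6 + k))
     assembled with roles
     ... | inj₁ out = inj₁ out
     ... | inj₂ r = choose (Fin.any? (λ v → closing? (r v)))
       where
       Closing : ∀ {v} → Role p v → Set
       Closing (closing _ _ _) = ⊤
       Closing _ = ⊥
       closing? : ∀ {v} (r : Role p v) → Dec (Closing r)
       closing? (on-path _ _ _) = no λ ()
       closing? (twinned _ _ _) = no λ ()
       closing? (closing _ _ _) = yes tt
       wrap : ∀ ζ → Out ⊎ Embeds G (T ⟦ representative ζ ⟧₄ (6 + k)) →
         Out ⊎ Embeds G (T Gaussian.1# (6 + k)) ⊎ Embeds G (T Gaussian.𝐢 (6 + k))
       wrap ζ (inj₁ out) = inj₁ out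
       wrap ζ⁰ (inj₂ E) = inj₂ (inj₁ E)
       wrap ζ¹ (inj₂ E) = inj₂ (inj₂ E)
       wrap ζ² (inj₂ E) = inj₂ (inj₁ E)
       wrap ζ³ (inj₂ E) = inj₂ (inj₂ E)
       trivial : ∀ {v} (s : Role p v) → ¬ Closing s → Consistent ζ⁰ s
       trivial (on-path _ _ _) _ = tt
       trivial (twinned _ _ _) _ = tt
       trivial (closing _ _ _) ¬c = ⊥-elim (¬c tt)
       same : ∀ {u v ζ c} → Closer k p ζ (u , c) → (s : Role p v) → Dec (v ≡ u) → (∀ (eq : v ≡ u) → Consistent (representative ζ) s) →
         Out ⊎ Consistent (representative ζ) s
       same C s (yes eq) refl-case = inj₂ (refl-case eq)
       same C (on-path _ _ _) (no _) _ = inj₂ tt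
       same C (twinned _ _ _) (no _) _ = inj₂ tt
       same {ζ = ζ} C (closing η _ D) (no v≢u) _ with closers window longer P C D v≢u
       ... | inj₁ out = inj₁ out
       ... | inj₂ (_ , refl) = inj₂ (representative-opposite ζ)
       choose : Dec (∃[ v ] Closing (r v)) → Out ⊎ Embeds G (T Gaussian.1# (6 + k)) ⊎ Embeds G (T Gaussian.𝐢 (6 + k))
       choose (no absent) = wrap ζ⁰ (embedding ζ⁰ r (λ v → trivial (r v) (λ c → absent (v , c))))
       choose (yes (u , c)) with r u in eq
       ... | closing ζ _ C with collect {Q = λ v → Consistent (representative ζ) (r v)} (λ v → same C (r v) (v Fin.≟ u) λ { refl → subst (Consistent (representative ζ)) (sym eq) refl })
       ... | inj₁ out = inj₁ out
       ... | inj₂ consistent = wrap ζ (embedding (representative ζ) r consistent)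

module Classification where

 open Configuration
 open Certificate
 open Gains
 open ShortPaths
 open TargetGraphs
 open Certificates
 open WheelWeights
 open PathReplacement using (module Replacement)
 open import Data.Bool.Base using (_∨_)
 open import Data.List.Base using ([]; _∷_)
 open import Data.List.Membership.Propositional using (_∈_)
 import Data.List.Relation.Unary.All as LAll
 open import Data.Maybe.Base using (is-just)
 open import Data.Nat.Base using (_≤_; _<_; _+_)
 open import Data.Nat.Properties
 open import Data.Vec.Relation.Unary.All using ([]; _∷_)
 open import Relation.Nullary.Decidable.Core using (_→-dec_)

 data IsTarget : ∀ {N} → Matrix N → Set where
   is-S₈ : IsTarget (adjacency S₈† enumLetter)
   is-S₁₄ : IsTarget (adjacency S₁₄ enumON)
   is-S₁₆ : IsTarget (adjacency S₁₆ enumON)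
   is-X₈ : IsTarget (adjacency X₈ enumON)
   is-T₁ : ∀ k → 3 ≤ k → IsTarget (T Gaussian.1# k)
   is-Tᵢ : ∀ k → 3 ≤ k → IsTarget (T Gaussian.𝐢 k)

 -- Equality of matrices by evaluation of the entries.
 by-entries : ∀ {N} (A B : Matrix N) → allFinᵇ (λ u → allFinᵇ λ v → does (A u v ≟ᵍ B u v)) ≡ true → A ≐ B
 by-entries A B ok u v = does-true (A u v ≟ᵍ B u v)
   (allFinᵇ-true (λ v → does (A u v ≟ᵍ B u v)) (allFinᵇ-true (λ u → allFinᵇ λ v → does (A u v ≟ᵍ B u v)) ok u) v)

 T-hermitian : ∀ ζ k → IsHermitian (T ⟦ ζ ⟧₄ k)
 T-hermitian ζ zero ()
 T-hermitian ζ (suc m) u v = begin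
   Gaussian.conj (T ⟦ ζ ⟧₄ (suc m) v u) ≡⟨ cong Gaussian.conj (T-weight m ζ y x l j) ⟩
   Gaussian.conj (⟦ arrow m ζ y (toℕ l) (toℕ j) ⟧ʷ Gaussian.+ Gaussian.conj ⟦ arrow m ζ x (toℕ j) (toℕ l) ⟧ʷ)
                                          ≡⟨ lemma ⟦ arrow m ζ y (toℕ l) (toℕ j) ⟧ʷ ⟦ arrow m ζ x (toℕ j) (toℕ l) ⟧ʷ ⟩
   ⟦ arrow m ζ x (toℕ j) (toℕ l) ⟧ʷ Gaussian.+ Gaussian.conj ⟦ arrow m ζ y (toℕ l) (toℕ j) ⟧ʷ
                                          ≡⟨ T-weight m ζ x y j l ⟨
   T ⟦ ζ ⟧₄ (suc m) u v ∎
   where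
   open ≡-Reasoning
   x = proj₁ (Inverse.to (enumTB {suc m}) u)
   j = proj₂ (Inverse.to (enumTB {suc m}) u)
   y = proj₁ (Inverse.to (enumTB {suc m}) v)
   l = proj₂ (Inverse.to (enumTB {suc m}) v)
   lemma : ∀ x y → Gaussian.conj (x Gaussian.+ Gaussian.conj y) ≡ y Gaussian.+ Gaussian.conj x
   lemma (a +i b) (c +i d) = cong₂ _+i_ (ℤ.+-comm a c)
     (trans (ℤ.neg-distrib-+ b (ℤ.- d)) (trans (cong (λ e → ℤ.- b ℤ.+ e) (ℤ.neg-involutive d)) (ℤ.+-comm (ℤ.- b) d)))

 target-hermitian : ∀ {N} {M : Matrix N} → IsTarget M → IsHermitian M
 target-hermitian is-S₈ = by-entries (adjacency S₈† enumLetter *ᴴ) (adjacency S₈† enumLetter) refl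
 target-hermitian is-S₁₄ = by-entries (adjacency S₁₄ enumON *ᴴ) (adjacency S₁₄ enumON) refl
 target-hermitian is-S₁₆ = by-entries (adjacency S₁₆ enumON *ᴴ) (adjacency S₁₆ enumON) refl
 target-hermitian is-X₈ = by-entries (adjacency X₈ enumON *ᴴ) (adjacency X₈ enumON) refl
 target-hermitian (is-T₁ k _) = T-hermitian ζ⁰ k
 target-hermitian (is-Tᵢ k _) = T-hermitian ζ¹ k

 open Soundness IsTarget target-hermitian

 valid : LAll.All (λ T → IsTarget (proj₂ T)) targets
 valid = is-S₈ LAll.∷ is-S₁₄ LAll.∷ is-S₁₆ LAll.∷ is-X₈
   LAll.∷ is-T₁ 3 3≤ LAll.∷ is-Tᵢ 3 3≤ LAll.∷ is-T₁ 4 3≤ LAll.∷ is-Tᵢ 4 3≤ LAll.∷ is-T₁ 5 3≤ LAll.∷ is-Tᵢ 5 3≤ LAll.∷ LAll.[]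
   where
   3≤ : ∀ {k} → 3 ≤ 3 + k
   3≤ = s≤s (s≤s (s≤s z≤n))

 record StateSound (S : State) : Set where
   constructor state-sound
   field
     complete : ∀ {n} (G : GainGraph n) →
       (g : Vec (Fin n × C₄) (proj₁ S)) → GainGraph.Distinct G g → GainGraph.conf G g ≡ proj₁ (proj₂ S) → InGraph.Complete G g (proj₂ (proj₂ S))

 start-sound : StateSound start
 start-sound = state-sound λ { G [] _ _ v _ → ζ⁰ , inj₂ refl }

 ▸-sound : ∀ S s → StateSound S → StateSound (S ▸ s)
 ▸-sound (s , N , L) (c , P) (state-sound complete) = state-sound λ { G (x ∷ g) d eq → extend G x g d eq }
   where
   extend : ∀ {n} (G : GainGraph n) →
     ∀ x (g : Vec (Fin n × C₄) s) → GainGraph.Distinct G (x ∷ g) → GainGraph.conf G (x ∷ g) ≡ column s c ∷ N →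
     InGraph.Complete G (x ∷ g) (grow (pool (2 + s) P) N (column s c) L)
   extend G x g d eq = subst₂ (λ c N → Complete (x ∷ g) (grow (pool (2 + s) P) N c L)) (cong newest eq) (cong older eq)
     (grow-complete (pool (2 + s) P) d (complete G g (proj₂ d) (cong older eq)))
     where
     open InGraph G
     newest : ∀ {s} → Conf (suc s) → Vec W s
     newest (c ∷ _) = c
     older : ∀ {s} → Conf (suc s) → Conf s
     older (_ ∷ N) = N

 by-tree : ∀ {S} T seeds → LAll.All Claim seeds → StateSound S → Check.check seeds targets S T ≡ true → Claim (seed S)
 by-tree {s , N , L} T seeds claims (state-sound complete) ok G g d eq =
   CheckSound.check-sound seeds claims targets valid s N L T ok G g d eq (complete G g d eq)

 P1-sound : StateSound P1
 P1-sound = ▸-sound start P1-step start-sound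

 P2-sound : StateSound P2
 P2-sound = ▸-sound P1 P2-step P1-sound

 P3-sound : StateSound P3
 P3-sound = ▸-sound P2 P3-step P2-sound

 P4-sound : StateSound P4
 P4-sound = ▸-sound P3 P4-step P3-sound

 P5-sound : StateSound P5
 P5-sound = ▸-sound P4 P5-step P4-sound

 E6-sound : StateSound E6
 E6-sound = ▸-sound P5 E6-step P5-sound

 F6-sound : StateSound F6
 F6-sound = ▸-sound P5 F6-step P5-sound

 G0-sound : StateSound G0
 G0-sound = ▸-sound E6 G0-step E6-sound

 G1-sound : StateSound G1
 G1-sound = ▸-sound E6 G1-step E6-sound

 G2-sound : StateSound G2
 G2-sound = ▸-sound E6 G2-step E6-sound

 G3-sound : StateSound G3
 G3-sound = ▸-sound E6 G3-step E6-sound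

 G4-sound : StateSound G4
 G4-sound = ▸-sound F6 G4-step F6-sound

 G5-sound : StateSound G5
 G5-sound = ▸-sound F6 G5-step F6-sound

 H0′-sound : StateSound H0′
 H0′-sound = ▸-sound P2 H0′-step P2-sound

 H0-sound : StateSound H0
 H0-sound = ▸-sound H0′ H0-step H0′-sound

 H1-sound : StateSound H1
 H1-sound = ▸-sound P3 H1-step P3-sound

 H2-sound : StateSound H2
 H2-sound = ▸-sound P3 H2-step P3-sound

 H3-sound : StateSound H3
 H3-sound = ▸-sound P3 H3-step P3-sound

 H4-sound : StateSound H4
 H4-sound = ▸-sound P3 H4-step P3-sound

 H5-sound : StateSound H5
 H5-sound = ▸-sound P3 H5-step P3-sound

 H6-sound : StateSound H6
 H6-sound = ▸-sound P3 H6-step P3-sound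

 H7-sound : StateSound H7
 H7-sound = ▸-sound P3 H7-step P3-sound

 H8-sound : StateSound H8
 H8-sound = ▸-sound P2 H8-step P2-sound

 H9-sound : StateSound H9
 H9-sound = ▸-sound P2 H9-step P2-sound

 claims-G0 : LAll.All Claim seeds-G0
 claims-G0 = LAll.[]

 G0-claim : Claim (seed G0)
 G0-claim = by-tree G0-tree seeds-G0 claims-G0 G0-sound G0-check

 claims-G1 : LAll.All Claim seeds-G1
 claims-G1 = G0-claim LAll.∷ claims-G0

 G1-claim : Claim (seed G1)
 G1-claim = by-tree G1-tree seeds-G1 claims-G1 G1-sound G1-check

 claims-G2 : LAll.All Claim seeds-G2
 claims-G2 = G1-claim LAll.∷ claims-G1

 G2-claim : Claim (seed G2)
 G2-claim = by-tree G2-tree seeds-G2 claims-G2 G2-sound G2-check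

 claims-G3 : LAll.All Claim seeds-G3
 claims-G3 = G2-claim LAll.∷ claims-G2

 G3-claim : Claim (seed G3)
 G3-claim = by-tree G3-tree seeds-G3 claims-G3 G3-sound G3-check

 claims-G4 : LAll.All Claim seeds-G4
 claims-G4 = G3-claim LAll.∷ claims-G3

 G4-claim : Claim (seed G4)
 G4-claim = by-tree G4-tree seeds-G4 claims-G4 G4-sound G4-check

 claims-G5 : LAll.All Claim seeds-G5
 claims-G5 = G4-claim LAll.∷ claims-G4

 G5-claim : Claim (seed G5)
 G5-claim = by-tree G5-tree seeds-G5 claims-G5 G5-sound G5-check

 claims-E6 : LAll.All Claim seeds-E6
 claims-E6 = G5-claim LAll.∷ claims-G5

 E6-claim : Claim (seed E6)
 E6-claim = by-tree E6-tree seeds-E6 claims-E6 E6-sound E6-check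

 claims-F6 : LAll.All Claim seeds-F6
 claims-F6 = E6-claim LAll.∷ claims-E6

 F6-claim : Claim (seed F6)
 F6-claim = by-tree F6-tree seeds-F6 claims-F6 F6-sound F6-check

 claims-P5 : LAll.All Claim seeds-P5
 claims-P5 = F6-claim LAll.∷ claims-F6

 at : ∀ {s} → Vec W s → ℕ → W
 at [] _ = 𝟎
 at (w ∷ c) zero = w
 at (w ∷ c) (suc i) = at c i

 nonzero? : ∀ (w : W) → Dec (w ≢ 𝟎)
 nonzero? w = ¬? (w ≟ʷ 𝟎)

 _<∣>_ : ∀ {A : Set} → Maybe A → Maybe A → Maybe A
 just x <∣> _ = just x
 nothing <∣> y = y

 from-dec : ∀ {P A : Set} → Dec P → (P → A) → Maybe A
 from-dec (yes p) f = just (f p)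
 from-dec (no _) _ = nothing

 pattern? : ∀ c → Maybe (Pat 0 c)
 pattern? c = none? <∣> (end? 0 first <∣> (end? 1 second <∣> (end? 3 penult <∣> (end? 4 last <∣>
   (twin? 0 (s≤s z≤n) <∣> (twin? 1 (s≤s (s≤s z≤n)) <∣> (twin? 2 (s≤s (s≤s (s≤s z≤n))) <∣> close?)))))))
   where
   none? : Maybe (Pat 0 c)
   none? = from-dec (allUpTo? (λ i → c i ≟ʷ 𝟎) 5) λ z → none λ i i< → z i<
   end? : ∀ j → Ends 0 j → Maybe (Pat 0 c)
   end? j e = from-dec (nonzero? (c j) ×-dec allUpTo? (λ i → ¬? (i ≟ j) →-dec (c i ≟ʷ 𝟎)) 5)
     λ { (cj , z) → end j e cj λ i i< → z i< }
   twin? : ∀ j → j < 3 → Maybe (Pat 0 c)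
   twin? j j< = from-dec (nonzero? (c j) ×-dec (c (2 + j) ≟ʷ negʷ (c j)) ×-dec
       allUpTo? (λ i → ¬? (i ≟ j) →-dec (¬? (i ≟ 2 + j) →-dec (c i ≟ʷ 𝟎))) 5)
     λ { (cj , eq , z) → twin j j< cj eq λ i i< → z i< }
   close? : Maybe (Pat 0 c)
   close? = from-dec (nonzero? (c 0) ×-dec nonzero? (c 4) ×-dec
       allUpTo? (λ i → ¬? (i ≟ 0) →-dec (¬? (i ≟ 4) →-dec (c i ≟ʷ 𝟎))) 5)
     λ { (c0 , c4 , z) → close c0 c4 λ i i< → z i< }

 E₆-column F₆-column : Vec W 5
 E₆-column = 𝟎 ∷ 𝟎 ∷ 𝟏 ∷ 𝟎 ∷ 𝟎 ∷ []
 F₆-column = 𝟏 ∷ 𝟎 ∷ just ζ² ∷ 𝟎 ∷ 𝟏 ∷ []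

 recognised : Vec W 5 → Bool
 recognised c = does (c ≟ᵛ E₆-column) ∨ (does (c ≟ᵛ F₆-column) ∨ is-just (pattern? (at c)))

 P5-recognised : allᵇ recognised (proj₂ (proj₂ P5)) ≡ true
 P5-recognised = refl

 recognise : ∀ c → recognised c ≡ true → c ≡ E₆-column ⊎ c ≡ F₆-column ⊎ Pat 0 (at c)
 recognise c ok with c ≟ᵛ E₆-column | c ≟ᵛ F₆-column | pattern? (at c)
 ... | yes eq | _ | _ = inj₁ eq
 ... | no _ | yes eq | _ = inj₂ (inj₁ eq)
 ... | no _ | no _ | just p = inj₂ (inj₂ p)

 module LongPaths {n} (G : GainGraph n) where
   open Paths G
   open InGraph G using (Complete)

   vertices : (ℕ → X) → Vec X 5
   vertices p = p 0 ∷ p 1 ∷ p 2 ∷ p 3 ∷ p 4 ∷ []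

   module _ {p} (P : IsPath 5 p) where

     vertices-distinct : Distinct (vertices p)
     vertices-distinct =
         (dist P 0 1 (s≤s z≤n) (s≤s (s≤s z≤n)) ∷ dist P 0 2 (s≤s z≤n) (s≤s (s≤s (s≤s z≤n)))
           ∷ dist P 0 3 (s≤s z≤n) (s≤s (s≤s (s≤s (s≤s z≤n)))) ∷ dist P 0 4 (s≤s z≤n) ≤-refl ∷ [])
       , (dist P 1 2 ≤-refl (s≤s (s≤s (s≤s z≤n))) ∷ dist P 1 3 (s≤s (s≤s z≤n)) (s≤s (s≤s (s≤s (s≤s z≤n))))
           ∷ dist P 1 4 (s≤s (s≤s z≤n)) ≤-refl ∷ [])
       , (dist P 2 3 ≤-refl (s≤s (s≤s (s≤s (s≤s z≤n)))) ∷ dist P 2 4 (s≤s (s≤s (s≤s z≤n))) ≤-refl ∷ [])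
       , (dist P 3 4 ≤-refl ≤-refl ∷ []) , [] , tt

     vertices-conf : conf (vertices p) ≡ proj₁ (proj₂ P5)
     vertices-conf rewrite adj P 0 (s≤s (s≤s z≤n)) | adj P 1 (s≤s (s≤s (s≤s z≤n)))
       | adj P 2 (s≤s (s≤s (s≤s (s≤s z≤n)))) | adj P 3 ≤-refl
       | far P 0 2 ≤-refl (s≤s (s≤s (s≤s z≤n))) | far P 0 3 (s≤s (s≤s z≤n)) (s≤s (s≤s (s≤s (s≤s z≤n))))
       | far P 0 4 (s≤s (s≤s z≤n)) ≤-refl | far P 1 3 ≤-refl (s≤s (s≤s (s≤s (s≤s z≤n))))
       | far P 1 4 (s≤s (s≤s (s≤s z≤n))) ≤-refl | far P 2 4 ≤-refl ≤-refl = refl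

     window : ∀ x → Off 5 p x → Fits G ⊎ Pat 0 (λ i → ⟪ x ∣ p i ⟫)
     window (v , q) off = by-column (StateSound.complete P5-sound G (vertices p) vertices-distinct vertices-conf v fresh)
       where
       fresh : Fresh v (vertices p)
       fresh = off 0 (s≤s z≤n) ∷ off 1 (s≤s (s≤s z≤n)) ∷ off 2 (s≤s (s≤s (s≤s z≤n)))
         ∷ off 3 (s≤s (s≤s (s≤s (s≤s z≤n)))) ∷ off 4 ≤-refl ∷ []
       vanish : ∀ {r i} → ⟪ (v , r) ∣ p i ⟫ ≡ 𝟎 → ⟪ (v , q) ∣ p i ⟫ ≡ 𝟎
       vanish {r} {i} eq = trans (cong (λ s → ⟪ (v , s) ∣ p i ⟫) (sym q≡)) (trans (⟪⟫-⋆ˡ (q ∙ r ⁻¹) (v , r) (p i)) (cong ((q ∙ r ⁻¹) ◃_) eq))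
         where
         q≡ : (q ∙ r ⁻¹) ∙ r ≡ q
         q≡ = trans (∙-assoc q (r ⁻¹) r) (trans (cong (q ∙_) (∙-inverseˡ r)) (∙-identityʳ q))
       at-col : ∀ a i → i < 5 → at (col (v , a) (vertices p)) i ≡ ⟪ (v , a) ∣ p i ⟫
       at-col a 0 _ = refl
       at-col a 1 _ = refl
       at-col a 2 _ = refl
       at-col a 3 _ = refl
       at-col a 4 _ = refl
       at-col a (suc (suc (suc (suc (suc _))))) (s≤s (s≤s (s≤s (s≤s (s≤s ())))))
       at-zeros : ∀ {s} i → at (zeros {s}) i ≡ 𝟎
       at-zeros {zero} i = refl
       at-zeros {suc s} zero = refl
       at-zeros {suc s} (suc i) = at-zeros {s} i
       by-column : ∃[ a ] (col (v , a) (vertices p) ∈ proj₂ (proj₂ P5) ⊎ col (v , a) (vertices p) ≡ zeros) →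
         Fits G ⊎ Pat 0 (λ i → ⟪ (v , q) ∣ p i ⟫)
       by-column (a , inj₂ eq) = inj₂ (none λ i i< →
         vanish {a} {i} (trans (sym (at-col a i i<)) (trans (cong (λ c → at c i) eq) (at-zeros {5} i))))
       by-column (a , inj₁ c∈) with recognise _ (allᵇ-true recognised {proj₂ (proj₂ P5)} P5-recognised c∈)
       ... | inj₁ eq = inj₁ (E6-claim G ((v , a) ∷ vertices p) (fresh , vertices-distinct) (cong₂ _∷_ eq vertices-conf))
       ... | inj₂ (inj₁ eq) = inj₁ (F6-claim G ((v , a) ∷ vertices p) (fresh , vertices-distinct) (cong₂ _∷_ eq vertices-conf))
       ... | inj₂ (inj₂ pt) = inj₂ (Pat-cong′ (Pat-scale (q ∙ a ⁻¹) pt))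
         where
         scaled : ∀ i → i < 5 → (q ∙ a ⁻¹) ◃ at (col (v , a) (vertices p)) i ≡ ⟪ (v , q) ∣ p i ⟫
         scaled i i< = trans (cong ((q ∙ a ⁻¹) ◃_) (at-col a i i<)) (trans (sym (⟪⟫-⋆ˡ (q ∙ a ⁻¹) (v , a) (p i)))
           (cong (λ s → ⟪ (v , s) ∣ p i ⟫) (trans (∙-assoc q (a ⁻¹) a) (trans (cong (q ∙_) (∙-inverseˡ a)) (∙-identityʳ q)))))
         Pat-cong′ : Pat 0 (λ i → (q ∙ a ⁻¹) ◃ at (col (v , a) (vertices p)) i) → Pat 0 (λ i → ⟪ (v , q) ∣ p i ⟫)
         Pat-cong′ = Pat-cong scaled

   path-length : ∀ {m p} → IsPath m p → m ≤ n
   path-length {m} {p} P = Fin.injective⇒≤ {f = λ i → proj₁ (p (toℕ {m} i))} injective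
     where
     injective : ∀ {i j : Fin m} → proj₁ (p (toℕ i)) ≡ proj₁ (p (toℕ j)) → i ≡ j
     injective {i} {j} eq with <-cmp (toℕ i) (toℕ j)
     ... | tri< i<j _ _ = contradiction eq (dist P (toℕ i) (toℕ j) i<j (Fin.toℕ<n j))
     ... | tri≈ _ i≡j _ = Fin.toℕ-injective i≡j
     ... | tri> _ _ j<i = contradiction (sym eq) (dist P (toℕ j) (toℕ i) j<i (Fin.toℕ<n i))

   fits : ∀ fuel k {p} → n ≤ fuel + (4 + k) → IsPath (5 + k) p → Fits G
   fits zero k n≤ P = contradiction (path-length P) (<⇒≱ (s≤s n≤))
   fits (suc fuel) k n≤ P
     with Assembling.Assembly.assembled G k window (λ q Q → fits fuel (suc k) (subst (n ≤_) (sym (+-suc fuel (4 + k))) n≤) Q) P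
   ... | inj₁ out = out
   ... | inj₂ (inj₁ E) = _ , _ , is-T₁ (6 + k) (s≤s (s≤s (s≤s z≤n))) , E
   ... | inj₂ (inj₂ E) = _ , _ , is-Tᵢ (6 + k) (s≤s (s≤s (s≤s z≤n))) , E

 P5-claim : Claim (seed P5)
 P5-claim {n} G (a ∷ b ∷ c ∷ d ∷ e ∷ []) distinct eq = LongPaths.fits G n 0 (m≤m+n n 4) (five-path-from-conf eq)
   where
   open GainGraph G
   open Paths G using (IsPath; cons)
   heads : ∀ {s} → Conf (suc s) → Vec W s
   heads (c ∷ _) = c
   rest : ∀ {s} → Conf (suc s) → Conf s
   rest (_ ∷ N) = N
   five-path-from-conf : conf (a ∷ b ∷ c ∷ d ∷ e ∷ []) ≡ proj₁ (proj₂ P5) →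
     IsPath 5 (cons a (cons b (cons c (cons d λ _ → e))))
   five-path-from-conf eq = Replacement.five-path G
     (at-eq 0 r₀) (at-eq 0 r₁) (at-eq 0 r₂) (at-eq 0 r₃)
     (at-eq 1 r₀) (at-eq 2 r₀) (at-eq 3 r₀) (at-eq 1 r₁) (at-eq 2 r₁) (at-eq 1 r₂) distinct
     where
     r₀ = cong heads eq
     r₁ = cong (λ N → heads (rest N)) eq
     r₂ = cong (λ N → heads (rest (rest N))) eq
     r₃ = cong (λ N → heads (rest (rest (rest N)))) eq
     at-eq : ∀ {s} {c d : Vec W s} i → c ≡ d → at c i ≡ at d i
     at-eq i refl = refl

 claims-H0 : LAll.All Claim seeds-H0
 claims-H0 = P5-claim LAll.∷ claims-P5

 H0-claim : Claim (seed H0)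
 H0-claim = by-tree H0-tree seeds-H0 claims-H0 H0-sound H0-check

 claims-H1 : LAll.All Claim seeds-H1
 claims-H1 = H0-claim LAll.∷ claims-H0

 H1-claim : Claim (seed H1)
 H1-claim = by-tree H1-tree seeds-H1 claims-H1 H1-sound H1-check

 claims-H2 : LAll.All Claim seeds-H2
 claims-H2 = H1-claim LAll.∷ claims-H1

 H2-claim : Claim (seed H2)
 H2-claim = by-tree H2-tree seeds-H2 claims-H2 H2-sound H2-check

 claims-H3 : LAll.All Claim seeds-H3
 claims-H3 = H2-claim LAll.∷ claims-H2

 H3-claim : Claim (seed H3)
 H3-claim = by-tree H3-tree seeds-H3 claims-H3 H3-sound H3-check

 claims-H4 : LAll.All Claim seeds-H4
 claims-H4 = H3-claim LAll.∷ claims-H3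

 H4-claim : Claim (seed H4)
 H4-claim = by-tree H4-tree seeds-H4 claims-H4 H4-sound H4-check

 claims-H5 : LAll.All Claim seeds-H5
 claims-H5 = H4-claim LAll.∷ claims-H4

 H5-claim : Claim (seed H5)
 H5-claim = by-tree H5-tree seeds-H5 claims-H5 H5-sound H5-check

 claims-H6 : LAll.All Claim seeds-H6
 claims-H6 = H5-claim LAll.∷ claims-H5

 H6-claim : Claim (seed H6)
 H6-claim = by-tree H6-tree seeds-H6 claims-H6 H6-sound H6-check

 claims-P4 : LAll.All Claim seeds-P4
 claims-P4 = H6-claim LAll.∷ claims-H6

 P4-claim : Claim (seed P4)
 P4-claim = by-tree P4-tree seeds-P4 claims-P4 P4-sound P4-check

 claims-H7 : LAll.All Claim seeds-H7
 claims-H7 = P4-claim LAll.∷ claims-P4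

 H7-claim : Claim (seed H7)
 H7-claim = by-tree H7-tree seeds-H7 claims-H7 H7-sound H7-check

 claims-H8 : LAll.All Claim seeds-H8
 claims-H8 = H7-claim LAll.∷ claims-H7

 H8-claim : Claim (seed H8)
 H8-claim = by-tree H8-tree seeds-H8 claims-H8 H8-sound H8-check

 claims-H9 : LAll.All Claim seeds-H9
 claims-H9 = H8-claim LAll.∷ claims-H8

 H9-claim : Claim (seed H9)
 H9-claim = by-tree H9-tree seeds-H9 claims-H9 H9-sound H9-check

 claims-P3 : LAll.All Claim seeds-P3
 claims-P3 = H9-claim LAll.∷ claims-H9

 P3-claim : Claim (seed P3)
 P3-claim = by-tree P3-tree seeds-P3 claims-P3 P3-sound P3-check

 claims-P2 : LAll.All Claim seeds-P2
 claims-P2 = P3-claim LAll.∷ claims-P3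

 P2-claim : Claim (seed P2)
 P2-claim = by-tree P2-tree seeds-P2 claims-P2 P2-sound P2-check

 claims-P1 : LAll.All Claim seeds-P1
 claims-P1 = P2-claim LAll.∷ claims-P2

 P1-claim : Claim (seed P1)
 P1-claim = by-tree P1-tree seeds-P1 claims-P1 P1-sound P1-check

 fits-target : ∀ {n} (G : GainGraph (suc n)) → Fits G
 fits-target G = P1-claim G ((Fin.zero , ζ⁰) ∷ []) ([] , tt) refl

module SquareFours where

 open Configuration using (C₄; ζ⁰; ζ¹; ζ²; ζ³; ⟦_⟧₄; ⟦_⟧ʷ)
 open Certificate using (_≟ᵍ_)
 open TargetGraphs
 open WheelWeights
 open AdjoinedRings
 open import Data.Fin.Base using (inject₁; fromℕ)
 open import Data.Integer.Solver using () renaming (module +-*-Solver to ℤ-Solver)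
 open import Relation.Binary.Construct.Closure.ReflexiveTransitive using (Star; ε; _◅_; _◅◅_)
 import Relation.Binary.Construct.Closure.ReflexiveTransitive as Star
 open import Relation.Nullary.Decidable using (_⊎-dec_)
 open Vertices using (TB; t; b)

 four : ℤ[i]
 four = ℤ.+ 4 +i 0ℤ

 SquareFour : ∀ {n} → Matrix n → Set
 SquareFour M = M ⊗ M ≐ λ u v → four Gaussian.* I u v

 Linked : ∀ {n} → Matrix n → Fin n → Fin n → Set
 Linked M i j = Adjacent M i j ⊎ (∃[ x ] Adjacent M i x × Adjacent M x j)

 Descends : ∀ {n} → Matrix n → Set
 Descends M = ∀ i → toℕ i ≡ 0 ⊎ (∃[ j ] j Fin.< i × Linked M i j)

 descends? : ∀ {n} (M : Matrix n) → Dec (Descends M)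
 descends? M = Fin.all? λ i → (toℕ i ℕ.≟ 0) ⊎-dec Fin.any? λ j → (j Fin.<? i) ×-dec
     ((adjacent? i j) ⊎-dec Fin.any? λ x → adjacent? i x ×-dec adjacent? x j)
   where
   adjacent? : ∀ u v → Dec (Adjacent M u v)
   adjacent? u v = ¬? (u Fin.≟ v) ×-dec ¬? (M u v ≟ᵍ Gaussian.0#)

 adjacent-sym : ∀ {n} {M : Matrix n} → IsHermitian M → ∀ {u v} → Adjacent M u v → Adjacent M v u
 adjacent-sym herm {u} {v} (u≢v , ne) = u≢v ∘ sym , λ eq → ne (trans (sym (herm u v)) (cong Gaussian.conj eq))

 descends⇒indecomposable : ∀ {n} {M : Matrix n} → IsHermitian M → Descends M → IsIndecomposable M
 descends⇒indecomposable {n} {M} herm down u v = climb (toℕ u) (toℕ v) u v ℕ.≤-refl ℕ.≤-refl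
   where
   path : ∀ {i j} → Linked M i j → Star (Adjacent M) i j
   path (inj₁ e) = e ◅ ε
   path (inj₂ (_ , e , e′)) = e ◅ e′ ◅ ε
   climb : ∀ k l u v → toℕ u ℕ.≤ k → toℕ v ℕ.≤ l → Star (Adjacent M) u v
   climb k l u v ≤k ≤l with down u | down v
   climb zero l u v ≤k ≤l | inj₂ (j , j<u , e) | _ = contradiction (ℕ.<-≤-trans j<u ≤k) λ ()
   climb (suc k) l u v ≤k ≤l | inj₂ (j , j<u , e) | _ = path e ◅◅ climb k l j v (ℕ.s≤s⁻¹ (ℕ.<-≤-trans j<u ≤k)) ≤l
   climb k zero u v ≤k ≤l | inj₁ _ | inj₂ (j , j<v , e) = contradiction (ℕ.<-≤-trans j<v ≤l) λ ()
   climb k (suc l) u v ≤k ≤l | inj₁ _ | inj₂ (j , j<v , e) =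
     climb k l u j ≤k (ℕ.s≤s⁻¹ (ℕ.<-≤-trans j<v ≤l)) ◅◅ Star.reverse (adjacent-sym {M = M} herm) (path e)
   climb k l u v ≤k ≤l | inj₁ u≡0 | inj₁ v≡0 = subst (Star (Adjacent M) u) (Fin.toℕ-injective (trans u≡0 (sym v≡0))) ε

 conj-* : ∀ z w → Gaussian.conj (z Gaussian.* w) ≡ Gaussian.conj z Gaussian.* Gaussian.conj w
 conj-* (p +i q) (c +i d) = cong₂ _+i_
   (solve 4 (λ p q c d → p :* c :+ :- (q :* d) := p :* c :+ :- (:- q :* :- d)) refl p q c d)
   (solve 4 (λ p q c d → :- (p :* d :+ q :* c) := p :* :- d :+ :- q :* c) refl p q c d)
   where open ℤ-Solver

 module Wheels (ζ : C₄) (m : ℕ) where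

   private
     P = suc m
     W = Graph.weight (T-graph ⟦ ζ ⟧₄ P)

   next : Fin P → Fin P
   next j = j ⊕ 1

   prev : Fin P → Fin P
   prev zero = fromℕ m
   prev (suc j) = inject₁ j

   next-prev : ∀ j → next (prev j) ≡ j
   next-prev zero = Fin.toℕ-injective (toℕ-wrap (fromℕ m) (cong suc (Fin.toℕ-fromℕ m)))
   next-prev (suc j) = Fin.toℕ-injective (trans
     (toℕ-next (inject₁ j) (s≤s (subst (ℕ._< m) (sym (Fin.toℕ-inject₁ j)) (Fin.toℕ<n j))))
     (cong suc (Fin.toℕ-inject₁ j)))

   next-injective : ∀ {i j} → next i ≡ next j → i ≡ j
   next-injective {i} {j} eq = by-cases (suc (toℕ i) ℕ.≟ P) (suc (toℕ j) ℕ.≟ P)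
     where
     step : ∀ i → suc (toℕ i) ≢ P → toℕ (next i) ≡ suc (toℕ i)
     step i p = toℕ-next i (ℕ.≤∧≢⇒< (Fin.toℕ<n i) p)
     by-cases : Dec (suc (toℕ i) ≡ P) → Dec (suc (toℕ j) ≡ P) → i ≡ j
     by-cases (yes p) (yes q) = Fin.toℕ-injective (ℕ.suc-injective (trans p (sym q)))
     by-cases (yes p) (no q) = contradiction (trans (sym (toℕ-wrap i p)) (trans (cong toℕ eq) (step j q))) λ ()
     by-cases (no p) (yes q) = contradiction (trans (sym (toℕ-wrap j q)) (trans (cong toℕ (sym eq)) (step i p))) λ ()
     by-cases (no p) (no q) = Fin.toℕ-injective (ℕ.suc-injective (trans (sym (step i p)) (trans (cong toℕ eq) (step j q))))

   open Gaussian using (_+_; _*_; -_; 0#; 1#; conj)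

   factor : Fin P → ℤ[i]
   factor j = if does (suc (toℕ j) ℕ.≟ P) then ⟦ ζ ⟧₄ else 1#

   out : TB → Fin P → Fin P → ℤ[i]
   out x i j = [ j ≡ next i ] * (⟦ layer x ⟧₄ * factor i)

   weight-out : ∀ x y i j → W (x , i) (y , j) ≡ out x i j + conj (out y j i)
   weight-out t t i j = refl
   weight-out t b i j = refl
   weight-out b t i j = refl
   weight-out b b i j = refl

   factor-norm : ∀ j → factor j * conj (factor j) ≡ 1#
   factor-norm j = norm (does (suc (toℕ j) ℕ.≟ P))
     where
     unit : ∀ ζ → ⟦ ζ ⟧₄ * conj ⟦ ζ ⟧₄ ≡ 1#
     unit ζ⁰ = refl
     unit ζ¹ = refl
     unit ζ² = refl
     unit ζ³ = refl
     norm : ∀ c → (if c then ⟦ ζ ⟧₄ else 1#) * conj (if c then ⟦ ζ ⟧₄ else 1#) ≡ 1#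
     norm true = unit ζ
     norm false = refl

   out-𝟎 : ∀ {x i j} → j ≢ next i → out x i j ≡ 0#
   out-𝟎 {x} {i} {j} ne = trans (cong (_* (⟦ layer x ⟧₄ * factor i)) (if-no (j Fin.≟ next i) ne)) (G.zeroˡ (⟦ layer x ⟧₄ * factor i))

   out-next : ∀ x i → out x i (next i) ≡ ⟦ layer x ⟧₄ * factor i
   out-next x i = trans (cong (_* (⟦ layer x ⟧₄ * factor i)) (if-yes (next i Fin.≟ next i) refl)) (G.*-identityˡ (⟦ layer x ⟧₄ * factor i))

   out-b : ∀ i j → out b i j ≡ - out t i j
   out-b i j = lemma [ j ≡ next i ] (factor i)
     where
     lemma : ∀ p f → p * ((- 1#) * f) ≡ - (p * (1# * f))
     lemma (p +i q) (f +i g) = cong₂ _+i_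
       (solve 4 (λ p q f g → p :* (con ℤ.-1ℤ :* f :+ :- (con 0ℤ :* g)) :+ :- (q :* (con ℤ.-1ℤ :* g :+ con 0ℤ :* f)) :=
         :- (p :* (con ℤ.1ℤ :* f :+ :- (con 0ℤ :* g)) :+ :- (q :* (con ℤ.1ℤ :* g :+ con 0ℤ :* f)))) refl p q f g)
       (solve 4 (λ p q f g → p :* (con ℤ.-1ℤ :* g :+ con 0ℤ :* f) :+ q :* (con ℤ.-1ℤ :* f :+ :- (con 0ℤ :* g)) :=
         :- (p :* (con ℤ.1ℤ :* g :+ con 0ℤ :* f) :+ q :* (con ℤ.1ℤ :* f :+ :- (con 0ℤ :* g)))) refl p q f g)
       where open ℤ-Solver

   two : ℤ[i]
   two = ℤ.+ 2 +i 0ℤ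

   -- The products of an incoming and an outgoing arrow cancel between the
   -- layers t and b.
   layers : ∀ x z i l j → W (x , i) (t , j) * W (t , j) (z , l) + W (x , i) (b , j) * W (b , j) (z , l) ≡
     two * (out x i j * conj (out z l j)) + two * (conj (out t j i) * out t j l)
   layers x z i l j = trans (cong₂ _+_
       (cong₂ _*_ (weight-out x t i j) (weight-out t z j l))
       (cong₂ _*_ (trans (weight-out x b i j) (cong (λ w → out x i j + conj w) (out-b j i)))
         (trans (weight-out b z j l) (cong (_+ conj (out z l j)) (out-b j l)))))
     (lemma (out x i j) (conj (out t j i)) (out t j l) (conj (out z l j)))
     where
     lemma : ∀ X U V Y → (X + U) * (V + Y) + (X + - U) * (- V + Y) ≡ two * (X * Y) + two * (U * V)
     lemma (x +i x′) (u +i u′) (v +i v′) (y +i y′) = cong₂ _+i_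
       (solve 8 (λ x x′ u u′ v v′ y y′ → (((x :+ u) :* (v :+ y) :+ :- ((x′ :+ u′) :* (v′ :+ y′))) :+ ((x :+ (:- u)) :* ((:- v) :+ y) :+ :- ((x′ :+ (:- u′)) :* ((:- v′) :+ y′)))) := ((con (ℤ.+ 2) :* (x :* y :+ :- (x′ :* y′)) :+ :- (con 0ℤ :* (x :* y′ :+ x′ :* y))) :+ (con (ℤ.+ 2) :* (u :* v :+ :- (u′ :* v′)) :+ :- (con 0ℤ :* (u :* v′ :+ u′ :* v))))) refl x x′ u u′ v v′ y y′)
       (solve 8 (λ x x′ u u′ v v′ y y′ → (((x :+ u) :* (v′ :+ y′) :+ (x′ :+ u′) :* (v :+ y)) :+ ((x :+ (:- u)) :* ((:- v′) :+ y′) :+ (x′ :+ (:- u′)) :* ((:- v) :+ y))) := ((con (ℤ.+ 2) :* (x :* y′ :+ x′ :* y) :+ con 0ℤ :* (x :* y :+ :- (x′ :* y′))) :+ (con (ℤ.+ 2) :* (u :* v′ :+ u′ :* v) :+ con 0ℤ :* (u :* v :+ :- (u′ :* v′))))) refl x x′ u u′ v v′ y y′)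
       where open ℤ-Solver

   conj-0 : ∀ {z} → z ≡ 0# → conj z ≡ 0#
   conj-0 refl = refl

   outgoing incoming : (x z : TB) (i l j : Fin P) → ℤ[i]
   outgoing x z i l j = two * (out x i j * conj (out z l j))
   incoming x z i l j = two * (conj (out t j i) * out t j l)

   zero-productʳ : ∀ z {w} → w ≡ 0# → two * (z * w) ≡ 0#
   zero-productʳ z eq = trans (cong (λ w → two * (z * w)) eq) (cong (two *_) (G.zeroʳ z))

   zero-productˡ : ∀ {z} w → z ≡ 0# → two * (z * w) ≡ 0#
   zero-productˡ w eq = trans (cong (λ z → two * (z * w)) eq) (cong (two *_) (G.zeroˡ w))

   vertex-square : ∀ (x z : TB) (i l : Fin P) → G.sum (λ j → W (x , i) (t , j) * W (t , j) (z , l)) + G.sum (λ j → W (x , i) (b , j) * W (b , j) (z , l)) ≡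
     G.sum (outgoing x z i l) + G.sum (incoming x z i l)
   vertex-square x z i l = trans (sym (G.sum-+ (λ j → W (x , i) (t , j) * W (t , j) (z , l)) (λ j → W (x , i) (b , j) * W (b , j) (z , l))))
     (trans (G.sum-cong (layers x z i l)) (G.sum-+ (outgoing x z i l) (incoming x z i l)))

   off-diagonal : ∀ (x z : TB) {i l : Fin P} → i ≢ l → G.sum (outgoing x z i l) + G.sum (incoming x z i l) ≡ 0#
   off-diagonal x z {i} {l} i≢l = cong₂ _+_ (G.sum-zero (outgoing x z i l) λ j → leaves j (j Fin.≟ next i) (j Fin.≟ next l))
       (G.sum-zero (incoming x z i l) λ j → enters j (i Fin.≟ next j) (l Fin.≟ next j))
     where
     leaves : ∀ j → Dec (j ≡ next i) → Dec (j ≡ next l) → outgoing x z i l j ≡ 0#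
     leaves j (yes p) (yes q) = contradiction (next-injective (trans (sym p) q)) i≢l
     leaves j (no p) _ = zero-productˡ (conj (out z l j)) (out-𝟎 {x} {i} {j} p)
     leaves j (yes _) (no q) = zero-productʳ (out x i j) (conj-0 (out-𝟎 {z} {l} {j} q))
     enters : ∀ j → Dec (i ≡ next j) → Dec (l ≡ next j) → incoming x z i l j ≡ 0#
     enters j (yes p) (yes q) = contradiction (trans p (sym q)) i≢l
     enters j (no p) _ = zero-productˡ (out t j l) (conj-0 (out-𝟎 {t} {j} {i} p))
     enters j (yes _) (no q) = zero-productʳ (conj (out t j i)) (out-𝟎 {t} {j} {l} q)

   on-diagonal : ∀ (x z : TB) (i : Fin P) → G.sum (outgoing x z i i) + G.sum (incoming x z i i) ≡ two * (⟦ layer x ⟧₄ * conj ⟦ layer z ⟧₄) + two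
   on-diagonal x z i = cong₂ _+_
     (trans (G.sum-only (outgoing x z i i) (next i) λ j ne → zero-productˡ (conj (out z i j)) (out-𝟎 {x} {i} {j} ne))
       (trans (cong₂ (λ v w → two * (v * conj w)) (out-next x i) (out-next z i)) (unit ⟦ layer x ⟧₄ ⟦ layer z ⟧₄ (factor i) (factor-norm i))))
     (trans (G.sum-only (incoming x z i i) (prev i) λ j ne → zero-productʳ (conj (out t j i)) (out-𝟎 {t} {j} {i} λ eq → ne (next-injective (trans (sym eq) (sym (next-prev i))))))
       (trans (cong (λ w → two * (conj w * w)) (trans (cong (out t (prev i)) (sym (next-prev i))) (out-next t (prev i)))) (unit′ (factor (prev i)) (factor-norm (prev i)))))
     where
     unit : ∀ x z f → f * conj f ≡ 1# → two * ((x * f) * conj (z * f)) ≡ two * (x * conj z)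
     unit x z f eq = cong (two *_) (trans (cong ((x * f) *_) (conj-* z f))
       (trans (shuffle x f (conj z) (conj f)) (trans (cong ((x * conj z) *_) eq) (G.*-identityʳ (x * conj z)))))
       where
       shuffle : ∀ x f z g → (x * f) * (z * g) ≡ (x * z) * (f * g)
       shuffle x f z g = trans (G.*-assoc x f (z * g)) (trans (cong (x *_)
           (trans (sym (G.*-assoc f z g)) (trans (cong (_* g) (G.*-comm f z)) (G.*-assoc z f g)))) (sym (G.*-assoc x z (f * g))))
     unit′ : ∀ f → f * conj f ≡ 1# → two * (conj (1# * f) * (1# * f)) ≡ two
     unit′ f eq = trans (cong (λ f → two * (conj f * f)) (G.*-identityˡ f)) (cong (two *_) (trans (G.*-comm (conj f) f) eq))

   private
     M = T ⟦ ζ ⟧₄ P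
     to : Fin (P ℕ.+ P) → TB × Fin P
     to = Inverse.to (enumTB {P})
     at : TB × Fin P → Fin (P ℕ.+ P)
     at = Inverse.from (enumTB {P})
     to-at : ∀ v → to (at v) ≡ v
     to-at = Inverse.strictlyInverseˡ (enumTB {P})
     at-to : ∀ u → at (to u) ≡ u
     at-to = Inverse.strictlyInverseʳ (enumTB {P})

   vertex-entry : ∀ (x z : TB) (i l : Fin P) (u v : Fin (P ℕ.+ P)) → (x ≡ z → i ≡ l → u ≡ v) → (u ≡ v → x ≡ z × i ≡ l) →
     G.sum (outgoing x z i l) + G.sum (incoming x z i l) ≡ four * I u v
   vertex-entry x z i l u v ⇒ ⇐ = by-cases (i Fin.≟ l) (u Fin.≟ v)
     where
     same : ∀ y → two * (⟦ layer y ⟧₄ * conj ⟦ layer y ⟧₄) + two ≡ four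
     same t = refl
     same b = refl
     different : ∀ {y y′} → y ≢ y′ → two * (⟦ layer y ⟧₄ * conj ⟦ layer y′ ⟧₄) + two ≡ 0#
     different {t} {t} ne = contradiction refl ne
     different {t} {b} ne = refl
     different {b} {t} ne = refl
     different {b} {b} ne = contradiction refl ne
     I-yes : u ≡ v → four ≡ four * I u v
     I-yes eq = sym (cong (four *_) (if-yes (u Fin.≟ v) eq))
     I-no : u ≢ v → 0# ≡ four * I u v
     I-no ne = sym (cong (four *_) (if-no (u Fin.≟ v) ne))
     by-cases : Dec (i ≡ l) → Dec (u ≡ v) → G.sum (outgoing x z i l) + G.sum (incoming x z i l) ≡ four * I u v
     by-cases (no ne) _ = trans (off-diagonal x z ne) (I-no λ eq → ne (proj₂ (⇐ eq)))
     by-cases (yes eq) (yes uv) = trans (cong₂ (λ z l → G.sum (outgoing x z i l) + G.sum (incoming x z i l)) (sym (proj₁ (⇐ uv))) (sym eq))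
       (trans (on-diagonal x x i) (trans (same x) (I-yes uv)))
     by-cases (yes eq) (no ne) = trans (cong (λ l → G.sum (outgoing x z i l) + G.sum (incoming x z i l)) (sym eq))
       (trans (on-diagonal x z i) (trans (different {x} {z} λ xz → ne (⇒ xz eq)) (I-no ne)))

   square-four : SquareFour M
   square-four u v = trans (G.sum-split P (λ w → W (to u) (to w) * W (to w) (to v))) (trans
       (cong₂ _+_ (G.sum-cong {P} {λ j → W (to u) (to (at (t , j))) * W (to (at (t , j))) (to v)} {λ j → W (to u) (t , j) * W (t , j) (to v)}
           λ j → cong (λ w → W (to u) w * W w (to v)) (to-at (t , j)))
         (G.sum-cong {P} {λ j → W (to u) (to (at (b , j))) * W (to (at (b , j))) (to v)} {λ j → W (to u) (b , j) * W (b , j) (to v)}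
           λ j → cong (λ w → W (to u) w * W w (to v)) (to-at (b , j))))
       (trans (vertex-square (proj₁ (to u)) (proj₁ (to v)) (proj₂ (to u)) (proj₂ (to v)))
         (vertex-entry (proj₁ (to u)) (proj₁ (to v)) (proj₂ (to u)) (proj₂ (to v)) u v
           (λ p q → trans (sym (at-to u)) (trans (cong at (cong₂ _,_ p q)) (at-to v)))
           (λ eq → cong (proj₁ ∘ to) eq , cong (proj₂ ∘ to) eq))))

   arrow≢0 : ∀ x y (i j : Fin P) → 2 ℕ.≤ m → toℕ j ≡ suc (toℕ i) → W (x , i) (y , j) ≢ 0#
   arrow≢0 x y i j 2≤m eq w≡0 = nonzero x (trans (sym (trans (T-weight m ζ x y i j) (cong₂ (λ v w → ⟦ v ⟧ʷ + conj ⟦ w ⟧ʷ)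
       (trans (cong (arrow m ζ x (toℕ i)) eq) (arrow-next {m} {ζ} x (toℕ i)))
       (arrow-𝟎 {m} {ζ} y (toℕ j) (toℕ i) (λ e → ℕ.<⇒≢ (ℕ.m<n⇒m<1+n (ℕ.n<1+n (toℕ i))) (trans e (cong suc eq)))
         λ { (j≡m , i≡0) → ℕ.<⇒≢ 2≤m (trans (sym (trans eq (cong suc i≡0))) j≡m) })))) w≡0)
     where
     nonzero : ∀ x → ⟦ layer x ⟧₄ + 0# ≢ 0#
     nonzero t ()
     nonzero b ()

   descends : 2 ℕ.≤ m → IsHermitian M → Descends M
   descends 2≤m herm u = subst (λ u → toℕ u ≡ 0 ⊎ (∃[ j ] j Fin.< u × Linked M u j)) (at-to u) (lower (to u))
     where
     edge : ∀ v w → W v w ≢ 0# → at v ≢ at w → Adjacent M (at v) (at w)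
     edge v w ne at≢ = at≢ , λ e → ne (trans (sym (cong₂ W (to-at v) (to-at w))) e)
     across : ∀ i j → at (t , i) Fin.< at (b , j)
     across i j = subst₂ ℕ._<_ (sym (Fin.toℕ-↑ˡ i P)) (sym (Fin.toℕ-↑ʳ P j)) (ℕ.<-≤-trans (Fin.toℕ<n i) (ℕ.m≤m+n P (toℕ j)))
     along : ∀ i → at (t , inject₁ i) Fin.< at (t , suc i)
     along i = subst₂ ℕ._<_ (sym (Fin.toℕ-↑ˡ (inject₁ i) P)) (sym (Fin.toℕ-↑ˡ (suc i) P)) (s≤s (ℕ.≤-reflexive (Fin.toℕ-inject₁ i)))
     1<P : 1 ℕ.< P
     1<P = s≤s (ℕ.≤-trans (s≤s z≤n) 2≤m)
     one : Fin P
     one = Fin.fromℕ< 1<P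
     lower : ∀ w → toℕ (at w) ≡ 0 ⊎ (∃[ j ] j Fin.< at w × Linked M (at w) j)
     lower (t , zero) = inj₁ refl
     lower (t , suc i) = inj₂ (at (t , inject₁ i) , along i , inj₁ (adjacent-sym {M = M} herm (edge (t , inject₁ i) (t , suc i)
       (arrow≢0 t t (inject₁ i) (suc i) 2≤m (cong suc (sym (Fin.toℕ-inject₁ i)))) λ e → ℕ.<⇒≢ (along i) (cong toℕ e))))
     lower (b , zero) = inj₂ (at (t , one) , across one zero , inj₁ (edge (b , zero) (t , one)
       (arrow≢0 b t zero one 2≤m (Fin.toℕ-fromℕ< 1<P)) λ e → ℕ.<⇒≢ (across one zero) (cong toℕ (sym e))))
     lower (b , suc i) = inj₂ (at (t , inject₁ i) , across (inject₁ i) (suc i) , inj₁ (adjacent-sym {M = M} herm (edge (t , inject₁ i) (b , suc i)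
       (arrow≢0 t b (inject₁ i) (suc i) 2≤m (cong suc (sym (Fin.toℕ-inject₁ i)))) λ e → ℕ.<⇒≢ (across (inject₁ i) (suc i)) (cong toℕ e))))

module TargetSquares where

 open Configuration using (ζ⁰; ζ¹)
 open Certificate using (_≟ᵍ_)
 open TargetGraphs
 open Gains using (does-true)
 open WheelWeights
 open Certificate using (allFinᵇ)
 open Classification using (IsTarget; is-S₈; is-S₁₄; is-S₁₆; is-X₈; is-T₁; is-Tᵢ; by-entries; target-hermitian)
 open AdjoinedRings
 open SquareFours
 open Vertices using (TB; t; b)

 tabulated : ∀ {n} → Matrix n → Vec (Vec ℤ[i] n) n
 tabulated M = Vec.tabulate λ u → Vec.tabulate (M u)

 look : ∀ {n} → Vec (Vec ℤ[i] n) n → Matrix n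
 look V u v = Vec.lookup (Vec.lookup V u) v

 look-tabulated : ∀ {n} (M : Matrix n) → look (tabulated M) ≐ M
 look-tabulated M u v = trans (cong (λ r → Vec.lookup r v) (Vec.lookup∘tabulate (λ u → Vec.tabulate (M u)) u)) (Vec.lookup∘tabulate (M u) v)

 -- Tabulating the matrix makes the evaluation compute every entry only once.
 square-check : ∀ {n} (M : Matrix n) →
   (λ V → allFinᵇ λ u → allFinᵇ λ v → does ((look V ⊗ look V) u v ≟ᵍ (four Gaussian.* I u v))) (tabulated M) ≡ true → SquareFour M
 square-check {n} M ok u v = trans (G.sum-cong {n} λ x → sym (cong₂ Gaussian._*_ (look-tabulated M u x) (look-tabulated M x v)))
   (by-entries (look (tabulated M) ⊗ look (tabulated M)) (λ u v → four Gaussian.* I u v) ok u v)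

 descends-check : ∀ {n} (M : Matrix n) → (λ V → does (descends? (look V))) (tabulated M) ≡ true → Descends M
 descends-check M ok i = transfer (does-true (descends? (look (tabulated M))) ok i)
   where
   adjacent : ∀ {u v} → Adjacent (look (tabulated M)) u v → Adjacent M u v
   adjacent {u} {v} (u≢v , ne) = u≢v , λ eq → ne (trans (look-tabulated M u v) eq)
   transfer : toℕ i ≡ 0 ⊎ (∃[ j ] j Fin.< i × Linked (look (tabulated M)) i j) → toℕ i ≡ 0 ⊎ (∃[ j ] j Fin.< i × Linked M i j)
   transfer (inj₁ eq) = inj₁ eq
   transfer (inj₂ (j , j<i , inj₁ e)) = inj₂ (j , j<i , inj₁ (adjacent e))
   transfer (inj₂ (j , j<i , inj₂ (x , e , e′))) = inj₂ (j , j<i , inj₂ (x , adjacent e , adjacent e′))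

 target-square : ∀ {N} {M : Matrix N} → IsTarget M → SquareFour M
 target-square is-S₈ = square-check (adjacency S₈† enumLetter) refl
 target-square is-S₁₄ = square-check (adjacency S₁₄ enumON) refl
 target-square is-S₁₆ = square-check (adjacency S₁₆ enumON) refl
 target-square is-X₈ = square-check (adjacency X₈ enumON) refl
 target-square (is-T₁ (suc m) _) = Wheels.square-four ζ⁰ m
 target-square (is-Tᵢ (suc m) _) = Wheels.square-four ζ¹ m

 target-descends : ∀ {N} {M : Matrix N} → IsTarget M → Descends M
 target-descends is-S₈ = descends-check (adjacency S₈† enumLetter) refl
 target-descends is-S₁₄ = descends-check (adjacency S₁₄ enumON) refl
 target-descends is-S₁₆ = descends-check (adjacency S₁₆ enumON) refl
 target-descends is-X₈ = descends-check (adjacency X₈ enumON) refl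
 target-descends (is-T₁ (suc m) (s≤s 2≤m)) = Wheels.descends ζ⁰ m 2≤m (target-hermitian (is-T₁ (suc m) (s≤s 2≤m)))
 target-descends (is-Tᵢ (suc m) (s≤s 2≤m)) = Wheels.descends ζ¹ m 2≤m (target-hermitian (is-Tᵢ (suc m) (s≤s 2≤m)))

module SquareRoots where

 open Forms using (fromℤ; fromℤ-+; fromℤ-*; fromℤ-neg; *-pos; 0≤p²)
 open Kernels using (Null; Null-cong; Null-+; Null-*; Bounded; bounded; Above; Apart; not-apart; Eventually; eventually-map; eventually₂; square-<; ∣∣<⇒<; ∣∣<⇒-<)
 open FormBound using (Null-neg; two)
 open AdjoinedRings
 open NegatedMatrix
 open SquareFours using (SquareFour; four)
 open import Data.Rational.Base
 open import Data.Rational.Properties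
 open import Data.Rational.Solver using (module +-*-Solver)
 open +-*-Solver using (solve; _:+_; _:*_; _:-_; :-_; con; _:=_)
 open WheelWeights using (if-yes; if-no)

 Nullᶜ-sum : ∀ {n} (f : Fin n → ℕ → ℚ [i]) → (∀ x → Nullᶜ (f x)) → Nullᶜ (λ k → H.sum (λ x → f x k))
 Nullᶜ-sum {zero} f null = Null-0 , Null-0
 Nullᶜ-sum {suc n} f null = Nullᶜ-+ {f zero} {λ k → H.sum (λ x → f (suc x) k)} (null zero) (Nullᶜ-sum (f ∘ suc) (null ∘ suc))

 Null-cancel : ∀ {ε f g} → 0ℚ < ε → Above ε f → Null (λ k → f k * g k) → Null g
 Null-cancel {ε} {f} {g} 0<ε above null η 0<η = eventually₂ {λ k → ∣ f k * g k ∣ < ε * η} {λ k → ε ≤ f k}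
   (λ k → divide (f k) (g k)) (null (ε * η) (*-pos 0<ε 0<η)) above
   where
   divide : ∀ p q → ∣ p * q ∣ < ε * η → ε ≤ p → ∣ q ∣ < η
   divide p q h le = *-cancelˡ-<-nonNeg ε {{nonNegative (<⇒≤ 0<ε)}} (≤-<-trans
     (*-monoʳ-≤-nonNeg ∣ q ∣ {{∣-∣-nonNeg q}} (≤-trans le (≤-reflexive (sym (0≤p⇒∣p∣≡p (≤-trans (<⇒≤ 0<ε) le))))))
     (subst (_< ε * η) (∣p*q∣≡∣p∣*∣q∣ p q) h))

 Null-apart : ∀ {g} (x : ℝ) → Apart x → Null (λ k → seq x k * g k) → Null g
 Null-apart {g} x (inj₁ (ε , 0<ε , above)) null = Null-cancel {ε} {seq x} {g} 0<ε above null
 Null-apart {g} x (inj₂ (ε , 0<ε , above)) null = Null-cancel {ε} {λ k → - seq x k} {g} 0<ε above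
   (Null-cong {λ k → - (seq x k * g k)} {λ k → - seq x k * g k} (λ k → neg-distribˡ-* (seq x k) (g k)) (Null-neg {λ k → seq x k * g k} null))

 -- Applying M to Mv - μv and adding μ times the same vector gives (4 - μ²)v.
 square-residue : ∀ {n} (M : Matrix n) → SquareFour M → ∀ (μ : ℚ [i]) (v : Fin n → ℚ [i]) u →
   let residue = λ u → H.sum (λ x → embed (M u x) H.* v x) H.+ H.- (μ H.* v u) in
   H.sum (λ x → residue x H.* embed (M u x)) H.+ residue u H.* μ ≡ v u H.* (embed four H.+ H.- (μ H.* μ))
 square-residue {n} M square μ v u = trans
   (cong₂ H._+_ applied refl)
   (combine (H.sum (λ x → embed (M u x) H.* v x)) μ (v u) (embed four))
   where
   Mv = λ u → H.sum (λ x → embed (M u x) H.* v x)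
   residue = λ u → Mv u H.+ H.- (μ H.* v u)
   row : ∀ y → H.sum (λ x → embed (M u x) H.* embed (M x y)) ≡ embed (four Gaussian.* I u y)
   row y = trans (H.sum-cong {n} λ x → sym (embed-* (M u x) (M x y))) (trans (sym (embed-sum (λ x → M u x Gaussian.* M x y))) (cong embed (square u y)))
   twice : H.sum (λ x → Mv x H.* embed (M u x)) ≡ embed four H.* v u
   twice = trans (H.sum-cong {n} λ x → trans (H.*-distribʳ-sum (embed (M u x)) (λ y → embed (M x y) H.* v y))
       (H.sum-cong {n} λ y → rearrange (embed (M x y)) (v y) (embed (M u x))))
     (trans (H.sum-swap (λ x y → (embed (M u x) H.* embed (M x y)) H.* v y))
     (trans (H.sum-cong {n} λ y → trans (sym (H.*-distribʳ-sum (v y) (λ x → embed (M u x) H.* embed (M x y)))) (cong (H._* v y) (row y)))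
     (trans (H.sum-only (λ y → embed (four Gaussian.* I u y) H.* v y) u
         λ y ne → trans (cong (λ z → embed (four Gaussian.* z) H.* v y) (if-no (u Fin.≟ y) (ne ∘ sym))) (H.zeroˡ (v y)))
       (cong (λ z → embed (four Gaussian.* z) H.* v u) (if-yes (u Fin.≟ u) refl)))))
     where
     rearrange : ∀ a v b → (a H.* v) H.* b ≡ (b H.* a) H.* v
     rearrange a v b = trans (H.*-comm (a H.* v) b) (sym (H.*-assoc b a v))
   applied : H.sum (λ x → residue x H.* embed (M u x)) ≡ embed four H.* v u H.+ H.- μ H.* Mv u
   applied = trans (H.sum-cong {n} λ x → expand (Mv x) μ (v x) (embed (M u x)))
     (trans (H.sum-+ (λ x → Mv x H.* embed (M u x)) (λ x → H.- μ H.* (embed (M u x) H.* v x)))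
       (cong₂ H._+_ twice (sym (H.*-distribˡ-sum (H.- μ) (λ x → embed (M u x) H.* v x)))))
     where
     expand : ∀ s μ v a → (s H.+ H.- (μ H.* v)) H.* a ≡ s H.* a H.+ H.- μ H.* (a H.* v)
     expand (s +i s′) (μ +i μ′) (v +i v′) (a +i a′) = cong₂ _+i_
       (solve 8 (λ s s′ μ μ′ v v′ a a′ → (s :+ :- (μ :* v :+ :- (μ′ :* v′))) :* a :+ :- ((s′ :+ :- (μ :* v′ :+ μ′ :* v)) :* a′) :=
         (s :* a :+ :- (s′ :* a′)) :+ (:- μ :* (a :* v :+ :- (a′ :* v′)) :+ :- (:- μ′ :* (a :* v′ :+ a′ :* v)))) refl s s′ μ μ′ v v′ a a′)
       (solve 8 (λ s s′ μ μ′ v v′ a a′ → (s :+ :- (μ :* v :+ :- (μ′ :* v′))) :* a′ :+ (s′ :+ :- (μ :* v′ :+ μ′ :* v)) :* a :=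
         (s :* a′ :+ s′ :* a) :+ (:- μ :* (a :* v′ :+ a′ :* v) :+ :- μ′ :* (a :* v :+ :- (a′ :* v′)))) refl s s′ μ μ′ v v′ a a′)
   combine : ∀ s μ v c → (c H.* v H.+ H.- μ H.* s) H.+ (s H.+ H.- (μ H.* v)) H.* μ ≡ v H.* (c H.+ H.- (μ H.* μ))
   combine (s +i s′) (μ +i μ′) (v +i v′) (c +i c′) = cong₂ _+i_
     (solve 8 (λ s s′ μ μ′ v v′ c c′ → ((c :* v :+ :- (c′ :* v′)) :+ (:- μ :* s :+ :- (:- μ′ :* s′))) :+ ((s :+ :- (μ :* v :+ :- (μ′ :* v′))) :* μ :+ :- ((s′ :+ :- (μ :* v′ :+ μ′ :* v)) :* μ′)) :=
       v :* (c :+ :- (μ :* μ :+ :- (μ′ :* μ′))) :+ :- (v′ :* (c′ :+ :- (μ :* μ′ :+ μ′ :* μ)))) refl s s′ μ μ′ v v′ c c′)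
     (solve 8 (λ s s′ μ μ′ v v′ c c′ → ((c :* v′ :+ c′ :* v) :+ (:- μ :* s′ :+ :- μ′ :* s)) :+ ((s :+ :- (μ :* v :+ :- (μ′ :* v′))) :* μ′ :+ (s′ :+ :- (μ :* v′ :+ μ′ :* v)) :* μ) :=
       v :* (c′ :+ :- (μ :* μ′ :+ μ′ :* μ)) :+ v′ :* (c :+ :- (μ :* μ :+ :- (μ′ :* μ′)))) refl s s′ μ μ′ v v′ c c′)

 constant-bounded : ∀ q → Bounded (λ _ → q)
 constant-bounded q = bounded (Real.fromℚ q)

 module _ (α β : ℝ) where

   4ℝ C D : ℝ
   4ℝ = Real.fromℚ (fromℤ (ℤ.+ 4))
   C = 4ℝ Real.+ Real.- (α Real.* α Real.+ Real.- (β Real.* β))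
   D = Real.fromℚ (fromℤ (ℤ.+ 0)) Real.+ Real.- (α Real.* β Real.+ β Real.* α)

   private
     c d p q : ℕ → ℚ
     c = seq C
     d = seq D
     p = seq α
     q = seq β

   module _ (C-null : Null (seq C)) (D-null : Null (seq D)) where

     im-null : Null q
     im-null ε 0<ε = eventually-map {λ k → ∣ f k ∣ < ε * ε} (λ k h → square-< 0<ε (≤-<-trans (below (q k)) (∣∣<⇒< (subst (λ e → ∣ e ∣ < ε * ε) (expansion (p k) (q k)) h))))
       (f-null (ε * ε) (*-pos 0<ε 0<ε))
       where
       f : ℕ → ℚ
       f k = c k * (q k * q k) + d k * (½ * ½ * d k)
       f-null : Null f
       f-null = Null-+ {λ k → c k * (q k * q k)} {λ k → d k * (½ * ½ * d k)}
         (Null-* {c} {λ k → q k * q k} C-null (bounded (β Real.* β)))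
         (Null-* {d} {λ k → ½ * ½ * d k} D-null (bounded (Real.fromℚ (½ * ½) Real.* D)))
       expansion : ∀ p q → (fromℤ (ℤ.+ 4) + - (p * p + - (q * q))) * (q * q) + (fromℤ (ℤ.+ 0) + - (p * q + q * p)) * (½ * ½ * (fromℤ (ℤ.+ 0) + - (p * q + q * p))) ≡
         q * q + (q * q + q * q + q * q + q * q * (q * q))
       expansion = solve 2 (λ p q → (con (fromℤ (ℤ.+ 4)) :+ :- (p :* p :+ :- (q :* q))) :* (q :* q) :+ (con (fromℤ (ℤ.+ 0)) :+ :- (p :* q :+ q :* p)) :* (con (½ * ½) :* (con (fromℤ (ℤ.+ 0)) :+ :- (p :* q :+ q :* p))) :=
         q :* q :+ (q :* q :+ q :* q :+ q :* q :+ q :* q :* (q :* q))) refl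
       below : ∀ q → q * q ≤ q * q + (q * q + q * q + q * q + q * q * (q * q))
       below q = subst (_≤ q * q + (q * q + q * q + q * q + q * q * (q * q))) (+-identityʳ (q * q)) (+-monoʳ-≤ (q * q)
         (+-mono-≤ {0ℚ} {_} {0ℚ} (+-mono-≤ {0ℚ} {_} {0ℚ} (+-mono-≤ {0ℚ} {_} {0ℚ} (0≤p² q) (0≤p² q)) (0≤p² q)) (0≤p² (q * q))))

     modulus : ∀ ε → 0ℚ < ε → Eventually λ k → ∣ p k ∣ < two + ε
     modulus ε 0<ε = eventually-map {λ k → ∣ q k * q k + - c k ∣ < ε} (λ k h → square-< 0<2+ε (bound (p k) (q k) (∣∣<⇒< h)))
       (Null-+ {λ k → q k * q k} {λ k → - c k} (Null-* {q} {q} im-null (bounded β)) (Null-neg {c} C-null) ε 0<ε)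
       where
       0<2+ε : 0ℚ < two + ε
       0<2+ε = +-mono-< {0ℚ} {two} {0ℚ} {ε} (positive⁻¹ two) 0<ε
       slack : ε + fromℤ (ℤ.+ 4) ≤ (two + ε) * (two + ε)
       slack = subst (ε + fromℤ (ℤ.+ 4) ≤_) (sym (expand ε)) (subst (_≤ ε + fromℤ (ℤ.+ 4) + (ε + ε + ε + ε * ε)) (+-identityʳ (ε + fromℤ (ℤ.+ 4)))
         (+-monoʳ-≤ (ε + fromℤ (ℤ.+ 4)) (+-mono-≤ {0ℚ} {_} {0ℚ} (+-mono-≤ {0ℚ} {_} {0ℚ} (+-mono-≤ {0ℚ} {_} {0ℚ} (<⇒≤ 0<ε) (<⇒≤ 0<ε)) (<⇒≤ 0<ε)) (0≤p² ε))))
         where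
         expand : ∀ ε → (two + ε) * (two + ε) ≡ ε + fromℤ (ℤ.+ 4) + (ε + ε + ε + ε * ε)
         expand = solve 1 (λ ε → (con two :+ ε) :* (con two :+ ε) := ε :+ con (fromℤ (ℤ.+ 4)) :+ (ε :+ ε :+ ε :+ ε :* ε)) refl
       bound : ∀ p q → q * q + - (fromℤ (ℤ.+ 4) + - (p * p + - (q * q))) < ε → p * p < (two + ε) * (two + ε)
       bound p q h = <-≤-trans (subst (_< ε + fromℤ (ℤ.+ 4)) (cancel p q) (+-monoˡ-< (fromℤ (ℤ.+ 4)) h)) slack
         where
         cancel : ∀ p q → q * q + - (fromℤ (ℤ.+ 4) + - (p * p + - (q * q))) + fromℤ (ℤ.+ 4) ≡ p * p
         cancel = solve 2 (λ p q → q :* q :+ :- (con (fromℤ (ℤ.+ 4)) :+ :- (p :* p :+ :- (q :* q))) :+ con (fromℤ (ℤ.+ 4)) := p :* p) refl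

     in-range : (β Real.≈ Real.fromℚ 0ℚ) × (Real.fromℚ (ℤ.- (ℤ.+ 2) / 1) Real.≤ α) × (α Real.≤ Real.fromℚ two)
     in-range = Null-cong {q} {λ k → q k - 0ℚ} (λ k → sym (+-identityʳ (q k))) im-null
       , (λ ε 0<ε → eventually-map {λ k → ∣ p k ∣ < two + ε} (λ k h → subst₂ _<_ (lower ε) refl (+-monoˡ-< ε (∣∣<⇒-< {p k} h))) (modulus ε 0<ε))
       , (λ ε 0<ε → eventually-map {λ k → ∣ p k ∣ < two + ε} (λ k h → ∣∣<⇒< {p k} h) (modulus ε 0<ε))
       where
       lower : ∀ ε → - (two + ε) + ε ≡ ℤ.- (ℤ.+ 2) / 1
       lower = solve 1 (λ ε → :- (con two :+ ε) :+ ε := con (ℤ.- (ℤ.+ 2) / 1)) refl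

   norm : ℝ
   norm = C Real.* C Real.+ D Real.* D

   norm-null : Null (seq norm) → Null (seq C) × Null (seq D)
   norm-null null = (λ ε 0<ε → eventually-map {λ k → ∣ seq norm k ∣ < ε * ε} (λ k h → square-< 0<ε (≤-<-trans (left (c k) (d k)) (∣∣<⇒< {seq norm k} h))) (null (ε * ε) (*-pos 0<ε 0<ε)))
     , (λ ε 0<ε → eventually-map {λ k → ∣ seq norm k ∣ < ε * ε} (λ k h → square-< 0<ε (≤-<-trans (right (c k) (d k)) (∣∣<⇒< {seq norm k} h))) (null (ε * ε) (*-pos 0<ε 0<ε)))
     where
     left : ∀ c d → c * c ≤ c * c + d * d
     left c d = subst (_≤ c * c + d * d) (+-identityʳ (c * c)) (+-monoʳ-≤ (c * c) (0≤p² d))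
     right : ∀ c d → d * d ≤ c * c + d * d
     right c d = subst (_≤ c * c + d * d) (+-identityˡ (d * d)) (+-monoˡ-≤ (d * d) (0≤p² c))

 square-four⇒cyclotomic : ∀ {n} (M : Matrix n) → IsHermitian M → SquareFour M → IsCyclotomic M
 square-four⇒cyclotomic {n} M hermitian square = hermitian , λ { μ (v , v≢0 , eq) → bounds μ v v≢0 eq }
   where
   module _ (μ : ℂ) (v : Fin n → ℂ) (v≢0 : ¬ (∀ x → v x Complex.≈ Complex.0#))
     (eq : ∀ u → Complex.sum (λ x → Complex.fromℤ[i] (M u x) Complex.* v x) Complex.≈ μ Complex.* v u) where
     α = re μ
     β = im μ
     m : ℕ → ℚ [i]
     m = stage μ
     vᵏ : ℕ → Fin n → ℚ [i]
     vᵏ k x = stage (v x) k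
     residue : Fin n → ℕ → ℚ [i]
     residue u k = H.sum (λ x → embed (M u x) H.* vᵏ k x) H.+ H.- (m k H.* vᵏ k u)
     w : ℕ → ℚ [i]
     w k = seq (C α β) k +i seq (D α β) k
     w̄ : ℕ → ℚ [i]
     w̄ k = seq (C α β) k +i - seq (D α β) k
     residue-null : ∀ u → Nullᶜ (residue u)
     residue-null u = Nullᶜ-cong {λ k → stage (Complex.sum (λ x → Complex.fromℤ[i] (M u x) Complex.* v x)) k H.+ H.- (m k H.* vᵏ k u)} {residue u}
       (λ k → cong (H._+ H.- (m k H.* vᵏ k u)) (stage-sum (λ x → Complex.fromℤ[i] (M u x) Complex.* v x) k)) (eq u)
     scaled-null : ∀ u → Nullᶜ (λ k → vᵏ k u H.* w k)
     scaled-null u = Nullᶜ-cong {λ k → H.sum (λ x → residue x k H.* embed (M u x)) H.+ residue u k H.* m k} {λ k → vᵏ k u H.* w k}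
       (λ k → square-residue M square (m k) (vᵏ k) u)
       (Nullᶜ-+ {λ k → H.sum (λ x → residue x k H.* embed (M u x))} {λ k → residue u k H.* m k}
         (Nullᶜ-sum (λ x k → residue x k H.* embed (M u x)) λ x → Nullᶜ-* {residue x} {λ _ → embed (M u x)} (residue-null x)
           (constant-bounded (fromℤ (re (M u x))) , constant-bounded (fromℤ (im (M u x)))))
         (Nullᶜ-* {residue u} {m} (residue-null u) (stage-bounded μ)))
     norm-scaled : ∀ u → Nullᶜ (λ k → seq (norm α β) k * re (vᵏ k u) +i seq (norm α β) k * im (vᵏ k u))
     norm-scaled u = Nullᶜ-cong {λ k → (vᵏ k u H.* w k) H.* w̄ k} (λ k → expansion (re (vᵏ k u)) (im (vᵏ k u)) (seq (C α β) k) (seq (D α β) k))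
       (Nullᶜ-* {λ k → vᵏ k u H.* w k} {w̄} (scaled-null u) (bounded (C α β) , bounded (Real.- D α β)))
       where
       expansion : ∀ p q c d → ((p +i q) H.* (c +i d)) H.* (c +i - d) ≡ ((c * c + d * d) * p +i (c * c + d * d) * q)
       expansion p q c d = cong₂ _+i_
         (solve 4 (λ p q c d → (p :* c :+ :- (q :* d)) :* c :+ :- ((p :* d :+ q :* c) :* :- d) := (c :* c :+ d :* d) :* p) refl p q c d)
         (solve 4 (λ p q c d → (p :* c :+ :- (q :* d)) :* :- d :+ (p :* d :+ q :* c) :* c := (c :* c :+ d :* d) :* q) refl p q c d)
     norm-not-apart : ¬ Apart (norm α β)
     norm-not-apart apart = v≢0 λ u →
         Null-cong {seq (re (v u))} {λ k → seq (re (v u)) k - 0ℚ} (λ k → sym (+-identityʳ (seq (re (v u)) k))) (Null-apart {seq (re (v u))} (norm α β) apart (proj₁ (norm-scaled u)))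
       , Null-cong {seq (im (v u))} {λ k → seq (im (v u)) k - 0ℚ} (λ k → sym (+-identityʳ (seq (im (v u)) k))) (Null-apart {seq (im (v u))} (norm α β) apart (proj₂ (norm-scaled u)))
     bounds : (im μ Real.≈ Real.fromℚ 0ℚ) × (Real.fromℚ (ℤ.- (ℤ.+ 2) / 1) Real.≤ re μ) × (re μ Real.≤ Real.fromℚ two)
     bounds = let null = norm-null α β (not-apart (norm α β) norm-not-apart) in in-range α β (proj₁ null) (proj₂ null)

open import Data.Nat.Base using (ℕ; _≤_)
open import Data.Product.Base using (∃-syntax; _×_)
open import Data.Sum.Base using (_⊎_)
open import Relation.Binary.PropositionalEquality using (_≡_; _≢_)
open Configuration using (C₄; ζ⁰; ζ¹; ζ²; ζ³; _∙_; _⁻¹; _◃_; ⟦_⟧₄; ⟦_⟧ʷ; rotate)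
open Gains
open Certificate using (Twist; twistʷ; twist; between; _≟ᵍ_; allFinᵇ)
open TargetGraphs
open WheelWeights using (if-yes; if-no; T-weight; arrow-𝟎)
open Classification using (IsTarget; is-S₈; is-S₁₄; is-S₁₆; is-X₈; is-T₁; is-Tᵢ; target-hermitian; fits-target)
open AdjoinedRings
open SquareFours
open TargetSquares
open SquareRoots using (square-four⇒cyclotomic)
open CyclotomicGains using (module FromMatrix)
open import Data.Integer.Solver using () renaming (module +-*-Solver to ℤ-Solver)
open import Function.Construct.Composition using (_↔-∘_)
open import Relation.Binary.Construct.Closure.ReflexiveTransitive using (Star)
import Relation.Binary.Construct.Closure.ReflexiveTransitive as Star
open import Relation.Binary.Core using (_Preserves_⟶_)
open Gaussian using (_+_; _*_; -_; 0#; 1#; conj)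

twist-* : ∀ τ z w → twist τ z * twist τ w ≡ ⟦ proj₂ τ ⟧ (z * w)
twist-* (Sign.+ , identity) z w = refl
twist-* (Sign.+ , conjugation) z w = sym (conj-* z w)
twist-* (Sign.- , identity) z w = negatives z w
  where
  negatives : ∀ z w → - z * - w ≡ z * w
  negatives (a +i b) (c +i d) = cong₂ _+i_
    (solve 4 (λ a b c d → :- a :* :- c :+ :- (:- b :* :- d) := a :* c :+ :- (b :* d)) refl a b c d)
    (solve 4 (λ a b c d → :- a :* :- d :+ :- b :* :- c := a :* d :+ b :* c) refl a b c d)
    where open ℤ-Solver
twist-* (Sign.- , conjugation) z w = trans (twist-* (Sign.- , identity) (conj z) (conj w)) (sym (conj-* z w))

rotate-* : ∀ p z → rotate p z ≡ ⟦ p ⟧₄ * z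
rotate-* ζ⁰ z = sym (G.*-identityˡ z)
rotate-* ζ¹ (a +i b) = cong₂ _+i_
  (solve 2 (λ a b → :- b := con 0ℤ :* a :+ :- (con ℤ.1ℤ :* b)) refl a b) (solve 2 (λ a b → a := con 0ℤ :* b :+ con ℤ.1ℤ :* a) refl a b)
  where open ℤ-Solver
rotate-* ζ² (a +i b) = cong₂ _+i_
  (solve 2 (λ a b → :- a := con ℤ.-1ℤ :* a :+ :- (con 0ℤ :* b)) refl a b) (solve 2 (λ a b → :- b := con ℤ.-1ℤ :* b :+ con 0ℤ :* a) refl a b)
  where open ℤ-Solver
rotate-* ζ³ (a +i b) = cong₂ _+i_
  (solve 2 (λ a b → b := con 0ℤ :* a :+ :- (con ℤ.-1ℤ :* b)) refl a b) (solve 2 (λ a b → :- a := con 0ℤ :* b :+ con ℤ.-1ℤ :* a) refl a b)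
  where open ℤ-Solver

⟦∙⟧ : ∀ p q → ⟦ p ∙ q ⟧₄ ≡ ⟦ p ⟧₄ * ⟦ q ⟧₄
⟦∙⟧ p q = trans (⟦⟧-◃ p (just q)) (rotate-* p ⟦ q ⟧₄)

⟦⁻¹⟧ : ∀ p → ⟦ p ⁻¹ ⟧₄ ≡ conj ⟦ p ⟧₄
⟦⁻¹⟧ p = ⟦⟧-conj (just p)

unit-norm : ∀ p → ⟦ p ⟧₄ * conj ⟦ p ⟧₄ ≡ 1#
unit-norm ζ⁰ = refl
unit-norm ζ¹ = refl
unit-norm ζ² = refl
unit-norm ζ³ = refl

between-* : ∀ p z q → between p z q ≡ ⟦ p ⟧₄ * z * conj ⟦ q ⟧₄
between-* p z q = trans (rotate-* (p ∙ q ⁻¹) z) (trans (cong (_* z) (trans (⟦∙⟧ p (q ⁻¹)) (cong (⟦ p ⟧₄ *_) (⟦⁻¹⟧ q))))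
  (swap ⟦ p ⟧₄ (conj ⟦ q ⟧₄) z))
  where
  swap : ∀ p q z → p * q * z ≡ p * z * q
  swap p q z = trans (G.*-assoc p q z) (trans (cong (p *_) (G.*-comm q z)) (sym (G.*-assoc p z q)))

zero-rotate : ∀ p {z} → rotate p z ≡ 0# → z ≡ 0#
zero-rotate p {z} eq = trans (cong (λ r → rotate r z) (sym (∙-inverseˡ p))) (trans (rotate-∙ (p ⁻¹) p z) (trans (cong (rotate (p ⁻¹)) eq) (rotate-0 (p ⁻¹))))
  where
  rotate-0 : ∀ p → rotate p 0# ≡ 0#
  rotate-0 ζ⁰ = refl
  rotate-0 ζ¹ = refl
  rotate-0 ζ² = refl
  rotate-0 ζ³ = refl

twist-involutive : ∀ τ z → twist τ (twist τ z) ≡ z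
twist-involutive (Sign.+ , identity) z = refl
twist-involutive (Sign.+ , conjugation) z = conj-involutive z
twist-involutive (Sign.- , identity) (a +i b) = cong₂ _+i_ (ℤ.neg-involutive a) (ℤ.neg-involutive b)
twist-involutive (Sign.- , conjugation) z = trans (twist-involutive (Sign.- , identity) (conj (conj z))) (conj-involutive z)

zero-twist : ∀ τ {z} → twist τ z ≡ 0# → z ≡ 0#
zero-twist τ {z} eq = trans (sym (twist-involutive τ z)) (trans (cong (twist τ) eq) (twist-0 τ))
  where
  twist-0 : ∀ τ → twist τ 0# ≡ 0#
  twist-0 (Sign.+ , identity) = refl
  twist-0 (Sign.+ , conjugation) = refl
  twist-0 (Sign.- , identity) = refl
  twist-0 (Sign.- , conjugation) = refl

1+i-not-unit : ∀ τ p w → ⟦ w ⟧ʷ ≢ twist τ (rotate p (ℤ.+ 1 +i ℤ.+ 1))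
1+i-not-unit τ p w eq = no-unit (p ⁻¹ ◃ twistʷ τ w) (trans (⟦⟧-◃ (p ⁻¹) (twistʷ τ w)) (trans
  (cong (rotate (p ⁻¹)) (trans (⟦⟧-twist τ w) (trans (cong (twist τ) eq) (twist-involutive τ (rotate p (ℤ.+ 1 +i ℤ.+ 1))))))
  (trans (sym (rotate-∙ (p ⁻¹) p (ℤ.+ 1 +i ℤ.+ 1))) (cong (λ r → rotate r (ℤ.+ 1 +i ℤ.+ 1)) (∙-inverseˡ p)))))
  where
  no-unit : ∀ w → ⟦ w ⟧ʷ ≢ (ℤ.+ 1 +i ℤ.+ 1)
  no-unit nothing ()
  no-unit (just ζ⁰) ()
  no-unit (just ζ¹) ()
  no-unit (just ζ²) ()
  no-unit (just ζ³) ()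

twist-hermitian : ∀ τ p z q → conj (twist τ (between p z q)) ≡ twist τ (between q (conj z) p)
twist-hermitian τ p z q = trans (sym (twist-conj τ (between p z q))) (cong (twist τ) (trans (conj-rotate (p ∙ q ⁻¹) z)
  (cong (λ r → rotate r (conj z)) (trans (⁻¹-distrib p (q ⁻¹)) (trans (cong (p ⁻¹ ∙_) (⁻¹-involutive q)) (∙-comm (p ⁻¹) q))))))

record Extremal {N} (M : Matrix N) : Set where
  field
    isHermitian : IsHermitian M
    square-four : SquareFour M
    indecomposable : IsIndecomposable M

module Switch {N} (M : Matrix N) (τ : Twist) (q : Fin N → C₄) where

  switched : Matrix N
  switched u v = twist τ (between (q u) (M u v) (q v))

  switched-extremal : Extremal M → Extremal switched
  switched-extremal extremal = record
    { isHermitian = λ u v → trans (twist-hermitian τ (q v) (M v u) (q u)) (cong (λ z → twist τ (between (q u) z (q v))) (M.isHermitian u v))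
    ; square-four = square
    ; indecomposable = λ u v → Star.map (λ { {u} {v} (u≢v , ne) → u≢v , λ eq → ne (zero-rotate (q u ∙ q v ⁻¹) (zero-twist τ eq)) }) (M.indecomposable u v)
    }
    where
    module M = Extremal extremal
    term : ∀ u x v → switched u x * switched x v ≡ ⟦ proj₂ τ ⟧ (⟦ q u ⟧₄ * (M u x * M x v) * conj ⟦ q v ⟧₄)
    term u x v = trans (twist-* τ (between (q u) (M u x) (q x)) (between (q x) (M x v) (q v)))
      (cong ⟦ proj₂ τ ⟧ (trans (cong₂ _*_ (between-* (q u) (M u x) (q x)) (between-* (q x) (M x v) (q v)))
        (cancel ⟦ q u ⟧₄ (M u x) ⟦ q x ⟧₄ (M x v) (conj ⟦ q v ⟧₄) (unit-norm (q x)))))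
      where
      cancel : ∀ p a x b r → x * conj x ≡ 1# →
        (p * a * conj x) * (x * b * r) ≡ p * (a * b) * r
      cancel p a x b r eq = begin
        (p * a * x̄) * (x * b * r) ≡⟨ G.*-assoc (p * a * x̄) (x * b) r ⟨
        (p * a * x̄) * (x * b) * r ≡⟨ cong (_* r) (G.*-assoc (p * a * x̄) x b) ⟨
        p * a * x̄ * x * b * r ≡⟨ cong (λ e → e * b * r) (G.*-assoc (p * a) x̄ x) ⟩
        p * a * (x̄ * x) * b * r ≡⟨ cong (λ e → p * a * e * b * r) (trans (G.*-comm x̄ x) eq) ⟩
        p * a * 1# * b * r ≡⟨ cong (λ e → e * b * r) (G.*-identityʳ (p * a)) ⟩
        p * a * b * r ≡⟨ cong (_* r) (G.*-assoc p a b) ⟩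
        p * (a * b) * r ∎
        where
        open ≡-Reasoning
        x̄ = conj x
    conj-+ : ∀ z w → conj (z + w) ≡ conj z + conj w
    conj-+ (a +i b) (c +i d) = cong (a ℤ.+ c +i_) (ℤ.neg-distrib-+ b d)
    sum-automorphism : ∀ σ {n} (f : Fin n → ℤ[i]) → Gaussian.sum (λ x → ⟦ σ ⟧ (f x)) ≡ ⟦ σ ⟧ (Gaussian.sum f)
    sum-automorphism identity f = refl
    sum-automorphism conjugation {zero} f = refl
    sum-automorphism conjugation {suc n} f = trans (cong (conj (f zero) +_) (sum-automorphism conjugation (f ∘ suc)))
      (sym (conj-+ (f zero) (Gaussian.sum (f ∘ suc))))
    square : SquareFour switched
    square u v = trans (G.sum-cong {N} {λ x → switched u x * switched x v} {λ x → ⟦ proj₂ τ ⟧ (pu * (M u x * M x v) * qv)} λ x → term u x v)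
      (trans (sum-automorphism (proj₂ τ) (λ x → pu * (M u x * M x v) * qv))
      (trans (cong ⟦ proj₂ τ ⟧ (trans (sym (G.*-distribʳ-sum qv (λ x → pu * (M u x * M x v))))
        (cong (_* qv) (trans (sym (G.*-distribˡ-sum pu (λ x → M u x * M x v))) (cong (pu *_) (M.square-four u v))))))
        (scaled (u Fin.≟ v))))
      where
      pu = ⟦ q u ⟧₄
      qv = conj ⟦ q v ⟧₄
      fixed : ∀ σ → ⟦ σ ⟧ four ≡ four
      fixed identity = refl
      fixed conjugation = refl
      fixed-0 : ∀ σ → ⟦ σ ⟧ 0# ≡ 0#
      fixed-0 identity = refl
      fixed-0 conjugation = refl
      scaled : Dec (u ≡ v) → ⟦ proj₂ τ ⟧ (pu * (four * I u v) * qv) ≡ four * I u v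
      scaled (yes eq) = trans (cong ⟦ proj₂ τ ⟧ (trans (cong₂ (λ e r → pu * (four * e) * r) (if-yes (u Fin.≟ v) eq) (cong (conj ∘ ⟦_⟧₄ ∘ q) (sym eq)))
          (turn (q u)))) (trans (fixed (proj₂ τ)) (sym (cong (four *_) (if-yes (u Fin.≟ v) eq))))
        where
        turn : ∀ p → ⟦ p ⟧₄ * (four * 1#) * conj ⟦ p ⟧₄ ≡ four
        turn ζ⁰ = refl
        turn ζ¹ = refl
        turn ζ² = refl
        turn ζ³ = refl
      scaled (no ne) = trans (cong ⟦ proj₂ τ ⟧ (trans (cong (λ e → pu * (four * e) * qv) (if-no (u Fin.≟ v) ne))
          (trans (cong (_* qv) (G.zeroʳ pu)) (G.zeroˡ qv)))) (trans (fixed-0 (proj₂ τ)) (sym (cong (four *_) (if-no (u Fin.≟ v) ne))))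

module Reindex {m N} (M : Matrix N) (π : Fin m ↔ Fin N) where

  private
    g : Fin m → Fin N
    g = Inverse.to π

  g-injective : ∀ {u v} → g u ≡ g v → u ≡ v
  g-injective {u} {v} eq = trans (sym (Inverse.strictlyInverseʳ π u)) (trans (cong (Inverse.from π) eq) (Inverse.strictlyInverseʳ π v))

  reindexed : Matrix m
  reindexed u v = M (g u) (g v)

  I-reindexed : ∀ u v → I (g u) (g v) ≡ I u v
  I-reindexed u v = by-cases (u Fin.≟ v)
    where
    by-cases : Dec (u ≡ v) → I (g u) (g v) ≡ I u v
    by-cases (yes eq) = trans (if-yes (g u Fin.≟ g v) (cong g eq)) (sym (if-yes (u Fin.≟ v) eq))
    by-cases (no ne) = trans (if-no (g u Fin.≟ g v) (ne ∘ g-injective)) (sym (if-no (u Fin.≟ v) ne))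

  reindexed-extremal : Extremal M → Extremal reindexed
  reindexed-extremal extremal = record
    { isHermitian = λ u v → M.isHermitian (g u) (g v)
    ; square-four = λ u v → trans (sym (G.sum-permute (λ x → M (g u) x * M x (g v)) π))
        (trans (M.square-four (g u) (g v)) (cong (four *_) (I-reindexed u v)))
    ; indecomposable = λ u v → subst₂ (Star (Adjacent reindexed)) (Inverse.strictlyInverseʳ π u) (Inverse.strictlyInverseʳ π v)
        (Star.gmap (Inverse.from π) lift (M.indecomposable (g u) (g v)))
    }
    where
    module M = Extremal extremal
    lift : ∀ {x y} → Adjacent M x y → Adjacent reindexed (Inverse.from π x) (Inverse.from π y)
    lift {x} {y} (x≢y , ne) =
        (λ eq → x≢y (trans (sym (Inverse.strictlyInverseˡ π x)) (trans (cong g eq) (Inverse.strictlyInverseˡ π y))))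
      , λ eq → ne (trans (sym (cong₂ M (Inverse.strictlyInverseˡ π x) (Inverse.strictlyInverseˡ π y))) eq)

Injection : ∀ {n N} → (Fin n → Fin N) → Set
Injection f = ∀ {u v} → f u ≡ f v → u ≡ v

Surjection : ∀ {n N} → (Fin n → Fin N) → Set
Surjection f = ∀ y → ∃[ x ] f x ≡ y

surjection? : ∀ {n N} (f : Fin n → Fin N) → Surjection f ⊎ (∃[ y ] ∀ x → f x ≢ y)
surjection? {n} {N} f = by-cases (Fin.all? λ y → Fin.any? λ x → f x Fin.≟ y)
  where
  by-cases : Dec (Surjection f) → Surjection f ⊎ (∃[ y ] ∀ x → f x ≢ y)
  by-cases (yes s) = inj₁ s
  by-cases (no ¬s) = let y , h = Fin.¬∀⟶∃¬ N (λ y → ∃[ x ] f x ≡ y) (λ y → Fin.any? λ x → f x Fin.≟ y) ¬s in inj₂ (y , λ x eq → h (x , eq))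

bijection : ∀ {n N} (f : Fin n → Fin N) → Injection f → Surjection f → Fin n ↔ Fin N
bijection f injective surjective = mk↔ₛ′ f (proj₁ ∘ surjective) (proj₂ ∘ surjective) λ x → injective (proj₂ (surjective (f x)))

extend : ∀ {n N} → Fin N → (Fin n → Fin N) → Fin (suc n) → Fin N
extend y f zero = y
extend y f (suc x) = f x

extend-injective : ∀ {n N} {y} {f : Fin n → Fin N} → Injection f → (∀ x → f x ≢ y) → Injection (extend y f)
extend-injective injective fresh {zero} {zero} _ = refl
extend-injective injective fresh {zero} {suc v} eq = contradiction (sym eq) (fresh v)
extend-injective injective fresh {suc u} {zero} eq = contradiction eq (fresh u)
extend-injective injective fresh {suc u} {suc v} eq = cong suc (injective eq)

-- An injection becomes a bijection by inserting the missed values in front,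
-- which keeps the order of the old indices.
complete : ∀ d {n N} (f : Fin n → Fin N) → Injection f → N ≤ d ℕ.+ n →
  Σ[ m ∈ ℕ ] Σ[ π ∈ Fin m ↔ Fin N ] ∃[ ι ] (ι Preserves Fin._<_ ⟶ Fin._<_) × (∀ u → Inverse.to π (ι u) ≡ f u)
complete d {n} {N} f injective N≤ = by-cases d N≤ (surjection? f)
  where
  by-cases : ∀ d → N ≤ d ℕ.+ n → Surjection f ⊎ (∃[ y ] ∀ x → f x ≢ y) →
    Σ[ m ∈ ℕ ] Σ[ π ∈ Fin m ↔ Fin N ] ∃[ ι ] (ι Preserves Fin._<_ ⟶ Fin._<_) × (∀ u → Inverse.to π (ι u) ≡ f u)
  by-cases d N≤ (inj₁ surjective) = n , bijection f injective surjective , (λ u → u) , (λ lt → lt) , λ _ → refl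
  by-cases zero N≤ (inj₂ (y , fresh)) = contradiction N≤ (ℕ.<⇒≱ (Fin.injective⇒≤ {f = extend y f} (extend-injective injective fresh)))
  by-cases (suc d) N≤ (inj₂ (y , fresh)) =
    let m , π , ι , monotone , agrees = complete d (extend y f) (extend-injective injective fresh) (subst (N ≤_) (sym (ℕ.+-suc d n)) N≤)
    in m , π , ι ∘ suc , (λ lt → monotone (s≤s lt)) , agrees ∘ suc

maximal⇒surjective : ∀ {n N} {A : Matrix n} {M : Matrix N} → IsMaximal A → Extremal M →
  (f : Fin n → Fin N) → Injection f → (∀ u v → A u v ≡ M (f u) (f v)) → Surjection f
maximal⇒surjective {n} {N} {A} {M} max extremal f injective matches = by-cases (surjection? f)
  where
  by-cases : Surjection f ⊎ (∃[ y ] ∀ x → f x ≢ y) → Surjection f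
  by-cases (inj₁ surjective) = surjective
  by-cases (inj₂ (y , fresh)) = extended (complete N f injective (ℕ.m≤m+n N n))
    where
    extended : Σ[ m ∈ ℕ ] Σ[ π ∈ Fin m ↔ Fin N ] ∃[ ι ] (ι Preserves Fin._<_ ⟶ Fin._<_) × (∀ u → Inverse.to π (ι u) ≡ f u) → Surjection f
    extended (m , π , ι , monotone , agrees) = ⊥-elim (IsMaximal.maximal max reindexed
      (square-four⇒cyclotomic reindexed (Extremal.isHermitian E) (Extremal.square-four E)) (Extremal.indecomposable E)
      (ℕ.<-≤-trans (Fin.injective⇒≤ {f = extend y f} (extend-injective injective fresh)) N≤m , ι , monotone ,
        λ u v → trans (matches u v) (sym (cong₂ M (agrees u) (agrees v)))))
      where
      open Reindex M π
      E = reindexed-extremal extremal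
      N≤m : N ≤ m
      N≤m = Fin.injective⇒≤ {f = Inverse.from π} λ {x} {y} eq →
        trans (sym (Inverse.strictlyInverseˡ π x)) (trans (cong (Inverse.to π) eq) (Inverse.strictlyInverseˡ π y))

target-extremal : ∀ {N} {M : Matrix N} → IsTarget M → Extremal M
target-extremal target = record
  { isHermitian = target-hermitian target
  ; square-four = target-square target
  ; indecomposable = descends⇒indecomposable (target-hermitian target) (target-descends target)
  }

-- Values of a partial function on the image of an injection
along : ∀ {n N} (f : Fin n → Fin N) → (Fin n → C₄) → Fin N → C₄
along f p y = by-cases (Fin.any? λ x → f x Fin.≟ y)
  where
  by-cases : Dec (∃[ x ] f x ≡ y) → C₄
  by-cases (yes (x , _)) = p x
  by-cases (no _) = ζ⁰

along-image : ∀ {n N} (f : Fin n → Fin N) (p : Fin n → C₄) → Injection f → ∀ u → along f p (f u) ≡ p u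
along-image f p injective u with Fin.any? (λ x → f x Fin.≟ f u)
... | yes (x , eq) = cong p (injective eq)
... | no none = contradiction (u , refl) none

diagonal : ∀ {n} → (Fin n → C₄) → Matrix n
diagonal q u v = ⟦ q u ⟧₄ * I u v

module _ {n} (q : Fin n → C₄) where

  I-≢ : ∀ {u v : Fin n} → u ≢ v → I u v ≡ 0#
  I-≢ {u} {v} = if-no (u Fin.≟ v)

  I-refl : ∀ (u : Fin n) → I u u ≡ 1#
  I-refl u = if-yes (u Fin.≟ u) refl

  diagonal-≢ : ∀ {u v} → u ≢ v → diagonal q u v ≡ 0#
  diagonal-≢ {u} ne = trans (cong (⟦ q u ⟧₄ *_) (I-≢ ne)) (G.zeroʳ ⟦ q u ⟧₄)

  diagonal-refl : ∀ u → diagonal q u u ≡ ⟦ q u ⟧₄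
  diagonal-refl u = trans (cong (⟦ q u ⟧₄ *_) (I-refl u)) (G.*-identityʳ ⟦ q u ⟧₄)

  diagonal-⊗ : ∀ (M : Matrix n) u v → (diagonal q ⊗ M) u v ≡ ⟦ q u ⟧₄ * M u v
  diagonal-⊗ M u v = trans (G.sum-only (λ x → diagonal q u x * M x v) u
      λ x ne → trans (cong (_* M x v) (diagonal-≢ (ne ∘ sym))) (G.zeroˡ (M x v)))
    (cong (_* M u v) (diagonal-refl u))

  ⊗-diagonalᴴ : ∀ (M : Matrix n) u v → (M ⊗ diagonal q *ᴴ) u v ≡ M u v * conj ⟦ q v ⟧₄
  ⊗-diagonalᴴ M u v = trans (G.sum-only (λ x → M u x * conj (diagonal q v x)) v
      λ x ne → trans (cong (λ z → M u x * conj z) (diagonal-≢ (ne ∘ sym))) (G.zeroʳ (M u x)))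
    (cong (λ z → M u v * conj z) (diagonal-refl v))

  diagonal-unitary : IsUnitary (diagonal q)
  diagonal-unitary = left , right
    where
    left : diagonal q ⊗ diagonal q *ᴴ ≐ I
    left u v = trans (⊗-diagonalᴴ (diagonal q) u v) (by-cases (u Fin.≟ v))
      where
      by-cases : Dec (u ≡ v) → diagonal q u v * conj ⟦ q v ⟧₄ ≡ I u v
      by-cases (yes refl) = trans (cong (_* conj ⟦ q u ⟧₄) (diagonal-refl u)) (trans (unit-norm (q u)) (sym (I-refl u)))
      by-cases (no ne) = trans (cong (_* conj ⟦ q v ⟧₄) (diagonal-≢ ne)) (trans (G.zeroˡ (conj ⟦ q v ⟧₄)) (sym (I-≢ ne)))
    right : diagonal q *ᴴ ⊗ diagonal q ≐ I
    right u v = trans (G.sum-only (λ x → conj (diagonal q x u) * diagonal q x v) u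
        λ x ne → trans (cong (λ z → conj z * diagonal q x v) (diagonal-≢ ne)) (G.zeroˡ (diagonal q x v)))
      (by-cases (u Fin.≟ v))
      where
      by-cases : Dec (u ≡ v) → conj (diagonal q u u) * diagonal q u v ≡ I u v
      by-cases (yes refl) = trans (cong (λ z → conj z * z) (diagonal-refl u))
        (trans (G.*-comm (conj ⟦ q u ⟧₄) ⟦ q u ⟧₄) (trans (unit-norm (q u)) (sym (I-refl u))))
      by-cases (no ne) = trans (cong (conj (diagonal q u u) *_) (diagonal-≢ ne)) (trans (G.zeroʳ (conj (diagonal q u u))) (sym (I-≢ ne)))

module Conclude {n} (A : Matrix (suc n)) (max : IsMaximal A) (loopless : ∀ u → A u u ≡ 0#)
  (units : ∀ u v → A u v ≢ 0# → Gaussian.IsUnit (A u v)) where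

  open FromMatrix A (IsMaximal.cyclotomic max) (IsMaximal.indecomposable max) loopless units

  module _ {N} {M : Matrix N} (target : IsTarget M) (M-loopless : ∀ u → M u u ≡ 0#) (embeds : Embeds graph M) where

    open Embeds embeds renaming (injective to distinct)

    f-injective : Injection f
    f-injective {u} {v} eq with u Fin.≟ v
    ... | yes u≡v = u≡v
    ... | no u≢v = contradiction eq (distinct u≢v)

    entries : ∀ u v → A u v ≡ twist τ (between (unitᶠ u) (M (f u) (f v)) (unitᶠ v))
    entries u v with u Fin.≟ v
    ... | no u≢v = trans (sym (value u v)) (matches u≢v)
    ... | yes refl = trans (loopless u) (sym (trans (cong (λ z → twist τ (between (unitᶠ u) z (unitᶠ u))) (M-loopless (f u)))
      (trans (sym (cong (λ w → twist τ w) (⟦⟧-◃ (unitᶠ u ∙ unitᶠ u ⁻¹) nothing))) (trans (sym (⟦⟧-twist τ nothing)) (cong ⟦_⟧ʷ (twistʷ-𝟎 τ))))))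

    surjective : Surjection f
    surjective = maximal⇒surjective max (switched-extremal (target-extremal target)) f f-injective
      λ u v → trans (entries u v) (cong₂ (λ p r → twist τ (between p (M (f u) (f v)) r))
        (sym (along-image f unitᶠ f-injective u)) (sym (along-image f unitᶠ f-injective v)))
      where open Switch M τ (along f unitᶠ)

    π : Fin (suc n) ↔ Fin N
    π = bijection f f-injective surjective

    equivalent : A ∼ λ u v → M (f u) (f v)
    equivalent = diagonal unitᶠ , diagonal-unitary unitᶠ , proj₁ τ , proj₂ τ , λ u v → trans (entries u v)
      (cong (twist τ) (trans (between-* (unitᶠ u) (M (f u) (f v)) (unitᶠ v))
        (sym (trans (⊗-diagonalᴴ unitᶠ (diagonal unitᶠ ⊗ M′) u v) (cong (_* conj ⟦ unitᶠ v ⟧₄) (diagonal-⊗ unitᶠ M′ u v))))))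
      where
      M′ : Matrix (suc n)
      M′ u v = M (f u) (f v)

  adjacency-equivalent : ∀ {N} Γ (E : Fin N ↔ Graph.Vertex Γ) → IsTarget (adjacency Γ E) → (∀ u → adjacency Γ E u u ≡ 0#) →
    Embeds graph (adjacency Γ E) → EquivalentToAdjacencyMatrixOf A Γ
  adjacency-equivalent Γ E target diag embeds = (λ u v → adjacency Γ E (f u) (f v)) , (E ↔-∘ π target diag embeds , λ u v → refl) , equivalent target diag embeds
    where open Embeds embeds using (f)

  not-X₈ : (∀ u → adjacency X₈ enumON u u ≡ 0#) → ¬ Embeds graph (adjacency X₈ enumON)
  not-X₈ diag embeds = 1+i-not-unit τ (unitᶠ u ∙ unitᶠ v ⁻¹) (B u v) (trans (value u v) (trans (entries is-X₈ diag embeds u v)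
      (cong₂ (λ x y → twist τ (between (unitᶠ u) (adjacency X₈ enumON x y) (unitᶠ v)))
        (proj₂ (surjective is-X₈ diag embeds zero)) (proj₂ (surjective is-X₈ diag embeds (Fin.fromℕ 7))))))
    where
    open Embeds embeds
    u = proj₁ (surjective is-X₈ diag embeds zero)
    v = proj₁ (surjective is-X₈ diag embeds (Fin.fromℕ 7))

by-diagonal : ∀ {N} (M : Matrix N) → allFinᵇ (λ u → does (M u u ≟ᵍ 0#)) ≡ true → ∀ u → M u u ≡ 0#
by-diagonal M ok u = does-true (M u u ≟ᵍ 0#) (allFinᵇ-true (λ u → does (M u u ≟ᵍ 0#)) ok u)

T-loopless : ∀ ζ m → 2 ≤ m → ∀ u → T ⟦ ζ ⟧₄ (suc m) u u ≡ 0#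
T-loopless ζ m 2≤m u = trans (T-weight m ζ x x i i) (cong (λ w → ⟦ w ⟧ʷ + conj ⟦ w ⟧ʷ)
  (arrow-𝟎 {m} {ζ} x (toℕ i) (toℕ i) (ℕ.<⇒≢ (ℕ.n<1+n (toℕ i))) λ { (i≡m , i≡0) → ℕ.<⇒≢ (ℕ.<-≤-trans (s≤s z≤n) 2≤m) (trans (sym i≡0) i≡m) }))
  where
  x = proj₁ (Inverse.to (enumTB {suc m}) u)
  i = proj₂ (Inverse.to (enumTB {suc m}) u)

target-loopless : ∀ {N} {M : Matrix N} → IsTarget M → ∀ u → M u u ≡ 0#
target-loopless is-S₈ = by-diagonal (adjacency S₈† enumLetter) refl
target-loopless is-S₁₄ = by-diagonal (adjacency S₁₄ enumON) refl
target-loopless is-S₁₆ = by-diagonal (adjacency S₁₆ enumON) refl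
target-loopless is-X₈ = by-diagonal (adjacency X₈ enumON) refl
target-loopless (is-T₁ (suc m) (s≤s 2≤m)) = T-loopless ζ⁰ m 2≤m
target-loopless (is-Tᵢ (suc m) (s≤s 2≤m)) = T-loopless ζ¹ m 2≤m

theorem3p1 : ∀ {n : ℕ} (A : Matrix n) → IsMaximal A →
    (∀ u → A u u ≡ Gaussian.0#) →
    (∀ u v → A u v ≢ Gaussian.0# → Gaussian.IsUnit (A u v)) →
    (∃[ k ] 3 ≤ k × EquivalentToAdjacencyMatrixOf A (T₂ₖ k))
    ⊎ (∃[ k ] 3 ≤ k × EquivalentToAdjacencyMatrixOf A (T₂ₖ⁽ⁱ⁾ k))
    ⊎ EquivalentToAdjacencyMatrixOf A S₈†
    ⊎ EquivalentToAdjacencyMatrixOf A S₁₄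
    ⊎ EquivalentToAdjacencyMatrixOf A S₁₆
theorem3p1 {zero} A max loopless units with () ← proj₁ (maximal⇒surjective {A = A} max (target-extremal is-S₈) (λ ()) (λ { {()} }) (λ ()) zero)
theorem3p1 {suc n} A max loopless units = by-target (fits-target graph)
  where
  open FromMatrix A (IsMaximal.cyclotomic max) (IsMaximal.indecomposable max) loopless units
  open Conclude A max loopless units
  by-target : (Σ[ N ∈ ℕ ] Σ[ M ∈ Matrix N ] IsTarget M × Embeds graph M) → _
  by-target (_ , _ , is-S₈ , e)         = inj₂ (inj₂ (inj₁ (adjacency-equivalent S₈† enumLetter is-S₈ (target-loopless is-S₈) e)))
  by-target (_ , _ , is-S₁₄ , e)        = inj₂ (inj₂ (inj₂ (inj₁ (adjacency-equivalent S₁₄ enumON is-S₁₄ (target-loopless is-S₁₄) e))))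
  by-target (_ , _ , is-S₁₆ , e)        = inj₂ (inj₂ (inj₂ (inj₂ (adjacency-equivalent S₁₆ enumON is-S₁₆ (target-loopless is-S₁₆) e))))
  by-target (_ , _ , is-X₈ , e)         = ⊥-elim (not-X₈ (target-loopless is-X₈) e)
  by-target (_ , _ , is-T₁ k 3≤k , e)   = inj₁ (k , 3≤k , adjacency-equivalent (T₂ₖ k) enumTB (is-T₁ k 3≤k) (target-loopless (is-T₁ k 3≤k)) e)
  by-target (_ , _ , is-Tᵢ k 3≤k , e)   = inj₂ (inj₁ (k , 3≤k , adjacency-equivalent (T₂ₖ⁽ⁱ⁾ k) enumTB (is-Tᵢ k 3≤k) (target-loopless (is-Tᵢ k 3≤k)) e))
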